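{- Let $F(\alpha)=\dfrac{1+e^{ -\alpha}}{1+e^{ -\alpha}+e^{ -2\alpha}}$ for $\alpha\ge 0$. Then, uniformly for all integers $\ell$, as $N\to+\infty$, $$V_d\left(\ell,\,N+\frac{|\ell|(|\ell|+1)}{2}\right)=p(N)\,F\left(\frac{\pi|\ell|}{\sqrt{6N}}\right)\left(1+O\left(N^{ -1/10}\right)\right),$$ where the implied constant is absolute (i.e. there are absolute constants $C,N_0$ such that the relative error is at most $CN^{ -1/10}$ for all integers $N\ge N_0$ and all $\ell\in\mathbb{Z}$). In particular, if $m=m(N)$ is an integer with $m=o(N^{3/8})$, then as $N\to\infty$ $$\frac{V_d(m,N)}{V_d(N)}\sim \frac{1}{(24N)^{1/4}}\exp\left(-\frac{\pi m^2}{\sqrt{24N}}\right).$$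
   Context: A strongly concave composition of a nonnegative integer $n$ is a finite sequence of nonnegative integers $(a_1,\dots,a_s)$, $s\ge 1$, summing to $n$, such that for some index $k$ with $1\le k\le s$ one has $a_1>a_2>\dots>a_{k-1}>a_k<a_{k+1}<\dots<a_s$; $a_k$ is called the central part. Its rank is $s-2k+1$. $V_d(m,n)$ denotes the number of strongly concave compositions of $n$ with rank $m$, and $V_d(n)$ the total number of strongly concave compositions of $n$. $p(n)$ is the partition function, with $p(n)=0$ for negative integers $n$. -}

module Defs where

open import Data.Nat.Base as ℕ using (ℕ; zero; suc)
import Data.Nat.Properties as ℕ
open import Data.Nat.ListAction using (sum)
open import Data.Integer.Base as ℤ using (ℤ; +_)
import Data.Integer.Properties as ℤ
open import Data.Integer.Solver renaming (module +-*-Solver to ℤ-Solver)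
open import Data.Rational.Base
open import Data.Rational.Properties
import Data.Rational.Unnormalised.Base as ℚᵘ
import Data.Rational.Unnormalised.Properties as ℚᵘ
open import Data.Rational.Solver using (module +-*-Solver)
open import Data.Product.Base using (∃; _×_; _,_; proj₁; proj₂)
open import Data.Sum.Base using (_⊎_; inj₁; inj₂)
open import Data.List.Base using (List; []; _∷_; length; take; drop; map; concat; filter; upTo; cartesianProductWith)
open import Data.List.Properties using (∷-injective)
open import Data.List.Membership.Propositional using (_∈_)
open import Data.List.Membership.Propositional.Properties
  using (∈-filter⁺; ∈-concat⁺′; ∈-map⁺; ∈-upTo⁺; ∈-cartesianProductWith⁺; ∈-cartesianProductWith⁻)
open import Data.List.Relation.Binary.Disjoint.Propositional using (Disjoint)
open import Data.List.Relation.Unary.All as All using (All; []; _∷_)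
import Data.List.Relation.Unary.All.Properties as All
import Data.List.Relation.Unary.AllPairs as AllPairs
import Data.List.Relation.Unary.AllPairs.Properties as AllPairs
open import Data.List.Relation.Unary.Any using (here; there)
open import Data.List.Relation.Unary.Linked using (Linked; []; [-]; _∷_; linked?)
open import Data.List.Relation.Unary.Unique.Propositional using (Unique)
import Data.List.Relation.Unary.Unique.Propositional.Properties as Unique
open import Relation.Nullary using (Dec; yes; no)
open import Relation.Nullary.Decidable using (map′; _×-dec_)
open import Relation.Unary using (Decidable)
open import Relation.Binary.PropositionalEquality using (_≡_; _≢_; refl; sym; trans; cong; cong₂; subst; subst₂)

open +-*-Solver using (solve; _:+_; _:*_; :-_; _:-_; _:=_; con)
open ≤-Reasoning

-- The k-th part (counting from 1) is central: a₁ > ⋯ > aₖ < aₖ₊₁ < ⋯ < aₛ.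
CentralAt : List ℕ → ℕ → Set
CentralAt a k = 1 ℕ.≤ k × k ℕ.≤ length a × Linked ℕ._>_ (take k a) × Linked ℕ._<_ (drop (k ℕ.∸ 1) a)

StronglyConcave : List ℕ → Set
StronglyConcave a = ∃ λ k → CentralAt a k

StronglyConcaveOfRank : ℤ → List ℕ → Set
StronglyConcaveOfRank m a = ∃ λ k → CentralAt a k × m ≡ + length a ℤ.- + 2 ℤ.* + k ℤ.+ + 1

Partition : List ℕ → Set
Partition a = Linked ℕ._≥_ a × All (λ x → 1 ℕ.≤ x) a

centralAt? : ∀ a k → Dec (CentralAt a k)
centralAt? a k = (1 ℕ.≤? k) ×-dec (k ℕ.≤? length a) ×-dec linked? ℕ._>?_ (take k a) ×-dec linked? ℕ._<?_ (drop (k ℕ.∸ 1) a)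

stronglyConcave? : Decidable StronglyConcave
stronglyConcave? a = map′ (λ (k , _ , c) → k , c) (λ (k , c) → k , ℕ.s≤s (proj₁ (proj₂ c)) , c)
  (ℕ.anyUpTo? (centralAt? a) (suc (length a)))

stronglyConcaveOfRank? : ∀ m → Decidable (StronglyConcaveOfRank m)
stronglyConcaveOfRank? m a = map′ (λ (k , _ , c) → k , c) (λ (k , c) → k , ℕ.s≤s (proj₁ (proj₂ (proj₁ c))) , c)
  (ℕ.anyUpTo? (λ k → centralAt? a k ×-dec (m ℤ.≟ + length a ℤ.- + 2 ℤ.* + k ℤ.+ + 1)) (suc (length a)))

partition? : Decidable Partition
partition? a = linked? ℕ._≥?_ a ×-dec All.all? (λ x → 1 ℕ.≤? x) a

sequences : List ℕ → ℕ → List (List ℕ)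
sequences xs zero    = [] ∷ []
sequences xs (suc s) = cartesianProductWith _∷_ xs (sequences xs s)

-- All sequences with entries ≤ n and length ≤ n + 1, each once (candidates-unique).
-- Every partition and every strongly concave composition of n is among them, by
-- candidates-complete with partition-length and stronglyConcave-length: a strongly
-- concave composition has at most one part equal to 0.
candidates : ℕ → List (List ℕ)
candidates n = concat (map (sequences (upTo (suc n))) (upTo (suc (suc n))))

count : {P : List ℕ → Set} → Decidable P → ℕ → ℕ
count P? n = length (filter (λ a → P? a ×-dec (sum a ℕ.≟ n)) (candidates n))

p : ℕ → ℕ
p = count partition?

V : ℤ → ℕ → ℕ
V m = count (stronglyConcaveOfRank? m)

V-total : ℕ → ℕ
V-total = count stronglyConcave?

∈-sequences : ∀ n a → All (ℕ._≤ n) a → a ∈ sequences (upTo (suc n)) (length a)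
∈-sequences n []      []        = here refl
∈-sequences n (x ∷ a) (h ∷ hs) = ∈-cartesianProductWith⁺ _∷_ (∈-upTo⁺ (ℕ.s≤s h)) (∈-sequences n a hs)

sequences-length : ∀ xs s {a} → a ∈ sequences xs s → length a ≡ s
sequences-length xs zero    (here refl) = refl
sequences-length xs (suc s) a∈ with ∈-cartesianProductWith⁻ _∷_ xs (sequences xs s) a∈
... | _ , _ , _ , b∈ , refl = cong suc (sequences-length xs s b∈)

sequences-unique : ∀ {xs} → Unique xs → ∀ s → Unique (sequences xs s)
sequences-unique u zero    = [] AllPairs.∷ AllPairs.[]
sequences-unique u (suc s) = Unique.cartesianProductWith⁺ _∷_ ∷-injective u (sequences-unique u s)

candidates-unique : ∀ n → Unique (candidates n)
candidates-unique n = Unique.concat⁺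
  (All.map⁺ (All.universal (sequences-unique (Unique.upTo⁺ (suc n))) (upTo (suc (suc n)))))
  (AllPairs.map⁺ (AllPairs.map disjoint (Unique.upTo⁺ (suc (suc n)))))
  where
  disjoint : ∀ {s t} → s ≢ t → Disjoint (sequences (upTo (suc n)) s) (sequences (upTo (suc n)) t)
  disjoint {s} {t} s≢t (a∈s , a∈t) = s≢t (trans (sym (sequences-length _ s a∈s)) (sequences-length _ t a∈t))

parts≤sum : ∀ a → All (ℕ._≤ sum a) a
parts≤sum []      = []
parts≤sum (x ∷ a) = ℕ.m≤m+n x (sum a) ∷ All.map (λ h → ℕ.≤-trans h (ℕ.m≤n+m (sum a) x)) (parts≤sum a)

candidates-complete : ∀ a → length a ℕ.≤ suc (sum a) → a ∈ candidates (sum a)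
candidates-complete a h = ∈-concat⁺′ (∈-sequences (sum a) a (parts≤sum a)) (∈-map⁺ (sequences (upTo (suc (sum a)))) (∈-upTo⁺ (ℕ.s≤s h)))

increasing-length : ∀ x a → Linked ℕ._<_ (x ∷ a) → length a ℕ.≤ sum a
increasing-length x []      _       = ℕ.z≤n
increasing-length x (y ∷ a) (h ∷ l) = ℕ.+-mono-≤ (ℕ.≤-trans (ℕ.s≤s ℕ.z≤n) h) (increasing-length y a l)

stronglyConcave-length : ∀ {a} → StronglyConcave a → length a ℕ.≤ suc (sum a)
stronglyConcave-length (suc k , _ , h) = go k _ h
  where
  go : ∀ k a → suc k ℕ.≤ length a × Linked ℕ._>_ (take (suc k) a) × Linked ℕ._<_ (drop k a) → length a ℕ.≤ suc (sum a)
  go zero    (x ∷ a)     (_ , _ , l) = ℕ.s≤s (ℕ.≤-trans (increasing-length x a l) (ℕ.m≤n+m (sum a) x))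
  go (suc k) (x ∷ y ∷ a) (ℕ.s≤s h , x>y ∷ l , r) =
    ℕ.s≤s (ℕ.≤-trans (go k (y ∷ a) (h , l , r)) (ℕ.+-monoˡ-≤ (sum (y ∷ a)) (ℕ.≤-trans (ℕ.s≤s ℕ.z≤n) x>y)))

partition-length : ∀ {a} → Partition a → length a ℕ.≤ suc (sum a)
partition-length (_ , h) = ℕ.m≤n⇒m≤1+n (go h)
  where
  go : ∀ {a} → All (λ x → 1 ℕ.≤ x) a → length a ℕ.≤ sum a
  go []       = ℕ.z≤n
  go (h ∷ hs) = ℕ.+-mono-≤ h (go hs)

V-total-nonZero : ∀ n → ℕ.NonZero (V-total n)
V-total-nonZero n = nonEmpty (∈-filter⁺ (λ a → stronglyConcave? a ×-dec (sum a ℕ.≟ n)) n∈ (sc , ℕ.+-identityʳ n))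
  where
  nonEmpty : ∀ {x : List ℕ} {xs} → x ∈ xs → ℕ.NonZero (length xs)
  nonEmpty (here _)  = _
  nonEmpty (there _) = _
  sc : StronglyConcave (n ∷ [])
  sc = 1 , ℕ.≤-refl , ℕ.≤-refl , [-] , [-]
  n∈ : (n ∷ []) ∈ candidates n
  n∈ = subst (λ s → (n ∷ []) ∈ candidates s) (ℕ.+-identityʳ n) (candidates-complete (n ∷ []) (stronglyConcave-length sc))

⌜_⌝ : ℕ → ℚ
⌜ n ⌝ = + n / 1

⌜suc⌝ : ∀ n → ⌜ suc n ⌝ ≡ 1ℚ + ⌜ n ⌝
⌜suc⌝ n = toℚᵘ-injective (ℚᵘ.≃-trans (toℚᵘ-fromℚᵘ (ℚᵘ.mkℚᵘ (+ suc n) 0))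
  (ℚᵘ.≃-trans (ℚᵘ.*≡* e)
  (ℚᵘ.≃-trans (ℚᵘ.+-congʳ (toℚᵘ 1ℚ) (ℚᵘ.≃-sym (toℚᵘ-fromℚᵘ (ℚᵘ.mkℚᵘ (+ n) 0))))
  (ℚᵘ.≃-sym (toℚᵘ-homo-+ 1ℚ ⌜ n ⌝)))))
  where
  e : + suc n ℤ.* + 1 ≡ (+ 1 ℤ.* + 1 ℤ.+ + n ℤ.* + 1) ℤ.* + 1
  e = ℤ-Solver.solve 1 (λ x → (ℤ-Solver.con (+ 1) ℤ-Solver.:+ x) ℤ-Solver.:* ℤ-Solver.con (+ 1)
        ℤ-Solver.:= ((ℤ-Solver.con (+ 1) ℤ-Solver.:* ℤ-Solver.con (+ 1)) ℤ-Solver.:+ x ℤ-Solver.:* ℤ-Solver.con (+ 1)) ℤ-Solver.:* ℤ-Solver.con (+ 1)) refl (+ n)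

⌜*⌝-inv : ∀ n → ⌜ suc n ⌝ * (+ 1 / suc n) ≡ 1ℚ
⌜*⌝-inv n = toℚᵘ-injective (ℚᵘ.≃-trans (toℚᵘ-homo-* ⌜ suc n ⌝ (+ 1 / suc n))
  (ℚᵘ.≃-trans (ℚᵘ.*-cong (toℚᵘ-fromℚᵘ (ℚᵘ.mkℚᵘ (+ suc n) 0)) (toℚᵘ-fromℚᵘ (ℚᵘ.mkℚᵘ (+ 1) n)))
   (ℚᵘ.*≡* e)))
  where
  e : (+ suc n ℤ.* + 1) ℤ.* + 1 ≡ + 1 ℤ.* (+ 1 ℤ.* + suc n)
  e = ℤ-Solver.solve 1 (λ x → (x ℤ-Solver.:* ℤ-Solver.con (+ 1)) ℤ-Solver.:* ℤ-Solver.con (+ 1)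
       ℤ-Solver.:= ℤ-Solver.con (+ 1) ℤ-Solver.:* (ℤ-Solver.con (+ 1) ℤ-Solver.:* x)) refl (+ suc n)

0≤⌜⌝ : ∀ n → 0ℚ ≤ ⌜ n ⌝
0≤⌜⌝ n = nonNegative⁻¹ ⌜ n ⌝ {{normalize-nonNeg n 1}}

0<⌜suc⌝ : ∀ n → 0ℚ < ⌜ suc n ⌝
0<⌜suc⌝ n = positive⁻¹ ⌜ suc n ⌝ {{normalize-pos (suc n) 1}}

0<inv : ∀ n → 0ℚ < + 1 / suc n
0<inv n = positive⁻¹ (+ 1 / suc n) {{normalize-pos 1 (suc n)}}

⌜+⌝ : ∀ m n → ⌜ m ℕ.+ n ⌝ ≡ ⌜ m ⌝ + ⌜ n ⌝
⌜+⌝ zero n = sym (+-identityˡ ⌜ n ⌝)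
⌜+⌝ (suc m) n = trans (⌜suc⌝ (m ℕ.+ n)) (trans (cong (λ z → 1ℚ + z) (⌜+⌝ m n))
  (trans (sym (+-assoc 1ℚ ⌜ m ⌝ ⌜ n ⌝)) (cong (_+ ⌜ n ⌝) (sym (⌜suc⌝ m)))))

⌜*⌝ : ∀ m n → ⌜ m ℕ.* n ⌝ ≡ ⌜ m ⌝ * ⌜ n ⌝
⌜*⌝ zero n = sym (*-zeroˡ ⌜ n ⌝)
⌜*⌝ (suc m) n = trans (⌜+⌝ n (m ℕ.* n)) (trans (cong (λ z → ⌜ n ⌝ + z) (⌜*⌝ m n))
  (trans (r ⌜ m ⌝ ⌜ n ⌝)
         (cong (_* ⌜ n ⌝) (sym (⌜suc⌝ m)))))
  where
  r : ∀ a b → b + a * b ≡ (1ℚ + a) * b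
  r = solve 2 (λ a b → b :+ a :* b := (con 1ℚ :+ a) :* b) refl

p≤p+q : ∀ p {q} → 0ℚ ≤ q → p ≤ p + q
p≤p+q p {q} h = ≤-trans (≤-reflexive (sym (+-identityʳ p))) (+-monoʳ-≤ p h)

⌜⌝-mono : ∀ {m n} → m ℕ.≤ n → ⌜ m ⌝ ≤ ⌜ n ⌝
⌜⌝-mono {m} {n} h = subst (⌜ m ⌝ ≤_) (trans (sym (⌜+⌝ m (n ℕ.∸ m))) (cong ⌜_⌝ (ℕ.m+[n∸m]≡n h)))
  (p≤p+q ⌜ m ⌝ (0≤⌜⌝ (n ℕ.∸ m)))

*-monoˡ : ∀ {r p q} → 0ℚ ≤ r → p ≤ q → r * p ≤ r * q
*-monoˡ {r} h = *-monoˡ-≤-nonNeg r {{nonNegative h}}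

*-monoʳ : ∀ {r p q} → 0ℚ ≤ r → p ≤ q → p * r ≤ q * r
*-monoʳ {r} h = *-monoʳ-≤-nonNeg r {{nonNegative h}}

*-mono : ∀ {p q r s} → 0ℚ ≤ q → 0ℚ ≤ r → p ≤ q → r ≤ s → p * r ≤ q * s
*-mono hq hr pq rs = ≤-trans (*-monoʳ hr pq) (*-monoˡ hq rs)

0≤* : ∀ {p q} → 0ℚ ≤ p → 0ℚ ≤ q → 0ℚ ≤ p * q
0≤* {p} {q} hp hq = subst (_≤ p * q) (*-zeroʳ p) (*-monoˡ hp hq)

0<* : ∀ {p q} → 0ℚ < p → 0ℚ < q → 0ℚ < p * q
0<* {p} {q} hp hq = positive⁻¹ (p * q) {{pos*pos⇒pos p {{positive hp}} q {{positive hq}}}}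

0≤+ : ∀ {p q} → 0ℚ ≤ p → 0ℚ ≤ q → 0ℚ ≤ p + q
0≤+ hp hq = +-mono-≤ hp hq

p≤∣p∣ : ∀ p → p ≤ ∣ p ∣
p≤∣p∣ p with ≤-total 0ℚ p
... | inj₁ h = ≤-reflexive (sym (0≤p⇒∣p∣≡p h))
... | inj₂ h = ≤-trans h (0≤∣p∣ p)

∣p-q∣≡∣q-p∣ : ∀ p q → ∣ p - q ∣ ≡ ∣ q - p ∣
∣p-q∣≡∣q-p∣ p q = trans (cong ∣_∣ (solve 2 (λ p q → p :- q := :- (q :- p)) refl p q)) (∣-p∣≡∣p∣ (q - p))

∣∣≤ : ∀ {p r} → p ≤ r → - p ≤ r → ∣ p ∣ ≤ r
∣∣≤ {p} {r} h₁ h₂ with ∣p∣≡p∨∣p∣≡-p p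
... | inj₁ e = subst (_≤ r) (sym e) h₁
... | inj₂ e = subst (_≤ r) (sym e) h₂

archimedean : ∀ c {ε} → 0ℚ < ε → ∃ λ K → c ≤ ε * ⌜ K ⌝
archimedean c {ε} 0<ε = proj₁ B ℕ.* ↧ₙ ε , (begin
    c                                 ≤⟨ proj₂ B ⟩
    ⌜ proj₁ B ⌝                        ≤⟨ ≤-reflexive (sym (*-identityʳ ⌜ proj₁ B ⌝)) ⟩
    ⌜ proj₁ B ⌝ * 1ℚ                   ≤⟨ *-monoˡ (0≤⌜⌝ (proj₁ B)) one≤ ⟩
    ⌜ proj₁ B ⌝ * (ε * ⌜ ↧ₙ ε ⌝)         ≡⟨ r ⌜ proj₁ B ⌝ ε ⌜ ↧ₙ ε ⌝ ⟩
    ε * (⌜ proj₁ B ⌝ * ⌜ ↧ₙ ε ⌝)         ≡⟨ cong (ε *_) (sym (⌜*⌝ (proj₁ B) (↧ₙ ε))) ⟩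
    ε * ⌜ proj₁ B ℕ.* ↧ₙ ε ⌝            ∎)
  where
  r : ∀ a b c → a * (b * c) ≡ b * (a * c)
  r = solve 3 (λ a b c → a :* (b :* c) := b :* (a :* c)) refl
  clear : ∀ q → q * ⌜ ↧ₙ q ⌝ ≡ ↥ q / 1
  clear q@record{} = toℚᵘ-injective (ℚᵘ.≃-trans (toℚᵘ-homo-* q ⌜ ↧ₙ q ⌝)
    (ℚᵘ.≃-trans (ℚᵘ.*-congˡ {toℚᵘ q} (toℚᵘ-fromℚᵘ (ℚᵘ.mkℚᵘ (↧ q) 0)))
    (ℚᵘ.≃-trans (ℚᵘ.*≡* (ℤ-Solver.solve 2 (λ x y → (x ℤ-Solver.:* y) ℤ-Solver.:* ℤ-Solver.con (+ 1)
         ℤ-Solver.:= x ℤ-Solver.:* (y ℤ-Solver.:* ℤ-Solver.con (+ 1))) refl (↥ q) (↧ q)))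
    (ℚᵘ.≃-sym (toℚᵘ-fromℚᵘ (ℚᵘ.mkℚᵘ (↥ q) 0))))))
  1≤pos : ∀ q → Positive q → 1ℚ ≤ ↥ q / 1
  1≤pos (mkℚ (+ suc n) d c) _ = ⌜⌝-mono {1} {suc n} (ℕ.s≤s ℕ.z≤n)
  one≤ : 1ℚ ≤ ε * ⌜ ↧ₙ ε ⌝
  one≤ = subst (1ℚ ≤_) (sym (clear ε)) (1≤pos ε (positive 0<ε))
  1≤den : ∀ q → 1 ℕ.≤ ↧ₙ q
  1≤den (mkℚ n d c) = ℕ.s≤s ℕ.z≤n
  bound : ∀ q → ∃ λ n → q ≤ ⌜ n ⌝
  bound q = ℤ.∣ ↥ ∣ q ∣ ∣ , (begin
    q                  ≤⟨ p≤∣p∣ q ⟩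
    ∣ q ∣              ≡⟨ sym (*-identityʳ ∣ q ∣) ⟩
    ∣ q ∣ * ⌜ 1 ⌝       ≤⟨ *-monoˡ (0≤∣p∣ q) (⌜⌝-mono (1≤den ∣ q ∣)) ⟩
    ∣ q ∣ * ⌜ ↧ₙ ∣ q ∣ ⌝ ≡⟨ clear ∣ q ∣ ⟩
    ↥ ∣ q ∣ / 1         ≡⟨ num q ⟩
    ⌜ ℤ.∣ ↥ ∣ q ∣ ∣ ⌝    ∎)
    where
    num : ∀ q → ↥ ∣ q ∣ / 1 ≡ ⌜ ℤ.∣ ↥ ∣ q ∣ ∣ ⌝
    num (mkℚ (+ n) d c) = refl
    num (mkℚ (ℤ.-[1+ n ]) d c) = refl
  B = bound c

small : ∀ c {ε} → 0ℚ < ε → ∃ λ K → ∀ k → K ℕ.≤ k → c * (+ 1 / suc k) ≤ ε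
small c {ε} 0<ε = proj₁ A , λ k K≤k → go ⌜ suc k ⌝ (+ 1 / suc k) (⌜*⌝-inv k) (<⇒≤ (0<inv k))
      (≤-trans (proj₂ A) (*-monoˡ {ε} {⌜ proj₁ A ⌝} {⌜ suc k ⌝} (<⇒≤ 0<ε) (⌜⌝-mono (ℕ.≤-trans K≤k (ℕ.n≤1+n k)))))
  where
  A = archimedean c 0<ε
  go : ∀ a b → a * b ≡ 1ℚ → 0ℚ ≤ b → c ≤ ε * a → c * b ≤ ε
  go a b ab hb le = begin
    c * b        ≤⟨ *-monoʳ {b} hb le ⟩
    ε * a * b    ≡⟨ *-assoc ε a b ⟩
    ε * (a * b)  ≡⟨ cong (λ z → ε * z) ab ⟩
    ε * 1ℚ       ≡⟨ *-identityʳ ε ⟩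
    ε            ∎

-- Real numbers as Cauchy sequences of rationals, with equality _≈ᴿ_.
Cauchy : (ℕ → ℚ) → Set
Cauchy x = ∀ ε → 0ℚ < ε → ∃ λ K → ∀ m n → K ℕ.≤ m → K ℕ.≤ n → ∣ x m - x n ∣ ≤ ε

infix 4 _≤ᴿ_ _≈ᴿ_
infixl 6 _+ᴿ_ _-ᴿ_
infixl 7 _*ᴿ_
infix 8 -ᴿ_

record ℝ : Set where
  constructor mkℝ
  field
    seq    : ℕ → ℚ
    cauchy : Cauchy seq
open ℝ public

_≤ᴿ_ : ℝ → ℝ → Set
x ≤ᴿ y = ∀ ε → 0ℚ < ε → ∃ λ K → ∀ k → K ℕ.≤ k → seq x k ≤ seq y k + ε

_≈ᴿ_ : ℝ → ℝ → Set
x ≈ᴿ y = ∀ ε → 0ℚ < ε → ∃ λ K → ∀ k → K ℕ.≤ k → ∣ seq x k - seq y k ∣ ≤ ε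

record Positiveᴿ (x : ℝ) : Set where
  constructor mkPositiveᴿ
  field
    bound   : ℚ
    0<bound : 0ℚ < bound
    onset   : ℕ
    bound≤  : ∀ k → onset ℕ.≤ k → bound ≤ seq x k

cauchy-lipschitz : ∀ (x y z : ℕ → ℚ) → Cauchy x → Cauchy y → ∀ L → 0ℚ < L → ∀ J →
  (∀ m n → J ℕ.≤ m → J ℕ.≤ n → ∣ z m - z n ∣ ≤ L * (∣ x m - x n ∣ + ∣ y m - y n ∣)) → Cauchy z
cauchy-lipschitz x y z cx cy L 0<L J h ε 0<ε =
    J ℕ.⊔ (proj₁ X ℕ.⊔ proj₁ Y) , λ m n hm hn → begin
      ∣ z m - z n ∣                          ≤⟨ h m n (ℕ.≤-trans j≤ hm) (ℕ.≤-trans j≤ hn) ⟩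
      L * (∣ x m - x n ∣ + ∣ y m - y n ∣)     ≤⟨ *-monoˡ {L} (<⇒≤ 0<L) (+-mono-≤
           (proj₂ X m n (ℕ.≤-trans x≤ hm) (ℕ.≤-trans x≤ hn)) (proj₂ Y m n (ℕ.≤-trans y≤ hm) (ℕ.≤-trans y≤ hn))) ⟩
      L * (δ + δ)                            ≡⟨ r L ε (1/ L) ⟩
      L * 1/ L * ε                           ≡⟨ cong (_* ε) (*-inverseʳ L) ⟩
      1ℚ * ε                                 ≡⟨ *-identityˡ ε ⟩
      ε                                      ∎
  where
  instance
    L⁺ : Positive L
    L⁺ = positive 0<L
    L≢0 : NonZero L
    L≢0 = pos⇒nonZero L
  δ : ℚ
  δ = ε * (½ * 1/ L)
  0<δ : 0ℚ < δ
  0<δ = 0<* 0<ε (0<* {½} (positive⁻¹ ½) (positive⁻¹ (1/ L) {{1/pos⇒pos L}}))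
  r : ∀ L ε i → L * (ε * (½ * i) + ε * (½ * i)) ≡ L * i * ε
  r = solve 3 (λ L ε i → L :* (ε :* (con ½ :* i) :+ ε :* (con ½ :* i)) := L :* i :* ε) refl
  X = cx δ 0<δ
  Y = cy δ 0<δ
  j≤ = ℕ.m≤m⊔n J (proj₁ X ℕ.⊔ proj₁ Y)
  x≤ = ℕ.≤-trans (ℕ.m≤m⊔n (proj₁ X) (proj₁ Y)) (ℕ.m≤n⊔m J (proj₁ X ℕ.⊔ proj₁ Y))
  y≤ = ℕ.≤-trans (ℕ.m≤n⊔m (proj₁ X) (proj₁ Y)) (ℕ.m≤n⊔m J (proj₁ X ℕ.⊔ proj₁ Y))

cauchy-rate : ∀ (x : ℕ → ℚ) J c →
  (∀ i n → ∣ x (J ℕ.+ i ℕ.+ n) - x (J ℕ.+ i) ∣ ≤ c * (+ 1 / suc i)) → Cauchy x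
cauchy-rate x J c h ε 0<ε = J ℕ.+ proj₁ K , λ m n hm hn → go m n hm hn (ℕ.≤-total m n)
  where
  K = small c 0<ε
  ordered : ∀ m n → J ℕ.+ proj₁ K ℕ.≤ m → m ℕ.≤ n → ∣ x n - x m ∣ ≤ ε
  ordered m n hm mn = ≤-trans
    (subst₂ (λ a b → ∣ x a - x b ∣ ≤ c * (+ 1 / suc (m ℕ.∸ J))) e₂ e₁ (h (m ℕ.∸ J) (n ℕ.∸ m)))
    (proj₂ K (m ℕ.∸ J) (ℕ.≤-trans (ℕ.≤-reflexive (sym (ℕ.m+n∸m≡n J (proj₁ K)))) (ℕ.∸-monoˡ-≤ J hm)))
    where
    e₁ : J ℕ.+ (m ℕ.∸ J) ≡ m
    e₁ = ℕ.m+[n∸m]≡n (ℕ.≤-trans (ℕ.m≤m+n J (proj₁ K)) hm)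
    e₂ : J ℕ.+ (m ℕ.∸ J) ℕ.+ (n ℕ.∸ m) ≡ n
    e₂ = trans (cong (ℕ._+ (n ℕ.∸ m)) e₁) (ℕ.m+[n∸m]≡n mn)
  go : ∀ m n → J ℕ.+ proj₁ K ℕ.≤ m → J ℕ.+ proj₁ K ℕ.≤ n → (m ℕ.≤ n) ⊎ (n ℕ.≤ m) → ∣ x m - x n ∣ ≤ ε
  go m n hm hn (inj₁ mn) = subst (_≤ ε) (∣p-q∣≡∣q-p∣ (x n) (x m)) (ordered m n hm mn)
  go m n hm hn (inj₂ nm) = ordered n m hn nm

cauchy-bounded : ∀ x → Cauchy x → ∃ λ B → ∃ λ K → ∀ k → K ℕ.≤ k → ∣ x k ∣ ≤ ⌜ B ⌝
cauchy-bounded x cx = proj₁ A , proj₁ C , λ k hk → begin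
    ∣ x k ∣                        ≡⟨ cong ∣_∣ (r (x k) (x K)) ⟩
    ∣ x k - x K + x K ∣            ≤⟨ ∣p+q∣≤∣p∣+∣q∣ (x k - x K) (x K) ⟩
    ∣ x k - x K ∣ + ∣ x K ∣        ≤⟨ +-monoˡ-≤ ∣ x K ∣ (proj₂ C k K hk ℕ.≤-refl) ⟩
    1ℚ + ∣ x K ∣                   ≤⟨ proj₂ A ⟩
    1ℚ * ⌜ proj₁ A ⌝               ≡⟨ *-identityˡ ⌜ proj₁ A ⌝ ⟩
    ⌜ proj₁ A ⌝                    ∎
  where
  r : ∀ a b → a ≡ a - b + b
  r = solve 2 (λ a b → a := a :- b :+ b) refl
  C = cx 1ℚ (positive⁻¹ 1ℚ)
  K = proj₁ C
  A = archimedean (1ℚ + ∣ x K ∣) {1ℚ} (positive⁻¹ 1ℚ)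

const-cauchy : ∀ q → Cauchy (λ _ → q)
const-cauchy q ε 0<ε = 0 , λ m n _ _ → ≤-trans (≤-reflexive (cong ∣_∣ (+-inverseʳ q))) (<⇒≤ 0<ε)

+-cauchy : ∀ x y → Cauchy x → Cauchy y → Cauchy (λ k → x k + y k)
+-cauchy x y cx cy = cauchy-lipschitz x y (λ k → x k + y k) cx cy 1ℚ (positive⁻¹ 1ℚ) 0 λ m n _ _ → begin
    ∣ (x m + y m) - (x n + y n) ∣        ≡⟨ cong ∣_∣ (r (x m) (y m) (x n) (y n)) ⟩
    ∣ (x m - x n) + (y m - y n) ∣        ≤⟨ ∣p+q∣≤∣p∣+∣q∣ (x m - x n) (y m - y n) ⟩
    ∣ x m - x n ∣ + ∣ y m - y n ∣        ≡⟨ sym (*-identityˡ (∣ x m - x n ∣ + ∣ y m - y n ∣)) ⟩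
    1ℚ * (∣ x m - x n ∣ + ∣ y m - y n ∣) ∎
  where
  r : ∀ a b c d → (a + b) - (c + d) ≡ (a - c) + (b - d)
  r = solve 4 (λ a b c d → (a :+ b) :- (c :+ d) := (a :- c) :+ (b :- d)) refl

neg-cauchy : ∀ x → Cauchy x → Cauchy (λ k → - x k)
neg-cauchy x cx ε 0<ε = proj₁ X , λ m n hm hn →
    subst (_≤ ε) (sym (trans (cong ∣_∣ (r (x m) (x n))) (∣-p∣≡∣p∣ (x m - x n)))) (proj₂ X m n hm hn)
  where
  X = cx ε 0<ε
  r : ∀ a b → - a - - b ≡ - (a - b)
  r = solve 2 (λ a b → :- a :- :- b := :- (a :- b)) refl

∣∣-cauchy : ∀ x → Cauchy x → Cauchy (λ k → ∣ x k ∣)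
∣∣-cauchy x cx ε 0<ε = proj₁ X , λ m n hm hn → ≤-trans (∣∣≤ (half (x m) (x n))
    (subst₂ _≤_ (r ∣ x m ∣ ∣ x n ∣) (∣p-q∣≡∣q-p∣ (x n) (x m)) (half (x n) (x m)))) (proj₂ X m n hm hn)
  where
  X = cx ε 0<ε
  r : ∀ a b → b - a ≡ - (a - b)
  r = solve 2 (λ a b → b :- a := :- (a :- b)) refl
  r₂ : ∀ a b → a ≡ a - b + b
  r₂ = solve 2 (λ a b → a := a :- b :+ b) refl
  r₃ : ∀ a b → a + b - b ≡ a
  r₃ = solve 2 (λ a b → a :+ b :- b := a) refl
  half : ∀ a b → ∣ a ∣ - ∣ b ∣ ≤ ∣ a - b ∣
  half a b = begin
    ∣ a ∣ - ∣ b ∣               ≤⟨ +-monoˡ-≤ (- ∣ b ∣) (subst (λ z → ∣ z ∣ ≤ ∣ a - b ∣ + ∣ b ∣) (sym (r₂ a b)) (∣p+q∣≤∣p∣+∣q∣ (a - b) b)) ⟩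
    ∣ a - b ∣ + ∣ b ∣ - ∣ b ∣   ≡⟨ r₃ ∣ a - b ∣ ∣ b ∣ ⟩
    ∣ a - b ∣                   ∎

*-cauchy : ∀ x y → Cauchy x → Cauchy y → Cauchy (λ k → x k * y k)
*-cauchy x y cx cy = cauchy-lipschitz x y (λ k → x k * y k) cx cy L 0<L J λ m n hm hn → begin
    ∣ x m * y m - x n * y n ∣                        ≡⟨ cong ∣_∣ (r (x m) (y m) (x n) (y n)) ⟩
    ∣ (x m - x n) * y n + x m * (y m - y n) ∣        ≤⟨ ∣p+q∣≤∣p∣+∣q∣ ((x m - x n) * y n) (x m * (y m - y n)) ⟩
    ∣ (x m - x n) * y n ∣ + ∣ x m * (y m - y n) ∣    ≡⟨ cong₂ _+_ (∣p*q∣≡∣p∣*∣q∣ (x m - x n) (y n)) (∣p*q∣≡∣p∣*∣q∣ (x m) (y m - y n)) ⟩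
    ∣ x m - x n ∣ * ∣ y n ∣ + ∣ x m ∣ * ∣ y m - y n ∣ ≤⟨ +-mono-≤
         (*-monoˡ (0≤∣p∣ (x m - x n)) (y≤L n (ℕ.≤-trans (ℕ.m≤n⊔m (proj₁ (proj₂ X)) (proj₁ (proj₂ Y))) hn)))
         (*-monoʳ (0≤∣p∣ (y m - y n)) (x≤L m (ℕ.≤-trans (ℕ.m≤m⊔n (proj₁ (proj₂ X)) (proj₁ (proj₂ Y))) hm))) ⟩
    ∣ x m - x n ∣ * L + L * ∣ y m - y n ∣            ≡⟨ r₂ ∣ x m - x n ∣ ∣ y m - y n ∣ L ⟩
    L * (∣ x m - x n ∣ + ∣ y m - y n ∣)              ∎
  where
  r : ∀ a b c d → a * b - c * d ≡ (a - c) * d + a * (b - d)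
  r = solve 4 (λ a b c d → a :* b :- c :* d := (a :- c) :* d :+ a :* (b :- d)) refl
  r₂ : ∀ a b l → a * l + l * b ≡ l * (a + b)
  r₂ = solve 3 (λ a b l → a :* l :+ l :* b := l :* (a :+ b)) refl
  X = cauchy-bounded x cx
  Y = cauchy-bounded y cy
  J = proj₁ (proj₂ X) ℕ.⊔ proj₁ (proj₂ Y)
  N = proj₁ X ℕ.+ proj₁ Y
  L = ⌜ suc N ⌝
  0<L : 0ℚ < L
  0<L = 0<⌜suc⌝ N
  x≤L : ∀ k → proj₁ (proj₂ X) ℕ.≤ k → ∣ x k ∣ ≤ L
  x≤L k hk = ≤-trans (proj₂ (proj₂ X) k hk) (⌜⌝-mono (ℕ.m≤n⇒m≤1+n (ℕ.m≤m+n (proj₁ X) (proj₁ Y))))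
  y≤L : ∀ k → proj₁ (proj₂ Y) ℕ.≤ k → ∣ y k ∣ ≤ L
  y≤L k hk = ≤-trans (proj₂ (proj₂ Y) k hk) (⌜⌝-mono (ℕ.m≤n⇒m≤1+n (ℕ.m≤n+m (proj₁ Y) (proj₁ X))))

-- Equals 1/q as soon as c ≤ q.
recip : ∀ c → 0ℚ < c → ℚ → ℚ
recip c 0<c q = (1/ (c ⊔ q)) {{pos⇒nonZero (c ⊔ q) {{positive (<-≤-trans 0<c (p≤p⊔q c q))}}}}

recip-cauchy : ∀ x → Cauchy x → ∀ c (0<c : 0ℚ < c) J → (∀ k → J ℕ.≤ k → c ≤ x k) →
  Cauchy (λ k → recip c 0<c (x k))
recip-cauchy x cx c 0<c J c≤x = cauchy-lipschitz x (λ _ → 0ℚ) i cx (const-cauchy 0ℚ) (d * d) (0<* 0<d 0<d) J λ m n hm hn → begin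
    ∣ i m - i n ∣                               ≡⟨ cong ∣_∣ (diff (i m) (x m) (i n) (x n) (inv m hm) (inv n hn)) ⟩
    ∣ i m * i n * (x n - x m) ∣                 ≡⟨ trans (∣p*q∣≡∣p∣*∣q∣ (i m * i n) (x n - x m))
                                                   (cong₂ _*_ (0≤p⇒∣p∣≡p (0≤* (0≤i m) (0≤i n))) (∣p-q∣≡∣q-p∣ (x n) (x m))) ⟩
    i m * i n * ∣ x m - x n ∣                   ≤⟨ *-monoʳ (0≤∣p∣ (x m - x n)) (*-mono (<⇒≤ 0<d) (0≤i n) (i≤d m hm) (i≤d n hn)) ⟩
    d * d * ∣ x m - x n ∣                       ≡⟨ cong (d * d *_) (sym (+-identityʳ ∣ x m - x n ∣)) ⟩
    d * d * (∣ x m - x n ∣ + ∣ 0ℚ - 0ℚ ∣)       ∎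
  where
  instance
    c⁺ : Positive c
    c⁺ = positive 0<c
    c≢0 : NonZero c
    c≢0 = pos⇒nonZero c
  d : ℚ
  d = 1/ c
  0<d : 0ℚ < d
  0<d = positive⁻¹ (1/ c) {{1/pos⇒pos c}}
  i : ℕ → ℚ
  i k = recip c 0<c (x k)
  pos⊔ : ∀ k → Positive (c ⊔ x k)
  pos⊔ k = positive (<-≤-trans 0<c (p≤p⊔q c (x k)))
  0≤i : ∀ k → 0ℚ ≤ i k
  0≤i k = <⇒≤ (positive⁻¹ (i k) {{1/pos⇒pos (c ⊔ x k) {{pos⊔ k}}}})
  inv : ∀ k → J ℕ.≤ k → i k * x k ≡ 1ℚ
  inv k hk = subst (λ z → i k * z ≡ 1ℚ) (p≤q⇒p⊔q≡q (c≤x k hk))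
    (*-inverseˡ (c ⊔ x k) {{pos⇒nonZero (c ⊔ x k) {{pos⊔ k}}}})
  i≤d : ∀ k → J ℕ.≤ k → i k ≤ d
  i≤d k hk = begin
    i k              ≡⟨ sym (*-identityʳ (i k)) ⟩
    i k * 1ℚ         ≡⟨ cong (i k *_) (sym (*-inverseʳ c)) ⟩
    i k * (c * d)    ≤⟨ *-monoˡ (0≤i k) (*-monoʳ (<⇒≤ 0<d) (c≤x k hk)) ⟩
    i k * (x k * d)  ≡⟨ sym (*-assoc (i k) (x k) d) ⟩
    i k * x k * d    ≡⟨ cong (_* d) (inv k hk) ⟩
    1ℚ * d           ≡⟨ *-identityˡ d ⟩
    d                ∎
  diff : ∀ a u b v → a * u ≡ 1ℚ → b * v ≡ 1ℚ → a - b ≡ a * b * (v - u)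
  diff a u b v au bv = sym (trans (r a u b v) (cong₂ (λ s t → a * t - b * s) au bv ⟨trans⟩ cong₂ _-_ (*-identityʳ a) (*-identityʳ b)))
    where
    _⟨trans⟩_ : ∀ {p q s : ℚ} → p ≡ q → q ≡ s → p ≡ s
    _⟨trans⟩_ = trans
    r : ∀ a u b v → a * b * (v - u) ≡ a * (b * v) - b * (a * u)
    r = solve 4 (λ a u b v → a :* b :* (v :- u) := a :* (b :* v) :- b :* (a :* u)) refl

fromℚ : ℚ → ℝ
fromℚ q = mkℝ (λ _ → q) (const-cauchy q)

fromℕ : ℕ → ℝ
fromℕ n = fromℚ ⌜ n ⌝

_+ᴿ_ : ℝ → ℝ → ℝ
x +ᴿ y = mkℝ (λ k → seq x k + seq y k) (+-cauchy (seq x) (seq y) (cauchy x) (cauchy y))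

-ᴿ_ : ℝ → ℝ
-ᴿ x = mkℝ (λ k → - seq x k) (neg-cauchy (seq x) (cauchy x))

_-ᴿ_ : ℝ → ℝ → ℝ
x -ᴿ y = x +ᴿ (-ᴿ y)

_*ᴿ_ : ℝ → ℝ → ℝ
x *ᴿ y = mkℝ (λ k → seq x k * seq y k) (*-cauchy (seq x) (seq y) (cauchy x) (cauchy y))

∣_∣ᴿ : ℝ → ℝ
∣ x ∣ᴿ = mkℝ (λ k → ∣ seq x k ∣) (∣∣-cauchy (seq x) (cauchy x))

inverse : (x : ℝ) → Positiveᴿ x → ℝ
inverse x x⁺ = mkℝ (λ k → recip bound 0<bound (seq x k)) (recip-cauchy (seq x) (cauchy x) bound 0<bound onset bound≤)
  where open Positiveᴿ x⁺

∑< : ℕ → (ℕ → ℚ) → ℚ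
∑< zero    t = 0ℚ
∑< (suc k) t = ∑< k t + t k

sign : ℕ → ℚ
sign zero    = 1ℚ
sign (suc j) = - sign j

odd⁻¹ : ℕ → ℚ
odd⁻¹ j = + 1 / suc (2 ℕ.* j)

-- Leibniz: π = 4 ∑ (-1)ʲ / (2j + 1).
leibniz : ℕ → ℚ
leibniz k = ∑< k (λ j → sign j * odd⁻¹ j)

inv-antitone : ∀ {m n} → m ℕ.≤ n → + 1 / suc n ≤ + 1 / suc m
inv-antitone {m} {n} m≤n = go ⌜ suc m ⌝ (+ 1 / suc m) ⌜ suc n ⌝ (+ 1 / suc n) (⌜*⌝-inv m) (⌜*⌝-inv n)
    (<⇒≤ (0<inv m)) (<⇒≤ (0<inv n)) (⌜⌝-mono (ℕ.s≤s m≤n))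
  where
  go : ∀ a i b j → a * i ≡ 1ℚ → b * j ≡ 1ℚ → 0ℚ ≤ i → 0ℚ ≤ j → a ≤ b → j ≤ i
  go a i b j ai bj 0≤i 0≤j a≤b = begin
    j              ≡⟨ sym (*-identityˡ j) ⟩
    1ℚ * j         ≡⟨ cong (_* j) (sym ai) ⟩
    a * i * j      ≤⟨ *-monoʳ {j} 0≤j (*-monoʳ {i} 0≤i a≤b) ⟩
    b * i * j      ≡⟨ r b i j ⟩
    b * j * i      ≡⟨ cong (_* i) bj ⟩
    1ℚ * i         ≡⟨ *-identityˡ i ⟩
    i              ∎
    where
    r : ∀ b i j → b * i * j ≡ b * j * i
    r = solve 3 (λ b i j → b :* i :* j := b :* j :* i) refl

∣sign∣ : ∀ j → ∣ sign j ∣ ≡ 1ℚ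
∣sign∣ zero    = refl
∣sign∣ (suc j) = trans (∣-p∣≡∣p∣ (sign j)) (∣sign∣ j)

leibniz-tail : ∀ n m → ∃ λ a → 0ℚ ≤ a × a ≤ odd⁻¹ m × leibniz (m ℕ.+ n) ≡ leibniz m + sign m * a
leibniz-tail zero m = 0ℚ , ≤-refl , <⇒≤ (0<inv (2 ℕ.* m)) ,
  trans (cong leibniz (ℕ.+-identityʳ m)) (r (leibniz m) (sign m))
  where
  r : ∀ l s → l ≡ l + s * 0ℚ
  r = solve 2 (λ l s → l := l :+ s :* con 0ℚ) refl
leibniz-tail (suc n) m = step (odd⁻¹ m) refl (leibniz-tail n (suc m))
  where
  r : ∀ l s b a → l + s * b + - s * a ≡ l + s * (b - a)
  r = solve 4 (λ l s b a → l :+ s :* b :+ :- s :* a := l :+ s :* (b :- a)) refl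
  step : ∀ b → b ≡ odd⁻¹ m →
    (∃ λ a → 0ℚ ≤ a × a ≤ odd⁻¹ (suc m) × leibniz (suc m ℕ.+ n) ≡ leibniz (suc m) + sign (suc m) * a) →
    ∃ λ a → 0ℚ ≤ a × a ≤ b × leibniz (m ℕ.+ suc n) ≡ leibniz m + sign m * a
  step b refl (a , 0≤a , a≤ , e) = b - a ,
    subst (_≤ b - a) (+-inverseʳ a) (+-monoˡ-≤ (- a) (≤-trans a≤ (inv-antitone (ℕ.*-monoʳ-≤ 2 (ℕ.n≤1+n m))))) ,
    ≤-trans (+-monoʳ-≤ b (neg-antimono-≤ 0≤a)) (≤-reflexive (+-identityʳ b)) ,
    trans (cong leibniz (ℕ.+-suc m n)) (trans e (r (leibniz m) (sign m) b a))

leibniz-cauchy : Cauchy leibniz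
leibniz-cauchy = cauchy-rate leibniz 0 1ℚ λ i n → go i n (leibniz-tail n i)
  where
  r : ∀ l b → l + b - l ≡ b
  r = solve 2 (λ l b → l :+ b :- l := b) refl
  go : ∀ i n → (∃ λ a → 0ℚ ≤ a × a ≤ odd⁻¹ i × leibniz (i ℕ.+ n) ≡ leibniz i + sign i * a) →
       ∣ leibniz (i ℕ.+ n) - leibniz i ∣ ≤ 1ℚ * (+ 1 / suc i)
  go i n (a , 0≤a , a≤ , e) = begin
    ∣ leibniz (i ℕ.+ n) - leibniz i ∣          ≡⟨ cong (λ z → ∣ z - leibniz i ∣) e ⟩
    ∣ leibniz i + sign i * a - leibniz i ∣     ≡⟨ cong ∣_∣ (r (leibniz i) (sign i * a)) ⟩
    ∣ sign i * a ∣                             ≡⟨ ∣p*q∣≡∣p∣*∣q∣ (sign i) a ⟩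
    ∣ sign i ∣ * ∣ a ∣                         ≡⟨ cong₂ _*_ (∣sign∣ i) (0≤p⇒∣p∣≡p 0≤a) ⟩
    1ℚ * a                                     ≤⟨ *-monoˡ {1ℚ} (<⇒≤ (positive⁻¹ 1ℚ)) (≤-trans a≤ (inv-antitone (ℕ.m≤m+n i _))) ⟩
    1ℚ * (+ 1 / suc i)                         ∎

π : ℝ
π = fromℕ 4 *ᴿ mkℝ leibniz leibniz-cauchy

-- xʲ / j!
expTerm : ℚ → ℕ → ℚ
expTerm x zero    = 1ℚ
expTerm x (suc j) = expTerm x j * (x * (+ 1 / suc j))

expSum : ℚ → ℕ → ℚ
expSum x k = ∑< k (expTerm x)

module _ (B : ℕ) where
  private
    b e : ℕ → ℚ
    b = expTerm ⌜ B ⌝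
    e = expSum ⌜ B ⌝

  0≤expTerm : ∀ j → 0ℚ ≤ b j
  0≤expTerm zero    = <⇒≤ (positive⁻¹ 1ℚ)
  0≤expTerm (suc j) = 0≤* (0≤expTerm j) (0≤* (0≤⌜⌝ B) (<⇒≤ (0<inv j)))

  expTerm-halves : ∀ j → 2 ℕ.* B ℕ.≤ j → b (suc j) + b (suc j) ≤ b j
  expTerm-halves j 2B≤j = go (b j) ⌜ B ⌝ ⌜ suc j ⌝ (+ 1 / suc j) (⌜*⌝-inv j) (0≤expTerm j) (<⇒≤ (0<inv j))
      (subst (_≤ ⌜ suc j ⌝) (trans (cong ⌜_⌝ (cong (B ℕ.+_) (ℕ.+-identityʳ B))) (⌜+⌝ B B)) (⌜⌝-mono (ℕ.m≤n⇒m≤1+n 2B≤j)))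
    where
    r : ∀ b B i → b * (B * i) + b * (B * i) ≡ b * ((B + B) * i)
    r = solve 3 (λ b B i → b :* (B :* i) :+ b :* (B :* i) := b :* ((B :+ B) :* i)) refl
    go : ∀ b B s i → s * i ≡ 1ℚ → 0ℚ ≤ b → 0ℚ ≤ i → B + B ≤ s → b * (B * i) + b * (B * i) ≤ b
    go b B s i si 0≤b 0≤i h = begin
      b * (B * i) + b * (B * i)  ≡⟨ r b B i ⟩
      b * ((B + B) * i)          ≤⟨ *-monoˡ {b} 0≤b (*-monoʳ {i} 0≤i h) ⟩
      b * (s * i)                ≡⟨ cong (λ z → b * z) si ⟩
      b * 1ℚ                     ≡⟨ *-identityʳ b ⟩
      b                          ∎

  expTerm-rate : ∀ i → ⌜ suc i ⌝ * b (2 ℕ.* B ℕ.+ i) ≤ b (2 ℕ.* B)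
  expTerm-rate zero = ≤-reflexive (trans (*-identityˡ _) (cong b (ℕ.+-identityʳ (2 ℕ.* B))))
  expTerm-rate (suc i) = subst (λ k → ⌜ suc (suc i) ⌝ * b k ≤ b (2 ℕ.* B)) (sym (ℕ.+-suc (2 ℕ.* B) i))
      (≤-trans (go ⌜ suc (suc i) ⌝ ⌜ suc i ⌝ (b (suc k)) (b k) s (0≤⌜⌝ i) (0≤expTerm (suc k))
                 (0≤⌜⌝ (suc i)) (expTerm-halves k (ℕ.m≤m+n (2 ℕ.* B) i)) (⌜suc⌝ (suc i)))
               (expTerm-rate i))
    where
    k = 2 ℕ.* B ℕ.+ i
    s : ⌜ suc i ⌝ ≡ 1ℚ + ⌜ i ⌝
    s = ⌜suc⌝ i
    r : ∀ i c → (1ℚ + (1ℚ + i)) * c + i * c ≡ (1ℚ + i) * (c + c)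
    r = solve 2 (λ i c → (con 1ℚ :+ (con 1ℚ :+ i)) :* c :+ i :* c := (con 1ℚ :+ i) :* (c :+ c)) refl
    go : ∀ u v c d {w} → v ≡ 1ℚ + w → 0ℚ ≤ w → 0ℚ ≤ c → 0ℚ ≤ v → c + c ≤ d → u ≡ 1ℚ + v → u * c ≤ v * d
    go u v c d {w} refl 0≤w 0≤c 0≤v h refl = begin
      (1ℚ + (1ℚ + w)) * c          ≤⟨ p≤p+q ((1ℚ + (1ℚ + w)) * c) (0≤* {w} {c} 0≤w 0≤c) ⟩
      (1ℚ + (1ℚ + w)) * c + w * c  ≡⟨ r w c ⟩
      (1ℚ + w) * (c + c)           ≤⟨ *-monoˡ {1ℚ + w} 0≤v h ⟩
      (1ℚ + w) * d                 ∎

  expSum-mono : ∀ n m → e m ≤ e (m ℕ.+ n)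
  expSum-mono zero    m = ≤-reflexive (cong e (sym (ℕ.+-identityʳ m)))
  expSum-mono (suc n) m = subst (λ k → e m ≤ e k) (sym (ℕ.+-suc m n))
    (≤-trans (expSum-mono n m) (p≤p+q (e (m ℕ.+ n)) (0≤expTerm (m ℕ.+ n))))

  expSum-upper : ∀ n m → 2 ℕ.* B ℕ.≤ m → e (m ℕ.+ n) + (b (m ℕ.+ n) + b (m ℕ.+ n)) ≤ e m + (b m + b m)
  expSum-upper zero    m h = ≤-reflexive (cong (λ k → e k + (b k + b k)) (ℕ.+-identityʳ m))
  expSum-upper (suc n) m h = subst (λ k → e k + (b k + b k) ≤ e m + (b m + b m)) (sym (ℕ.+-suc m n))
      (≤-trans (go (e k) (b k) (b (suc k)) (expTerm-halves k (ℕ.≤-trans h (ℕ.m≤m+n m n)))) (expSum-upper n m h))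
    where
    k = m ℕ.+ n
    go : ∀ e b c → c + c ≤ b → e + b + (c + c) ≤ e + (b + b)
    go e b c h = ≤-trans (+-monoʳ-≤ (e + b) h) (≤-reflexive (+-assoc e b b))

  expSum-rate : ∀ i n → ∣ e (2 ℕ.* B ℕ.+ i ℕ.+ n) - e (2 ℕ.* B ℕ.+ i) ∣ ≤ (b (2 ℕ.* B) + b (2 ℕ.* B)) * (+ 1 / suc i)
  expSum-rate i n = go (e (k ℕ.+ n)) (e k) (b k) (b (k ℕ.+ n)) (b (2 ℕ.* B)) ⌜ suc i ⌝ (+ 1 / suc i) (⌜*⌝-inv i) (<⇒≤ (0<inv i))
      (0≤expTerm (k ℕ.+ n)) (expSum-mono n k) (expSum-upper n k (ℕ.m≤m+n (2 ℕ.* B) i)) (expTerm-rate i)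
    where
    k = 2 ℕ.* B ℕ.+ i
    r : ∀ c s i → (c + c) * (s * i) ≡ (s * c + s * c) * i
    r = solve 3 (λ c s i → (c :+ c) :* (s :* i) := (s :* c :+ s :* c) :* i) refl
    r₂ : ∀ a b → a + b - a ≡ b
    r₂ = solve 2 (λ a b → a :+ b :- a := b) refl
    go : ∀ e′ e c c′ d s i → s * i ≡ 1ℚ → 0ℚ ≤ i → 0ℚ ≤ c′ → e ≤ e′ → e′ + (c′ + c′) ≤ e + (c + c) → s * c ≤ d →
         ∣ e′ - e ∣ ≤ (d + d) * i
    go e′ e c c′ d s i si 0≤i 0≤c′ e≤e′ h sc≤d = begin
      ∣ e′ - e ∣           ≡⟨ 0≤p⇒∣p∣≡p (subst (_≤ e′ - e) (+-inverseʳ e) (+-monoˡ-≤ (- e) e≤e′)) ⟩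
      e′ - e               ≤⟨ +-monoˡ-≤ (- e) (≤-trans (p≤p+q e′ (0≤+ {c′} {c′} 0≤c′ 0≤c′)) h) ⟩
      e + (c + c) - e      ≡⟨ r₂ e (c + c) ⟩
      c + c                ≡⟨ sym (*-identityʳ (c + c)) ⟩
      (c + c) * 1ℚ         ≡⟨ cong (λ z → (c + c) * z) (sym si) ⟩
      (c + c) * (s * i)    ≡⟨ r c s i ⟩
      (s * c + s * c) * i  ≤⟨ *-monoʳ {i} 0≤i (+-mono-≤ sc≤d sc≤d) ⟩
      (d + d) * i          ∎

  expSum-ℕ-cauchy : Cauchy e
  expSum-ℕ-cauchy = cauchy-rate e (2 ℕ.* B) (b (2 ℕ.* B) + b (2 ℕ.* B)) expSum-rate

  expSum-bound : ∃ λ L → 0ℚ < L × 1ℚ ≤ L × (∀ k → e k ≤ L)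
  expSum-bound = L , <-≤-trans (positive⁻¹ 1ℚ) 1≤L , 1≤L , λ k → begin
      e k                                    ≤⟨ expSum-mono (2 ℕ.* B) k ⟩
      e (k ℕ.+ 2 ℕ.* B)                      ≡⟨ cong e (ℕ.+-comm k (2 ℕ.* B)) ⟩
      e (2 ℕ.* B ℕ.+ k)                      ≤⟨ p≤p+q (e (2 ℕ.* B ℕ.+ k)) (0≤+ (0≤expTerm (2 ℕ.* B ℕ.+ k)) (0≤expTerm (2 ℕ.* B ℕ.+ k))) ⟩
      e (2 ℕ.* B ℕ.+ k) + (b (2 ℕ.* B ℕ.+ k) + b (2 ℕ.* B ℕ.+ k)) ≤⟨ expSum-upper k (2 ℕ.* B) ℕ.≤-refl ⟩
      U                                      ≤⟨ p≤p+q U (<⇒≤ (positive⁻¹ 1ℚ)) ⟩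
      L                                      ∎
    where
    U L : ℚ
    U = e (2 ℕ.* B) + (b (2 ℕ.* B) + b (2 ℕ.* B))
    L = U + 1ℚ
    0≤U : 0ℚ ≤ U
    0≤U = 0≤+ (expSum-mono (2 ℕ.* B) 0) (0≤+ (0≤expTerm (2 ℕ.* B)) (0≤expTerm (2 ℕ.* B)))
    1≤L : 1ℚ ≤ L
    1≤L = ≤-trans (≤-reflexive (sym (+-identityˡ 1ℚ))) (+-monoˡ-≤ 1ℚ 0≤U)

  expTerm-dominated : ∀ x → ∣ x ∣ ≤ ⌜ B ⌝ → ∀ j → ∣ expTerm x j ∣ ≤ b j
  expTerm-dominated x h zero    = ≤-refl
  expTerm-dominated x h (suc j) = go (expTerm x j) (b j) ⌜ B ⌝ (+ 1 / suc j) h (<⇒≤ (0<inv j)) (expTerm-dominated x h j) (0≤expTerm j)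
    where
    go : ∀ t c B i → ∣ x ∣ ≤ B → 0ℚ ≤ i → ∣ t ∣ ≤ c → 0ℚ ≤ c → ∣ t * (x * i) ∣ ≤ c * (B * i)
    go t c B i xB 0≤i tc 0≤c = begin
      ∣ t * (x * i) ∣           ≡⟨ ∣p*q∣≡∣p∣*∣q∣ t (x * i) ⟩
      ∣ t ∣ * ∣ x * i ∣         ≡⟨ cong (λ z → ∣ t ∣ * z) (trans (∣p*q∣≡∣p∣*∣q∣ x i) (cong (λ z → ∣ x ∣ * z) (0≤p⇒∣p∣≡p 0≤i))) ⟩
      ∣ t ∣ * (∣ x ∣ * i)       ≤⟨ *-mono {∣ t ∣} {c} 0≤c (0≤* {∣ x ∣} {i} (0≤∣p∣ x) 0≤i) tc (*-monoʳ {i} 0≤i xB) ⟩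
      c * (B * i)               ∎

  expSum-tail : ∀ x → ∣ x ∣ ≤ ⌜ B ⌝ → ∀ n m → ∣ expSum x (m ℕ.+ n) - expSum x m ∣ ≤ e (m ℕ.+ n) - e m
  expSum-tail x h zero    m = subst (λ k → ∣ expSum x k - expSum x m ∣ ≤ e k - e m) (sym (ℕ.+-identityʳ m))
    (≤-reflexive (trans (cong ∣_∣ (+-inverseʳ (expSum x m))) (sym (+-inverseʳ (e m)))))
  expSum-tail x h (suc n) m = subst (λ k → ∣ expSum x k - expSum x m ∣ ≤ e k - e m) (sym (ℕ.+-suc m n))
      (go (expSum x (m ℕ.+ n)) (expSum x m) (expTerm x (m ℕ.+ n)) (e (m ℕ.+ n)) (e m) (b (m ℕ.+ n))
         (expSum-tail x h n m) (expTerm-dominated x h (m ℕ.+ n)))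
    where
    r : ∀ a c t → a + t - c ≡ a - c + t
    r = solve 3 (λ a c t → a :+ t :- c := a :- c :+ t) refl
    go : ∀ S s t E e c → ∣ S - s ∣ ≤ E - e → ∣ t ∣ ≤ c → ∣ S + t - s ∣ ≤ E + c - e
    go S s t E e c h₁ h₂ = begin
      ∣ S + t - s ∣      ≡⟨ cong ∣_∣ (r S s t) ⟩
      ∣ S - s + t ∣      ≤⟨ ∣p+q∣≤∣p∣+∣q∣ (S - s) t ⟩
      ∣ S - s ∣ + ∣ t ∣  ≤⟨ +-mono-≤ h₁ h₂ ⟩
      E - e + c          ≡⟨ sym (r E e c) ⟩
      E + c - e          ∎

  expTerm-lipschitz : ∀ x y → ∣ x ∣ ≤ ⌜ B ⌝ → ∣ y ∣ ≤ ⌜ B ⌝ → ∀ j →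
    ∣ expTerm x (suc j) - expTerm y (suc j) ∣ ≤ ∣ x - y ∣ * b j
  expTerm-lipschitz x y hx hy zero = ≤-reflexive (trans (cong ∣_∣ (r x y)) (sym (*-identityʳ ∣ x - y ∣)))
    where
    r : ∀ x y → 1ℚ * (x * 1ℚ) - 1ℚ * (y * 1ℚ) ≡ x - y
    r = solve 2 (λ x y → con 1ℚ :* (x :* con 1ℚ) :- con 1ℚ :* (y :* con 1ℚ) := x :- y) refl
  expTerm-lipschitz x y hx hy (suc j) =
      go (expTerm x (suc j)) (expTerm y (suc j)) (b j) ⌜ B ⌝ ⌜ suc j ⌝ (+ 1 / suc j) ⌜ suc (suc j) ⌝ (+ 1 / suc (suc j))
         (⌜*⌝-inv j) (⌜*⌝-inv (suc j)) (⌜suc⌝ (suc j)) hx (<⇒≤ (0<inv (suc j))) (0≤expTerm j)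
         (expTerm-lipschitz x y hx hy j) (expTerm-dominated y hy (suc j))
    where
    r : ∀ s t x y i → s * (x * i) - t * (y * i) ≡ ((s - t) * x + t * (x - y)) * i
    r = solve 5 (λ s t x y i → s :* (x :* i) :- t :* (y :* i) := ((s :- t) :* x :+ t :* (x :- y)) :* i) refl
    r₂ : ∀ D c B u i v → D * c * B * 1ℚ + c * (B * i) * D ≡ D * (c * B) * 1ℚ + D * (c * (B * i))
    r₂ = solve 6 (λ D c B u i v → D :* c :* B :* con 1ℚ :+ c :* (B :* i) :* D := D :* (c :* B) :* con 1ℚ :+ D :* (c :* (B :* i))) refl
    r₃ : ∀ D c B u i → D * (c * B) * (u * i) + D * (c * (B * i)) ≡ D * (c * (B * i)) * (1ℚ + u)
    r₃ = solve 5 (λ D c B u i → D :* (c :* B) :* (u :* i) :+ D :* (c :* (B :* i)) := D :* (c :* (B :* i)) :* (con 1ℚ :+ u)) refl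
    go : ∀ s t c B u i w k → u * i ≡ 1ℚ → w * k ≡ 1ℚ → w ≡ 1ℚ + u → ∣ x ∣ ≤ B → 0ℚ ≤ k → 0ℚ ≤ c →
         ∣ s - t ∣ ≤ ∣ x - y ∣ * c → ∣ t ∣ ≤ c * (B * i) →
         ∣ s * (x * k) - t * (y * k) ∣ ≤ ∣ x - y ∣ * (c * (B * i))
    go s t c B u i w k ui wk ew xB 0≤k 0≤c h₁ h₂ = begin
      ∣ s * (x * k) - t * (y * k) ∣                      ≡⟨ cong ∣_∣ (r s t x y k) ⟩
      ∣ ((s - t) * x + t * (x - y)) * k ∣                ≡⟨ trans (∣p*q∣≡∣p∣*∣q∣ ((s - t) * x + t * (x - y)) k) (cong (λ z → ∣ (s - t) * x + t * (x - y) ∣ * z) (0≤p⇒∣p∣≡p 0≤k)) ⟩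
      ∣ (s - t) * x + t * (x - y) ∣ * k                  ≤⟨ *-monoʳ {k} 0≤k (∣p+q∣≤∣p∣+∣q∣ ((s - t) * x) (t * (x - y))) ⟩
      (∣ (s - t) * x ∣ + ∣ t * (x - y) ∣) * k            ≡⟨ cong (_* k) (cong₂ _+_ (∣p*q∣≡∣p∣*∣q∣ (s - t) x) (∣p*q∣≡∣p∣*∣q∣ t (x - y))) ⟩
      (∣ s - t ∣ * ∣ x ∣ + ∣ t ∣ * D) * k                ≤⟨ *-monoʳ {k} 0≤k (+-mono-≤
                                                             (*-mono {∣ s - t ∣} {D * c} {∣ x ∣} {B} (0≤* {D} {c} (0≤∣p∣ (x - y)) 0≤c) (0≤∣p∣ x) h₁ xB)
                                                             (*-monoʳ {D} (0≤∣p∣ (x - y)) h₂)) ⟩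
      (D * c * B + c * (B * i) * D) * k                  ≡⟨ cong (_* k) (trans (cong (_+ c * (B * i) * D) (sym (*-identityʳ (D * c * B)))) (r₂ D c B u i w)) ⟩
      (D * (c * B) * 1ℚ + D * (c * (B * i))) * k         ≡⟨ cong (λ z → (D * (c * B) * z + D * (c * (B * i))) * k) (sym ui) ⟩
      (D * (c * B) * (u * i) + D * (c * (B * i))) * k    ≡⟨ cong (_* k) (r₃ D c B u i) ⟩
      D * (c * (B * i)) * (1ℚ + u) * k                   ≡⟨ cong (λ z → D * (c * (B * i)) * z * k) (sym ew) ⟩
      D * (c * (B * i)) * w * k                          ≡⟨ *-assoc (D * (c * (B * i))) w k ⟩
      D * (c * (B * i)) * (w * k)                        ≡⟨ cong (λ z → D * (c * (B * i)) * z) wk ⟩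
      D * (c * (B * i)) * 1ℚ                             ≡⟨ *-identityʳ (D * (c * (B * i))) ⟩
      D * (c * (B * i))                                  ∎
      where D = ∣ x - y ∣

  expSum-lipschitz : ∀ x y → ∣ x ∣ ≤ ⌜ B ⌝ → ∣ y ∣ ≤ ⌜ B ⌝ → ∀ m →
    ∣ expSum x (suc m) - expSum y (suc m) ∣ ≤ ∣ x - y ∣ * e m
  expSum-lipschitz x y hx hy zero = ≤-reflexive (sym (*-zeroʳ ∣ x - y ∣))
  expSum-lipschitz x y hx hy (suc m) =
      go (expSum x (suc m)) (expSum y (suc m)) (expTerm x (suc m)) (expTerm y (suc m)) ∣ x - y ∣ (e m) (b m)
         (expSum-lipschitz x y hx hy m) (expTerm-lipschitz x y hx hy m)
    where
    r : ∀ S T s t → S + s - (T + t) ≡ S - T + (s - t)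
    r = solve 4 (λ S T s t → S :+ s :- (T :+ t) := S :- T :+ (s :- t)) refl
    go : ∀ S T s t D E c → ∣ S - T ∣ ≤ D * E → ∣ s - t ∣ ≤ D * c → ∣ S + s - (T + t) ∣ ≤ D * (E + c)
    go S T s t D E c h₁ h₂ = begin
      ∣ S + s - (T + t) ∣        ≡⟨ cong ∣_∣ (r S T s t) ⟩
      ∣ S - T + (s - t) ∣        ≤⟨ ∣p+q∣≤∣p∣+∣q∣ (S - T) (s - t) ⟩
      ∣ S - T ∣ + ∣ s - t ∣      ≤⟨ +-mono-≤ h₁ h₂ ⟩
      D * E + D * c              ≡⟨ sym (*-distribˡ-+ D E c) ⟩
      D * (E + c)                ∎

  expSum-lipschitz′ : ∀ L → (∀ k → e k ≤ L) → ∀ x y → ∣ x ∣ ≤ ⌜ B ⌝ → ∣ y ∣ ≤ ⌜ B ⌝ → ∀ m →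
    ∣ expSum x m - expSum y m ∣ ≤ L * ∣ x - y ∣
  expSum-lipschitz′ L eL x y hx hy zero    = 0≤* {L} (≤-trans (expSum-mono 0 0) (eL 0)) (0≤∣p∣ (x - y))
  expSum-lipschitz′ L eL x y hx hy (suc m) = ≤-trans (expSum-lipschitz x y hx hy m)
    (≤-trans (*-monoˡ {∣ x - y ∣} (0≤∣p∣ (x - y)) (eL m)) (≤-reflexive (*-comm ∣ x - y ∣ L)))

expSum-cauchy : ∀ x → Cauchy x → Cauchy (λ k → expSum (x k) k)
expSum-cauchy x cx = cauchy-lipschitz x e (λ k → expSum (x k) k) cx (expSum-ℕ-cauchy B) L 0<L (proj₁ (proj₂ X)) main
  where
  X = cauchy-bounded x cx
  B = proj₁ X
  e : ℕ → ℚ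
  e = expSum ⌜ B ⌝
  L : ℚ
  L = proj₁ (expSum-bound B)
  0<L : 0ℚ < L
  0<L = proj₁ (proj₂ (expSum-bound B))
  1≤L : 1ℚ ≤ L
  1≤L = proj₁ (proj₂ (proj₂ (expSum-bound B)))
  tail : ∀ y → ∣ y ∣ ≤ ⌜ B ⌝ → ∀ m n → m ℕ.≤ n → ∣ expSum y n - expSum y m ∣ ≤ ∣ e n - e m ∣
  tail y hy m n mn = subst (λ k → ∣ expSum y k - expSum y m ∣ ≤ ∣ e k - e m ∣) (ℕ.m+[n∸m]≡n mn)
    (≤-trans (expSum-tail B y hy (n ℕ.∸ m) m) (p≤∣p∣ _))
  tail′ : ∀ y → ∣ y ∣ ≤ ⌜ B ⌝ → ∀ m n → (m ℕ.≤ n) ⊎ (n ℕ.≤ m) → ∣ expSum y m - expSum y n ∣ ≤ ∣ e m - e n ∣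
  tail′ y hy m n (inj₁ mn) = subst₂ _≤_ (∣p-q∣≡∣q-p∣ (expSum y n) (expSum y m)) (∣p-q∣≡∣q-p∣ (e n) (e m)) (tail y hy m n mn)
  tail′ y hy m n (inj₂ nm) = tail y hy n m nm
  r : ∀ a b c → a - c ≡ a - b + (b - c)
  r = solve 3 (λ a b c → a :- c := a :- b :+ (b :- c)) refl
  main : ∀ m n → proj₁ (proj₂ X) ℕ.≤ m → proj₁ (proj₂ X) ℕ.≤ n →
         ∣ expSum (x m) m - expSum (x n) n ∣ ≤ L * (∣ x m - x n ∣ + ∣ e m - e n ∣)
  main m n hm hn = begin
    ∣ expSum (x m) m - expSum (x n) n ∣                                          ≡⟨ cong ∣_∣ (r (expSum (x m) m) (expSum (x n) m) (expSum (x n) n)) ⟩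
    ∣ expSum (x m) m - expSum (x n) m + (expSum (x n) m - expSum (x n) n) ∣      ≤⟨ ∣p+q∣≤∣p∣+∣q∣ (expSum (x m) m - expSum (x n) m) (expSum (x n) m - expSum (x n) n) ⟩
    ∣ expSum (x m) m - expSum (x n) m ∣ + ∣ expSum (x n) m - expSum (x n) n ∣    ≤⟨ +-mono-≤
        (expSum-lipschitz′ B L (proj₂ (proj₂ (proj₂ (expSum-bound B)))) (x m) (x n) bm bn m)
        (≤-trans (tail′ (x n) bn m n (ℕ.≤-total m n)) (scale ∣ e m - e n ∣ (0≤∣p∣ (e m - e n)))) ⟩
    L * ∣ x m - x n ∣ + L * ∣ e m - e n ∣                                        ≡⟨ sym (*-distribˡ-+ L ∣ x m - x n ∣ ∣ e m - e n ∣) ⟩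
    L * (∣ x m - x n ∣ + ∣ e m - e n ∣)                                          ∎
    where
    bm = proj₂ (proj₂ X) m hm
    bn = proj₂ (proj₂ X) n hn
    scale : ∀ d → 0ℚ ≤ d → d ≤ L * d
    scale d 0≤d = ≤-trans (≤-reflexive (sym (*-identityˡ d))) (*-monoʳ {d} 0≤d 1≤L)

exp : ℝ → ℝ
exp x = mkℝ (λ k → expSum (seq x k) k) (expSum-cauchy (seq x) (cauchy x))

-- The largest r with rᵈ ≤ n (for d ≥ 1).
⌊root⌋ : ℕ → ℕ → ℕ
⌊root⌋ d zero    = 0
⌊root⌋ d (suc n) with suc (⌊root⌋ d n) ℕ.^ d ℕ.≤? suc n
... | yes _ = suc (⌊root⌋ d n)
... | no  _ = ⌊root⌋ d n

⌊root⌋-spec : ∀ d .{{_ : ℕ.NonZero d}} n → ⌊root⌋ d n ℕ.^ d ℕ.≤ n × n ℕ.< suc (⌊root⌋ d n) ℕ.^ d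
⌊root⌋-spec (suc d) zero    = ℕ.z≤n , ℕ.≤-reflexive (sym (ℕ.^-zeroˡ (suc d)))
⌊root⌋-spec (suc d) (suc n) with suc (⌊root⌋ (suc d) n) ℕ.^ suc d ℕ.≤? suc n
... | yes h = h , ℕ.≤-<-trans (proj₂ (⌊root⌋-spec (suc d) n)) (ℕ.^-monoˡ-< (suc d) (ℕ.n<1+n (suc (⌊root⌋ (suc d) n))))
... | no ¬h = ℕ.m≤n⇒m≤1+n (proj₁ (⌊root⌋-spec (suc d) n)) , ℕ.≰⇒> ¬h

^-distribʳ-* : ∀ d a b → (a ℕ.* b) ℕ.^ d ≡ a ℕ.^ d ℕ.* b ℕ.^ d
^-distribʳ-* zero    a b = refl
^-distribʳ-* (suc d) a b = trans (cong (a ℕ.* b ℕ.*_) (^-distribʳ-* d a b)) (ℕ.[m*n]*[o*p]≡[m*o]*[n*p] a b (a ℕ.^ d) (b ℕ.^ d))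

rootNum : ℕ → ℕ → ℕ → ℕ
rootNum d n k = ⌊root⌋ d (n ℕ.* suc k ℕ.^ d)

-- ⌊(k + 1) n^(1/d)⌋ / (k + 1)
rootSeq : ℕ → ℕ → ℕ → ℚ
rootSeq d n k = ⌜ rootNum d n k ⌝ * (+ 1 / suc k)

module _ (d : ℕ) .{{_ : ℕ.NonZero d}} (n : ℕ) where
  private
    ρ : ℕ → ℕ
    ρ = rootNum d n

  rootNum-compare : ∀ i j → ρ i ℕ.* suc j ℕ.≤ suc (ρ j) ℕ.* suc i
  rootNum-compare i j = ℕ.≮⇒≥ λ lt → ℕ.<-irrefl refl (ℕ.<-trans (ℕ.^-monoˡ-< d lt) key)
    where
    swap : ∀ a b c → a ℕ.* b ℕ.* c ≡ a ℕ.* c ℕ.* b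
    swap a b c = trans (ℕ.*-assoc a b c) (trans (cong (a ℕ.*_) (ℕ.*-comm b c)) (sym (ℕ.*-assoc a c b)))
    instance
      pow≢0 : ℕ.NonZero (suc i ℕ.^ d)
      pow≢0 = ℕ.m^n≢0 (suc i) d
    key : (ρ i ℕ.* suc j) ℕ.^ d ℕ.< (suc (ρ j) ℕ.* suc i) ℕ.^ d
    key = subst₂ ℕ._<_ (sym (^-distribʳ-* d (ρ i) (suc j))) (sym (^-distribʳ-* d (suc (ρ j)) (suc i)))
      (ℕ.≤-<-trans
        (ℕ.*-monoˡ-≤ (suc j ℕ.^ d) (proj₁ (⌊root⌋-spec d (n ℕ.* suc i ℕ.^ d))))
        (subst (ℕ._< suc (ρ j) ℕ.^ d ℕ.* suc i ℕ.^ d) (swap n (suc j ℕ.^ d) (suc i ℕ.^ d))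
          (ℕ.*-monoˡ-< (suc i ℕ.^ d) (proj₂ (⌊root⌋-spec d (n ℕ.* suc j ℕ.^ d))))))

  rootSeq-compare : ∀ i j → rootSeq d n i - rootSeq d n j ≤ + 1 / suc j
  rootSeq-compare i j = go ⌜ ρ i ⌝ ⌜ ρ j ⌝ ⌜ suc i ⌝ (+ 1 / suc i) ⌜ suc j ⌝ (+ 1 / suc j) (⌜*⌝-inv i) (⌜*⌝-inv j)
      (<⇒≤ (0<inv i)) (<⇒≤ (0<inv j))
      (subst₂ _≤_ (⌜*⌝ (ρ i) (suc j)) (trans (⌜*⌝ (suc (ρ j)) (suc i)) (cong (_* ⌜ suc i ⌝) (⌜suc⌝ (ρ j))))
        (⌜⌝-mono (rootNum-compare i j)))
    where
    r₁ : ∀ a p t q → a * p * (t * q) ≡ a * t * (p * q)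
    r₁ = solve 4 (λ a p t q → a :* p :* (t :* q) := a :* t :* (p :* q)) refl
    r₂ : ∀ b s p q → (1ℚ + b) * s * (p * q) ≡ (1ℚ + b) * (s * p) * q
    r₂ = solve 4 (λ b s p q → (con 1ℚ :+ b) :* s :* (p :* q) := (con 1ℚ :+ b) :* (s :* p) :* q) refl
    r₃ : ∀ b q → (1ℚ + b) * 1ℚ * q - b * q ≡ q
    r₃ = solve 2 (λ b q → (con 1ℚ :+ b) :* con 1ℚ :* q :- b :* q := q) refl
    go : ∀ a b s p t q → s * p ≡ 1ℚ → t * q ≡ 1ℚ → 0ℚ ≤ p → 0ℚ ≤ q → a * t ≤ (1ℚ + b) * s → a * p - b * q ≤ q
    go a b s p t q sp tq 0≤p 0≤q h = begin
      a * p - b * q                       ≡⟨ cong (_- b * q) (sym (*-identityʳ (a * p))) ⟩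
      a * p * 1ℚ - b * q                  ≡⟨ cong (λ z → a * p * z - b * q) (sym tq) ⟩
      a * p * (t * q) - b * q             ≡⟨ cong (_- b * q) (r₁ a p t q) ⟩
      a * t * (p * q) - b * q             ≤⟨ +-monoˡ-≤ (- (b * q)) (*-monoʳ {p * q} (0≤* {p} {q} 0≤p 0≤q) h) ⟩
      (1ℚ + b) * s * (p * q) - b * q      ≡⟨ cong (_- b * q) (r₂ b s p q) ⟩
      (1ℚ + b) * (s * p) * q - b * q      ≡⟨ cong (λ z → (1ℚ + b) * z * q - b * q) sp ⟩
      (1ℚ + b) * 1ℚ * q - b * q           ≡⟨ r₃ b q ⟩
      q                                   ∎

  rootSeq-cauchy : Cauchy (rootSeq d n)
  rootSeq-cauchy = cauchy-rate (rootSeq d n) 0 1ℚ λ i m → subst (∣ rootSeq d n (i ℕ.+ m) - rootSeq d n i ∣ ≤_) (sym (*-identityˡ (+ 1 / suc i)))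
      (∣∣≤ (rootSeq-compare (i ℕ.+ m) i)
           (≤-trans (≤-reflexive (r (rootSeq d n (i ℕ.+ m)) (rootSeq d n i)))
             (≤-trans (rootSeq-compare i (i ℕ.+ m)) (inv-antitone (ℕ.m≤m+n i m)))))
    where
    r : ∀ a b → - (a - b) ≡ b - a
    r = solve 2 (λ a b → :- (a :- b) := b :- a) refl

  root : ℝ
  root = mkℝ (rootSeq d n) rootSeq-cauchy

  root-positive : .{{_ : ℕ.NonZero n}} → Positiveᴿ root
  root-positive = mkPositiveᴿ 1ℚ (positive⁻¹ 1ℚ) 0 λ k _ → subst (_≤ rootSeq d n k) (⌜*⌝-inv k)
      (*-monoʳ {+ 1 / suc k} {⌜ suc k ⌝} {⌜ ρ k ⌝} (<⇒≤ (0<inv k)) (⌜⌝-mono (large k)))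
    where
    large : ∀ k → suc k ℕ.≤ ρ k
    large k = ℕ.≮⇒≥ λ lt → ℕ.<-irrefl refl (ℕ.<-≤-trans (proj₂ (⌊root⌋-spec d (n ℕ.* suc k ℕ.^ d)))
      (ℕ.≤-trans (ℕ.^-monoˡ-≤ d lt) (ℕ.m≤n*m (suc k ℕ.^ d) n)))

infixl 7 _÷ᴿ_⟨_⟩

_÷ᴿ_⟨_⟩ : ℝ → (y : ℝ) → Positiveᴿ y → ℝ
x ÷ᴿ y ⟨ y⁺ ⟩ = x *ᴿ inverse y y⁺

-- e^(-2α) is written as the square of e^(-α); then t² + t + 1 ≥ 3/4 bounds every approximant.
F-denominator : ℝ → ℝ
F-denominator α = fromℕ 1 +ᴿ exp (-ᴿ α) +ᴿ exp (-ᴿ α) *ᴿ exp (-ᴿ α)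

F-denominator-positive : ∀ α → Positiveᴿ (F-denominator α)
F-denominator-positive α = mkPositiveᴿ (+ 3 / 4) (positive⁻¹ (+ 3 / 4)) 0 λ k _ → go (seq (exp (-ᴿ α)) k)
  where
  sq : ∀ p → 0ℚ ≤ p * p
  sq p = subst (0ℚ ≤_) (abs² p) (0≤* (0≤∣p∣ p) (0≤∣p∣ p))
    where
    r : ∀ p → - p * - p ≡ p * p
    r = solve 1 (λ p → :- p :* :- p := p :* p) refl
    abs² : ∀ p → ∣ p ∣ * ∣ p ∣ ≡ p * p
    abs² p with ∣p∣≡p∨∣p∣≡-p p
    ... | inj₁ e = cong₂ _*_ e e
    ... | inj₂ e = trans (cong₂ _*_ e e) (r p)
  r : ∀ t → (+ 3 / 4) + (t + ½) * (t + ½) ≡ 1ℚ + t + t * t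
  r = solve 1 (λ t → con (+ 3 / 4) :+ (t :+ con ½) :* (t :+ con ½) := con 1ℚ :+ t :+ t :* t) refl
  go : ∀ t → + 3 / 4 ≤ 1ℚ + t + t * t
  go t = subst (+ 3 / 4 ≤_) (r t) (p≤p+q (+ 3 / 4) (sq (t + ½)))

F : ℝ → ℝ
F α = (fromℕ 1 +ᴿ exp (-ᴿ α)) ÷ᴿ F-denominator α ⟨ F-denominator-positive α ⟩

-- π |ℓ| / √(6N)
scaledRank : ℤ → (N : ℕ) → .{{_ : ℕ.NonZero N}} → ℝ
scaledRank ℓ N = (π *ᴿ fromℕ ℤ.∣ ℓ ∣) ÷ᴿ root 2 (6 ℕ.* N) ⟨ root-positive 2 (6 ℕ.* N) {{ℕ.m*n≢0 6 N}} ⟩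

-- N^(-1/10)
tenthRoot⁻¹ : (N : ℕ) → .{{_ : ℕ.NonZero N}} → ℝ
tenthRoot⁻¹ N = fromℕ 1 ÷ᴿ root 10 N ⟨ root-positive 10 N ⟩

-- (24N)^(-1/4) exp(-π m² / √(24N))
gaussian : ℤ → (N : ℕ) → .{{_ : ℕ.NonZero N}} → ℝ
gaussian m N =
  (fromℕ 1 ÷ᴿ root 4 (24 ℕ.* N) ⟨ root-positive 4 (24 ℕ.* N) {{24N≢0}} ⟩) *ᴿ
  exp (-ᴿ ((π *ᴿ fromℕ (ℤ.∣ m ∣ ℕ.* ℤ.∣ m ∣)) ÷ᴿ root 2 (24 ℕ.* N) ⟨ root-positive 2 (24 ℕ.* N) {{24N≢0}} ⟩))
  where
  24N≢0 : ℕ.NonZero (24 ℕ.* N)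
  24N≢0 = ℕ.m*n≢0 24 N

rankProportion : ℤ → ℕ → ℚ
rankProportion m n = (+ V m n / V-total n) {{V-total-nonZero n}}

infix 4 _∼_

-- f(N) = g(N) (1 + o(1)) as N → ∞.
_∼_ : (f g : (N : ℕ) → .{{_ : ℕ.NonZero N}} → ℝ) → Set
f ∼ g = ∀ ε → 0ℚ < ε → ∃ λ N₀ → ∀ N → .{{_ : ℕ.NonZero N}} → N₀ ℕ.≤ N →
  ∃ λ E → ∣ E ∣ᴿ ≤ᴿ fromℚ ε × f N ≈ᴿ g N *ᴿ (fromℕ 1 +ᴿ E)

{-# OPTIONS --safe #-}
module Submission where

-- For a fixed total M the numbers a(ℓ) = V_d(ℓ, M) satisfy a(ℓ) + a(ℓ+2) + s(ℓ+1) = g(ℓ) + g(ℓ+1),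
-- where g(ℓ) = p(M - ℓ(ℓ+1)/2) and a(ℓ) - s(ℓ) lies between 0 and two backward differences of p.
-- If g were geometric with ratio z and s equal to a, the solution would be a = g (1+z)/(1+z+z²);
-- the deviation from it telescopes in steps of three, and is bounded by the variation of the
-- increments of g, hence by convexity of p.
-- No asymptotic formula for p is needed: n p(n) = Σ σ(k) p(n-k) says that the second partial sums U
-- of p satisfy U″ ≈ θ² U with θ = π/√(6n), so that p(n-d) ≈ (1+θ)^(-d) p(n) on short windows.
-- For the Gaussian law, Σ_k (1+θ)^(-k(k+1)/2) is compared termwise with Σ_k C(2n+1,n-k)/C(2n+1,n),
-- n ≈ 2/θ, whose square is (n+1) times an alternating sum tending to π/4.

open import Data.Nat.Base as ℕ using (ℕ; zero; suc)
import Data.Nat.Properties as ℕ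
import Data.Nat.DivMod as ℕ
import Data.Nat.Tactic.RingSolver as ℕ-Ring
open import Data.Product.Base using (∃; _×_; _,_; proj₁; proj₂)
open import Data.Sum.Base using (_⊎_; inj₁; inj₂)
open import Data.Unit.Base using (tt)
open import Function.Base using (_∘_)
open import Relation.Nullary using (yes; no)
open import Relation.Binary.PropositionalEquality

-- Real numbers enter only at the end. For fixed N the estimates are proved for any rational θ with
-- Nθ² close to ζ(N), a partial sum of ζ(2); the approximants of π/√(6N) are such θ from some index
-- on, because π²/6 = ζ(2) is derived from the Leibniz series that defines π. Let w be about
-- N^(1/8). For d up to w⁶, p(n-d) is known up to an error of order p(n)/w². For ℓ ≥ w³ the sum of
-- the relevant g is of order w p(N), so these errors add up to order 1/w. For ℓ ≤ w³ there are too
-- many terms, but z is within O(1/w) of 1, and convexity alone bounds the variation of the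
-- increments. The final error is of order N^(-1/8). In the Gaussian law (1+θ)^(-d) may be
-- exponentially small, so additive errors are useless and the window estimate is redone
-- multiplicatively; its relative error has a part of order d/w⁶, which limits the rank to
-- o(N^(3/8)). Binomial weights serve instead of an integral: their sum has a closed form, and their
-- consecutive ratios 1 - 2(k+1)/(n+k+2) match 1 - (k+1)θ.

module QSeries where
 open import Data.Nat.Base
 open import Data.Nat.Properties
 open import Data.Nat.Solver using (module +-*-Solver)
 open +-*-Solver using (solve; con; _:+_; _:*_; _:=_)
 open ≡-Reasoning

 ≡≤ : ∀ {a b c} → a ≡ b → b ≤ c → a ≤ c
 ≡≤ refl h = h

 ≤≡ : ∀ {a b c} → a ≤ b → b ≡ c → a ≤ c
 ≤≡ h refl = h

 -- Power series as coefficient sequences; partitions with bounded parts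

 Seq : Set
 Seq = ℕ → ℕ

 Σ< : ℕ → (ℕ → ℕ) → ℕ
 Σ< zero f = 0
 Σ< (suc k) f = Σ< k f + f k

 Σ-cong< : ∀ k {f g : ℕ → ℕ} → (∀ i → i < k → f i ≡ g i) → Σ< k f ≡ Σ< k g
 Σ-cong< zero h = refl
 Σ-cong< (suc k) h = cong₂ _+_ (Σ-cong< k λ i i<k → h i (m≤n⇒m≤1+n i<k)) (h k ≤-refl)

 Σ-cong : ∀ k {f g : ℕ → ℕ} → (∀ i → f i ≡ g i) → Σ< k f ≡ Σ< k g
 Σ-cong k h = Σ-cong< k λ i _ → h i

 Σ-mono : ∀ k {f g : ℕ → ℕ} → (∀ i → f i ≤ g i) → Σ< k f ≤ Σ< k g
 Σ-mono zero h = z≤n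
 Σ-mono (suc k) h = +-mono-≤ (Σ-mono k h) (h k)

 private
  +-interchange = solve 4 (λ a b c d → (a :+ b) :+ (c :+ d) := (a :+ c) :+ (b :+ d)) refl

 Σ-+ : ∀ k (f g : ℕ → ℕ) → Σ< k (λ i → f i + g i) ≡ Σ< k f + Σ< k g
 Σ-+ zero f g = refl
 Σ-+ (suc k) f g = trans (cong (_+ (f k + g k)) (Σ-+ k f g)) (+-interchange (Σ< k f) (Σ< k g) (f k) (g k))

 Σ-head : ∀ k (f : ℕ → ℕ) → Σ< (suc k) f ≡ f 0 + Σ< k (f ∘ suc)
 Σ-head zero f = sym (+-identityʳ (f 0))
 Σ-head (suc k) f = trans (cong (_+ f (suc k)) (Σ-head k f)) (+-assoc (f 0) (Σ< k (f ∘ suc)) (f (suc k)))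

 Σ-0 : ∀ k {f : ℕ → ℕ} → (∀ i → f i ≡ 0) → Σ< k f ≡ 0
 Σ-0 zero h = refl
 Σ-0 (suc k) h = cong₂ _+_ (Σ-0 k h) (h k)

 -- Multiplication of a power series by q^k; `conv` below is the product of two series.
 sh : ℕ → Seq → Seq
 sh zero a n = a n
 sh (suc k) a zero = 0
 sh (suc k) a (suc n) = sh k a n

 sh-cong≤ : ∀ k n {a b : Seq} → (∀ m → m ≤ n → a m ≡ b m) → sh k a n ≡ sh k b n
 sh-cong≤ zero n h = h n ≤-refl
 sh-cong≤ (suc k) zero h = refl
 sh-cong≤ (suc k) (suc n) h = sh-cong≤ k n λ m m≤n → h m (m≤n⇒m≤1+n m≤n)

 sh-cong< : ∀ k n {a b : Seq} → (∀ m → m < n → a m ≡ b m) → sh (suc k) a n ≡ sh (suc k) b n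
 sh-cong< k zero h = refl
 sh-cong< k (suc n) h = sh-cong≤ k n λ m m≤n → h m (s≤s m≤n)

 sh-cong : ∀ k {a b : Seq} → (∀ m → a m ≡ b m) → ∀ n → sh k a n ≡ sh k b n
 sh-cong k h n = sh-cong≤ k n λ m _ → h m

 sh-+ : ∀ j k a n → sh (j + k) a n ≡ sh j (sh k a) n
 sh-+ zero k a n = refl
 sh-+ (suc j) k a zero = refl
 sh-+ (suc j) k a (suc n) = sh-+ j k a n

 sh-comm : ∀ j k a n → sh j (sh k a) n ≡ sh k (sh j a) n
 sh-comm j k a n = trans (sym (sh-+ j k a n)) (trans (cong (λ i → sh i a n) (+-comm j k)) (sh-+ k j a n))

 sh-< : ∀ k a n → n < k → sh k a n ≡ 0
 sh-< (suc k) a zero _ = refl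
 sh-< (suc k) a (suc n) (s≤s n<k) = sh-< k a n n<k

 sh-≥ : ∀ k a n → sh k a (k + n) ≡ a n
 sh-≥ zero a n = refl
 sh-≥ (suc k) a n = sh-≥ k a n

 sh-⊕ : ∀ k a b n → sh k (λ m → a m + b m) n ≡ sh k a n + sh k b n
 sh-⊕ zero a b n = refl
 sh-⊕ (suc k) a b zero = refl
 sh-⊕ (suc k) a b (suc n) = sh-⊕ k a b n

 sh-* : ∀ k c a n → sh k (λ m → c * a m) n ≡ c * sh k a n
 sh-* zero c a n = refl
 sh-* (suc k) c a zero = sym (*-zeroʳ c)
 sh-* (suc k) c a (suc n) = sh-* k c a n

 sh-Σ : ∀ k K (f : ℕ → Seq) n → sh k (λ m → Σ< K (λ i → f i m)) n ≡ Σ< K (λ i → sh k (f i) n)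
 sh-Σ k zero f n = sh-0 k n
  where
  sh-0 : ∀ k n → sh k (λ _ → 0) n ≡ 0
  sh-0 zero n = refl
  sh-0 (suc k) zero = refl
  sh-0 (suc k) (suc n) = sh-0 k n
 sh-Σ k (suc K) f n = trans (sh-⊕ k (λ m → Σ< K (λ i → f i m)) (f K) n) (cong (_+ sh k (f K) n) (sh-Σ k K f n))

 sh-mono : ∀ k {a b : Seq} → (∀ n → a n ≤ b n) → ∀ n → sh k a n ≤ sh k b n
 sh-mono zero h n = h n
 sh-mono (suc k) h zero = z≤n
 sh-mono (suc k) h (suc n) = sh-mono k h n

 Increasing : Seq → Set
 Increasing a = ∀ n → a n ≤ a (suc n)

 sh-increasing : ∀ k {a} → Increasing a → Increasing (sh k a)
 sh-increasing zero h n = h n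
 sh-increasing (suc k) h zero = z≤n
 sh-increasing (suc k) h (suc n) = sh-increasing k h n

 sh-suc≤ : ∀ k {a} → Increasing a → ∀ n → sh (suc k) a n ≤ sh k a n
 sh-suc≤ k h zero = z≤n
 sh-suc≤ k h (suc n) = sh-increasing k h n

 sh-antitone : ∀ {j k a} → Increasing a → j ≤ k → ∀ n → sh k a n ≤ sh j a n
 sh-antitone {j} {k} {a} h j≤k n = go (≤⇒≤′ j≤k)
  where
  go : ∀ {k} → j ≤′ k → sh k a n ≤ sh j a n
  go ≤′-refl = ≤-refl
  go (≤′-step {k} j≤′k) = ≤-trans (sh-suc≤ k h n) (go j≤′k)

 conv : Seq → Seq → Seq
 conv f g zero = f 0 * g 0
 conv f g (suc n) = f 0 * g (suc n) + conv (f ∘ suc) g n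

 conv-cong : ∀ {f f′ g g′} → (∀ n → f n ≡ f′ n) → (∀ n → g n ≡ g′ n) → ∀ n → conv f g n ≡ conv f′ g′ n
 conv-cong h k zero = cong₂ _*_ (h 0) (k 0)
 conv-cong h k (suc n) = cong₂ _+_ (cong₂ _*_ (h 0) (k (suc n))) (conv-cong (h ∘ suc) k n)

 conv-⊕ˡ : ∀ f f′ g n → conv (λ m → f m + f′ m) g n ≡ conv f g n + conv f′ g n
 conv-⊕ˡ f f′ g zero = *-distribʳ-+ (g 0) (f 0) (f′ 0)
 conv-⊕ˡ f f′ g (suc n) = trans
  (cong₂ _+_ (*-distribʳ-+ (g (suc n)) (f 0) (f′ 0)) (conv-⊕ˡ (f ∘ suc) (f′ ∘ suc) g n))
  (+-interchange (f 0 * g (suc n)) (f′ 0 * g (suc n)) (conv (f ∘ suc) g n) (conv (f′ ∘ suc) g n))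

 conv-last : ∀ f g n → conv f g (suc n) ≡ conv f (g ∘ suc) n + f (suc n) * g 0
 conv-last f g zero = refl
 conv-last f g (suc n) = trans (cong (f 0 * g (suc (suc n)) +_) (conv-last (f ∘ suc) g n))
  (sym (+-assoc (f 0 * g (suc (suc n))) (conv (f ∘ suc) (g ∘ suc) n) (f (suc (suc n)) * g 0)))

 conv-comm : ∀ f g n → conv f g n ≡ conv g f n
 conv-comm f g zero = *-comm (f 0) (g 0)
 conv-comm f g (suc n) = begin
  f 0 * g (suc n) + conv (f ∘ suc) g n ≡⟨ +-comm (f 0 * g (suc n)) _ ⟩
  conv (f ∘ suc) g n + f 0 * g (suc n) ≡⟨ cong₂ _+_ (conv-comm (f ∘ suc) g n) (*-comm (f 0) (g (suc n))) ⟩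
  conv g (f ∘ suc) n + g (suc n) * f 0 ≡⟨ conv-last g f n ⟨
  conv g f (suc n) ∎

 conv-⊕ʳ : ∀ f g g′ n → conv f (λ m → g m + g′ m) n ≡ conv f g n + conv f g′ n
 conv-⊕ʳ f g g′ n = trans (conv-comm f _ n) (trans (conv-⊕ˡ g g′ f n) (cong₂ _+_ (conv-comm g f n) (conv-comm g′ f n)))

 conv-shˡ : ∀ k f g n → conv (sh k f) g n ≡ sh k (conv f g) n
 conv-shˡ zero f g n = refl
 conv-shˡ (suc k) f g zero = refl
 conv-shˡ (suc k) f g (suc n) = conv-shˡ k f g n

 conv-shʳ : ∀ k f g n → conv f (sh k g) n ≡ sh k (conv f g) n
 conv-shʳ k f g n = trans (conv-comm f _ n) (trans (conv-shˡ k g f n) (sh-cong k (conv-comm g f) n))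

 conv-monoˡ : ∀ {f f′} g → (∀ n → f n ≤ f′ n) → ∀ n → conv f g n ≤ conv f′ g n
 conv-monoˡ g h zero = *-monoˡ-≤ (g 0) (h 0)
 conv-monoˡ g h (suc n) = +-mono-≤ (*-monoˡ-≤ (g (suc n)) (h 0)) (conv-monoˡ g (h ∘ suc) n)

 conv-increasing : ∀ {f} g → Increasing f → Increasing (conv f g)
 conv-increasing {f} g h n = ≤-trans (conv-monoˡ g h n) (m≤n+m _ (f 0 * g (suc n)))

 -- Truncations of s / (1 - q^(k+1)). The recursive call is used only at smaller coefficients, which
 -- is not structural, hence the fuel; every fuel above n gives the same coefficient at n.
 geoF : ℕ → ℕ → Seq → Seq
 geoF zero k s n = 0
 geoF (suc f) k s n = s n + sh (suc k) (geoF f k s) n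

 geoF-fuel : ∀ f f′ k s n → n < f → n < f′ → geoF f k s n ≡ geoF f′ k s n
 geoF-fuel (suc f) (suc f′) k s n (s≤s n≤f) (s≤s n≤f′) = cong (s n +_)
  (sh-cong< k n λ m m<n → geoF-fuel f f′ k s m (<-≤-trans m<n n≤f) (<-≤-trans m<n n≤f′))

 geo : ℕ → Seq → Seq
 geo k s n = geoF (suc n) k s n

 geo-rec : ∀ k s n → geo k s n ≡ s n + sh (suc k) (geo k s) n
 geo-rec k s n = cong (s n +_) (sh-cong< k n λ m m<n → geoF-fuel n (suc m) k s m m<n ≤-refl)

 geo-increasing : ∀ k {s} → Increasing s → Increasing (geo k s)
 geo-increasing k {s} h n = ≡≤ (geoF-fuel (suc n) (suc (suc n)) k s n ≤-refl (m≤n⇒m≤1+n ≤-refl)) (go (suc (suc n)) n)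
  where
  go : ∀ f → Increasing (geoF f k s)
  go zero n = z≤n
  go (suc f) n = +-mono-≤ (h n) (sh-increasing (suc k) (go f) n)

 one : Seq
 one zero = 1
 one (suc _) = 0

 -- The series 1 / ((1-q)⋯(1-q^k)) of partitions into parts at most k.
 A : ℕ → Seq
 A zero = one
 A (suc k) = geo k (A k)

 P : Seq
 P n = A n n

 A-rec : ∀ k n → A (suc k) n ≡ A k n + sh (suc k) (A (suc k)) n
 A-rec k = geo-rec k (A k)

 A-increasing : ∀ k → Increasing (A (suc k))
 A-increasing (suc k) n = geo-increasing (suc k) (A-increasing k) n
 A-increasing zero n = ≤-reflexive (sym (geo-rec 0 one (suc n)))

 A-stable : ∀ k n → n ≤ k → A k n ≡ P n
 A-stable k n n≤k = go (≤⇒≤′ n≤k)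
  where
  go : ∀ {k} → n ≤′ k → A k n ≡ P n
  go ≤′-refl = refl
  go (≤′-step {k} n≤k) = trans (A-rec k n) (trans (cong (A k n +_) (sh-< (suc k) (A (suc k)) n (s≤s (≤′⇒≤ n≤k))))
   (trans (+-identityʳ (A k n)) (go n≤k)))

 -- The backward difference p(n) - p(n-1) with visibly nonnegative terms: adding 1 to the largest
 -- part misses exactly the partitions whose two largest parts coincide, and for the common value r
 -- these have the series q^(2r) / ((1-q)⋯(1-q^r)).
 ∇ : Seq
 ∇ n = Σ< (suc n) (λ r → sh (r + r) (A r) n)

 P-split : ∀ k n → A k n ≡ Σ< (suc k) (λ r → sh r (A r) n)
 P-split zero n = refl
 P-split (suc k) n = trans (A-rec k n) (cong (_+ sh (suc k) (A (suc k)) n) (P-split k n))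

 P-∇ : ∀ n → P (suc n) ≡ P n + ∇ (suc n)
 P-∇ n = begin
  P (suc n)
   ≡⟨ P-split (suc n) (suc n) ⟩
  Σ< (suc (suc n)) (λ r → sh r (A r) (suc n))
   ≡⟨ Σ-head (suc n) (λ r → sh r (A r) (suc n)) ⟩
  0 + Σ< (suc n) (λ r → sh r (A (suc r)) n)
   ≡⟨ Σ-cong (suc n) (λ r → trans (sh-cong r (A-rec r) n) (trans (sh-⊕ r (A r) _ n)
      (cong (sh r (A r) n +_) (trans (sym (sh-+ r (suc r) (A (suc r)) n)) refl)))) ⟩
  Σ< (suc n) (λ r → sh r (A r) n + sh (r + suc r) (A (suc r)) n)
   ≡⟨ Σ-+ (suc n) _ _ ⟩
  Σ< (suc n) (λ r → sh r (A r) n) + Σ< (suc n) (λ r → sh (suc r + suc r) (A (suc r)) (suc n))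
   ≡⟨ cong₂ _+_ (sym (P-split n n)) (sym (Σ-head (suc n) (λ r → sh (r + r) (A r) (suc n)))) ⟩
  P n + ∇ (suc n) ∎

 -- Every summand with r ≥ 1 has nondecreasing coefficients; the summand r = 0 is the constant
 -- series 1 and spoils index 0 only. This is the convexity of p.
 ∇-step : ∀ n → ∇ (suc n) ≤ ∇ (suc (suc n))
 ∇-step n = begin′
  where
  begin′ : ∇ (suc n) ≤ ∇ (suc (suc n))
  begin′ = ≤-trans
   (≡≤ (Σ-head (suc n) (λ r → sh (r + r) (A r) (suc n)))
    (≤-trans (Σ-mono (suc n) (λ r → sh-increasing (suc r + suc r) (A-increasing r) (suc n)))
     (≤-reflexive (sym (Σ-head (suc n) (λ r → sh (r + r) (A r) (suc (suc n))))))))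
   (m≤m+n _ _)

 ∇-mono : ∀ {m n} → suc m ≤ n → ∇ (suc m) ≤ ∇ n
 ∇-mono {m} h = go (≤⇒≤′ h)
  where
  go : ∀ {n} → suc m ≤′ n → ∇ (suc m) ≤ ∇ n
  go ≤′-refl = ≤-refl
  go (≤′-step {suc n} h) = ≤-trans (go h) (∇-step n)
  go (≤′-step {zero} h) with () ← ≤′⇒≤ h

 -- The irregular value ∇ 0 = 1 exceeds ∇ 1 = 0 but not ∇ 2 = 1. This is the origin of the shifts by
 -- 2 later on.
 ∇-mono₂ : ∀ {m n} → 2 + m ≤ n → ∇ m ≤ ∇ n
 ∇-mono₂ {zero} h = ≤-trans ∇0≤∇2 (∇-mono h)
  where
  ∇0≤∇2 : ∇ 0 ≤ ∇ 2
  ∇0≤∇2 = s≤s z≤n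
 ∇-mono₂ {suc m} h = ∇-mono (≤-trans (n≤1+n (suc m)) (≤-trans (n≤1+n _) h))

 P-increasing : Increasing P
 P-increasing n = ≤≡ (m≤m+n (P n) (∇ (suc n))) (sym (P-∇ n))

 -- n p(n) = Σ σ(k) p(n - k)

 module _ (K : ℕ) where
  -- Multiplication by q^(j+1) / (1 - q^(j+1)), truncated after K terms, which is exact up to degree
  -- K. The weighted sum `Q k` is then multiplication by the logarithmic derivative of `A k`.
  T : ℕ → Seq → Seq
  T j a n = Σ< K (λ i → sh (suc i * suc j) a n)

  T-⊕ : ∀ j a b n → T j (λ m → a m + b m) n ≡ T j a n + T j b n
  T-⊕ j a b n = trans (Σ-cong K λ i → sh-⊕ (suc i * suc j) a b n) (Σ-+ K _ _)

  T-sh : ∀ j k a n → T j (sh k a) n ≡ sh k (T j a) n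
  T-sh j k a n = trans (Σ-cong K λ i → sh-comm (suc i * suc j) k a n) (sym (sh-Σ k K (λ i → sh (suc i * suc j) a) n))

  T-rec : ∀ j a n → n ≤ K → T j a n ≡ sh (suc j) a n + sh (suc j) (T j a) n
  T-rec j a n n≤K = begin
   Σ< K f ≡⟨ +-identityʳ _ ⟨
   Σ< K f + 0 ≡⟨ cong (Σ< K f +_) (sh-< (suc K * suc j) a n (<-≤-trans (s≤s n≤K) (m≤m*n (suc K) (suc j)))) ⟨
   Σ< (suc K) f ≡⟨ Σ-head K f ⟩
   f 0 + Σ< K (f ∘ suc) ≡⟨ cong₂ _+_ (cong (λ k → sh k a n) (*-identityˡ (suc j)))
                            (Σ-cong K λ i → sh-+ (suc j) (suc i * suc j) a n) ⟩
   sh (suc j) a n + Σ< K (λ i → sh (suc j) (sh (suc i * suc j) a) n) ≡⟨ cong (sh (suc j) a n +_) (sh-Σ (suc j) K (λ i → sh (suc i * suc j) a) n) ⟨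
   sh (suc j) a n + sh (suc j) (T j a) n ∎
   where
   f : ℕ → ℕ
   f i = sh (suc i * suc j) a n

  Q : ℕ → Seq → Seq
  Q k a n = Σ< k (λ j → suc j * T j a n)

  Q-⊕ : ∀ k a b n → Q k (λ m → a m + b m) n ≡ Q k a n + Q k b n
  Q-⊕ k a b n = trans (Σ-cong k λ j → trans (cong (suc j *_) (T-⊕ j a b n)) (*-distribˡ-+ (suc j) (T j a n) (T j b n))) (Σ-+ k _ _)

  Q-sh : ∀ k l a n → Q k (sh l a) n ≡ sh l (Q k a) n
  Q-sh k l a n = trans (Σ-cong k λ j → trans (cong (suc j *_) (T-sh j l a n)) (sym (sh-* l (suc j) (T j a) n)))
   (sym (sh-Σ l k (λ j m → suc j * T j a m) n))

  T-cong : ∀ j {a b : Seq} → (∀ n → a n ≡ b n) → ∀ n → T j a n ≡ T j b n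
  T-cong j h n = Σ-cong K λ i → sh-cong (suc i * suc j) h n

  Q-cong : ∀ k {a b : Seq} → (∀ n → a n ≡ b n) → ∀ n → Q k a n ≡ Q k b n
  Q-cong k h n = Σ-cong k λ j → cong (suc j *_) (T-cong j h n)

  deriv-sh : ∀ k a n → n * sh k a n ≡ k * sh k a n + sh k (λ m → m * a m) n
  deriv-sh zero a n = refl
  deriv-sh (suc k) a zero = sym (trans (+-identityʳ (k * 0)) (*-zeroʳ k))
  deriv-sh (suc k) a (suc n) = trans (cong (sh k a n +_) (deriv-sh k a n)) (sym (+-assoc (sh k a n) (k * sh k a n) _))

  -- Weighting coefficients by their index is a derivation; it is applied to `A-rec`. The shifted
  -- term has the same k but a smaller index, so an induction on the degree, bounded by f, runs
  -- beside the one on k.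
  log-derivative : ∀ f k n → n < f → n ≤ K → n * A k n ≡ Q k (A k) n
  log-derivative f zero zero _ _ = refl
  log-derivative f zero (suc n) _ _ = *-zeroʳ n
  log-derivative (suc f) (suc k) n (s≤s n≤f) n≤K = begin
   n * A (suc k) n
    ≡⟨ cong (n *_) (A-rec k n) ⟩
   n * (A k n + sh (suc k) a n)
    ≡⟨ *-distribˡ-+ n (A k n) (sh (suc k) a n) ⟩
   n * A k n + n * sh (suc k) a n
    ≡⟨ cong₂ _+_ (log-derivative (suc f) k n (s≤s n≤f) n≤K) (deriv-sh (suc k) a n) ⟩
   Q k (A k) n + (suc k * sh (suc k) a n + sh (suc k) (λ m → m * a m) n)
    ≡⟨ cong (λ x → Q k (A k) n + (suc k * sh (suc k) a n + x))
       (trans (sh-cong< k n λ m m<n → log-derivative f (suc k) m (<-≤-trans m<n n≤f) (≤-trans (<⇒≤ m<n) n≤K))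
          (sh-⊕ (suc k) (Q k a) (λ m → suc k * T k a m) n)) ⟩
   Q k (A k) n + (suc k * sh (suc k) a n + (sh (suc k) (Q k a) n + sh (suc k) (λ m → suc k * T k a m) n))
    ≡⟨ cong₂ (λ x y → Q k (A k) n + (suc k * sh (suc k) a n + (x + y))) (sym (Q-sh k (suc k) a n)) (sh-* (suc k) (suc k) (T k a) n) ⟩
   Q k (A k) n + (suc k * sh (suc k) a n + (Q k (sh (suc k) a) n + suc k * sh (suc k) (T k a) n))
    ≡⟨ rearrange (Q k (A k) n) (suc k) (sh (suc k) a n) (Q k (sh (suc k) a) n) (sh (suc k) (T k a) n) ⟩
   (Q k (A k) n + Q k (sh (suc k) a) n) + suc k * (sh (suc k) a n + sh (suc k) (T k a) n)
    ≡⟨ cong₂ (λ x y → x + suc k * y) (trans (sym (Q-⊕ k (A k) (sh (suc k) a) n)) (Q-cong k (λ m → sym (A-rec k m)) n)) (sym (T-rec k a n n≤K)) ⟩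
   Q (suc k) a n ∎
   where
   a : Seq
   a = A (suc k)
   rearrange = solve 5 (λ x c s q t → x :+ (c :* s :+ (q :+ c :* t)) := (x :+ q) :+ c :* (s :+ t)) refl

 P-recurrence : ∀ n → n * P n ≡ Σ< n (λ j → suc j * Σ< n (λ i → sh (suc i * suc j) P n))
 P-recurrence n = trans (log-derivative n (suc n) n n ≤-refl ≤-refl)
  (Σ-cong n λ j → cong (suc j *_) (Σ-cong n λ i → sh-cong≤ (suc i * suc j) n λ m m≤n → A-stable n m m≤n))

 -- Durfee rectangles

 -- t r = r(r-1)/2, so the triangular number ℓ(ℓ+1)/2 is t (suc ℓ).
 t : ℕ → ℕ
 t zero = 0
 t (suc r) = t r + r

 Σ-drop : ∀ K (f : ℕ → ℕ) → f K ≡ 0 → Σ< (suc K) f ≡ Σ< K f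
 Σ-drop K f h = trans (cong (Σ< K f +_) h) (+-identityʳ _)

 module _ (K : ℕ) where
  cA : ℕ → ℕ → Seq
  cA r l = conv (A r) (A l)

  -- The Durfee rectangle sum Σ q^(l(l+ℓ)) / ((q)_l (q)_(l+ℓ)), where (q)_k = (1-q)⋯(1-q^k), cut off
  -- at l < K. In `X` the larger index is raised by one, so that either factor can be expanded.
  D : ℕ → Seq
  D ℓ n = Σ< K (λ l → sh (l * (l + ℓ)) (cA (l + ℓ) l) n)

  X : ℕ → Seq
  X ℓ n = Σ< K (λ l → sh (l * (l + ℓ)) (cA (l + suc ℓ) l) n)

  cA-recˡ : ∀ r l n → cA (suc r) l n ≡ cA r l n + sh (suc r) (cA (suc r) l) n
  cA-recˡ r l n = trans (conv-cong (A-rec r) (λ _ → refl) n)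
   (trans (conv-⊕ˡ (A r) (sh (suc r) (A (suc r))) (A l) n) (cong (cA r l n +_) (conv-shˡ (suc r) (A (suc r)) (A l) n)))

  cA-recʳ : ∀ r l n → cA r (suc l) n ≡ cA r l n + sh (suc l) (cA r (suc l)) n
  cA-recʳ r l n = trans (conv-cong {g = A (suc l)} (λ _ → refl) (A-rec l) n)
   (trans (conv-⊕ʳ (A r) (A l) (sh (suc l) (A (suc l))) n) (cong (cA r l n +_) (conv-shʳ (suc l) (A r) (A (suc l)) n)))

  X≡₁ : ∀ ℓ n → X ℓ n ≡ D ℓ n + sh (suc ℓ) (D (suc ℓ)) n
  X≡₁ ℓ n = trans (trans (Σ-cong K term) (Σ-+ K _ _)) (cong (D ℓ n +_) (sym (sh-Σ (suc ℓ) K (λ l → sh (l * (l + suc ℓ)) (cA (l + suc ℓ) l)) n)))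
   where
   exponent = solve 2 (λ l ℓ → l :* (l :+ ℓ) :+ (con 1 :+ (l :+ ℓ)) := (con 1 :+ ℓ) :+ l :* (l :+ (con 1 :+ ℓ))) refl
   term : ∀ l → sh (l * (l + ℓ)) (cA (l + suc ℓ) l) n ≡
          sh (l * (l + ℓ)) (cA (l + ℓ) l) n + sh (suc ℓ) (sh (l * (l + suc ℓ)) (cA (l + suc ℓ) l)) n
   term l = begin
    sh (l * (l + ℓ)) (cA (l + suc ℓ) l) n
     ≡⟨ cong (λ r → sh (l * (l + ℓ)) (cA r l) n) (+-suc l ℓ) ⟩
    sh (l * (l + ℓ)) (cA (suc (l + ℓ)) l) n
     ≡⟨ sh-cong (l * (l + ℓ)) (cA-recˡ (l + ℓ) l) n ⟩
    sh (l * (l + ℓ)) (λ m → cA (l + ℓ) l m + sh (suc (l + ℓ)) (cA (suc (l + ℓ)) l) m) n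
     ≡⟨ sh-⊕ (l * (l + ℓ)) _ _ n ⟩
    sh (l * (l + ℓ)) (cA (l + ℓ) l) n + sh (l * (l + ℓ)) (sh (suc (l + ℓ)) (cA (suc (l + ℓ)) l)) n
     ≡⟨ cong (sh (l * (l + ℓ)) (cA (l + ℓ) l) n +_) (trans (sym (sh-+ (l * (l + ℓ)) (suc (l + ℓ)) _ n))
        (trans (cong₂ (λ e r → sh e (cA r l) n) (exponent l ℓ) (sym (+-suc l ℓ))) (sh-+ (suc ℓ) (l * (l + suc ℓ)) _ n))) ⟩
    sh (l * (l + ℓ)) (cA (l + ℓ) l) n + sh (suc ℓ) (sh (l * (l + suc ℓ)) (cA (l + suc ℓ) l)) n ∎

 X≡₂ : ∀ K ℓ n → n < K → X (suc K) ℓ n ≡ D (suc K) (suc ℓ) n + sh (suc ℓ) (D (suc K) (suc (suc ℓ))) n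
 X≡₂ K ℓ n n<K = begin
  Σ< (suc K) f ≡⟨ Σ-head K f ⟩
  f 0 + Σ< K (f ∘ suc) ≡⟨ cong (f 0 +_) (trans (Σ-cong K term) (Σ-+ K _ _)) ⟩
  f 0 + (Σ< K (g ∘ suc) + Σ< K h) ≡⟨ +-assoc (f 0) _ _ ⟨
  (f 0 + Σ< K (g ∘ suc)) + Σ< K h ≡⟨ cong₂ _+_ (sym (Σ-head K g)) (sym (Σ-drop K h h-K)) ⟩
  Σ< (suc K) g + Σ< (suc K) h ≡⟨ cong (Σ< (suc K) g +_) (sh-Σ (suc ℓ) (suc K) (λ l → sh (l * (l + suc (suc ℓ))) (conv (A (l + suc (suc ℓ))) (A l))) n) ⟨
  D (suc K) (suc ℓ) n + sh (suc ℓ) (D (suc K) (suc (suc ℓ))) n ∎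
  where
  f g h : ℕ → ℕ
  f l = sh (l * (l + ℓ)) (conv (A (l + suc ℓ)) (A l)) n
  g l = sh (l * (l + suc ℓ)) (conv (A (l + suc ℓ)) (A l)) n
  h l = sh (suc ℓ) (sh (l * (l + suc (suc ℓ))) (conv (A (l + suc (suc ℓ))) (A l))) n
  h-K : h K ≡ 0
  h-K = trans (sh-comm (suc ℓ) (K * (K + suc (suc ℓ))) _ n) (sh-< (K * (K + suc (suc ℓ))) _ n
   (<-≤-trans n<K (≤≡ (m≤m*n K (suc (K + suc ℓ))) (cong (K *_) (sym (+-suc K (suc ℓ)))))))
  e₁ = solve 2 (λ l ℓ → (con 1 :+ l) :* ((con 1 :+ l) :+ ℓ) :+ (con 1 :+ l) := (con 1 :+ l) :* ((con 1 :+ l) :+ (con 1 :+ ℓ))) refl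
  e₂ = solve 2 (λ l ℓ → (con 1 :+ l) :* ((con 1 :+ l) :+ ℓ) := (con 1 :+ ℓ) :+ l :* (l :+ (con 1 :+ ((con 1 :+ ℓ))))) refl
  term : ∀ l → f (suc l) ≡ g (suc l) + h l
  term l = begin
   sh e (conv (A (suc l + suc ℓ)) (A (suc l))) n
    ≡⟨ sh-cong e (cA-recʳ K (suc l + suc ℓ) l) n ⟩
   sh e (λ m → conv (A (suc l + suc ℓ)) (A l) m + sh (suc l) (conv (A (suc l + suc ℓ)) (A (suc l))) m) n
    ≡⟨ sh-⊕ e _ _ n ⟩
   sh e (conv (A (suc l + suc ℓ)) (A l)) n + sh e (sh (suc l) (conv (A (suc l + suc ℓ)) (A (suc l)))) n
    ≡⟨ +-comm (sh e (conv (A (suc l + suc ℓ)) (A l)) n) _ ⟩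
   sh e (sh (suc l) (conv (A (suc l + suc ℓ)) (A (suc l)))) n + sh e (conv (A (suc l + suc ℓ)) (A l)) n
    ≡⟨ cong₂ _+_ (trans (sym (sh-+ e (suc l) (conv (A (suc l + suc ℓ)) (A (suc l))) n)) (cong (λ i → sh i (conv (A (suc l + suc ℓ)) (A (suc l))) n) (e₁ l ℓ)))
       (trans (cong₂ (λ i r → sh i (conv (A r) (A l)) n) (e₂ l ℓ) (sym (+-suc l (suc ℓ)))) (sh-+ (suc ℓ) (l * (l + suc (suc ℓ))) _ n)) ⟩
   g (suc l) + h l ∎
   where
   e = suc l * (suc l + ℓ)

 -- The two expansions of X give D_ℓ - D_(ℓ+1) = q^(ℓ+1) (D_(ℓ+2) - D_(ℓ+1)), and the positive shift
 -- makes this an induction on the degree.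
 D-step : ∀ K f ℓ n → n < f → n < K → D (suc K) ℓ n ≡ D (suc K) (suc ℓ) n
 D-step K (suc f) ℓ n (s≤s n≤f) n<K = +-cancelʳ-≡ (sh (suc ℓ) (D (suc K) (suc ℓ)) n) _ _ (begin
  D (suc K) ℓ n + sh (suc ℓ) (D (suc K) (suc ℓ)) n ≡⟨ X≡₁ (suc K) ℓ n ⟨
  X (suc K) ℓ n ≡⟨ X≡₂ K ℓ n n<K ⟩
  D (suc K) (suc ℓ) n + sh (suc ℓ) (D (suc K) (suc (suc ℓ))) n ≡⟨ cong (D (suc K) (suc ℓ) n +_)
    (sh-cong< ℓ n λ m m<n → sym (D-step K f (suc ℓ) m (<-≤-trans m<n n≤f) (<-trans m<n n<K))) ⟩
  D (suc K) (suc ℓ) n + sh (suc ℓ) (D (suc K) (suc ℓ)) n ∎)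

 -- By `D-step` the parameter can be raised to n + ℓ, and then only the term l = 0 reaches degree n.
 D≡P : ∀ K ℓ n → n < K → D (suc K) ℓ n ≡ P n
 D≡P K ℓ n n<K = trans (go n) large
  where
  go : ∀ k → D (suc K) ℓ n ≡ D (suc K) (k + ℓ) n
  go zero = refl
  go (suc k) = trans (go k) (D-step K (suc n) (k + ℓ) n ≤-refl n<K)
  one-conv : ∀ f n → conv f one n ≡ f n
  one-conv f n = trans (conv-comm f one n) (conv-one n f)
   where
   conv-0 : ∀ n g → conv (λ _ → 0) g n ≡ 0
   conv-0 zero g = refl
   conv-0 (suc n) g = conv-0 n g
   conv-one : ∀ n g → conv one g n ≡ g n
   conv-one zero g = *-identityˡ (g 0)
   conv-one (suc n) g = trans (cong₂ _+_ (*-identityˡ (g (suc n))) (conv-0 n g)) (+-identityʳ _)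
  large : D (suc K) (n + ℓ) n ≡ P n
  large = begin
   D (suc K) (n + ℓ) n
    ≡⟨ Σ-head K _ ⟩
   conv (A (n + ℓ)) one n + Σ< K (λ l → sh (suc l * (suc l + (n + ℓ))) (conv (A (suc l + (n + ℓ))) (A (suc l))) n)
    ≡⟨ cong₂ _+_ (trans (one-conv (A (n + ℓ)) n) (A-stable (n + ℓ) n (m≤m+n n ℓ)))
       (Σ-0 K λ l → sh-< (suc l * (suc l + (n + ℓ))) _ n
        (<-≤-trans (s≤s (≤-trans (m≤m+n n ℓ) (m≤n+m (n + ℓ) l))) (m≤m+n _ _))) ⟩
   P n + 0 ≡⟨ +-identityʳ (P n) ⟩
   P n ∎

 -- Strictly increasing sequences and pairs of them

 d : ℕ → ℕ → Seq
 d n r = sh (n * r + t r) (A r)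

 -- `d n r` is the series of strictly increasing sequences of r parts, all at least n; the two terms
 -- say whether n itself is absent or present.
 d-rec : ∀ n r m → d n (suc r) m ≡ d (suc n) (suc r) m + sh n (d (suc n) r) m
 d-rec n r m = begin
  sh (n * suc r + (t r + r)) (A (suc r)) m
   ≡⟨ cong (λ i → sh i (A (suc r)) m) (e₁ n r (t r)) ⟩
  sh e (A (suc r)) m
   ≡⟨ trans (sh-cong e (A-rec r) m) (sh-⊕ e (A r) (sh (suc r) (A (suc r))) m) ⟩
  sh e (A r) m + sh e (sh (suc r) (A (suc r))) m
   ≡⟨ +-comm (sh e (A r) m) _ ⟩
  sh e (sh (suc r) (A (suc r))) m + sh e (A r) m
   ≡⟨ cong₂ _+_ (trans (sym (sh-+ e (suc r) (A (suc r)) m)) (cong (λ i → sh i (A (suc r)) m) (e₂ n r (t r)))) (sh-+ n (suc n * r + t r) (A r) m) ⟩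
  d (suc n) (suc r) m + sh n (d (suc n) r) m ∎
  where
  e = n + (suc n * r + t r)
  e₁ = solve 3 (λ n r x → n :* (con 1 :+ r) :+ (x :+ r) := n :+ ((con 1 :+ n) :* r :+ x)) refl
  e₂ = solve 3 (λ n r x → n :+ ((con 1 :+ n) :* r :+ x) :+ (con 1 :+ r) := (con 1 :+ n) :* (con 1 :+ r) :+ (x :+ r)) refl

 conv-sh-sh : ∀ i j f g n → conv (sh i f) (sh j g) n ≡ sh (i + j) (conv f g) n
 conv-sh-sh i j f g n = trans (conv-shˡ i f (sh j g) n) (trans (sh-cong i (conv-shʳ j f g) n) (sym (sh-+ i j (conv f g) n)))

 module _ (K : ℕ) where
  -- Pairs of strictly increasing sequences with parts at least n and lengths l + ℓ and l, with l <
  -- K.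
  H : ℕ → ℕ → Seq
  H n ℓ m = Σ< K (λ l → conv (d n (l + ℓ)) (d n l) m)

  H-increasing : ∀ n ℓ → Increasing (H n (suc ℓ))
  H-increasing n ℓ m = Σ-mono K λ l → conv-increasing (d n l)
   (subst (λ r → Increasing (d n r)) (sym (+-suc l ℓ)) (sh-increasing (n * suc (l + ℓ) + t (suc (l + ℓ))) (A-increasing (l + ℓ)))) m

  H-vanish : ∀ n ℓ m → m < n → H n (suc ℓ) m ≡ 0
  H-vanish n ℓ m m<n = Σ-0 K λ l → trans (conv-shˡ (n * (l + suc ℓ) + t (l + suc ℓ)) (A (l + suc ℓ)) (d n l) m)
   (sh-< _ _ m (<-≤-trans m<n (≤-trans (≤≡ (m≤m*n n (suc (l + ℓ))) (cong (n *_) (sym (+-suc l ℓ)))) (m≤m+n _ _))))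

 -- The part n occurs in neither sequence, only in the longer, only in the shorter, or in both;
 -- removing it changes the length difference by 0, -1, +1 or 0. Starting from a positive difference
 -- avoids negative ones.
 H-rec : ∀ K n ℓ m → m < K → H (suc K) n (suc ℓ) m ≡ H (suc K) (suc n) (suc ℓ) m
  + (sh n (λ i → H (suc K) (suc n) ℓ i + H (suc K) (suc n) (suc (suc ℓ)) i) m + sh (n + n) (H (suc K) (suc n) (suc ℓ)) m)
 H-rec K n ℓ m m<K = begin
  Σ< (suc K) f
   ≡⟨ Σ-head K f ⟩
  f 0 + Σ< K (f ∘ suc)
   ≡⟨ cong₂ _+_ f0 (trans (Σ-cong K term) (trans (Σ-+ K _ _) (cong₂ _+_ (Σ-+ K _ _) (Σ-+ K _ _)))) ⟩
  (x 0 + y 0) + ((Σ< K (x ∘ suc) + Σ< K (y ∘ suc)) + (Σ< K z + Σ< K u))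
   ≡⟨ shuffle (x 0) (y 0) (Σ< K (x ∘ suc)) (Σ< K (y ∘ suc)) (Σ< K z) (Σ< K u) ⟩
  (x 0 + Σ< K (x ∘ suc)) + (((y 0 + Σ< K (y ∘ suc)) + Σ< K z) + Σ< K u)
   ≡⟨ cong₂ _+_ (sym (Σ-head K x)) (cong₂ _+_ (cong₂ _+_ (sym (Σ-head K y)) (sym (Σ-drop K z z-K))) (sym (Σ-drop K u u-K))) ⟩
  Σ< (suc K) x + ((Σ< (suc K) y + Σ< (suc K) z) + Σ< (suc K) u)
   ≡⟨ cong (Σ< (suc K) x +_) (cong₂ _+_
      (trans (cong₂ _+_ (sym (sh-Σ n (suc K) (λ l → c (l + ℓ) l) m)) (sym (sh-Σ n (suc K) (λ l → c (l + suc (suc ℓ)) l) m))) (sym (sh-⊕ n _ _ m)))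
      (sym (sh-Σ (n + n) (suc K) (λ l → c (l + suc ℓ) l) m))) ⟩
  H (suc K) (suc n) (suc ℓ) m
   + (sh n (λ i → H (suc K) (suc n) ℓ i + H (suc K) (suc n) (suc (suc ℓ)) i) m + sh (n + n) (H (suc K) (suc n) (suc ℓ)) m) ∎
  where
  c : ℕ → ℕ → Seq
  c r l = conv (d (suc n) r) (d (suc n) l)
  f x y z u : ℕ → ℕ
  f l = conv (d n (l + suc ℓ)) (d n l) m
  x l = c (l + suc ℓ) l m
  y l = sh n (c (l + ℓ) l) m
  z l = sh n (c (l + suc (suc ℓ)) l) m
  u l = sh (n + n) (c (l + suc ℓ) l) m
  vanish : ∀ r i → sh i (c r K) m ≡ 0
  vanish r i = trans (sh-cong i (conv-shʳ (suc n * K + t K) (d (suc n) r) (A K)) m)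
   (trans (sh-comm i (suc n * K + t K) _ m) (sh-< (suc n * K + t K) _ m (<-≤-trans m<K (≤-trans (m≤m+n K (n * K)) (m≤m+n _ (t K))))))
  z-K : z K ≡ 0
  z-K = vanish (K + suc (suc ℓ)) n
  u-K : u K ≡ 0
  u-K = vanish (K + suc ℓ) (n + n)
  shuffle = solve 6 (λ a b c d e f → (a :+ b) :+ ((c :+ d) :+ (e :+ f)) := (a :+ c) :+ (((b :+ d) :+ e) :+ f)) refl
  split : ∀ r l → conv (d n (suc r)) (d (suc n) l) m ≡ c (suc r) l m + sh n (c r l) m
  split r l = trans (conv-cong {g = d (suc n) l} (d-rec n r) (λ _ → refl) m) (trans (conv-⊕ˡ (d (suc n) (suc r)) (sh n (d (suc n) r)) (d (suc n) l) m)
   (cong (c (suc r) l m +_) (conv-shˡ n (d (suc n) r) (d (suc n) l) m)))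
  d-0 : ∀ i → d n 0 i ≡ d (suc n) 0 i
  d-0 i = cong (λ e → sh (e + 0) one i) (trans (*-zeroʳ n) (sym (*-zeroʳ (suc n))))
  f0 : f 0 ≡ x 0 + y 0
  f0 = trans (conv-cong {f = d n (suc ℓ)} (λ _ → refl) d-0 m) (split ℓ 0)
  term : ∀ l → f (suc l) ≡ (x (suc l) + y (suc l)) + (z l + u l)
  term l = begin
   conv (d n (suc l + suc ℓ)) (d n (suc l)) m
    ≡⟨ conv-cong {f = d n (suc l + suc ℓ)} (λ _ → refl) (d-rec n l) m ⟩
   conv (d n (suc l + suc ℓ)) (λ i → d (suc n) (suc l) i + sh n (d (suc n) l) i) m
    ≡⟨ trans (conv-⊕ʳ (d n (suc l + suc ℓ)) _ _ m) (cong (conv (d n (suc l + suc ℓ)) (d (suc n) (suc l)) m +_) (conv-shʳ n (d n (suc l + suc ℓ)) (d (suc n) l) m)) ⟩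
   conv (d n (suc (l + suc ℓ))) (d (suc n) (suc l)) m + sh n (conv (d n (suc (l + suc ℓ))) (d (suc n) l)) m
    ≡⟨ cong₂ _+_ (split (l + suc ℓ) (suc l)) (trans (sh-cong n split′ m) (trans (sh-⊕ n _ _ m) (cong (sh n (c (suc (l + suc ℓ)) l) m +_) (sym (sh-+ n n _ m))))) ⟩
   (c (suc (l + suc ℓ)) (suc l) m + sh n (c (l + suc ℓ) (suc l)) m) + (sh n (c (suc (l + suc ℓ)) l) m + sh (n + n) (c (l + suc ℓ) l) m)
    ≡⟨ cong₂ (λ r r′ → (x (suc l) + sh n (c r (suc l)) m) + (sh n (c r′ l) m + u l)) (+-suc l ℓ) (sym (+-suc l (suc ℓ))) ⟩
   (x (suc l) + y (suc l)) + (z l + u l) ∎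
   where
   split′ : ∀ i → conv (d n (suc (l + suc ℓ))) (d (suc n) l) i ≡ c (suc (l + suc ℓ)) l i + sh n (c (l + suc ℓ) l) i
   split′ i = trans (conv-cong {g = d (suc n) l} (d-rec n (l + suc ℓ)) (λ _ → refl) i) (trans (conv-⊕ˡ (d (suc n) (suc (l + suc ℓ))) (sh n (d (suc n) (l + suc ℓ))) (d (suc n) l) i)
    (cong (c (suc (l + suc ℓ)) l i +_) (conv-shˡ n (d (suc n) (l + suc ℓ)) (d (suc n) l) i)))

 -- Expanding the factor of the shorter sequence once turns the triangular exponents into two
 -- families of Durfee exponents, each of which sums to a shifted p.
 H-0 : ∀ K ℓ m → m < K → H (suc (suc K)) 0 ℓ m ≡ sh (t ℓ) P m + sh (t (suc ℓ)) P m
 H-0 K ℓ m m<K = begin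
  Σ< (suc (suc K)) f
   ≡⟨ Σ-head (suc K) f ⟩
  f 0 + Σ< (suc K) (f ∘ suc)
   ≡⟨ cong₂ _+_ (conv-shˡ (t ℓ) (A ℓ) one m) (trans (Σ-cong (suc K) term) (Σ-+ (suc K) _ _)) ⟩
  g 0 + (Σ< (suc K) (g ∘ suc) + Σ< (suc K) h)
   ≡⟨ +-assoc (g 0) _ _ ⟨
  (g 0 + Σ< (suc K) (g ∘ suc)) + Σ< (suc K) h
   ≡⟨ cong₂ _+_ (trans (sym (Σ-head (suc K) g)) (sym (sh-Σ (t ℓ) (suc (suc K)) (λ l → sh (l * (l + ℓ)) (conv (A (l + ℓ)) (A l))) m)))
      (sym (sh-Σ (t (suc ℓ)) (suc K) (λ l → sh (l * (l + suc ℓ)) (conv (A (l + suc ℓ)) (A l))) m)) ⟩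
  sh (t ℓ) (D (suc (suc K)) ℓ) m + sh (t (suc ℓ)) (D (suc K) (suc ℓ)) m
   ≡⟨ cong₂ _+_ (sh-cong≤ (t ℓ) m λ i i≤m → D≡P (suc K) ℓ i (≤-<-trans i≤m (<-trans m<K (n<1+n K))))
          (sh-cong≤ (t (suc ℓ)) m λ i i≤m → D≡P K (suc ℓ) i (≤-<-trans i≤m m<K)) ⟩
  sh (t ℓ) P m + sh (t (suc ℓ)) P m ∎
  where
  f g h : ℕ → ℕ
  f l = conv (d 0 (l + ℓ)) (d 0 l) m
  g l = sh (t ℓ) (sh (l * (l + ℓ)) (conv (A (l + ℓ)) (A l))) m
  h l = sh (t (suc ℓ)) (sh (l * (l + suc ℓ)) (conv (A (l + suc ℓ)) (A l))) m
  t-sum : ∀ l → t (suc l + ℓ) + t (suc l) ≡ t ℓ + suc l * (l + ℓ)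
  t-sum zero = cong (_+ 0) (cong (t ℓ +_) (sym (+-identityʳ ℓ))) ⟨trans⟩ +-identityʳ _
   where
   _⟨trans⟩_ : ∀ {a b c : ℕ} → a ≡ b → b ≡ c → a ≡ c
   _⟨trans⟩_ = trans
  t-sum (suc l) = trans (+-interchange (t (suc l + ℓ)) (suc l + ℓ) (t (suc l)) (suc l))
   (trans (cong (_+ (suc l + ℓ + suc l)) (t-sum l)) (e (t ℓ) l ℓ))
   where
   e = solve 3 (λ x l ℓ → x :+ (con 1 :+ l) :* (l :+ ℓ) :+ ((con 1 :+ l) :+ ℓ :+ (con 1 :+ l)) := x :+ (con 1 :+ ((con 1 :+ l))) :* ((con 1 :+ l) :+ ℓ)) refl
  e₁ = solve 3 (λ x l ℓ → x :+ (con 1 :+ l) :* (l :+ ℓ) :+ (con 1 :+ l) := x :+ (con 1 :+ l) :* ((con 1 :+ l) :+ ℓ)) refl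
  e₂ = solve 3 (λ x l ℓ → x :+ (con 1 :+ l) :* (l :+ ℓ) := (x :+ ℓ) :+ l :* (l :+ (con 1 :+ ℓ))) refl
  term : ∀ l → f (suc l) ≡ g (suc l) + h l
  term l = begin
   conv (d 0 (suc l + ℓ)) (d 0 (suc l)) m
    ≡⟨ conv-sh-sh (t (suc l + ℓ)) (t (suc l)) (A (suc l + ℓ)) (A (suc l)) m ⟩
   sh (t (suc l + ℓ) + t (suc l)) (conv (A (suc l + ℓ)) (A (suc l))) m
    ≡⟨ cong (λ i → sh i (conv (A (suc l + ℓ)) (A (suc l))) m) (t-sum l) ⟩
   sh e (conv (A (suc l + ℓ)) (A (suc l))) m
    ≡⟨ trans (sh-cong e (cA-recʳ K (suc l + ℓ) l) m) (sh-⊕ e _ _ m) ⟩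
   sh e (conv (A (suc l + ℓ)) (A l)) m + sh e (sh (suc l) (conv (A (suc l + ℓ)) (A (suc l)))) m
    ≡⟨ +-comm (sh e (conv (A (suc l + ℓ)) (A l)) m) _ ⟩
   sh e (sh (suc l) (conv (A (suc l + ℓ)) (A (suc l)))) m + sh e (conv (A (suc l + ℓ)) (A l)) m
    ≡⟨ cong₂ _+_
       (trans (sym (sh-+ e (suc l) (conv (A (suc l + ℓ)) (A (suc l))) m))
        (trans (cong (λ i → sh i (conv (A (suc l + ℓ)) (A (suc l))) m) (e₁ (t ℓ) l ℓ)) (sh-+ (t ℓ) (suc l * (suc l + ℓ)) _ m)))
       (trans (cong₂ (λ i r → sh i (conv (A r) (A l)) m) (e₂ (t ℓ) l ℓ) (sym (+-suc l ℓ))) (sh-+ (t (suc ℓ)) (l * (l + suc ℓ)) _ m)) ⟩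
   g (suc l) + h l ∎
   where
   e = t ℓ + suc l * (l + ℓ)

 -- Recurrences for strongly concave compositions

 module Compositions (M : ℕ) where
  K : ℕ
  K = suc (suc (suc M))

  Hᴷ : ℕ → ℕ → Seq
  Hᴷ = H K

  -- `S₁` is the series of compositions of rank ℓ, with c the central part. In `S₂` and `S₃` the
  -- central part is weighted doubly and triply; they arise when `H-rec` is summed over c with
  -- weights 1 and q^c.
  S₁ S₂ S₃ : ℕ → ℕ → Seq
  S₁ C ℓ m = Σ< C (λ c → sh c (Hᴷ (suc c) ℓ) m)
  S₂ C ℓ m = Σ< C (λ c → sh (c + c) (Hᴷ (suc c) ℓ) m)
  S₃ C ℓ m = Σ< C (λ c → sh (c + (c + c)) (Hᴷ (suc c) ℓ) m)

  telescope₀ : ∀ C ℓ m → m ≤ M → Hᴷ 0 (suc ℓ) m ≡ Hᴷ C (suc ℓ) m + ((S₁ C ℓ m + S₁ C (suc (suc ℓ)) m) + S₂ C (suc ℓ) m)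
  telescope₀ zero ℓ m m≤M = sym (+-identityʳ _)
  telescope₀ (suc C) ℓ m m≤M = begin
   Hᴷ 0 (suc ℓ) m
    ≡⟨ telescope₀ C ℓ m m≤M ⟩
   Hᴷ C (suc ℓ) m + ((S₁ C ℓ m + S₁ C (suc (suc ℓ)) m) + S₂ C (suc ℓ) m)
    ≡⟨ cong (_+ ((S₁ C ℓ m + S₁ C (suc (suc ℓ)) m) + S₂ C (suc ℓ) m)) (trans (H-rec (suc (suc M)) C ℓ m (s≤s (m≤n⇒m≤1+n m≤M)))
       (cong (λ x → Hᴷ (suc C) (suc ℓ) m + (x + sh (C + C) (Hᴷ (suc C) (suc ℓ)) m)) (sh-⊕ C _ _ m))) ⟩
   Hᴷ (suc C) (suc ℓ) m + ((a + b) + c) + ((S₁ C ℓ m + S₁ C (suc (suc ℓ)) m) + S₂ C (suc ℓ) m)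
    ≡⟨ shuffle (Hᴷ (suc C) (suc ℓ) m) a b c (S₁ C ℓ m) (S₁ C (suc (suc ℓ)) m) (S₂ C (suc ℓ) m) ⟩
   Hᴷ (suc C) (suc ℓ) m + ((S₁ (suc C) ℓ m + S₁ (suc C) (suc (suc ℓ)) m) + S₂ (suc C) (suc ℓ) m) ∎
   where
   a = sh C (Hᴷ (suc C) ℓ) m
   b = sh C (Hᴷ (suc C) (suc (suc ℓ))) m
   c = sh (C + C) (Hᴷ (suc C) (suc ℓ)) m
   shuffle = solve 7 (λ h a b c x y z → h :+ ((a :+ b) :+ c) :+ ((x :+ y) :+ z) := h :+ (((x :+ a) :+ (y :+ b)) :+ (z :+ c))) refl

  -- `H-rec` is multiplied by q^c before summing. The weights of neighbouring terms then differ by a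
  -- factor q, and this leaves the extra shift of `S₁` on the left.
  telescope₁ : ∀ C ℓ m → m ≤ M → Hᴷ 0 (suc ℓ) m + sh 1 (S₁ C (suc ℓ)) m ≡
   sh C (Hᴷ C (suc ℓ)) m + (S₁ C (suc ℓ) m + ((S₂ C ℓ m + S₂ C (suc (suc ℓ)) m) + S₃ C (suc ℓ) m))
  telescope₁ zero ℓ m m≤M = cong (Hᴷ 0 (suc ℓ) m +_) (sh-Σ 1 0 (λ c → Hᴷ (suc c) ℓ) m)
  telescope₁ (suc C) ℓ m m≤M = begin
   Hᴷ 0 (suc ℓ) m + sh 1 (S₁ (suc C) (suc ℓ)) m
    ≡⟨ cong (Hᴷ 0 (suc ℓ) m +_) (trans (sh-⊕ 1 (S₁ C (suc ℓ)) (sh C (Hᴷ (suc C) (suc ℓ))) m) (cong (sh 1 (S₁ C (suc ℓ)) m +_) (sym (sh-+ 1 C _ m)))) ⟩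
   Hᴷ 0 (suc ℓ) m + (sh 1 (S₁ C (suc ℓ)) m + new)
    ≡⟨ +-assoc (Hᴷ 0 (suc ℓ) m) _ _ ⟨
   (Hᴷ 0 (suc ℓ) m + sh 1 (S₁ C (suc ℓ)) m) + new
    ≡⟨ cong (_+ new) (trans (telescope₁ C ℓ m m≤M) (cong (_+ rest) unfold)) ⟩
   ((a + ((b + b′) + c)) + rest) + new
    ≡⟨ shuffle new a b b′ c (S₁ C (suc ℓ) m) (S₂ C ℓ m) (S₂ C (suc (suc ℓ)) m) (S₃ C (suc ℓ) m) ⟩
   new + (S₁ (suc C) (suc ℓ) m + ((S₂ (suc C) ℓ m + S₂ (suc C) (suc (suc ℓ)) m) + S₃ (suc C) (suc ℓ) m)) ∎
   where
   new = sh (suc C) (Hᴷ (suc C) (suc ℓ)) m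
   rest = S₁ C (suc ℓ) m + ((S₂ C ℓ m + S₂ C (suc (suc ℓ)) m) + S₃ C (suc ℓ) m)
   a = sh C (Hᴷ (suc C) (suc ℓ)) m
   b = sh (C + C) (Hᴷ (suc C) ℓ) m
   b′ = sh (C + C) (Hᴷ (suc C) (suc (suc ℓ))) m
   c = sh (C + (C + C)) (Hᴷ (suc C) (suc ℓ)) m
   unfold : sh C (Hᴷ C (suc ℓ)) m ≡ a + ((b + b′) + c)
   unfold = begin
    sh C (Hᴷ C (suc ℓ)) m
     ≡⟨ sh-cong≤ C m (λ i i≤m → H-rec (suc (suc M)) C ℓ i (s≤s (m≤n⇒m≤1+n (≤-trans i≤m m≤M)))) ⟩
    sh C (λ i → Hᴷ (suc C) (suc ℓ) i + (sh C (λ j → Hᴷ (suc C) ℓ j + Hᴷ (suc C) (suc (suc ℓ)) j) i + sh (C + C) (Hᴷ (suc C) (suc ℓ)) i)) m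
     ≡⟨ trans (sh-⊕ C _ _ m) (cong (a +_) (sh-⊕ C _ _ m)) ⟩
    a + (sh C (sh C (λ j → Hᴷ (suc C) ℓ j + Hᴷ (suc C) (suc (suc ℓ)) j)) m + sh C (sh (C + C) (Hᴷ (suc C) (suc ℓ))) m)
     ≡⟨ cong (a +_) (cong₂ _+_ (trans (sym (sh-+ C C _ m)) (sh-⊕ (C + C) _ _ m)) (sym (sh-+ C (C + C) _ m))) ⟩
    a + ((b + b′) + c) ∎
   shuffle = solve 9 (λ n a b b′ c w x y z → ((a :+ ((b :+ b′) :+ c)) :+ (w :+ ((x :+ y) :+ z))) :+ n := n :+ ((w :+ a) :+ (((x :+ b) :+ (y :+ b′)) :+ (z :+ c)))) refl

  S₂≤S₁ : ∀ C ℓ m → S₂ C (suc ℓ) m ≤ S₁ C (suc ℓ) m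
  S₂≤S₁ C ℓ m = Σ-mono C λ c → sh-antitone (H-increasing K (suc c) ℓ) (m≤m+n c c) m

  S₃≤S₂ : ∀ C ℓ m → S₃ C (suc ℓ) m ≤ S₂ C (suc ℓ) m
  S₃≤S₂ C ℓ m = Σ-mono C λ c → sh-antitone (H-increasing K (suc c) ℓ) (m≤n+m (c + c) c) m

  private
   C₀ : ℕ
   C₀ = suc M

  a s g q : ℕ → ℕ
  a ℓ = S₁ C₀ ℓ M
  s ℓ = S₂ C₀ ℓ M
  g k = sh (t (suc k)) P M
  q k = sh (t (suc k)) ∇ M

  H₀ : ∀ ℓ m → m ≤ M → Hᴷ 0 (suc ℓ) m ≡ sh (t (suc ℓ)) P m + sh (t (suc (suc ℓ))) P m
  H₀ ℓ m m≤M = H-0 (suc M) (suc ℓ) m (s≤s m≤M)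

  three-term : ∀ ℓ → (a ℓ + a (suc (suc ℓ))) + s (suc ℓ) ≡ g ℓ + g (suc ℓ)
  three-term ℓ = sym (trans (sym (H₀ ℓ M ≤-refl)) (trans (telescope₀ C₀ ℓ M ≤-refl) (cong (_+ ((a ℓ + a (suc (suc ℓ))) + s (suc ℓ))) (H-vanish K C₀ ℓ M ≤-refl))))

  s≤a : ∀ ℓ → s (suc ℓ) ≤ a (suc ℓ)
  s≤a ℓ = S₂≤S₁ C₀ ℓ M

  private
   a′ : ℕ → ℕ
   a′ ℓ = sh 1 (S₁ C₀ ℓ) M

  -- Eliminating H₀ between the two telescoped recurrences leaves a first difference on the right.
  excess≤difference : ∀ ℓ → a ℓ + a′ (suc ℓ) ≤ a (suc ℓ) + s ℓ
  excess≤difference ℓ = +-cancelʳ-≤ (a (suc (suc ℓ)) + s (suc ℓ)) _ _ (begin′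
   (≤-reflexive (trans (e₁ (a ℓ) (a′ (suc ℓ)) (a (suc (suc ℓ))) (s (suc ℓ))) (cong (_+ a′ (suc ℓ)) (sym first))))
   (≡≤ second (≤-trans (+-monoʳ-≤ (a (suc ℓ)) (+-mono-≤ (+-monoʳ-≤ (s ℓ) (s≤a (suc ℓ))) (S₃≤S₂ C₀ ℓ M)))
    (≤-reflexive (e₂ (a (suc ℓ)) (s ℓ) (a (suc (suc ℓ))) (s (suc ℓ)))))))
   where
   begin′ : ∀ {x y z} → x ≤ y → y ≤ z → x ≤ z
   begin′ = ≤-trans
   first : Hᴷ 0 (suc ℓ) M ≡ (a ℓ + a (suc (suc ℓ))) + s (suc ℓ)
   first = trans (telescope₀ C₀ ℓ M ≤-refl) (cong (_+ ((a ℓ + a (suc (suc ℓ))) + s (suc ℓ))) (H-vanish K C₀ ℓ M ≤-refl))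
   second : Hᴷ 0 (suc ℓ) M + a′ (suc ℓ) ≡ a (suc ℓ) + ((s ℓ + s (suc (suc ℓ))) + S₃ C₀ (suc ℓ) M)
   second = trans (telescope₁ C₀ ℓ M ≤-refl) (cong (_+ (a (suc ℓ) + ((s ℓ + s (suc (suc ℓ))) + S₃ C₀ (suc ℓ) M))) (sh-< C₀ _ M ≤-refl))
   e₁ = solve 4 (λ x y z w → (x :+ y) :+ (z :+ w) := ((x :+ z) :+ w) :+ y) refl
   e₂ = solve 4 (λ x y z w → x :+ ((y :+ z) :+ w) := (x :+ y) :+ (z :+ w)) refl

  -- The three-term relation is compared at totals M and M - 1: the two other terms on the left do
  -- not decrease with the total, so a(ℓ) changes by at most the change of g(ℓ) + g(ℓ+1).
  difference≤ : ∀ ℓ → a ℓ ≤ a′ ℓ + (q ℓ + q (suc ℓ))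
  difference≤ ℓ = +-cancelʳ-≤ (a (suc (suc ℓ)) + s (suc ℓ)) _ _
   (≤-trans (≤-reflexive (trans (sym (+-assoc (a ℓ) _ _)) (trans (three-term ℓ) (trans (cong₂ _+_ (g-split ℓ) (g-split (suc ℓ)))
         (+-interchange (g′ ℓ) (q ℓ) (g′ (suc ℓ)) (q (suc ℓ)))))))
   (≡≤ (cong (_+ (q ℓ + q (suc ℓ))) shifted)
   (≤-trans (+-monoˡ-≤ (q ℓ + q (suc ℓ)) (+-mono-≤ (+-monoʳ-≤ (a′ ℓ) (sh-increasing′ (S₁ C₀ (suc (suc ℓ))) (S₁-inc (suc ℓ)))) (sh-increasing′ (S₂ C₀ (suc ℓ)) (S₂-inc ℓ))))
   (≤-reflexive (e (a′ ℓ) (a (suc (suc ℓ))) (s (suc ℓ)) (q ℓ + q (suc ℓ)))))))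
   where
   e = solve 4 (λ x y z w → ((x :+ y) :+ z) :+ w := (x :+ w) :+ (y :+ z)) refl
   g′ : ℕ → ℕ
   g′ k = sh (t (suc k)) (sh 1 P) M
   P-∇′ : ∀ n → P n ≡ sh 1 P n + ∇ n
   P-∇′ zero = refl
   P-∇′ (suc n) = P-∇ n
   g-split : ∀ k → g k ≡ g′ k + q k
   g-split k = trans (sh-cong (t (suc k)) P-∇′ M) (sh-⊕ (t (suc k)) (sh 1 P) ∇ M)
   S₁-inc : ∀ ℓ → Increasing (S₁ C₀ (suc ℓ))
   S₁-inc ℓ m = Σ-mono C₀ λ c → sh-increasing c (H-increasing K (suc c) ℓ) m
   S₂-inc : ∀ ℓ → Increasing (S₂ C₀ (suc ℓ))
   S₂-inc ℓ m = Σ-mono C₀ λ c → sh-increasing (c + c) (H-increasing K (suc c) ℓ) m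
   sh-increasing′ : ∀ (f : Seq) → Increasing f → sh 1 f M ≤ f M
   sh-increasing′ f h = sh-suc≤ 0 h M
   shifted : g′ ℓ + g′ (suc ℓ) ≡ (a′ ℓ + sh 1 (S₁ C₀ (suc (suc ℓ))) M) + sh 1 (S₂ C₀ (suc ℓ)) M
   shifted = begin
    g′ ℓ + g′ (suc ℓ)
     ≡⟨ cong₂ _+_ (sh-comm (t (suc ℓ)) 1 P M) (sh-comm (t (suc (suc ℓ))) 1 P M) ⟩
    sh 1 (sh (t (suc ℓ)) P) M + sh 1 (sh (t (suc (suc ℓ))) P) M
     ≡⟨ sh-⊕ 1 _ _ M ⟨
    sh 1 (λ m → sh (t (suc ℓ)) P m + sh (t (suc (suc ℓ))) P m) M
     ≡⟨ sh-cong≤ 1 M (λ m m≤M → trans (sym (H₀ ℓ m m≤M)) (trans (telescope₀ C₀ ℓ m m≤M)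
        (cong (_+ ((S₁ C₀ ℓ m + S₁ C₀ (suc (suc ℓ)) m) + S₂ C₀ (suc ℓ) m)) (H-vanish K C₀ ℓ m (s≤s m≤M))))) ⟩
    sh 1 (λ m → (S₁ C₀ ℓ m + S₁ C₀ (suc (suc ℓ)) m) + S₂ C₀ (suc ℓ) m) M
     ≡⟨ trans (sh-⊕ 1 _ _ M) (cong (_+ sh 1 (S₂ C₀ (suc ℓ)) M) (sh-⊕ 1 _ _ M)) ⟩
    (a′ ℓ + sh 1 (S₁ C₀ (suc (suc ℓ))) M) + sh 1 (S₂ C₀ (suc ℓ)) M ∎

  -- Both preceding estimates contain the difference of a(ℓ+1) at totals M and M - 1, which is
  -- eliminated.
  a≤s : ∀ ℓ → a ℓ ≤ s ℓ + (q (suc ℓ) + q (suc (suc ℓ)))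
  a≤s ℓ = +-cancelʳ-≤ (a′ (suc ℓ)) _ _ (≤-trans (excess≤difference ℓ) (≤-trans (+-monoˡ-≤ (s ℓ) (difference≤ (suc ℓ)))
   (≤-reflexive (e (a′ (suc ℓ)) (q (suc ℓ) + q (suc (suc ℓ))) (s ℓ)))))
   where
   e = solve 3 (λ x y z → (x :+ y) :+ z := (z :+ y) :+ x) refl

-- The series count partitions and strongly concave compositions

module Counting where
 open import Defs using (partition?; partition-length; CentralAt; StronglyConcave; stronglyConcave?; stronglyConcave-length; StronglyConcaveOfRank; stronglyConcaveOfRank?; candidates; candidates-unique; candidates-complete; count; V; V-total; p)
 open QSeries
 open import Data.Empty using (⊥; ⊥-elim)
 open import Data.Integer.Base as ℤ using (ℤ; +_; -[1+_])
 import Data.Integer.Properties as ℤ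
 open import Data.List.Base using (List; []; _∷_; _++_; length; map; filter; take; drop; cartesianProduct; _ʳ++_; _∷ʳ_)
 open import Data.List.Membership.Propositional using (_∈_)
 open import Data.List.Membership.Propositional.Properties using (∈-map⁺; ∈-map⁻; ∈-++⁺ˡ; ∈-++⁺ʳ; ∈-++⁻; ∈-filter⁺; ∈-filter⁻; ∈-∃++; ∈-cartesianProduct⁺; ∈-cartesianProduct⁻)
 open import Data.List.Properties using (length-++; length-map; length-ʳ++; ++-ʳ++; ∷-injective)
 open import Data.List.Relation.Unary.All as All using (All; []; _∷_)
 open import Data.List.Relation.Unary.Any using (here; there)
 import Data.List.Relation.Unary.AllPairs as AllPairs
 open import Data.List.Relation.Unary.Linked as Linked using (Linked; []; [-]; _∷_)
 open import Data.List.Relation.Unary.Linked.Properties using (Linked⇒All)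
 open import Data.List.Relation.Unary.Unique.Propositional using (Unique)
 import Data.List.Relation.Unary.Unique.Propositional.Properties as Unique
 open import Data.Nat.Base
 open import Data.Nat.ListAction using (sum)
 open import Data.Nat.Properties
 open import Data.Nat.Solver using (module +-*-Solver)
 open +-*-Solver using (solve; con; _:+_; _:*_; _:=_)
 import Data.Integer.Tactic.RingSolver as ℤ-Ring
 open import Relation.Nullary using (¬_)
 open import Relation.Nullary.Decidable using (_×-dec_)
 open import Relation.Unary using (Decidable)

 -- A count is certified by a duplicate-free complete list. Two certificates for one predicate give
 -- equal numbers, so the list of the definition and the one built along a recurrence are never
 -- matched explicitly.
 record Card {X : Set} (Φ : X → Set) (n : ℕ) : Set where
  constructor mkCard
  field
   elements : List X
   unique : Unique elements
   sound : ∀ {x} → x ∈ elements → Φ x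
   complete : ∀ {x} → Φ x → x ∈ elements
   size : length elements ≡ n
 open Card

 length-⊆ : ∀ {X : Set} {xs ys : List X} → Unique xs → (∀ {x} → x ∈ xs → x ∈ ys) → length xs ≤ length ys
 length-⊆ {xs = []} _ _ = z≤n
 length-⊆ {xs = x ∷ xs} {ys} (x∉ AllPairs.∷ u) sub with ∈-∃++ (sub (here refl))
 ... | zs₁ , zs₂ , refl = ≤≡ (s≤s (length-⊆ u sub′)) (sym eq)
  where
  sub′ : ∀ {y} → y ∈ xs → y ∈ zs₁ ++ zs₂
  sub′ y∈ with ∈-++⁻ zs₁ (sub (there y∈))
  ... | inj₁ y∈zs₁ = ∈-++⁺ˡ y∈zs₁
  ... | inj₂ (there y∈zs₂) = ∈-++⁺ʳ zs₁ y∈zs₂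
  ... | inj₂ (here refl) = ⊥-elim (All.lookup x∉ y∈ refl)
  eq : length (zs₁ ++ x ∷ zs₂) ≡ suc (length (zs₁ ++ zs₂))
  eq = trans (length-++ zs₁) (trans (+-suc (length zs₁) (length zs₂)) (cong suc (sym (length-++ zs₁))))

 card-unique : ∀ {X : Set} {Φ : X → Set} {m n} → Card Φ m → Card Φ n → m ≡ n
 card-unique c c′ = ≤-antisym (le c c′) (le c′ c)
  where
  le : ∀ {X : Set} {Φ : X → Set} {m n} → Card Φ m → Card Φ n → m ≤ n
  le c c′ = subst₂ _≤_ (size c) (size c′) (length-⊆ (unique c) (complete c′ ∘ sound c))

 card-resp : ∀ {X : Set} {Φ Ψ : X → Set} {n} → (∀ {x} → Φ x → Ψ x) → (∀ {x} → Ψ x → Φ x) → Card Φ n → Card Ψ n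
 card-resp f g c = mkCard (elements c) (unique c) (f ∘ sound c) (complete c ∘ g) (size c)

 card-0 : ∀ {X : Set} {Φ : X → Set} → (∀ {x} → ¬ Φ x) → Card Φ 0
 card-0 h = mkCard [] AllPairs.[] (λ ()) (⊥-elim ∘ h) refl

 card-1 : ∀ {X : Set} {Φ : X → Set} x → Φ x → (∀ {y} → Φ y → y ≡ x) → Card Φ 1
 card-1 x Φx h = mkCard (x ∷ []) ([] AllPairs.∷ AllPairs.[]) (λ { (here refl) → Φx }) (here ∘ h) refl

 card-⊎ : ∀ {X : Set} {Φ Ψ : X → Set} {m n} → (∀ {x} → Φ x → Ψ x → ⊥) → Card Φ m → Card Ψ n → Card (λ x → Φ x ⊎ Ψ x) (m + n)
 card-⊎ disj c c′ = mkCard (elements c ++ elements c′)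
  (Unique.++⁺ (unique c) (unique c′) λ (x∈ , x∈′) → disj (sound c x∈) (sound c′ x∈′))
  (λ x∈ → case (∈-++⁻ (elements c) x∈))
  (λ { (inj₁ h) → ∈-++⁺ˡ (complete c h) ; (inj₂ h) → ∈-++⁺ʳ (elements c) (complete c′ h) })
  (trans (length-++ (elements c)) (cong₂ _+_ (size c) (size c′)))
  where
  case : ∀ {x} → (x ∈ elements c) ⊎ (x ∈ elements c′) → _
  case (inj₁ h) = inj₁ (sound c h)
  case (inj₂ h) = inj₂ (sound c′ h)

 unique-map : ∀ {X Y : Set} {Φ : X → Set} (f : X → Y) → (∀ {x y} → Φ x → Φ y → f x ≡ f y → x ≡ y) →
  ∀ {xs} → (∀ {x} → x ∈ xs → Φ x) → Unique xs → Unique (map f xs)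
 unique-map f inj {[]} h u = AllPairs.[]
 unique-map f inj {x ∷ xs} h (x∉ AllPairs.∷ u) =
  All.tabulate (λ y∈ eq → let z , z∈ , e = ∈-map⁻ f y∈ in All.lookup x∉ z∈ (inj (h (here refl)) (h (there z∈)) (trans eq e)))
  AllPairs.∷ unique-map f inj (h ∘ there) u

 card-map : ∀ {X Y : Set} {Φ : X → Set} {Ψ : Y → Set} {n} (f : X → Y) → (∀ {x y} → Φ x → Φ y → f x ≡ f y → x ≡ y) →
  (∀ {x} → Φ x → Ψ (f x)) → (∀ {y} → Ψ y → ∃ λ x → Φ x × y ≡ f x) → Card Φ n → Card Ψ n
 card-map {Ψ = Ψ} f inj to from c = mkCard (map f (elements c)) (unique-map f inj (sound c) (unique c))
  (λ y∈ → let x , x∈ , e = ∈-map⁻ f y∈ in subst Ψ (sym e) (to (sound c x∈)))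
  (λ ψ → let x , φ , e = from ψ in subst (_∈ map f (elements c)) (sym e) (∈-map⁺ f (complete c φ)))
  (trans (length-map f (elements c)) (size c))

 card-× : ∀ {X Y : Set} {Φ : X → Set} {Ψ : Y → Set} {m n} → Card Φ m → Card Ψ n → Card {X × Y} (λ z → Φ (proj₁ z) × Ψ (proj₂ z)) (m * n)
 card-× c c′ = mkCard (cartesianProduct (elements c) (elements c′)) (Unique.cartesianProduct⁺ (unique c) (unique c′))
  (λ x∈ → let h , h′ = ∈-cartesianProduct⁻ (elements c) (elements c′) x∈ in sound c h , sound c′ h′)
  (λ (φ , ψ) → ∈-cartesianProduct⁺ (complete c φ) (complete c′ ψ))
  (trans (len (elements c) (elements c′)) (cong₂ _*_ (size c) (size c′)))
  where
  len : ∀ {X Y : Set} (xs : List X) (ys : List Y) → length (cartesianProduct xs ys) ≡ length xs * length ys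
  len [] ys = refl
  len (x ∷ xs) ys = trans (length-++ (map (x ,_) ys)) (cong₂ _+_ (length-map (x ,_) ys) (len xs ys))

 card-Σ : ∀ {X : Set} K {Φ : ℕ → X → Set} {f : ℕ → ℕ} → (∀ {i j x} → Φ i x → Φ j x → i ≡ j) → (∀ i → i < K → Card (Φ i) (f i)) →
  Card (λ x → ∃ λ i → i < K × Φ i x) (Σ< K f)
 card-Σ zero disj c = card-0 λ ()
 card-Σ {X} (suc K) {Φ} disj c = card-resp
  (λ { (inj₁ (i , i<K , φ)) → i , m≤n⇒m≤1+n i<K , φ ; (inj₂ φ) → K , ≤-refl , φ })
  (λ (i , i<K , φ) → split i (m≤n⇒m<n∨m≡n (≤-pred i<K)) φ)
  (card-⊎ (λ (i , i<K , φ) ψ → <-irrefl (disj φ ψ) i<K) (card-Σ K disj λ i i<K → c i (m≤n⇒m≤1+n i<K)) (c K ≤-refl))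
  where
  split : ∀ i {x : X} → i < K ⊎ i ≡ K → Φ i x → (∃ λ i → i < K × Φ i x) ⊎ Φ K x
  split i (inj₁ h) φ = inj₁ (i , h , φ)
  split i (inj₂ refl) φ = inj₂ φ

 card-sh : ∀ {X : Set} k n {Φ : ℕ → X → Set} {f : Seq} → (∀ m → k + m ≡ n → Card (Φ m) (f m)) →
  Card (λ x → ∃ λ m → k + m ≡ n × Φ m x) (sh k f n)
 card-sh zero n c = card-resp (λ φ → n , refl , φ) (λ { (_ , refl , φ) → φ }) (c n refl)
 card-sh (suc k) zero c = card-0 λ ()
 card-sh (suc k) (suc n) c = card-resp (λ (m , e , φ) → m , cong suc e , φ) (λ (m , e , φ) → m , suc-injective e , φ)
  (card-sh k n λ m e → c m (cong suc e))

 card-conv : ∀ {X Y : Set} n {Φ : ℕ → X → Set} {Ψ : ℕ → Y → Set} {f g : Seq} → (∀ {i j x} → Φ i x → Φ j x → i ≡ j) →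
  (∀ i → Card (Φ i) (f i)) → (∀ i → Card (Ψ i) (g i)) →
  Card {X × Y} (λ z → ∃ λ i → ∃ λ j → i + j ≡ n × Φ i (proj₁ z) × Ψ j (proj₂ z)) (conv f g n)
 card-conv zero disj c c′ = card-resp (λ (φ , ψ) → 0 , 0 , refl , φ , ψ) (λ { (zero , zero , refl , φ , ψ) → φ , ψ }) (card-× (c 0) (c′ 0))
 card-conv (suc n) disj c c′ = card-resp
  (λ { (inj₁ (φ , ψ)) → 0 , suc n , refl , φ , ψ ; (inj₂ (i , j , e , φ , ψ)) → suc i , j , cong suc e , φ , ψ })
  (λ { (zero , j , refl , φ , ψ) → inj₁ (φ , ψ) ; (suc i , j , e , φ , ψ) → inj₂ (i , j , suc-injective e , φ , ψ) })
  (card-⊎ (λ (φ , _) (i , _ , _ , φ′ , _) → 0≢suc (disj φ φ′)) (card-× (c 0) (c′ (suc n)))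
   (card-conv n (λ φ φ′ → suc-injective (disj φ φ′)) (c ∘ suc) c′))
  where
  0≢suc : ∀ {i} → 0 ≡ suc i → ⊥
  0≢suc ()

 count-card : ∀ {Φ : List ℕ → Set} (Φ? : Decidable Φ) → (∀ {a} → Φ a → length a ≤ suc (sum a)) → ∀ n →
  Card (λ a → Φ a × sum a ≡ n) (count Φ? n)
 count-card Φ? bound n = mkCard (filter Φ?′ (candidates n)) (Unique.filter⁺ Φ?′ (candidates-unique n))
  (λ a∈ → proj₂ (∈-filter⁻ Φ?′ {xs = candidates n} a∈))
  (λ { (φ , refl) → ∈-filter⁺ Φ?′ (candidates-complete _ (bound φ)) (φ , refl) }) refl
  where
  Φ?′ = λ a → Φ? a ×-dec (sum a Data.Nat.Properties.≟ n)

 PartitionIn : ℕ → ℕ → List ℕ → Set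
 PartitionIn k n a = Linked _≥_ a × All (1 ≤_) a × All (_≤ k) a × sum a ≡ n

 card-partition : ∀ f k n → n < f → Card (PartitionIn k n) (A k n)
 card-partition f zero zero _ = card-1 [] ([] , [] , [] , refl) only
  where
  only : ∀ {a} → PartitionIn 0 0 a → a ≡ []
  only {[]} _ = refl
  only {x ∷ a} (_ , s≤s _ ∷ _ , () ∷ _ , _)
 card-partition f zero (suc n) _ = card-0 none
  where
  none : ∀ {a} → ¬ PartitionIn 0 (suc n) a
  none {[]} (_ , _ , _ , ())
  none {x ∷ a} (_ , s≤s _ ∷ _ , () ∷ _ , _)
 card-partition (suc f) (suc k) n (s≤s n≤f) = subst (Card _) (sym (A-rec k n))
  (card-resp to from (card-⊎ disj (card-partition (suc f) k n (s≤s n≤f)) large))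
  where
  Large : List ℕ → Set
  Large a = ∃ λ b → (∃ λ m → suc k + m ≡ n × PartitionIn (suc k) m b) × a ≡ suc k ∷ b
  large : Card Large (sh (suc k) (A (suc k)) n)
  large = card-map (suc k ∷_) (λ _ _ e → proj₂ (∷-injective e)) (λ {b} φ → b , φ , refl) (λ ψ → ψ)
   (card-sh (suc k) n λ m e → card-partition f (suc k) m (≤-trans (s≤s (≤-trans (m≤n+m m k) ≤-refl)) (≡≤ e n≤f)))
  disj : ∀ {a} → PartitionIn k n a → Large a → ⊥
  disj (_ , _ , h ∷ _ , _) (b , _ , refl) = <-irrefl refl h
  to : ∀ {a} → PartitionIn k n a ⊎ Large a → PartitionIn (suc k) n a
  to (inj₁ (l , h , b , e)) = l , h , All.map m≤n⇒m≤1+n b , e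
  to (inj₂ ([] , (m , refl , l , h , b , refl) , refl)) = [-] , s≤s z≤n ∷ [] , ≤-refl ∷ [] , refl
  to (inj₂ (x ∷ b , (m , refl , l , h , hb ∷ bs , refl) , refl)) = hb ∷ l , s≤s z≤n ∷ h , ≤-refl ∷ hb ∷ bs , refl
  tail : ∀ {x} {a : List ℕ} → Linked _≥_ (x ∷ a) → Linked _≥_ a
  tail [-] = []
  tail (_ ∷ l) = l
  from : ∀ {a} → PartitionIn (suc k) n a → PartitionIn k n a ⊎ Large a
  from {[]} (l , h , b , e) = inj₁ (l , h , [] , e)
  from {x ∷ a} (l , h ∷ hs , b ∷ bs , e) with m≤n⇒m<n∨m≡n b
  ... | inj₁ (s≤s x≤k) = inj₁ (l , h ∷ hs , bound l x≤k , e)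
   where
   bound : ∀ {x a} → Linked _≥_ (x ∷ a) → x ≤ k → All (_≤ k) (x ∷ a)
   bound [-] h = h ∷ []
   bound (y≤x ∷ l) h = h ∷ bound l (≤-trans y≤x h)
  ... | inj₂ refl = inj₂ (a , (sum a , e , tail l , hs , bs , refl) , refl)

 p≡P : ∀ n → p n ≡ P n
 p≡P n = card-unique (count-card partition? partition-length n)
  (card-resp (λ (l , h , _ , e) → (l , h) , e) (λ { ((l , h) , refl) → l , h , parts≤ _ , refl }) (card-partition (suc n) n n ≤-refl))
  where
  parts≤ : ∀ a → All (_≤ sum a) a
  parts≤ [] = []
  parts≤ (x ∷ a) = m≤m+n x (sum a) ∷ All.map (λ h → ≤-trans h (m≤n+m (sum a) x)) (parts≤ a)

 Inc : ℕ → ℕ → ℕ → List ℕ → Set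
 Inc n r m a = Linked _<_ a × All (n ≤_) a × length a ≡ r × sum a ≡ m

 -- The recursion raises the least admissible part n, so f measures how far n still is from m; once
 -- m < n no nonempty sequence fits.
 card-inc : ∀ f n r m → m < n + f → Card (Inc n r m) (d n r m)
 card-inc f n zero m _ = subst (Card _) (cong (λ e → sh e one m) (sym (trans (+-identityʳ (n * 0)) (*-zeroʳ n)))) (empty m)
  where
  empty : ∀ m → Card (Inc n 0 m) (one m)
  empty zero = card-1 [] ([] , [] , refl , refl) λ { {[]} _ → refl }
  empty (suc m) = card-0 λ { {[]} (_ , _ , _ , ()) }
 card-inc zero n (suc r) m m<n = subst (Card _) (sym (sh-< (n * suc r + t (suc r)) (A (suc r)) m
   (<-≤-trans (subst (m <_) (+-identityʳ n) m<n) (≤-trans (m≤m*n n (suc r)) (m≤m+n _ _)))))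
  (card-0 none)
  where
  none : ∀ {a} → ¬ Inc n (suc r) m a
  none {x ∷ a} (_ , h ∷ _ , _ , refl) = <-irrefl refl (<-≤-trans (subst (m <_) (+-identityʳ n) m<n) (≤-trans h (m≤m+n x (sum a))))
 card-inc (suc f) n (suc r) m m<n = subst (Card _) (sym (d-rec n r m))
  (card-resp to from (card-⊎ disj (card-inc f (suc n) (suc r) m m<n′) small))
  where
  m<n′ : m < suc n + f
  m<n′ = subst (m <_) (+-suc n f) m<n
  Small : List ℕ → Set
  Small a = ∃ λ b → (∃ λ i → n + i ≡ m × Inc (suc n) r i b) × a ≡ n ∷ b
  small : Card Small (sh n (d (suc n) r) m)
  small = card-map (n ∷_) (λ _ _ e → proj₂ (∷-injective e)) (λ {b} φ → b , φ , refl) (λ ψ → ψ)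
   (card-sh n m λ i e → card-inc f (suc n) r i (≤-<-trans (≤≡ (m≤n+m i n) e) m<n′))
  disj : ∀ {a} → Inc (suc n) (suc r) m a → Small a → ⊥
  disj (_ , h ∷ _ , _ , _) (b , _ , refl) = <-irrefl refl h
  to : ∀ {a} → Inc (suc n) (suc r) m a ⊎ Small a → Inc n (suc r) m a
  to (inj₁ (l , h , e , e′)) = l , All.map (≤-trans (n≤1+n n)) h , e , e′
  to (inj₂ ([] , (i , refl , l , h , refl , refl) , refl)) = [-] , ≤-refl ∷ [] , refl , refl
  to (inj₂ (x ∷ b , (i , refl , l , h ∷ hs , refl , refl) , refl)) = h ∷ l , ≤-refl ∷ All.map (≤-trans (n≤1+n n)) (h ∷ hs) , refl , refl
  from : ∀ {a} → Inc n (suc r) m a → Inc (suc n) (suc r) m a ⊎ Small a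
  from {x ∷ a} (l , h ∷ hs , e , e′) with m≤n⇒m<n∨m≡n h
  ... | inj₁ n<x = inj₁ (l , n<x ∷ bound l n<x , e , e′)
   where
   bound : ∀ {x a} → Linked _<_ (x ∷ a) → n < x → All (n <_) a
   bound [-] _ = []
   bound (x<y ∷ l) h = <-trans h x<y ∷ bound l (<-trans h x<y)
  ... | inj₂ refl = inj₂ (a , (sum a , e′ , tail l , bound l , suc-injective e , refl) , refl)
   where
   tail : ∀ {x} {a : List ℕ} → Linked _<_ (x ∷ a) → Linked _<_ a
   tail [-] = []
   tail (_ ∷ l) = l
   bound : ∀ {x a} → Linked _<_ (x ∷ a) → All (x <_) a
   bound [-] = []
   bound (x<y ∷ l) = Linked⇒All <-trans x<y l

 -- A strongly concave composition of rank ℓ ≥ 0 is encoded by its central part c and its longer and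
 -- shorter sides B and S, both read outwards from c.

 Sides : ℕ → ℕ → ℕ × List ℕ × List ℕ → Set
 Sides ℓ M (c , B , S) = Linked _<_ (c ∷ B) × Linked _<_ (c ∷ S) × length B ≡ length S + ℓ × c + (sum B + sum S) ≡ M

 card-sides : ∀ ℓ M → Card (Sides ℓ M) (Compositions.a M ℓ)
 card-sides ℓ M = card-resp to from
  (card-Σ (suc M) (λ (_ , _ , e) (_ , _ , e′) → trans (sym (cong proj₁ e)) (cong proj₁ e′)) λ c _ →
   card-map (c ,_) (λ _ _ e → cong proj₂ e) (λ φ → _ , φ , refl) (λ ψ → ψ) (card-sh c M λ m _ →
    card-Σ K (λ (_ , _ , _ , _ , _ , _ , e , _) (_ , _ , _ , _ , _ , _ , e′ , _) → trans (sym e) e′) λ l _ →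
     card-conv m (λ (_ , _ , _ , e) (_ , _ , _ , e′) → trans (sym e) e′)
      (λ i → card-inc (suc i) (suc c) (l + ℓ) i (s≤s (m≤n⇒m≤o+n c (n≤1+n i))))
      (λ i → card-inc (suc i) (suc c) l i (s≤s (m≤n⇒m≤o+n c (n≤1+n i))))))
  where
  -- The truncation built into `Compositions`; the parts of the shorter side are positive, so its
  -- length is at most M and stays below it.
  K = suc (suc (suc M))
  Raw : ℕ × List ℕ × List ℕ → Set
  Raw x = ∃ λ c → c < suc M × ∃ λ (y : List ℕ × List ℕ) → (∃ λ m → c + m ≡ M × ∃ λ l → l < K ×
   ∃ λ i → ∃ λ j → i + j ≡ m × Inc (suc c) (l + ℓ) i (proj₁ y) × Inc (suc c) l j (proj₂ y)) × x ≡ (c , y)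
  link : ∀ {c a} → Linked _<_ a → All (suc c ≤_) a → Linked _<_ (c ∷ a)
  link [] [] = [-]
  link [-] (h ∷ _) = h ∷ [-]
  link (e ∷ l) (h ∷ _) = h ∷ e ∷ l
  unlink : ∀ {c a} → Linked _<_ (c ∷ a) → Linked _<_ a × All (suc c ≤_) a
  unlink [-] = [] , []
  unlink (h ∷ l) = l , Linked⇒All <-trans h l
  to : ∀ {x} → Raw x → Sides ℓ M x
  to (c , _ , _ , (_ , refl , _ , _ , _ , _ , refl , (l , h , e , refl) , (l′ , h′ , refl , refl)) , refl) = link l h , link l′ h′ , e , refl
  short : ∀ {c} a → All (suc c ≤_) a → length a ≤ sum a
  short [] [] = z≤n
  short (x ∷ a) (h ∷ hs) = +-mono-≤ (≤-trans (s≤s z≤n) h) (short a hs)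
  from : ∀ {x} → Sides ℓ M x → Raw x
  from {c , B , S} (b , s , e , refl) = c , s≤s (m≤m+n c _) , _ , (sum B + sum S , refl , length S ,
   s≤s (≤-trans (short S (proj₂ (unlink s))) (≤-trans (m≤n+m (sum S) (sum B)) (≤-trans (m≤n+m _ c) (m≤n+m _ 2)))) ,
   sum B , sum S , refl , (proj₁ (unlink b) , proj₂ (unlink b) , e , refl) , (proj₁ (unlink s) , proj₂ (unlink s) , refl , refl)) , refl

 join : ℕ → List ℕ → List ℕ → List ℕ
 join c L R = L ʳ++ (c ∷ R)

 take-ʳ++ : ∀ (L : List ℕ) ys j → take (length L + j) (L ʳ++ ys) ≡ L ʳ++ take j ys
 take-ʳ++ [] ys j = refl
 take-ʳ++ (x ∷ L) ys j = trans (cong (λ i → take i (L ʳ++ (x ∷ ys))) (sym (+-suc (length L) j))) (take-ʳ++ L (x ∷ ys) (suc j))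

 drop-ʳ++ : ∀ (L : List ℕ) ys j → drop (length L + j) (L ʳ++ ys) ≡ drop j ys
 drop-ʳ++ [] ys j = refl
 drop-ʳ++ (x ∷ L) ys j = trans (cong (λ i → drop i (L ʳ++ (x ∷ ys))) (sym (+-suc (length L) j))) (drop-ʳ++ L (x ∷ ys) (suc j))

 join-central : ∀ {c L R} → Linked _<_ (c ∷ L) → Linked _<_ (c ∷ R) → CentralAt (join c L R) (suc (length L))
 join-central {c} {L} {R} l r = s≤s z≤n ,
  subst (suc (length L) ≤_) (sym (trans (length-ʳ++ L) (+-suc (length L) (length R)))) (s≤s (m≤m+n _ _)) ,
  subst (Linked _>_) (sym (trans (cong (λ i → take i (join c L R)) (+-comm 1 (length L))) (take-ʳ++ L (c ∷ R) 1))) (descend L [-] l) ,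
  subst (Linked _<_) (sym (trans (cong (λ i → drop i (join c L R)) (sym (+-identityʳ (length L)))) (drop-ʳ++ L (c ∷ R) 0))) r
  where
  descend : ∀ L {c ys} → Linked _>_ (c ∷ ys) → Linked _<_ (c ∷ L) → Linked _>_ (L ʳ++ (c ∷ ys))
  descend [] g _ = g
  descend (x ∷ L) g (h ∷ l) = descend L (h ∷ g) l

 central-join : ∀ {a k} → CentralAt a k → ∃ λ c → ∃ λ L → ∃ λ R → a ≡ join c L R × k ≡ suc (length L) × Linked _<_ (c ∷ L) × Linked _<_ (c ∷ R)
 central-join {a} {suc k} (_ , h , l , r) = go k a h l r
  where
  extend : ∀ L {c R x y ys} → Linked _<_ (c ∷ L) → y ∷ ys ≡ L ʳ++ (c ∷ R) → y < x → Linked _<_ (c ∷ (L ∷ʳ x))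
  extend [] l refl h = h ∷ [-]
  extend (z ∷ L) (e ∷ l) eq h = e ∷ extend L l eq h
  go : ∀ k a → suc k ≤ length a → Linked _>_ (take (suc k) a) → Linked _<_ (drop k a) →
     ∃ λ c → ∃ λ L → ∃ λ R → a ≡ join c L R × suc k ≡ suc (length L) × Linked _<_ (c ∷ L) × Linked _<_ (c ∷ R)
  go zero (x ∷ a) _ _ r = x , [] , a , refl , refl , [-] , r
  go (suc k) (x ∷ y ∷ a) (s≤s h) (x>y ∷ l) r with go k (y ∷ a) h l r
  ... | c , L , R , e , e′ , l′ , r′ = c , L ∷ʳ x , R , trans (cong (x ∷_) e) (sym (++-ʳ++ L)) ,
   cong suc (trans e′ (sym (trans (length-++ L) (+-comm (length L) 1)))) , extend L l′ e x>y , r′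

 -- Between two distinct central positions some neighbouring pair would have to fall and rise at
 -- once.
 central-unique : ∀ {a k k′} → CentralAt a k → CentralAt a k′ → k ≡ k′
 central-unique {a} {suc k} {suc k′} (_ , h , l , r) (_ , h′ , l′ , r′) = cong suc (go k k′ a h l r h′ l′ r′)
  where
  go : ∀ k k′ a → suc k ≤ length a → Linked _>_ (take (suc k) a) → Linked _<_ (drop k a) →
     suc k′ ≤ length a → Linked _>_ (take (suc k′) a) → Linked _<_ (drop k′ a) → k ≡ k′
  go zero zero a _ _ _ _ _ _ = refl
  go zero (suc k′) (x ∷ y ∷ a) _ _ (lt ∷ _) _ (gt ∷ _) _ = ⊥-elim (<-asym lt gt)
  go zero (suc k′) (x ∷ []) _ _ _ (s≤s ()) _ _
  go (suc k) zero (x ∷ y ∷ a) _ (gt ∷ _) _ _ _ (lt ∷ _) = ⊥-elim (<-asym lt gt)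
  go (suc k) zero (x ∷ []) (s≤s ()) _ _ _ _ _
  go (suc k) (suc k′) (x ∷ y ∷ a) (s≤s h) (_ ∷ l) r (s≤s h′) (_ ∷ l′) r′ = cong suc (go k k′ (y ∷ a) h l r h′ l′ r′)
  go (suc k) (suc k′) (x ∷ []) (s≤s ()) _ _ _ _ _

 join-injective : ∀ {c L R c′ L′ R′} → Linked _<_ (c ∷ L) → Linked _<_ (c ∷ R) → Linked _<_ (c′ ∷ L′) → Linked _<_ (c′ ∷ R′) →
  join c L R ≡ join c′ L′ R′ → c ≡ c′ × L ≡ L′ × R ≡ R′
 join-injective {c} {L} {R} {c′} {L′} {R′} l r l′ r′ e = proj₁ parts , left , proj₂ parts
  where
  same : length L ≡ length L′
  same = suc-injective (central-unique (join-central l r) (subst (λ a → CentralAt a (suc (length L′))) (sym e) (join-central l′ r′)))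
  parts : c ≡ c′ × R ≡ R′
  parts = ∷-injective (trans (sym (drop-ʳ++ L (c ∷ R) 0)) (trans (cong₂ (λ i a → drop (i + 0) a) same e) (drop-ʳ++ L′ (c′ ∷ R′) 0)))
  rev : L ʳ++ [] ≡ L′ ʳ++ []
  rev = trans (sym (take-ʳ++ L (c ∷ R) 0)) (trans (cong₂ (λ i a → take (i + 0) a) same e) (take-ʳ++ L′ (c′ ∷ R′) 0))
  ʳ++-involutive : ∀ (L ys : List ℕ) → (L ʳ++ ys) ʳ++ [] ≡ ys ʳ++ (L ++ [])
  ʳ++-involutive [] ys = refl
  ʳ++-involutive (x ∷ L) ys = ʳ++-involutive L (x ∷ ys)
  ++[] : ∀ (L : List ℕ) → L ++ [] ≡ L
  ++[] [] = refl
  ++[] (x ∷ L) = cong (x ∷_) (++[] L)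
  left : L ≡ L′
  left = trans (sym (trans (ʳ++-involutive L []) (++[] L))) (trans (cong (_ʳ++ []) rev) (trans (ʳ++-involutive L′ []) (++[] L′)))

 sum-join : ∀ c L R → sum (join c L R) ≡ c + (sum L + sum R)
 sum-join c L R = trans (go L (c ∷ R)) (e (sum L) c (sum R))
  where
  go : ∀ L ys → sum (L ʳ++ ys) ≡ sum L + sum ys
  go [] ys = refl
  go (x ∷ L) ys = trans (go L (x ∷ ys)) (e′ (sum L) x (sum ys))
   where
   e′ = solve 3 (λ a b c → a :+ (b :+ c) := (b :+ a) :+ c) refl
  e = solve 3 (λ a b c → a :+ (b :+ c) := b :+ (a :+ c)) refl

 rank-join : ∀ c L R → + length (join c L R) ℤ.- + 2 ℤ.* + suc (length L) ℤ.+ + 1 ≡ + length R ℤ.- + length L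
 rank-join c L R = trans (cong (λ n → n ℤ.- + 2 ℤ.* + suc (length L) ℤ.+ + 1) (cong +_ (length-ʳ++ L)))
  (go (+ length L) (+ length R))
  where
  go : ∀ l r → (l ℤ.+ (+ 1 ℤ.+ r)) ℤ.- + 2 ℤ.* (+ 1 ℤ.+ l) ℤ.+ + 1 ≡ r ℤ.- l
  go = ℤ-Ring.solve-∀

 rank-unique : ∀ {m m′ a} → StronglyConcaveOfRank m a → StronglyConcaveOfRank m′ a → m ≡ m′
 rank-unique {a = a} (k , c , e) (k′ , c′ , e′) = trans e (trans (cong (λ k → + length a ℤ.- + 2 ℤ.* + k ℤ.+ + 1) (central-unique c c′)) (sym e′))

 rank-card : ∀ m M → Card (λ a → StronglyConcaveOfRank m a × sum a ≡ M) (V m M)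
 rank-card m M = count-card (stronglyConcaveOfRank? m) (λ (k , c , _) → stronglyConcave-length (k , c)) M

 diff-+ : ∀ r l ℓ → + r ℤ.- + l ≡ + ℓ → r ≡ l + ℓ
 diff-+ r l ℓ e = ℤ.+-injective (trans (go (+ r) (+ l)) (cong (λ x → + l ℤ.+ x) e))
  where
  go : ∀ r l → r ≡ l ℤ.+ (r ℤ.- l)
  go = ℤ-Ring.solve-∀

 V⁺ : ∀ ℓ M → V (+ ℓ) M ≡ Compositions.a M ℓ
 V⁺ ℓ M = card-unique (rank-card (+ ℓ) M) (card-map (λ (c , B , S) → join c S B)
  (λ (b , s , _) (b′ , s′ , _) e → let e₁ , e₂ , e₃ = join-injective s b s′ b′ e in cong₂ _,_ e₁ (cong₂ _,_ e₃ e₂))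
  (λ {(c , B , S)} (b , s , e , e′) → (suc (length S) , join-central s b ,
    sym (trans (rank-join c S B) (trans (cong (λ n → + n ℤ.- + length S) e) (cancel (+ length S) (+ ℓ))))) ,
    trans (sum-join c S B) (trans (cong (λ x → c + x) (+-comm (sum S) (sum B))) e′))
  from (card-sides ℓ M))
  where
  cancel : ∀ s l → (s ℤ.+ l) ℤ.- s ≡ l
  cancel = ℤ-Ring.solve-∀
  from : ∀ {a} → StronglyConcaveOfRank (+ ℓ) a × sum a ≡ M → ∃ λ x → Sides ℓ M x × a ≡ join (proj₁ x) (proj₂ (proj₂ x)) (proj₁ (proj₂ x))
  from ((k , c , e) , e′) with central-join c
  ... | x , L , R , refl , refl , l , r = (x , R , L) , (r , l , diff-+ (length R) (length L) ℓ (sym (trans e (rank-join x L R))) ,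
   trans (cong (λ y → x + y) (+-comm (sum R) (sum L))) (trans (sym (sum-join x L R)) e′)) , refl

 V⁻ : ∀ n M → V -[1+ n ] M ≡ Compositions.a M (suc n)
 V⁻ n M = card-unique (rank-card -[1+ n ] M) (card-map (λ (c , B , S) → join c B S)
  (λ (b , s , _) (b′ , s′ , _) e → let e₁ , e₂ , e₃ = join-injective b s b′ s′ e in cong₂ _,_ e₁ (cong₂ _,_ e₂ e₃))
  (λ {(c , B , S)} (b , s , e , e′) → (suc (length B) , join-central b s ,
    sym (trans (rank-join c B S) (trans (cong (λ n → + length S ℤ.- + n) e) (cancel (+ length S) (+ suc n))))) ,
    trans (sum-join c B S) e′)
  from (card-sides (suc n) M))
  where
  cancel : ∀ s l → s ℤ.- (s ℤ.+ l) ≡ ℤ.- l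
  cancel = ℤ-Ring.solve-∀
  flip′ : ∀ r l → l ℤ.- r ≡ ℤ.- (r ℤ.- l)
  flip′ = ℤ-Ring.solve-∀
  from : ∀ {a} → StronglyConcaveOfRank -[1+ n ] a × sum a ≡ M → ∃ λ x → Sides (suc n) M x × a ≡ join (proj₁ x) (proj₁ (proj₂ x)) (proj₂ (proj₂ x))
  from ((k , c , e) , e′) with central-join c
  ... | x , L , R , refl , refl , l , r = (x , L , R) , (l , r ,
   diff-+ (length L) (length R) (suc n) (trans (flip′ (+ length R) (+ length L)) (cong ℤ.-_ (sym (trans e (rank-join x L R))))) ,
   trans (sym (sum-join x L R)) e′) , refl

 V≡a : ∀ m M → V m M ≡ Compositions.a M ℤ.∣ m ∣
 V≡a (+ ℓ) M = V⁺ ℓ M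
 V≡a (-[1+ n ]) M = V⁻ n M

 -- Every composition has exactly one rank, and the ranks 0, ±1, ..., ±(M+1) suffice because a
 -- composition of M has at most M + 1 parts.
 V-total≡ : ∀ M → V-total M ≡ Compositions.a M 0 + Σ< (suc M) (λ i → Compositions.a M (suc i) + Compositions.a M (suc i))
 V-total≡ M = card-unique (count-card stronglyConcave? stronglyConcave-length M)
  (subst (Card _) (cong₂ _+_ (V⁺ 0 M) (Σ-cong (suc M) λ i → cong₂ _+_ (V⁺ (suc i) M) (V⁻ i M)))
  (card-resp to from (card-⊎ disj₀ (rank-card (+ 0) M) (card-Σ (suc M) disj λ i _ → card-⊎ disj± (rank-card (+ suc i) M) (rank-card -[1+ i ] M)))))
  where
  Rank : ℤ → List ℕ → Set
  Rank m a = StronglyConcaveOfRank m a × sum a ≡ M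
  Rank± : ℕ → List ℕ → Set
  Rank± i a = Rank (+ suc i) a ⊎ Rank -[1+ i ] a
  disj± : ∀ {i a} → Rank (+ suc i) a → Rank -[1+ i ] a → ⊥
  disj± (r , _) (r′ , _) with () ← rank-unique r r′
  disj : ∀ {i j a} → Rank± i a → Rank± j a → i ≡ j
  disj (inj₁ (r , _)) (inj₁ (r′ , _)) with refl ← rank-unique r r′ = refl
  disj (inj₁ (r , _)) (inj₂ (r′ , _)) with () ← rank-unique r r′
  disj (inj₂ (r , _)) (inj₁ (r′ , _)) with () ← rank-unique r r′
  disj (inj₂ (r , _)) (inj₂ (r′ , _)) with refl ← rank-unique r r′ = refl
  disj₀ : ∀ {a} → Rank (+ 0) a → (∃ λ i → i < suc M × Rank± i a) → ⊥
  disj₀ (r , _) (i , _ , inj₁ (r′ , _)) with () ← rank-unique r r′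
  disj₀ (r , _) (i , _ , inj₂ (r′ , _)) with () ← rank-unique r r′
  All± : List ℕ → Set
  All± a = Rank (+ 0) a ⊎ (∃ λ i → i < suc M × Rank± i a)
  to : ∀ {a} → All± a → StronglyConcave a × sum a ≡ M
  to (inj₁ ((k , c , _) , e)) = (k , c) , e
  to (inj₂ (_ , _ , inj₁ ((k , c , _) , e))) = (k , c) , e
  to (inj₂ (_ , _ , inj₂ ((k , c , _) , e))) = (k , c) , e
  from : ∀ {a} → StronglyConcave a × sum a ≡ M → All± a
  from {a} ((k , c) , refl) with central-join c
  ... | x , L , R , refl , refl , l , r = go (+ length R ℤ.- + length L) refl
   where
   b = join x L R
   len : length L + length R ≤ sum b
   len = ≤-pred (subst (_≤ suc (sum b)) (trans (length-ʳ++ L) (+-suc (length L) (length R))) (stronglyConcave-length (suc (length L) , c)))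
   go : ∀ m → m ≡ + length R ℤ.- + length L → All± b
   go (+ zero) e = inj₁ ((_ , c , trans e (sym (rank-join x L R))) , refl)
   go (+ suc i) e = inj₂ (i , m≤n⇒m≤1+n (≤-trans (≤≡ (m≤n+m (suc i) (length L)) (sym (diff-+ (length R) (length L) (suc i) (sym e))))
                (≤-trans (m≤n+m _ (length L)) len)) , inj₁ ((_ , c , trans e (sym (rank-join x L R))) , refl))
   go -[1+ i ] e = inj₂ (i , m≤n⇒m≤1+n (≤-trans (≤≡ (m≤n+m (suc i) (length R)) (sym (diff-+ (length L) (length R) (suc i) e′)))
                (≤-trans (m≤m+n _ (length R)) len)) , inj₂ ((_ , c , trans e (sym (rank-join x L R))) , refl))
    where
    flip′ : ∀ r l → l ℤ.- r ≡ ℤ.- (r ℤ.- l)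
    flip′ = ℤ-Ring.solve-∀
    e′ : + length L ℤ.- + length R ≡ + suc i
    e′ = trans (flip′ (+ length R) (+ length L)) (cong ℤ.-_ (sym e))

-- Riemann sums for the divisor recurrence

module PartialSums where
 open QSeries
 open import Data.Nat.Base
 open import Data.Nat.Properties
 open import Data.Nat.Solver using (module +-*-Solver)
 open +-*-Solver using (solve; con; _:+_; _:*_; _:=_)

 Σ-* : ∀ k c (f : ℕ → ℕ) → Σ< k (λ i → c * f i) ≡ c * Σ< k f
 Σ-* zero c f = sym (*-zeroʳ c)
 Σ-* (suc k) c f = trans (cong (_+ c * f k) (Σ-* k c f)) (sym (*-distribˡ-+ c (Σ< k f) (f k)))

 Σ-swap : ∀ m n (f : ℕ → ℕ → ℕ) → Σ< m (λ i → Σ< n (f i)) ≡ Σ< n (λ j → Σ< m (λ i → f i j))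
 Σ-swap zero n f = sym (Σ-0 n λ _ → refl)
 Σ-swap (suc m) n f = trans (cong (_+ Σ< n (f m)) (Σ-swap m n f)) (sym (Σ-+ n _ _))

 Σ-append : ∀ m n (f : ℕ → ℕ) → Σ< (m + n) f ≡ Σ< m f + Σ< n (λ r → f (m + r))
 Σ-append m zero f = trans (cong (λ k → Σ< k f) (+-identityʳ m)) (sym (+-identityʳ _))
 Σ-append m (suc n) f = trans (cong (λ k → Σ< k f) (+-suc m n)) (trans (cong (_+ f (m + n)) (Σ-append m n f)) (+-assoc (Σ< m f) _ _))

 Σ-blocks : ∀ I j (f : ℕ → ℕ) → Σ< (I * j) f ≡ Σ< I (λ i → Σ< j (λ r → f (i * j + r)))
 Σ-blocks zero j f = refl
 Σ-blocks (suc I) j f = trans (cong (λ k → Σ< k f) (+-comm j (I * j))) (trans (Σ-append (I * j) j f) (cong (_+ Σ< j (λ r → f (I * j + r))) (Σ-blocks I j f)))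

 Σ-≥const : ∀ k {c} {f : ℕ → ℕ} → (∀ i → i < k → c ≤ f i) → k * c ≤ Σ< k f
 Σ-≥const zero h = z≤n
 Σ-≥const (suc k) {c} {f} h = ≡≤ (+-comm c (k * c)) (+-mono-≤ (Σ-≥const k λ i i<k → h i (m≤n⇒m≤1+n i<k)) (h k ≤-refl))

 Σ-≤const : ∀ k {c} {f : ℕ → ℕ} → (∀ i → i < k → f i ≤ c) → Σ< k f ≤ k * c
 Σ-≤const zero h = z≤n
 Σ-≤const (suc k) {c} {f} h = ≤≡ (+-mono-≤ (Σ-≤const k λ i i<k → h i (m≤n⇒m≤1+n i<k)) (h k ≤-refl)) (+-comm (k * c) c)

 -- `U n` equals Σ k p(n-k); it is the integral that the sums over multiples of j discretise.
 S U : Seq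
 S n = Σ< (suc n) P
 U zero = 0
 U (suc n) = U n + S n

 S-sum : ∀ K n → n < K → Σ< K (λ k → sh k P n) ≡ S n
 S-sum (suc K) zero _ = trans (Σ-head K (λ k → sh k P 0)) (cong (P 0 +_) (Σ-0 K λ _ → refl))
 S-sum (suc K) (suc n) (s≤s n<K) = trans (Σ-head K (λ k → sh k P (suc n))) (trans (cong (P (suc n) +_) (S-sum K n n<K)) (+-comm (P (suc n)) (S n)))

 U-sum : ∀ K n → n < K → Σ< K (λ k → k * sh k P n) ≡ U n
 U-sum (suc K) zero _ = trans (Σ-head K (λ k → k * sh k P 0)) (Σ-0 K λ k → *-zeroʳ (suc k))
 U-sum (suc K) (suc n) (s≤s n<K) = trans (Σ-head K (λ k → k * sh k P (suc n))) (trans (Σ-+ K (λ k → sh k P n) (λ k → k * sh k P n))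
  (trans (cong₂ _+_ (S-sum K n n<K) (U-sum K n n<K)) (+-comm (S n) (U n))))

 module _ (n : ℕ) where
  private
   f : ℕ → ℕ
   f k = sh k P n

   f-anti : ∀ {j k} → j ≤ k → f k ≤ f j
   f-anti j≤k = sh-antitone P-increasing j≤k n

  -- The double sum for n p(n) grouped by the cofactor j = b + 1: j² `W b` is a Riemann sum of mesh
  -- j for `U n`, and `R b` measures its error.
  W R : ℕ → ℕ
  W b = Σ< n (λ i → suc i * f (suc b * suc i))
  R b = Σ< n (λ i → f (suc b * suc i))

  P-recurrence′ : n * P n ≡ Σ< n W
  P-recurrence′ = trans (P-recurrence n) (trans (Σ-cong n λ j → sym (Σ-* n (suc j) (λ i → f (suc i * suc j))))
   (Σ-swap n n (λ j i → suc j * f (suc i * suc j))))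

  private
   module _ (b : ℕ) where
    j = suc b
    last-0 : f (j * suc n) ≡ 0
    last-0 = sh-< (j * suc n) P n (m≤m+n (suc n) _)
    n<jn : n < suc n * j
    n<jn = m≤m*n (suc n) j

    jR≤S : j * R b ≤ S n
    jR≤S = begin
     j * R b ≡⟨ Σ-* n j _ ⟨
     Σ< n (λ i → j * f (j * suc i)) ≡⟨ Σ-drop n _ (trans (cong (j *_) last-0) (*-zeroʳ j)) ⟨
     Σ< (suc n) (λ i → j * f (j * suc i)) ≤⟨ Σ-mono (suc n) (λ i → Σ-≥const j λ r r<j → f-anti (block i r r<j)) ⟩
     Σ< (suc n) (λ i → Σ< j (λ r → f (i * j + r))) ≡⟨ Σ-blocks (suc n) j f ⟨
     Σ< (suc n * j) f ≡⟨ S-sum (suc n * j) n n<jn ⟩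
     S n ∎
     where
     open ≤-Reasoning
     block : ∀ i r → r < j → i * j + r ≤ j * suc i
     block i r r<j = ≤≡ (+-monoʳ-≤ (i * j) (<⇒≤ r<j)) (trans (+-comm (i * j) j) (*-comm (suc i) j))

    -- On a block of length j the weight k is at least its left endpoint, and p(n-k) is at least its
    -- value at the right endpoint. Moving the weight to the right endpoint costs j² R. `U≤`
    -- exchanges the endpoints.
    W≤ : j * j * W b ≤ U n + j * j * R b
    W≤ = begin
     j * j * W b ≡⟨ Σ-* n (j * j) _ ⟨
     Σ< n (λ i → j * j * (suc i * f (j * suc i))) ≡⟨ Σ-cong n (λ i → e₁ j i (f (j * suc i))) ⟩
     Σ< n (λ i → j * (i * j * f (j * suc i)) + j * j * f (j * suc i)) ≡⟨ Σ-+ n _ _ ⟩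
     Σ< n (λ i → j * (i * j * f (j * suc i))) + Σ< n (λ i → j * j * f (j * suc i)) ≡⟨ cong₂ _+_ (sym (Σ-drop n _ last)) (Σ-* n (j * j) _) ⟩
     Σ< (suc n) (λ i → j * (i * j * f (j * suc i))) + j * j * R b ≤⟨ +-monoˡ-≤ (j * j * R b) (Σ-mono (suc n) λ i → Σ-≥const j λ r r<j →
                                *-mono-≤ (m≤m+n (i * j) r) (f-anti (block i r r<j))) ⟩
     Σ< (suc n) (λ i → Σ< j (λ r → (i * j + r) * f (i * j + r))) + j * j * R b ≡⟨ cong (_+ j * j * R b) (trans (sym (Σ-blocks (suc n) j (λ k → k * f k))) (U-sum (suc n * j) n n<jn)) ⟩
     U n + j * j * R b ∎
     where
     open ≤-Reasoning
     e₁ = solve 3 (λ j i x → j :* j :* ((con 1 :+ i) :* x) := j :* (i :* j :* x) :+ j :* j :* x) refl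
     last : j * (n * j * f (j * suc n)) ≡ 0
     last = trans (cong (λ x → j * (n * j * x)) last-0) (trans (cong (j *_) (*-zeroʳ (n * j))) (*-zeroʳ j))
     block : ∀ i r → r < j → i * j + r ≤ j * suc i
     block i r r<j = ≤≡ (+-monoʳ-≤ (i * j) (<⇒≤ r<j)) (trans (+-comm (i * j) j) (*-comm (suc i) j))

    U≤ : U n ≤ j * j * P n + (j * j * W b + j * j * R b)
    U≤ = begin
     U n ≡⟨ trans (sym (U-sum (suc n * j) n n<jn)) (Σ-blocks (suc n) j (λ k → k * f k)) ⟩
     Σ< (suc n) (λ i → Σ< j (λ r → (i * j + r) * f (i * j + r))) ≤⟨ Σ-mono (suc n) (λ i → Σ-≤const j λ r r<j →
                                *-mono-≤ (≤≡ (+-monoʳ-≤ (i * j) (<⇒≤ r<j)) (+-comm (i * j) j)) (f-anti (m≤m+n (i * j) r))) ⟩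
     Σ< (suc n) (λ i → j * (suc i * j * f (i * j))) ≡⟨ Σ-head n _ ⟩
     j * (1 * j * P n) + Σ< n (λ i → j * (suc (suc i) * j * f (suc i * j))) ≡⟨ cong₂ _+_ (e₀ j (P n)) (trans (Σ-cong n term) (trans (Σ-+ n _ _) (cong₂ _+_ (Σ-* n (j * j) _) (Σ-* n (j * j) _)))) ⟩
     j * j * P n + (j * j * W b + j * j * R b) ∎
     where
     open ≤-Reasoning
     e₀ = solve 2 (λ j x → j :* (con 1 :* j :* x) := j :* j :* x) refl
     e₁ = solve 3 (λ j i x → j :* ((con 1 :+ ((con 1 :+ i))) :* j :* x) := j :* j :* ((con 1 :+ i) :* x) :+ j :* j :* x) refl
     term : ∀ i → j * (suc (suc i) * j * f (suc i * j)) ≡ j * j * (suc i * f (j * suc i)) + j * j * f (j * suc i)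
     term i = trans (e₁ j i (f (suc i * j))) (cong (λ k → j * j * (suc i * f k) + j * j * f k) (*-comm (suc i) j))

  gaps≤S : ∀ b → suc b * R b ≤ S n
  gaps≤S = jR≤S

  W-upper : ∀ b → suc b * suc b * W b ≤ U n + suc b * S n
  W-upper b = ≤-trans (W≤ b) (+-monoʳ-≤ (U n) (≡≤ (*-assoc (suc b) (suc b) (R b)) (*-monoʳ-≤ (suc b) (jR≤S b))))

  W-lower : ∀ b → U n ≤ suc b * suc b * W b + (suc b * suc b * P n + suc b * S n)
  W-lower b = ≤-trans (U≤ b) (≡≤ (e (suc b * suc b * P n) (suc b * suc b * W b) (suc b * suc b * R b))
   (+-monoʳ-≤ (suc b * suc b * W b) (+-monoʳ-≤ (suc b * suc b * P n) (≡≤ (*-assoc (suc b) (suc b) (R b)) (*-monoʳ-≤ (suc b) (jR≤S b))))))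
   where
   e = solve 3 (λ x y z → x :+ (y :+ z) := y :+ (x :+ z)) refl

  -- The group j = 1 of the recurrence is U itself.
  U≤nP : U n ≤ n * P n
  U≤nP = ≤-trans (≤-reflexive (trans (sym (U-sum (suc n) n ≤-refl)) (trans (Σ-head n (λ k → k * f k))
    (Σ-cong n λ i → cong (λ k → suc i * f k) (sym (*-identityˡ (suc i))))))) (≤≡ (go n refl) (sym P-recurrence′))
   where
   first≤ : ∀ k (g : ℕ → ℕ) → g 0 ≤ Σ< (suc k) g
   first≤ zero g = ≤-refl
   first≤ (suc k) g = ≤-trans (first≤ k g) (m≤m+n _ _)
   go : ∀ k → k ≡ n → W 0 ≤ Σ< n W
   go zero refl = z≤n
   go (suc k) refl = first≤ k W

  -- Split S at k = K: beyond it the factor K is at most k, so that part is dominated by U.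
  KS≤ : ∀ K → K * S n ≤ K * (K * P n) + U n
  KS≤ K = begin
   K * S n ≡⟨ trans (cong (K *_) (sym (S-sum (K + suc n) n (m≤n+m (suc n) K)))) (sym (Σ-* (K + suc n) K f)) ⟩
   Σ< (K + suc n) (λ k → K * f k) ≡⟨ Σ-append K (suc n) _ ⟩
   Σ< K (λ k → K * f k) + Σ< (suc n) (λ r → K * f (K + r)) ≤⟨ +-mono-≤ (Σ-≤const K λ k _ → *-monoʳ-≤ K (f-anti {0} {k} z≤n))
                                    (≤-trans (Σ-mono (suc n) λ r → *-monoˡ-≤ (f (K + r)) (m≤m+n K r)) (m≤n+m _ (Σ< K (λ k → k * f k)))) ⟩
   K * (K * P n) + (Σ< K (λ k → k * f k) + Σ< (suc n) (λ r → (K + r) * f (K + r))) ≡⟨ cong (K * (K * P n) +_) (trans (sym (Σ-append K (suc n) (λ k → k * f k))) (U-sum (K + suc n) n (m≤n+m (suc n) K))) ⟩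
   K * (K * P n) + U n ∎
   where open ≤-Reasoning

  sP≤S : ∀ s → s * sh s P n ≤ S n
  sP≤S s = ≤-trans (Σ-≥const s λ k k<s → f-anti (<⇒≤ k<s)) (≤≡ (m≤m+n _ _) (trans (sym (Σ-append s (suc n) f)) (S-sum (s + suc n) n (m≤n+m (suc n) s))))

  tP≤U : ∀ s → t s * sh s P n ≤ U n
  tP≤U s = ≤-trans (go s λ k k<s → f-anti (<⇒≤ k<s)) (≤≡ (m≤m+n _ _) (trans (sym (Σ-append s (suc n) (λ k → k * f k))) (U-sum (s + suc n) n (m≤n+m (suc n) s))))
   where
   go : ∀ s {c} → (∀ k → k < s → c ≤ f k) → t s * c ≤ Σ< s (λ k → k * f k)
   go zero h = z≤n
   go (suc s) {c} h = ≡≤ (*-distribʳ-+ c (t s) s) (+-mono-≤ (go s λ k k<s → h k (m≤n⇒m≤1+n k<s)) (*-monoʳ-≤ s (h s ≤-refl)))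

 S-increasing : Increasing S
 S-increasing n = m≤m+n (S n) (P (suc n))

 sS≤U : ∀ s n → s * sh s S n ≤ U n
 sS≤U zero n = z≤n
 sS≤U (suc s) zero = ≤-reflexive (*-zeroʳ s)
 sS≤U (suc s) (suc n) = ≡≤ (+-comm (sh s S n) _) (+-mono-≤ (sS≤U s n) (sh-antitone S-increasing (z≤n {s}) n))

-- Inequalities, powers and finite sums over the rationals

module Rationals where
 open import Defs public
 open import Data.Integer.Base using (+_)
 open import Data.Rational.Base public
 open import Data.Rational.Properties
 open import Data.Rational.Solver using (module +-*-Solver)
 open +-*-Solver public using (Polynomial; solve; con; _:+_; _:*_; :-_; _:-_; _:=_)

 # : ∀ {n} → ℕ → Polynomial n
 # k = con ⌜ k ⌝

 :0 :1 :½ : ∀ {n} → Polynomial n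
 :0 = con 0ℚ
 :1 = con 1ℚ
 :½ = con ½

 ≡≤ : ∀ {a b c : ℚ} → a ≡ b → b ≤ c → a ≤ c
 ≡≤ refl h = h

 ≤≡ : ∀ {a b c : ℚ} → a ≤ b → b ≡ c → a ≤ c
 ≤≡ h refl = h

 ℕ≡≤ : ∀ {a b c} → a ≡ b → b ℕ.≤ c → a ℕ.≤ c
 ℕ≡≤ refl h = h

 ℕ≤≡ : ∀ {a b c} → a ℕ.≤ b → b ≡ c → a ℕ.≤ c
 ℕ≤≡ h refl = h

 2ℚ 3ℚ 4ℚ 6ℚ 8ℚ : ℚ
 2ℚ = ⌜ 2 ⌝
 3ℚ = ⌜ 3 ⌝
 4ℚ = ⌜ 4 ⌝
 6ℚ = ⌜ 6 ⌝
 8ℚ = ⌜ 8 ⌝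

 0≤2 : 0ℚ ≤ 2ℚ
 0≤2 = 0≤⌜⌝ 2
 0≤3 : 0ℚ ≤ 3ℚ
 0≤3 = 0≤⌜⌝ 3
 0≤4 : 0ℚ ≤ 4ℚ
 0≤4 = 0≤⌜⌝ 4
 0≤6 : 0ℚ ≤ 6ℚ
 0≤6 = 0≤⌜⌝ 6
 0≤8 : 0ℚ ≤ 8ℚ
 0≤8 = 0≤⌜⌝ 8
 0≤½ : 0ℚ ≤ ½
 0≤½ = <⇒≤ (positive⁻¹ ½)

 0≤1 : 0ℚ ≤ 1ℚ
 0≤1 = <⇒≤ (positive⁻¹ 1ℚ)

 sub≥0 : ∀ {a b} → a ≤ b → 0ℚ ≤ b - a
 sub≥0 {a} {b} h = subst (_≤ b - a) (+-inverseʳ a) (+-monoˡ-≤ (- a) h)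

 -- The pattern for most estimates below: the gap `e` is written as a combination of nonnegative
 -- quantities with explicit constants, and the identity is left to the ring solver.
 by : ∀ {a b} e → 0ℚ ≤ e → a + e ≡ b → a ≤ b
 by {a} e h eq = subst (a ≤_) eq (p≤p+q a h)

 sub-≤ : ∀ {a b} → 0ℚ ≤ b → a - b ≤ a
 sub-≤ {a} {b} h = by b h (r a b)
  where
  r = solve 2 (λ a b → a :- b :+ b := a) refl

 abs≤ : ∀ {x r} → ∣ x ∣ ≤ r → x ≤ r
 abs≤ {x} h = ≤-trans (p≤∣p∣ x) h

 -abs≤ : ∀ {x r} → ∣ x ∣ ≤ r → - x ≤ r
 -abs≤ {x} h = ≤-trans (p≤∣p∣ (- x)) (≡≤ (∣-p∣≡∣p∣ x) h)

 close : ∀ {a b r} → a ≤ b + r → b ≤ a + r → ∣ a - b ∣ ≤ r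
 close {a} {b} {r} h₁ h₂ = ∣∣≤ (by _ (sub≥0 h₁) (e₁ a b r)) (by _ (sub≥0 h₂) (e₂ a b r))
  where
  e₁ = solve 3 (λ a b r → a :- b :+ (b :+ r :- a) := r) refl
  e₂ = solve 3 (λ a b r → :- (a :- b) :+ (a :+ r :- b) := r) refl

 close⁻ˡ : ∀ {a b r} → ∣ a - b ∣ ≤ r → a ≤ b + r
 close⁻ˡ {a} {b} {r} h = by _ (sub≥0 (abs≤ h)) (e a b r)
  where
  e = solve 3 (λ a b r → a :+ (r :- (a :- b)) := b :+ r) refl

 close⁻ʳ : ∀ {a b r} → ∣ a - b ∣ ≤ r → b ≤ a + r
 close⁻ʳ {a} {b} {r} h = by _ (sub≥0 (-abs≤ h)) (e a b r)
  where
  e = solve 3 (λ a b r → b :+ (r :- :- (a :- b)) := a :+ r) refl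

 ∣*∣ : ∀ {a b r} → 0ℚ ≤ a → ∣ b ∣ ≤ r → ∣ a * b ∣ ≤ a * r
 ∣*∣ {a} {b} ha hb = ≡≤ (trans (∣p*q∣≡∣p∣*∣q∣ a b) (cong (_* ∣ b ∣) (0≤p⇒∣p∣≡p ha))) (*-monoˡ ha hb)

 ∣+∣ : ∀ {a b r s} → ∣ a ∣ ≤ r → ∣ b ∣ ≤ s → ∣ a + b ∣ ≤ r + s
 ∣+∣ {a} {b} h₁ h₂ = ≤-trans (∣p+q∣≤∣p∣+∣q∣ a b) (+-mono-≤ h₁ h₂)

 ∣-∣ : ∀ {a b r s} → ∣ a ∣ ≤ r → ∣ b ∣ ≤ s → ∣ a - b ∣ ≤ r + s
 ∣-∣ {a} {b} h₁ h₂ = ∣+∣ h₁ (≡≤ (∣-p∣≡∣p∣ b) h₂)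

 ∣≥0∣ : ∀ {a r} → 0ℚ ≤ a → a ≤ r → ∣ a ∣ ≤ r
 ∣≥0∣ h h′ = ≡≤ (0≤p⇒∣p∣≡p h) h′

 *-cancel-≤ : ∀ {c a b} → 0ℚ < c → c * a ≤ c * b → a ≤ b
 *-cancel-≤ {c} h = *-cancelˡ-≤-pos c {{positive h}}

 reciprocal : ∀ x → 0ℚ < x → ∃ λ i → 0ℚ < i × x * i ≡ 1ℚ
 reciprocal x h = (1/ x) {{nz}} , positive⁻¹ _ {{1/pos⇒pos x {{positive h}}}} , *-inverseʳ x {{nz}}
  where
  nz = pos⇒nonZero x {{positive h}}

 0≤sq : ∀ x → 0ℚ ≤ x * x
 0≤sq x with ≤-total 0ℚ x
 ... | inj₁ h = 0≤* h h
 ... | inj₂ h = ≤≡ (0≤* { - x } { - x } (neg-antimono-≤ h) (neg-antimono-≤ h)) (r x)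
  where
  r = solve 1 (λ x → :- x :* :- x := x :* x) refl

 pow : ℚ → ℕ → ℚ
 pow x zero = 1ℚ
 pow x (suc n) = x * pow x n

 0≤pow : ∀ {x} → 0ℚ ≤ x → ∀ n → 0ℚ ≤ pow x n
 0≤pow h zero = 0≤1
 0≤pow h (suc n) = 0≤* h (0≤pow h n)

 0<pow : ∀ {x} → 0ℚ < x → ∀ n → 0ℚ < pow x n
 0<pow h zero = positive⁻¹ 1ℚ
 0<pow h (suc n) = 0<* h (0<pow h n)

 pow≤1 : ∀ {x} → 0ℚ ≤ x → x ≤ 1ℚ → ∀ n → pow x n ≤ 1ℚ
 pow≤1 h h′ zero = ≤-refl
 pow≤1 {x} h h′ (suc n) = ≤≡ (*-mono {x} {1ℚ} 0≤1 (0≤pow h n) h′ (pow≤1 h h′ n)) (*-identityˡ 1ℚ)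

 pow-+ : ∀ x m n → pow x (m ℕ.+ n) ≡ pow x m * pow x n
 pow-+ x zero n = sym (*-identityˡ (pow x n))
 pow-+ x (suc m) n = trans (cong (x *_) (pow-+ x m n)) (sym (*-assoc x (pow x m) (pow x n)))

 pow-*-distrib : ∀ x y n → pow (x * y) n ≡ pow x n * pow y n
 pow-*-distrib x y zero = sym (*-identityˡ 1ℚ)
 pow-*-distrib x y (suc n) = trans (cong (x * y *_) (pow-*-distrib x y n)) (r x y (pow x n) (pow y n))
  where
  r = solve 4 (λ x y a b → x :* y :* (a :* b) := x :* a :* (y :* b)) refl

 pow-mono : ∀ {x y} → 0ℚ ≤ x → x ≤ y → ∀ n → pow x n ≤ pow y n
 pow-mono h h′ zero = ≤-refl
 pow-mono {x} {y} h h′ (suc n) = *-mono {x} {y} (≤-trans h h′) (0≤pow h n) h′ (pow-mono h h′ n)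

 ⌜⌝-pow : ∀ w n → ⌜ w ℕ.^ n ⌝ ≡ pow ⌜ w ⌝ n
 ⌜⌝-pow w zero = refl
 ⌜⌝-pow w (suc n) = trans (⌜*⌝ w (w ℕ.^ n)) (cong (⌜ w ⌝ *_) (⌜⌝-pow w n))

 module _ {θ y : ℚ} (0≤θ : 0ℚ ≤ θ) (yθ : y * (1ℚ + θ) ≡ 1ℚ) (0≤y : 0ℚ ≤ y) where
  y≤1 : y ≤ 1ℚ
  y≤1 = by (y * θ) (0≤* 0≤y 0≤θ) (trans (r y θ) yθ)
   where
   r = solve 2 (λ y θ → y :+ y :* θ := y :* (:1 :+ θ)) refl

  pow-lower : ∀ n → 1ℚ - ⌜ n ⌝ * θ ≤ pow y n
  pow-lower zero = ≤-reflexive (r θ)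
   where
   r = solve 1 (λ θ → :1 :- :0 :* θ := :1) refl
  pow-lower (suc n) = by (y * (pow y n - (1ℚ - ⌜ n ⌝ * θ)) + (1ℚ - y) * (θ + ⌜ n ⌝ * θ))
    (0≤+ (0≤* 0≤y (sub≥0 (pow-lower n))) (0≤* (sub≥0 y≤1) (0≤+ 0≤θ (0≤* (0≤⌜⌝ n) 0≤θ))))
    (trans (cong (λ m → 1ℚ - m * θ + (y * (pow y n - (1ℚ - ⌜ n ⌝ * θ)) + (1ℚ - y) * (θ + ⌜ n ⌝ * θ))) (⌜suc⌝ n))
     (trans (r y θ ⌜ n ⌝ (pow y n)) (trans (cong (λ z → 1ℚ + y * pow y n - z) yθ) (r₂ (y * pow y n)))))
   where
   r = solve 4 (λ y θ m p → :1 :- (:1 :+ m) :* θ :+ (y :* (p :- (:1 :- m :* θ)) :+ (:1 :- y) :* (θ :+ m :* θ)) := :1 :+ y :* p :- y :* (:1 :+ θ)) refl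
   r₂ = solve 1 (λ x → :1 :+ x :- :1 := x) refl

  pow-upper : ∀ n → pow y n * (1ℚ + ⌜ n ⌝ * θ) ≤ 1ℚ
  pow-upper zero = ≤-reflexive (r θ)
   where
   r = solve 1 (λ θ → :1 :* (:1 :+ :0 :* θ) := :1) refl
  pow-upper (suc n) = ≤-trans (by (y * pow y n * (⌜ n ⌝ * θ * θ)) (0≤* (0≤* 0≤y (0≤pow 0≤y n)) (0≤* (0≤* (0≤⌜⌝ n) 0≤θ) 0≤θ))
    (trans (cong (λ m → y * pow y n * (1ℚ + m * θ) + y * pow y n * (⌜ n ⌝ * θ * θ)) (⌜suc⌝ n))
     (trans (r y θ ⌜ n ⌝ (pow y n)) (trans (cong (_* (pow y n * (1ℚ + ⌜ n ⌝ * θ))) yθ) (*-identityˡ _))))) (pow-upper n)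
   where
   r = solve 4 (λ y θ m p → y :* p :* (:1 :+ (:1 :+ m) :* θ) :+ y :* p :* (m :* θ :* θ) := y :* (:1 :+ θ) :* (p :* (:1 :+ m :* θ))) refl

 ∑-cong< : ∀ k {f g : ℕ → ℚ} → (∀ i → i ℕ.< k → f i ≡ g i) → ∑< k f ≡ ∑< k g
 ∑-cong< zero h = refl
 ∑-cong< (suc k) h = cong₂ _+_ (∑-cong< k λ i i<k → h i (ℕ.m≤n⇒m≤1+n i<k)) (h k ℕ.≤-refl)

 ∑-cong : ∀ k {f g : ℕ → ℚ} → (∀ i → f i ≡ g i) → ∑< k f ≡ ∑< k g
 ∑-cong k h = ∑-cong< k λ i _ → h i

 ∑-mono< : ∀ k {f g : ℕ → ℚ} → (∀ i → i ℕ.< k → f i ≤ g i) → ∑< k f ≤ ∑< k g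
 ∑-mono< zero h = ≤-refl
 ∑-mono< (suc k) h = +-mono-≤ (∑-mono< k λ i i<k → h i (ℕ.m≤n⇒m≤1+n i<k)) (h k ℕ.≤-refl)

 ∑-mono : ∀ k {f g : ℕ → ℚ} → (∀ i → f i ≤ g i) → ∑< k f ≤ ∑< k g
 ∑-mono k h = ∑-mono< k λ i _ → h i

 0≤∑ : ∀ k {f : ℕ → ℚ} → (∀ i → 0ℚ ≤ f i) → 0ℚ ≤ ∑< k f
 0≤∑ zero h = ≤-refl
 0≤∑ (suc k) h = 0≤+ (0≤∑ k h) (h k)

 ∑-+ : ∀ k (f g : ℕ → ℚ) → ∑< k (λ i → f i + g i) ≡ ∑< k f + ∑< k g
 ∑-+ zero f g = sym (+-identityˡ 0ℚ)
 ∑-+ (suc k) f g = trans (cong (_+ (f k + g k)) (∑-+ k f g)) (r (∑< k f) (∑< k g) (f k) (g k))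
  where
  r = solve 4 (λ a b c d → a :+ b :+ (c :+ d) := a :+ c :+ (b :+ d)) refl

 ∑-* : ∀ k c (f : ℕ → ℚ) → ∑< k (λ i → c * f i) ≡ c * ∑< k f
 ∑-* zero c f = sym (*-zeroʳ c)
 ∑-* (suc k) c f = trans (cong (_+ c * f k) (∑-* k c f)) (sym (*-distribˡ-+ c (∑< k f) (f k)))

 ∑-head : ∀ k (f : ℕ → ℚ) → ∑< (suc k) f ≡ f 0 + ∑< k (f ∘ suc)
 ∑-head zero f = +-comm 0ℚ (f 0)
 ∑-head (suc k) f = trans (cong (_+ f (suc k)) (∑-head k f)) (+-assoc (f 0) (∑< k (f ∘ suc)) (f (suc k)))

 ∑-append : ∀ m n (f : ℕ → ℚ) → ∑< (m ℕ.+ n) f ≡ ∑< m f + ∑< n (λ r → f (m ℕ.+ r))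
 ∑-append m zero f = trans (cong (λ k → ∑< k f) (ℕ.+-identityʳ m)) (sym (+-identityʳ _))
 ∑-append m (suc n) f = trans (cong (λ k → ∑< k f) (ℕ.+-suc m n)) (trans (cong (_+ f (m ℕ.+ n)) (∑-append m n f)) (+-assoc (∑< m f) _ _))

 ∑-const : ∀ k c → ∑< k (λ _ → c) ≡ ⌜ k ⌝ * c
 ∑-const zero c = sym (*-zeroˡ c)
 ∑-const (suc k) c = trans (cong (_+ c) (∑-const k c)) (trans (r ⌜ k ⌝ c) (cong (_* c) (sym (⌜suc⌝ k))))
  where
  r = solve 2 (λ k c → k :* c :+ c := (:1 :+ k) :* c) refl

 ∑-abs : ∀ k (f : ℕ → ℚ) → ∣ ∑< k f ∣ ≤ ∑< k (λ i → ∣ f i ∣)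
 ∑-abs zero f = ≤-refl
 ∑-abs (suc k) f = ≤-trans (∣p+q∣≤∣p∣+∣q∣ (∑< k f) (f k)) (+-monoˡ-≤ ∣ f k ∣ (∑-abs k f))

 ⌜⌝-reflect : ∀ {k m} → ⌜ k ⌝ ≤ ⌜ m ⌝ → k ℕ.≤ m
 ⌜⌝-reflect {k} {m} h = ℕ.≮⇒≥ λ lt → <-irrefl refl (<-≤-trans (subst₂ _<_ (+-identityˡ ⌜ m ⌝) (sym (⌜suc⌝ m)) (+-monoˡ-< ⌜ m ⌝ (positive⁻¹ 1ℚ))) (≤-trans (⌜⌝-mono lt) h))

-- Local growth of p from the discrete equation U″ ≈ θ² U

module LocalGrowth where
 open QSeries using (P; P-increasing)
 open PartialSums using (S; U)
 open Rationals
 open import Data.Rational.Properties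

 p̂ Ŝ Û : ℕ → ℚ
 p̂ n = ⌜ P n ⌝
 Ŝ n = ⌜ S n ⌝
 Û n = ⌜ U n ⌝

 0≤p̂ : ∀ n → 0ℚ ≤ p̂ n
 0≤p̂ n = 0≤⌜⌝ (P n)

 0≤Ŝ : ∀ n → 0ℚ ≤ Ŝ n
 0≤Ŝ n = 0≤⌜⌝ (S n)

 0≤Û : ∀ n → 0ℚ ≤ Û n
 0≤Û n = 0≤⌜⌝ (U n)

 Ŝ-suc : ∀ n → Ŝ (suc n) ≡ Ŝ n + p̂ (suc n)
 Ŝ-suc n = ⌜+⌝ (S n) (P (suc n))

 Û-suc : ∀ n → Û (suc n) ≡ Û n + Ŝ n
 Û-suc n = ⌜+⌝ (U n) (S n)

 p̂-step : ∀ n → p̂ n ≤ p̂ (suc n)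
 p̂-step n = ⌜⌝-mono (P-increasing n)

 p̂-mono : ∀ d n → p̂ n ≤ p̂ (d ℕ.+ n)
 p̂-mono zero n = ≤-refl
 p̂-mono (suc d) n = ≤-trans (p̂-mono d n) (p̂-step (d ℕ.+ n))

 -- Equality up to a factor between 1 - κ and 1 / (1 - κ)
 record Near (κ x z : ℚ) : Set where
  constructor _&_
  field
   near-≥ : (1ℚ - κ) * z ≤ x
   near-≤ : (1ℚ - κ) * x ≤ z
 open Near public

 near-sym : ∀ {κ x z} → Near κ x z → Near κ z x
 near-sym (a & b) = b & a

 private
  neg-scale : ∀ {κ z x} → 1ℚ ≤ κ → 0ℚ ≤ z → 0ℚ ≤ x → (1ℚ - κ) * z ≤ x
  neg-scale {κ} {z} h hz hx = ≤-trans (by ((κ - 1ℚ) * z) (0≤* (sub≥0 h) hz) (r κ z)) hx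
   where
   r = solve 2 (λ κ z → (:1 :- κ) :* z :+ (κ :- :1) :* z := :0) refl

 near-refl : ∀ {κ x} → 0ℚ ≤ κ → 0ℚ ≤ x → Near κ x x
 near-refl {κ} {x} h hx = le & le
  where
  r = solve 2 (λ κ x → (:1 :- κ) :* x :+ κ :* x := x) refl
  le = by (κ * x) (0≤* h hx) (r κ x)

 near-weaken : ∀ {κ μ x z} → κ ≤ μ → 0ℚ ≤ x → 0ℚ ≤ z → Near κ x z → Near μ x z
 near-weaken {κ} {μ} h hx hz (a & b) = ≤-trans (le hz) a & ≤-trans (le hx) b
  where
  r = solve 3 (λ κ μ z → (:1 :- μ) :* z :+ (μ :- κ) :* z := (:1 :- κ) :* z) refl
  le : ∀ {z} → 0ℚ ≤ z → (1ℚ - μ) * z ≤ (1ℚ - κ) * z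
  le {z} hz = by ((μ - κ) * z) (0≤* (sub≥0 h) hz) (r κ μ z)

 -- For κ > 1 the first inequality cannot be multiplied through, but then the left side of the claim
 -- is nonpositive.
 trans-≤ : ∀ {κ μ x y z} → 0ℚ ≤ κ → 0ℚ ≤ μ → 0ℚ ≤ z → 0ℚ ≤ x → (1ℚ - κ) * y ≤ x → (1ℚ - μ) * z ≤ y → (1ℚ - (κ + μ)) * z ≤ x
 trans-≤ {κ} {μ} {x} {y} {z} hκ hμ hz hx a c with ≤-total κ 1ℚ
 ... | inj₁ le = ≤-trans (by (κ * μ * z) (0≤* (0≤* hκ hμ) hz) (r κ μ z)) (≤-trans (*-monoˡ (sub≥0 le) c) a)
  where
  r = solve 3 (λ κ μ z → (:1 :- (κ :+ μ)) :* z :+ κ :* μ :* z := (:1 :- κ) :* ((:1 :- μ) :* z)) refl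
 ... | inj₂ ge = neg-scale (≤-trans ge (p≤p+q κ hμ)) hz hx

 near-trans : ∀ {κ μ x y z} → 0ℚ ≤ κ → 0ℚ ≤ μ → 0ℚ ≤ x → 0ℚ ≤ z → Near κ x y → Near μ y z → Near (κ + μ) x z
 near-trans {κ} {μ} {x} {y} {z} hκ hμ hx hz (a & b) (c & d) = trans-≤ hκ hμ hz hx a c &
   ≡≤ (cong (λ t → (1ℚ - t) * x) (+-comm κ μ)) (trans-≤ hμ hκ hx hz d b)

 near-* : ∀ {κ μ x y u v} → 0ℚ ≤ κ → 0ℚ ≤ μ → 0ℚ ≤ x → 0ℚ ≤ y → 0ℚ ≤ u → 0ℚ ≤ v → Near κ x y → Near μ u v → Near (κ + μ) (x * u) (y * v)
 near-* {κ} {μ} {x} {y} {u} {v} hκ hμ hx hy hu hv (a & b) (c & d) =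
   near-trans hκ hμ (0≤* hx hu) (0≤* hy hv)
    (≡≤ (sym (*-assoc (1ℚ - κ) y u)) (*-monoʳ hu a) & ≡≤ (sym (*-assoc (1ℚ - κ) x u)) (*-monoʳ hu b))
    (≡≤ (r (1ℚ - μ) y v) (*-monoˡ hy c) & ≡≤ (r (1ℚ - μ) y u) (*-monoˡ hy d))
  where
  r = solve 3 (λ k y v → k :* (y :* v) := y :* (k :* v)) refl

 near-scale : ∀ {k c x u} → 0ℚ ≤ c → 0ℚ ≤ k → 0ℚ ≤ x → 0ℚ ≤ u → Near k x u → Near k (c * x) (c * u)
 near-scale {k} {c} {x} {u} hc hk hx hu h = subst (λ k → Near k (c * x) (c * u)) (+-identityˡ k) (near-* ≤-refl hk hc hc hx hu (near-refl ≤-refl hc) h)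

 near-cancel : ∀ {κ c x y} → 0ℚ < c → Near κ (c * x) (c * y) → Near κ x y
 near-cancel {κ} {c} {x} {y} hc (a & b) = *-cancel-≤ hc (≡≤ (r c (1ℚ - κ) y) a) & *-cancel-≤ hc (≡≤ (r c (1ℚ - κ) x) b)
  where
  r = solve 3 (λ c k y → c :* (k :* y) := k :* (c :* y)) refl

 -- No root is extracted: x < (1-κ) y would give x² < (1-κ)² y² ≤ (1-κ) y².
 near-√ : ∀ {κ x y} → 0ℚ ≤ κ → 0ℚ ≤ x → 0ℚ ≤ y → Near κ (x * x) (y * y) → Near κ x y
 near-√ {κ} hκ hx hy (a & b) = half hx hy a & half hy hx b
  where
  half : ∀ {x y} → 0ℚ ≤ x → 0ℚ ≤ y → (1ℚ - κ) * (y * y) ≤ x * x → (1ℚ - κ) * y ≤ x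
  half {x} {y} hx hy h with ≤-total κ 1ℚ
  ... | inj₂ ge = neg-scale ge hy hx
  ... | inj₁ le = ≮⇒≥ λ lt → <-irrefl refl (<-≤-trans (strict lt) (≤-trans le₂ h))
   where
   m = (1ℚ - κ) * y
   0≤m : 0ℚ ≤ m
   0≤m = 0≤* (sub≥0 le) hy
   strict : x < m → x * x < m * m
   strict lt = ≤-<-trans (*-monoˡ hx (<⇒≤ lt)) (*-monoˡ-<-pos m {{positive (≤-<-trans hx lt)}} lt)
   r = solve 2 (λ κ y → (:1 :- κ) :* y :* ((:1 :- κ) :* y) :+ κ :* ((:1 :- κ) :* (y :* y)) := (:1 :- κ) :* (y :* y)) refl
   le₂ : m * m ≤ (1ℚ - κ) * (y * y)
   le₂ = by (κ * ((1ℚ - κ) * (y * y))) (0≤* hκ (0≤* (sub≥0 le) (0≤sq y))) (r κ y)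

 -- An error relative to x alone yields both halves because (1-κ)(1+κ) ≤ 1.
 near-abs : ∀ {κ x z} → 0ℚ ≤ κ → 0ℚ ≤ x → 0ℚ ≤ z → ∣ x - z ∣ ≤ κ * x → Near κ x z
 near-abs {κ} {x} {z} hκ hx hz h = second & by _ (sub≥0 (close⁻ˡ {x} {z} h)) (r₁ κ x z)
  where
  r₁ = solve 3 (λ κ x z → (:1 :- κ) :* x :+ (z :+ κ :* x :- x) := z) refl
  r₂ = solve 2 (λ κ x → (:1 :- κ) :* (x :+ κ :* x) :+ κ :* κ :* x := x) refl
  second : (1ℚ - κ) * z ≤ x
  second with ≤-total κ 1ℚ
  ... | inj₂ ge = neg-scale ge hz hx
  ... | inj₁ le = ≤-trans (*-monoˡ (sub≥0 le) (close⁻ʳ {x} {z} h)) (by (κ * κ * x) (0≤* (0≤* hκ hκ) hx) (r₂ κ x))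

 -- The discrete analogue of U″ = θ² U on a window, θ being frozen.
 module Window {θ y ε σ : ℚ} (0≤θ : 0ℚ ≤ θ) (θ≤1 : θ ≤ 1ℚ) (yθ : y * (1ℚ + θ) ≡ 1ℚ) (0≤y : 0ℚ ≤ y) (0≤ε : 0ℚ ≤ ε) (0≤σ : 0ℚ ≤ σ)
  (lo hi : ℕ) (near : ∀ n → lo ℕ.≤ n → n ℕ.≤ hi → ∣ p̂ n - θ * θ * Û n ∣ ≤ ε * p̂ n)
  (S≤ : ∀ n → lo ℕ.≤ n → n ℕ.≤ hi → Ŝ n ≤ σ * p̂ n) where

  -- U′ - θU kills the growing solution of U″ = θ²U. Once it is small, U grows by the factor 1 + θ
  -- at each step.
  drift : ℕ → ℚ
  drift n = Ŝ n - θ * Û n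

  drift-rec : ∀ n → drift (suc n) ≡ (1ℚ - θ) * drift n + (θ * θ * Ŝ n + (p̂ (suc n) - θ * θ * Û (suc n)))
  drift-rec n = trans (cong₂ (λ a b → a - θ * b) (Ŝ-suc n) (Û-suc n))
   (trans (r (Ŝ n) (Û n) (p̂ (suc n)) θ) (cong (λ b → (1ℚ - θ) * drift n + (θ * θ * Ŝ n + (p̂ (suc n) - θ * θ * b))) (sym (Û-suc n))))
   where
   r = solve 4 (λ s u q θ → s :+ q :- θ :* (u :+ s) := (:1 :- θ) :* (s :- θ :* u) :+ (θ :* θ :* s :+ (q :- θ :* θ :* (u :+ s)))) refl

  0≤θθ : 0ℚ ≤ θ * θ
  0≤θθ = 0≤* 0≤θ 0≤θ

  η : ℚ
  η = ε + θ * θ * σ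

  0≤η : 0ℚ ≤ η
  0≤η = 0≤+ 0≤ε (0≤* 0≤θθ 0≤σ)

  -- The forcing term is at most η p, and p telescopes to S.
  drift-growth : ∀ k m → lo ℕ.≤ m → k ℕ.+ m ℕ.≤ hi → ∣ drift (k ℕ.+ m) ∣ ≤ ∣ drift m ∣ + η * (Ŝ (k ℕ.+ m) - Ŝ m)
  drift-growth zero m lo≤m _ = ≤-reflexive (r ∣ drift m ∣ η (Ŝ m))
   where
   r = solve 3 (λ a η s → a := a :+ η :* (s :- s)) refl
  drift-growth (suc k) m lo≤m n<hi = begin
   ∣ drift (suc n) ∣ ≡⟨ cong ∣_∣ (drift-rec n) ⟩
   ∣ (1ℚ - θ) * drift n + (θ * θ * Ŝ n + (p̂ (suc n) - θ * θ * Û (suc n))) ∣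
    ≤⟨ ∣+∣ {(1ℚ - θ) * drift n} (∣*∣ {1ℚ - θ} (sub≥0 θ≤1) ≤-refl) (∣+∣ {θ * θ * Ŝ n} (∣≥0∣ (0≤* 0≤θθ (0≤Ŝ n)) step₁) (near (suc n) lo≤n hi≥n)) ⟩
   (1ℚ - θ) * ∣ drift n ∣ + (θ * θ * (σ * p̂ (suc n)) + ε * p̂ (suc n))
    ≤⟨ by (θ * ∣ drift n ∣ + (∣ drift m ∣ + η * (Ŝ n - Ŝ m) - ∣ drift n ∣)) (0≤+ (0≤* 0≤θ (0≤∣p∣ (drift n))) (sub≥0 (drift-growth k m lo≤m (ℕ.<⇒≤ n<hi))))
       (r ∣ drift n ∣ ∣ drift m ∣ (Ŝ n) (Ŝ m) (p̂ (suc n)) θ ε σ) ⟩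
   ∣ drift m ∣ + η * (Ŝ n + p̂ (suc n) - Ŝ m)
    ≡⟨ cong (λ s → ∣ drift m ∣ + η * (s - Ŝ m)) (sym (Ŝ-suc n)) ⟩
   ∣ drift m ∣ + η * (Ŝ (suc n) - Ŝ m) ∎
   where
   open ≤-Reasoning
   n = k ℕ.+ m
   lo≤n : lo ℕ.≤ suc n
   lo≤n = ℕ.≤-trans lo≤m (ℕ.m≤n⇒m≤1+n (ℕ.m≤n+m m k))
   hi≥n : suc n ℕ.≤ hi
   hi≥n = n<hi
   step₁ : θ * θ * Ŝ n ≤ θ * θ * (σ * p̂ (suc n))
   step₁ = *-monoˡ 0≤θθ (≤-trans (p≤p+q (Ŝ n) (0≤p̂ (suc n))) (≡≤ (sym (Ŝ-suc n)) (S≤ (suc n) lo≤n hi≥n)))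
   r = solve 8 (λ e e₀ s s₀ q θ ε σ → (:1 :- θ) :* e :+ (θ :* θ :* (σ :* q) :+ ε :* q) :+ (θ :* e :+ (e₀ :+ (ε :+ θ :* θ :* σ) :* (s :- s₀) :- e)) := e₀ :+ (ε :+ θ :* θ :* σ) :* (s :+ q :- s₀)) refl

  module Gap (u δ : ℚ) (0≤u : 0ℚ ≤ u) (0≤δ : 0ℚ ≤ δ) (gap : ℕ)
   (U≤ : ∀ n → lo ℕ.≤ n → n ℕ.≤ hi → Û n ≤ u * p̂ n)
   (decay : ∀ m → lo ℕ.≤ m → gap ℕ.+ m ℕ.≤ hi → p̂ m ≤ δ * p̂ (gap ℕ.+ m)) where

   -- The first term is the drift inherited from a distance `gap` below, where p is smaller by δ;
   -- the second is the forcing accumulated since.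
   γ : ℚ
   γ = (σ + θ * u) * δ + η * σ

   0≤γ : 0ℚ ≤ γ
   0≤γ = 0≤+ (0≤* (0≤+ 0≤σ (0≤* 0≤θ 0≤u)) 0≤δ) (0≤* 0≤η 0≤σ)

   drift-bound′ : ∀ m → lo ℕ.≤ m → gap ℕ.+ m ℕ.≤ hi → ∣ drift (gap ℕ.+ m) ∣ ≤ γ * p̂ (gap ℕ.+ m)
   drift-bound′ m lo≤m n≤hi = begin
    ∣ drift n ∣ ≤⟨ drift-growth gap m lo≤m n≤hi ⟩
    ∣ drift m ∣ + η * (Ŝ n - Ŝ m) ≤⟨ +-mono-≤ (∣-∣ {Ŝ m} (∣≥0∣ (0≤Ŝ m) (S≤ m lo≤m m≤hi)) (∣≥0∣ (0≤* 0≤θ (0≤Û m)) (*-monoˡ 0≤θ (U≤ m lo≤m m≤hi))))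
                           (*-monoˡ 0≤η (≤-trans (sub-≤ (0≤Ŝ m)) (S≤ n (ℕ.≤-trans lo≤m (ℕ.m≤n+m m gap)) n≤hi))) ⟩
    σ * p̂ m + θ * (u * p̂ m) + η * (σ * p̂ n) ≡⟨ r (p̂ m) (p̂ n) σ θ u η ⟩
    (σ + θ * u) * p̂ m + η * σ * p̂ n ≤⟨ +-monoˡ-≤ (η * σ * p̂ n) (*-monoˡ (0≤+ 0≤σ (0≤* 0≤θ 0≤u)) (decay m lo≤m n≤hi)) ⟩
    (σ + θ * u) * (δ * p̂ n) + η * σ * p̂ n ≡⟨ r₂ (p̂ n) (σ + θ * u) δ (η * σ) ⟩
    γ * p̂ n ∎
    where
    open ≤-Reasoning
    n = gap ℕ.+ m
    m≤hi : m ℕ.≤ hi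
    m≤hi = ℕ.≤-trans (ℕ.m≤n+m m gap) n≤hi
    r = solve 6 (λ a b σ θ u η → σ :* a :+ θ :* (u :* a) :+ η :* (σ :* b) := (σ :+ θ :* u) :* a :+ η :* σ :* b) refl
    r₂ = solve 4 (λ b x δ z → x :* (δ :* b) :+ z :* b := (x :* δ :+ z) :* b) refl

   lo′ : ℕ
   lo′ = gap ℕ.+ lo

   drift-bound : ∀ n → lo′ ℕ.≤ n → n ℕ.≤ hi → ∣ drift n ∣ ≤ γ * p̂ n
   drift-bound n lo≤n n≤hi = subst (λ k → ∣ drift k ∣ ≤ γ * p̂ k) e
     (drift-bound′ (n ℕ.∸ gap) (ℕ≡≤ (sym (ℕ.m+n∸m≡n gap lo)) (ℕ.∸-monoˡ-≤ gap lo≤n)) (subst (ℕ._≤ hi) (sym e) n≤hi))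
    where
    e : gap ℕ.+ (n ℕ.∸ gap) ≡ n
    e = ℕ.m+[n∸m]≡n (ℕ.≤-trans (ℕ.m≤m+n gap lo) lo≤n)

   -- Since y (1+θ) = 1, the difference is exactly -y times the drift.
   U-step : ∀ n → lo′ ℕ.≤ n → n ℕ.≤ hi → ∣ Û n - y * Û (suc n) ∣ ≤ γ * p̂ n
   U-step n lo≤n n≤hi = begin
    ∣ Û n - y * Û (suc n) ∣ ≡⟨ cong ∣_∣ (trans (cong (λ b → Û n - y * b) (Û-suc n)) (trans (r₁ (Û n) (Ŝ n) y θ)
                    (trans (cong (λ z → (1ℚ - z) * Û n - y * drift n) yθ) (r₂ (Û n) (y * drift n))))) ⟩
    ∣ - (y * drift n) ∣ ≡⟨ ∣-p∣≡∣p∣ (y * drift n) ⟩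
    ∣ y * drift n ∣ ≤⟨ ∣*∣ 0≤y (drift-bound n lo≤n n≤hi) ⟩
    y * (γ * p̂ n) ≤⟨ *-monoʳ (0≤* 0≤γ (0≤p̂ n)) (y≤1 0≤θ yθ 0≤y) ⟩
    1ℚ * (γ * p̂ n) ≡⟨ *-identityˡ _ ⟩
    γ * p̂ n ∎
    where
    open ≤-Reasoning
    r₁ = solve 4 (λ u s y θ → u :- y :* (u :+ s) := (:1 :- y :* (:1 :+ θ)) :* u :- y :* (s :- θ :* u)) refl
    r₂ = solve 2 (λ u z → (:1 :- :1) :* u :- z := :- z) refl

   U-ratio : ∀ d n → lo′ ℕ.≤ n → d ℕ.+ n ℕ.≤ hi → ∣ Û n - pow y d * Û (d ℕ.+ n) ∣ ≤ γ * (Ŝ (d ℕ.+ n) - Ŝ n)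
   U-ratio zero n _ _ = ≤-reflexive (trans (cong ∣_∣ (r (Û n))) (r₂ γ (Ŝ n)))
    where
    r = solve 1 (λ u → u :- :1 :* u := :0) refl
    r₂ = solve 2 (λ g s → :0 := g :* (s :- s)) refl
   U-ratio (suc d) n lo≤n m<hi = begin
    ∣ Û n - y * pow y d * Û (suc m) ∣ ≡⟨ cong ∣_∣ (r (Û n) (Û m) (Û (suc m)) y (pow y d)) ⟩
    ∣ (Û n - pow y d * Û m) + pow y d * (Û m - y * Û (suc m)) ∣ ≤⟨ ∣+∣ {Û n - pow y d * Û m} (U-ratio d n lo≤n (ℕ.<⇒≤ m<hi))
                                          (∣*∣ (0≤pow 0≤y d) (U-step m (ℕ.≤-trans lo≤n (ℕ.m≤n+m n d)) (ℕ.<⇒≤ m<hi))) ⟩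
    γ * (Ŝ m - Ŝ n) + pow y d * (γ * p̂ m) ≤⟨ +-monoʳ-≤ (γ * (Ŝ m - Ŝ n)) (*-mono {pow y d} {1ℚ} 0≤1 (0≤* 0≤γ (0≤p̂ m)) (pow≤1 0≤y (y≤1 0≤θ yθ 0≤y) d) (*-monoˡ 0≤γ (p̂-step m))) ⟩
    γ * (Ŝ m - Ŝ n) + 1ℚ * (γ * p̂ (suc m)) ≡⟨ r₂ γ (Ŝ m) (Ŝ n) (p̂ (suc m)) ⟩
    γ * (Ŝ m + p̂ (suc m) - Ŝ n) ≡⟨ cong (λ s → γ * (s - Ŝ n)) (sym (Ŝ-suc m)) ⟩
    γ * (Ŝ (suc m) - Ŝ n) ∎
    where
    open ≤-Reasoning
    m = d ℕ.+ n
    r = solve 5 (λ a b c y q → a :- y :* q :* c := (a :- q :* b) :+ q :* (b :- y :* c)) refl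
    r₂ = solve 4 (λ g s s₀ q → g :* (s :- s₀) :+ :1 :* (g :* q) := g :* (s :+ q :- s₀)) refl

   κ : ℚ
   κ = ε + θ * θ * (γ * σ) + ε

   0≤κ : 0ℚ ≤ κ
   0≤κ = 0≤+ (0≤+ 0≤ε (0≤* 0≤θθ (0≤* 0≤γ 0≤σ))) 0≤ε

   -- p is exchanged for θ²U at both ends. The error is measured against p at the upper end, which
   -- is what the uniform formula uses.
   P-ratio : ∀ d n → lo′ ℕ.≤ n → d ℕ.+ n ℕ.≤ hi → ∣ p̂ n - pow y d * p̂ (d ℕ.+ n) ∣ ≤ κ * p̂ (d ℕ.+ n)
   P-ratio d n lo≤n m≤hi = begin
    ∣ p̂ n - z * p̂ m ∣
     ≡⟨ cong ∣_∣ (r (p̂ n) (p̂ m) (Û n) (Û m) θ z) ⟩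
    ∣ (p̂ n - θ * θ * Û n) + θ * θ * (Û n - z * Û m) - z * (p̂ m - θ * θ * Û m) ∣
     ≤⟨ ∣-∣ {(p̂ n - θ * θ * Û n) + θ * θ * (Û n - z * Û m)}
        (∣+∣ {p̂ n - θ * θ * Û n} (near n lo≤n₀ (ℕ.≤-trans (ℕ.m≤n+m n d) m≤hi)) (∣*∣ 0≤θθ (U-ratio d n lo≤n m≤hi)))
        (∣*∣ (0≤pow 0≤y d) (near m lo≤m m≤hi)) ⟩
    ε * p̂ n + θ * θ * (γ * (Ŝ m - Ŝ n)) + z * (ε * p̂ m)
     ≤⟨ +-mono-≤ (+-mono-≤ (*-monoˡ 0≤ε (p̂-mono d n)) (*-monoˡ 0≤θθ (*-monoˡ 0≤γ (≤-trans (sub-≤ (0≤Ŝ n)) (S≤ m lo≤m m≤hi)))))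
        (*-monoʳ (0≤* 0≤ε (0≤p̂ m)) (pow≤1 0≤y (y≤1 0≤θ yθ 0≤y) d)) ⟩
    ε * p̂ m + θ * θ * (γ * (σ * p̂ m)) + 1ℚ * (ε * p̂ m)
     ≡⟨ r₂ (p̂ m) ε θ γ σ ⟩
    κ * p̂ m ∎
    where
    open ≤-Reasoning
    m = d ℕ.+ n
    z = pow y d
    lo≤n₀ : lo ℕ.≤ n
    lo≤n₀ = ℕ.≤-trans (ℕ.m≤n+m lo gap) lo≤n
    lo≤m : lo ℕ.≤ m
    lo≤m = ℕ.≤-trans lo≤n₀ (ℕ.m≤n+m n d)
    r = solve 6 (λ a b u v θ z → a :- z :* b := (a :- θ :* θ :* u) :+ θ :* θ :* (u :- z :* v) :- z :* (b :- θ :* θ :* v)) refl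
    r₂ = solve 5 (λ q ε θ γ σ → ε :* q :+ θ :* θ :* (γ :* (σ :* q)) :+ :1 :* (ε :* q) := (ε :+ θ :* θ :* (γ :* σ) :+ ε) :* q) refl

   module _ (γ′ : ℚ) (0≤γ′ : 0ℚ ≤ γ′) (P≤U : ∀ n → lo ℕ.≤ n → n ℕ.≤ hi → γ * p̂ n ≤ γ′ * Û n) where
    U-near : ∀ d n → lo′ ℕ.≤ n → d ℕ.+ n ℕ.≤ hi → Near (⌜ d ⌝ * γ′) (Û n) (pow y d * Û (d ℕ.+ n))
    U-near zero n _ _ = subst₂ (λ k u → Near k (Û n) u) (sym (*-zeroˡ γ′)) (sym (*-identityˡ (Û n))) (near-refl ≤-refl (0≤Û n))
    U-near (suc d) n lo≤n m<hi = subst₂ (λ k u → Near k (Û n) u) (trans (r ⌜ d ⌝ γ′) (cong (_* γ′) (sym (⌜suc⌝ d)))) (r₂ (pow y d) y (Û (suc m)))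
     (near-trans (0≤* (0≤⌜⌝ d) 0≤γ′) 0≤γ′ (0≤Û n) (0≤* (0≤pow 0≤y d) (0≤* 0≤y (0≤Û (suc m))))
      (U-near d n lo≤n (ℕ.<⇒≤ m<hi))
      (near-scale (0≤pow 0≤y d) 0≤γ′ (0≤Û m) (0≤* 0≤y (0≤Û (suc m)))
        ((near-abs 0≤γ′ (0≤Û m) (0≤* 0≤y (0≤Û (suc m))) (≤-trans (U-step m lo≤m (ℕ.<⇒≤ m<hi)) (P≤U m (ℕ.≤-trans (ℕ.m≤n+m lo gap) lo≤m) (ℕ.<⇒≤ m<hi)))))))
     where
     m = d ℕ.+ n
     lo≤m : lo′ ℕ.≤ m
     lo≤m = ℕ.≤-trans lo≤n (ℕ.m≤n+m n d)
     r = solve 2 (λ d g → d :* g :+ g := (:1 :+ d) :* g) refl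
     r₂ = solve 3 (λ p y u → p :* (y :* u) := y :* p :* u) refl

    -- Here the errors of single steps are multiplied, not added, so the estimate stays relative
    -- even when y^d is far smaller than the error in `P-ratio`. The Gaussian law depends on this.
    P-near : ∀ d n → lo′ ℕ.≤ n → d ℕ.+ n ℕ.≤ hi → Near (ε + ⌜ d ⌝ * γ′ + ε) (p̂ n) (pow y d * p̂ (d ℕ.+ n))
    P-near d n lo≤n m≤hi = near-trans (0≤+ 0≤ε 0≤dγ) 0≤ε (0≤p̂ n) (0≤* 0≤z (0≤p̂ m))
     (near-trans 0≤ε 0≤dγ (0≤p̂ n) (0≤* 0≤θθ (0≤* 0≤z (0≤Û m)))
      (near-abs 0≤ε (0≤p̂ n) (0≤* 0≤θθ (0≤Û n)) (near n lo≤n₀ (ℕ.≤-trans (ℕ.m≤n+m n d) m≤hi)))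
      (near-scale 0≤θθ 0≤dγ (0≤Û n) (0≤* 0≤z (0≤Û m)) (U-near d n lo≤n m≤hi)))
     (subst (λ u → Near ε u (z * p̂ m)) (r z (θ * θ) (Û m))
      (near-scale 0≤z 0≤ε (0≤* 0≤θθ (0≤Û m)) (0≤p̂ m) (near-sym (near-abs 0≤ε (0≤p̂ m) (0≤* 0≤θθ (0≤Û m)) (near m lo≤m m≤hi)))))
     where
     m = d ℕ.+ n
     z = pow y d
     0≤z = 0≤pow 0≤y d
     0≤dγ : 0ℚ ≤ ⌜ d ⌝ * γ′
     0≤dγ = 0≤* (0≤⌜⌝ d) 0≤γ′
     lo≤n₀ : lo ℕ.≤ n
     lo≤n₀ = ℕ.≤-trans (ℕ.m≤n+m lo gap) lo≤n
     lo≤m : lo ℕ.≤ m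
     lo≤m = ℕ.≤-trans lo≤n₀ (ℕ.m≤n+m n d)
     r = solve 3 (λ z q u → z :* (q :* u) := q :* (z :* u)) refl

-- The divisor recurrence compared with ζ(2)

module ZetaSums where
 open QSeries using (P; Σ<)
 open PartialSums using (S; U; W; W-upper; W-lower; P-recurrence′; U≤nP)
 open Rationals
 open LocalGrowth
 open import Data.Integer.Base using (+_)
 open import Data.Rational.Properties
 open ≤-Reasoning

 inv : ℕ → ℚ
 inv j = + 1 / suc j

 0≤inv : ∀ j → 0ℚ ≤ inv j
 0≤inv j = <⇒≤ (0<inv j)

 inv≤1 : ∀ j → inv j ≤ 1ℚ
 inv≤1 j = inv-antitone {0} {j} ℕ.z≤n

 ζ Har : ℕ → ℚ
 ζ n = ∑< n (λ j → inv j * inv j)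
 Har n = ∑< n inv

 -- The right side is 1 / ((j+1)(j+2)), and its sums telescope.
 inv-diff : ∀ j → inv (suc j) * inv (suc j) ≤ inv j - inv (suc j)
 inv-diff j = go ⌜ suc j ⌝ (inv j) (inv (suc j)) (⌜*⌝-inv j) (trans (cong (_* inv (suc j)) (sym (⌜suc⌝ (suc j)))) (⌜*⌝-inv (suc j))) (0≤inv j) (0≤inv (suc j))
  where
  go : ∀ a x z → a * x ≡ 1ℚ → (1ℚ + a) * z ≡ 1ℚ → 0ℚ ≤ x → 0ℚ ≤ z → z * z ≤ x - z
  go a x z ax az 0≤x 0≤z = by (x * z * z) (0≤* (0≤* 0≤x 0≤z) 0≤z) (begin-equality
   z * z + x * z * z ≡⟨ cong (_+ x * z * z) (sym (*-identityˡ (z * z))) ⟩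
   1ℚ * (z * z) + x * z * z ≡⟨ cong (λ t → t * (z * z) + x * z * z) (sym ax) ⟩
   a * x * (z * z) + x * z * z ≡⟨ r₁ a x z ⟩
   x * z * ((1ℚ + a) * z) ≡⟨ cong (λ t → x * z * t) az ⟩
   x * z * 1ℚ ≡⟨ r₂ a x z ⟩
   x * ((1ℚ + a) * z) - z * (a * x) ≡⟨ cong₂ (λ s t → x * s - z * t) az ax ⟩
   x * 1ℚ - z * 1ℚ ≡⟨ cong₂ _-_ (*-identityʳ x) (*-identityʳ z) ⟩
   x - z ∎)
   where
   r₁ = solve 3 (λ a x z → a :* x :* (z :* z) :+ x :* z :* z := x :* z :* ((:1 :+ a) :* z)) refl
   r₂ = solve 3 (λ a x z → x :* z :* :1 := x :* ((:1 :+ a) :* z) :- z :* (a :* x)) refl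

 ζ-tail′ : ∀ k j → ζ (k ℕ.+ suc j) ≤ ζ (suc j) + (inv j - inv (k ℕ.+ j))
 ζ-tail′ zero j = ≤-reflexive (r (ζ (suc j)) (inv j))
  where
  r = solve 2 (λ z i → z := z :+ (i :- i)) refl
 ζ-tail′ (suc k) j = begin
  ζ (k ℕ.+ suc j) + inv (k ℕ.+ suc j) * inv (k ℕ.+ suc j) ≤⟨ +-mono-≤ (ζ-tail′ k j) (subst (λ i → inv i * inv i ≤ inv (k ℕ.+ j) - inv (suc (k ℕ.+ j))) (sym (ℕ.+-suc k j)) (inv-diff (k ℕ.+ j))) ⟩
  ζ (suc j) + (inv j - inv (k ℕ.+ j)) + (inv (k ℕ.+ j) - inv (suc (k ℕ.+ j))) ≡⟨ r (ζ (suc j)) (inv j) (inv (k ℕ.+ j)) (inv (suc (k ℕ.+ j))) ⟩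
  ζ (suc j) + (inv j - inv (suc (k ℕ.+ j))) ∎
  where
  r = solve 4 (λ z a b c → z :+ (a :- b) :+ (b :- c) := z :+ (a :- c)) refl

 ζ-mono : ∀ {m n} → m ℕ.≤ n → ζ m ≤ ζ n
 ζ-mono {m} {n} h = subst (λ k → ζ m ≤ ζ k) (ℕ.m∸n+n≡m h) (go (n ℕ.∸ m))
  where
  go : ∀ k → ζ m ≤ ζ (k ℕ.+ m)
  go zero = ≤-refl
  go (suc k) = ≤-trans (go k) (p≤p+q _ (0≤sq (inv (k ℕ.+ m))))

 ζ-tail : ∀ {j n} → suc j ℕ.≤ n → ζ n ≤ ζ (suc j) + inv j
 ζ-tail {j} {n} h = subst (λ k → ζ k ≤ ζ (suc j) + inv j) (ℕ.m∸n+n≡m h)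
  (≤-trans (ζ-tail′ (n ℕ.∸ suc j) j) (+-monoʳ-≤ (ζ (suc j)) (sub-≤ (0≤inv (n ℕ.∸ suc j ℕ.+ j)))))

 ζ-close : ∀ {j m n} → suc j ℕ.≤ m → suc j ℕ.≤ n → ∣ ζ m - ζ n ∣ ≤ inv j
 ζ-close {j} {m} {n} hm hn = close {ζ m} {ζ n} (≤-trans (ζ-tail hm) (+-monoˡ-≤ (inv j) (ζ-mono hn))) (≤-trans (ζ-tail hn) (+-monoˡ-≤ (inv j) (ζ-mono hm)))

 1≤ζ : ∀ {n} → 1 ℕ.≤ n → 1ℚ ≤ ζ n
 1≤ζ h = ζ-mono h

 ζ≤2 : ∀ n → ζ n ≤ 1ℚ + 1ℚ
 ζ≤2 zero = 0≤+ 0≤1 0≤1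
 ζ≤2 (suc n) = ζ-tail {0} {suc n} (ℕ.s≤s ℕ.z≤n)

 Har-mono : ∀ {m n} → m ℕ.≤ n → Har m ≤ Har n
 Har-mono {m} {n} h = subst (λ k → Har m ≤ Har k) (ℕ.m∸n+n≡m h) (go (n ℕ.∸ m))
  where
  go : ∀ k → Har m ≤ Har (k ℕ.+ m)
  go zero = ≤-refl
  go (suc k) = ≤-trans (go k) (p≤p+q _ (0≤inv (k ℕ.+ m)))

 Har-double : ∀ m → Har (m ℕ.+ m) ≤ Har m + 1ℚ
 Har-double m = ≡≤ (∑-append m m inv) (+-monoʳ-≤ (Har m)
  (≤-trans (∑-mono m λ r → inv-antitone (ℕ.m≤m+n m r)) (≡≤ (∑-const m (inv m))
   (≤≡ (*-monoʳ (0≤inv m) (⌜⌝-mono (ℕ.n≤1+n m))) (⌜*⌝-inv m)))))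

 -- Doubling the range adds at most 1 to the harmonic sum.
 Har-log : ∀ k {n} → n ℕ.≤ 2 ℕ.^ k → Har n ≤ 1ℚ + ⌜ k ⌝
 Har-log k h = ≤-trans (Har-mono h) (go k)
  where
  go : ∀ k → Har (2 ℕ.^ k) ≤ 1ℚ + ⌜ k ⌝
  go zero = ≤-refl
  go (suc k) = begin
   Har (2 ℕ.^ k ℕ.+ (2 ℕ.^ k ℕ.+ 0)) ≡⟨ cong (λ i → Har (2 ℕ.^ k ℕ.+ i)) (ℕ.+-identityʳ (2 ℕ.^ k)) ⟩
   Har (2 ℕ.^ k ℕ.+ 2 ℕ.^ k) ≤⟨ Har-double (2 ℕ.^ k) ⟩
   Har (2 ℕ.^ k) + 1ℚ ≤⟨ +-monoˡ-≤ 1ℚ (go k) ⟩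
   1ℚ + ⌜ k ⌝ + 1ℚ ≡⟨ trans (+-assoc 1ℚ ⌜ k ⌝ 1ℚ) (cong (λ z → 1ℚ + z) (trans (+-comm ⌜ k ⌝ 1ℚ) (sym (⌜suc⌝ k)))) ⟩
   1ℚ + ⌜ suc k ⌝ ∎

 ⌜Σ⌝ : ∀ k (f : ℕ → ℕ) → ⌜ Σ< k f ⌝ ≡ ∑< k (λ i → ⌜ f i ⌝)
 ⌜Σ⌝ zero f = refl
 ⌜Σ⌝ (suc k) f = trans (⌜+⌝ (Σ< k f) (f k)) (cong (_+ ⌜ f k ⌝) (⌜Σ⌝ k f))

 module _ (n : ℕ) where
  private
   Ŵ : ℕ → ℚ
   Ŵ b = ⌜ W n b ⌝

   upper : ∀ b → Ŵ b ≤ Û n * (inv b * inv b) + Ŝ n * inv b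
   upper b = go ⌜ suc b ⌝ (inv b) (⌜*⌝-inv b) (0≤inv b) (subst₂ _≤_
     (trans (⌜*⌝ (suc b ℕ.* suc b) (W n b)) (cong (_* Ŵ b) (⌜*⌝ (suc b) (suc b))))
     (trans (⌜+⌝ (U n) (suc b ℕ.* S n)) (cong (λ z → Û n + z) (⌜*⌝ (suc b) (S n)))) (⌜⌝-mono (W-upper n b)))
    where
    go : ∀ j v → j * v ≡ 1ℚ → 0ℚ ≤ v → j * j * Ŵ b ≤ Û n + j * Ŝ n → Ŵ b ≤ Û n * (v * v) + Ŝ n * v
    go j v jv 0≤v h = begin
     Ŵ b ≡⟨ sym (trans (cong₂ (λ x z → x * z * Ŵ b) jv jv) (trans (cong (_* Ŵ b) (*-identityˡ 1ℚ)) (*-identityˡ (Ŵ b)))) ⟩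
     j * v * (j * v) * Ŵ b ≡⟨ r₁ j v (Ŵ b) ⟩
     v * v * (j * j * Ŵ b) ≤⟨ *-monoˡ (0≤* 0≤v 0≤v) h ⟩
     v * v * (Û n + j * Ŝ n) ≡⟨ r₂ j v (Û n) (Ŝ n) ⟩
     Û n * (v * v) + Ŝ n * v * (j * v) ≡⟨ cong (λ x → Û n * (v * v) + Ŝ n * v * x) jv ⟩
     Û n * (v * v) + Ŝ n * v * 1ℚ ≡⟨ cong (λ z → Û n * (v * v) + z) (*-identityʳ (Ŝ n * v)) ⟩
     Û n * (v * v) + Ŝ n * v ∎
     where
     r₁ = solve 3 (λ j v q → j :* v :* (j :* v) :* q := v :* v :* (j :* j :* q)) refl
     r₂ = solve 4 (λ j v u s → v :* v :* (u :+ j :* s) := u :* (v :* v) :+ s :* v :* (j :* v)) refl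

   lower : ∀ b → Û n * (inv b * inv b) ≤ Ŵ b + (p̂ n + Ŝ n * inv b)
   lower b = go ⌜ suc b ⌝ (inv b) (⌜*⌝-inv b) (0≤inv b) (subst (Û n ≤_)
     (trans (⌜+⌝ (suc b ℕ.* suc b ℕ.* W n b) _) (cong₂ _+_
      (trans (⌜*⌝ (suc b ℕ.* suc b) (W n b)) (cong (_* Ŵ b) (⌜*⌝ (suc b) (suc b))))
      (trans (⌜+⌝ (suc b ℕ.* suc b ℕ.* P n) (suc b ℕ.* S n)) (cong₂ _+_ (trans (⌜*⌝ (suc b ℕ.* suc b) (P n)) (cong (_* p̂ n) (⌜*⌝ (suc b) (suc b)))) (⌜*⌝ (suc b) (S n))))))
     (⌜⌝-mono (W-lower n b)))
    where
    go : ∀ j v → j * v ≡ 1ℚ → 0ℚ ≤ v → Û n ≤ j * j * Ŵ b + (j * j * p̂ n + j * Ŝ n) → Û n * (v * v) ≤ Ŵ b + (p̂ n + Ŝ n * v)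
    go j v jv 0≤v h = begin
     Û n * (v * v) ≤⟨ *-monoʳ (0≤* 0≤v 0≤v) h ⟩
     (j * j * Ŵ b + (j * j * p̂ n + j * Ŝ n)) * (v * v) ≡⟨ r₂ j v (Ŵ b) (p̂ n) (Ŝ n) ⟩
     j * v * (j * v) * Ŵ b + (j * v * (j * v) * p̂ n + j * v * (Ŝ n * v)) ≡⟨ cong (λ x → x * x * Ŵ b + (x * x * p̂ n + x * (Ŝ n * v))) jv ⟩
     1ℚ * 1ℚ * Ŵ b + (1ℚ * 1ℚ * p̂ n + 1ℚ * (Ŝ n * v)) ≡⟨ r₃ (Ŵ b) (p̂ n) (Ŝ n * v) ⟩
     Ŵ b + (p̂ n + Ŝ n * v) ∎
     where
     r₂ = solve 5 (λ j v q p s → (j :* j :* q :+ (j :* j :* p :+ j :* s)) :* (v :* v) := j :* v :* (j :* v) :* q :+ (j :* v :* (j :* v) :* p :+ j :* v :* (s :* v))) refl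
     r₃ = solve 3 (λ a b c → :1 :* :1 :* a :+ (:1 :* :1 :* b :+ :1 :* c) := a :+ (b :+ c)) refl

   nP : ⌜ n ⌝ * p̂ n ≡ ∑< n Ŵ
   nP = trans (sym (⌜*⌝ n (P n))) (trans (cong ⌜_⌝ (P-recurrence′ n)) (⌜Σ⌝ n (W n)))

  nP≤ : ⌜ n ⌝ * p̂ n ≤ ζ n * Û n + Har n * Ŝ n
  nP≤ = begin
   ⌜ n ⌝ * p̂ n ≡⟨ nP ⟩
   ∑< n Ŵ ≤⟨ ∑-mono n upper ⟩
   ∑< n (λ b → Û n * (inv b * inv b) + Ŝ n * inv b) ≡⟨ trans (∑-+ n _ _) (cong₂ _+_ (trans (∑-* n (Û n) _) (*-comm (Û n) (ζ n))) (trans (∑-* n (Ŝ n) inv) (*-comm (Ŝ n) (Har n)))) ⟩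
   ζ n * Û n + Har n * Ŝ n ∎

  -- Each lower Riemann estimate loses a full p(n), so only the first J groups are used. Later J is
  -- about √n, which balances this loss against the tail of ζ.
  nP≥ : ∀ J → J ℕ.≤ n → ζ J * Û n ≤ ⌜ n ⌝ * p̂ n + (⌜ J ⌝ * p̂ n + Har n * Ŝ n)
  nP≥ J J≤n = begin
   ζ J * Û n ≡⟨ trans (*-comm (ζ J) (Û n)) (sym (∑-* J (Û n) _)) ⟩
   ∑< J (λ b → Û n * (inv b * inv b)) ≤⟨ ∑-mono J lower ⟩
   ∑< J (λ b → Ŵ b + (p̂ n + Ŝ n * inv b)) ≡⟨ trans (∑-+ J _ _) (cong (λ z → ∑< J Ŵ + z) (trans (∑-+ J _ _) (cong₂ _+_ (∑-const J (p̂ n)) (trans (∑-* J (Ŝ n) inv) (*-comm (Ŝ n) (Har J)))))) ⟩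
   ∑< J Ŵ + (⌜ J ⌝ * p̂ n + Har J * Ŝ n) ≤⟨ +-mono-≤ (≤≡ (part J≤n) (sym nP)) (+-monoʳ-≤ (⌜ J ⌝ * p̂ n) (*-monoʳ (0≤Ŝ n) (Har-mono J≤n))) ⟩
   ⌜ n ⌝ * p̂ n + (⌜ J ⌝ * p̂ n + Har n * Ŝ n) ∎
   where
   part : ∀ {m} → J ℕ.≤ m → ∑< J Ŵ ≤ ∑< m Ŵ
   part {m} h = subst (λ k → ∑< J Ŵ ≤ ∑< k Ŵ) (ℕ.m∸n+n≡m h) (go (m ℕ.∸ J))
    where
    go : ∀ k → ∑< J Ŵ ≤ ∑< (k ℕ.+ J) Ŵ
    go zero = ≤-refl
    go (suc k) = ≤-trans (go k) (p≤p+q _ (0≤⌜⌝ (W n (k ℕ.+ J))))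

  U≤np̂ : Û n ≤ ⌜ n ⌝ * p̂ n
  U≤np̂ = ≤≡ (⌜⌝-mono (U≤nP n)) (⌜*⌝ n (P n))

-- Explicit estimates on a window around N

module Scales where
 open QSeries using (P; sh-≥; t)
 open PartialSums using (S; U; KS≤; tP≤U)
 open Rationals
 open LocalGrowth
 open ZetaSums
 open import Data.Integer.Base using (+_)
 open import Data.Rational.Properties
 open ≤-Reasoning

 w² w⁴ w⁶ w⁸ : ℕ → ℕ
 w² w = w ℕ.* w
 w⁴ w = w² w ℕ.* w² w
 w⁶ w = w⁴ w ℕ.* w² w
 w⁸ w = w⁴ w ℕ.* w⁴ w

 2t+r : ∀ r → 2 ℕ.* t r ℕ.+ r ≡ r ℕ.* r
 2t+r zero = refl
 2t+r (suc r) = trans (e₁ (t r) r) (trans (cong (λ x → x ℕ.+ (1 ℕ.+ r ℕ.+ r)) (2t+r r)) (e₂ r))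
  where
  e₁ : ∀ x r → 2 ℕ.* (x ℕ.+ r) ℕ.+ suc r ≡ (2 ℕ.* x ℕ.+ r) ℕ.+ (1 ℕ.+ r ℕ.+ r)
  e₁ = ℕ-Ring.solve-∀
  e₂ : ∀ r → r ℕ.* r ℕ.+ (1 ℕ.+ r ℕ.+ r) ≡ suc r ℕ.* suc r
  e₂ = ℕ-Ring.solve-∀

 sq≤4t : ∀ r → 2 ℕ.≤ r → r ℕ.* r ℕ.≤ 4 ℕ.* t r
 sq≤4t (suc zero) (ℕ.s≤s ())
 sq≤4t (suc (suc r)) _ = ℕ≡≤ (sym (2t+r (suc (suc r)))) (ℕ.≤-trans
  (ℕ.+-monoʳ-≤ (2 ℕ.* t (suc (suc r))) (ℕ.≤-trans (ℕ≤≡ (ℕ.m≤m+n (suc (suc r)) r) (e₁ r)) (ℕ.*-monoʳ-≤ 2 (ℕ.m≤n+m (suc r) (t (suc r))))))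
  (ℕ.≤-reflexive (e₂ (t (suc (suc r))))))
  where
  e₁ : ∀ r → suc (suc r) ℕ.+ r ≡ 2 ℕ.* suc r
  e₁ = ℕ-Ring.solve-∀
  e₂ : ∀ x → 2 ℕ.* x ℕ.+ 2 ℕ.* x ≡ 4 ℕ.* x
  e₂ = ℕ-Ring.solve-∀

 sq-≤ : ∀ {a b} → 0ℚ ≤ a → 0ℚ ≤ b → a * a ≤ b * b → a ≤ b
 sq-≤ {a} {b} ha hb h = ≮⇒≥ λ lt → <-irrefl refl (<-≤-trans (≤-<-trans (*-monoˡ hb (<⇒≤ lt)) (*-monoˡ-<-pos a {{positive (≤-<-trans hb lt)}} lt)) h)

 -- w is about N^(1/8): p is controlled on windows of length w⁶ around N, up to relative errors O(1/w).
 record Setting : Set where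
  field
   w N : ℕ
   -- Large enough for the later error 9552 / w² to be below 1/4.
   200≤w : 200 ℕ.≤ w
   N≥ : w⁸ w ℕ.≤ N
   N≤ : N ℕ.≤ 2 ℕ.* w⁸ w
   θ y : ℚ
   0≤θ : 0ℚ ≤ θ
   yθ : y * (1ℚ + θ) ≡ 1ℚ
   0≤y : 0ℚ ≤ y
   -- θ plays the part of π/√(6N); of that number only this approximate square enters.
   θ-near : ∣ ⌜ N ⌝ * (θ * θ) - ζ N ∣ ≤ inv (ℕ.pred w) * inv (ℕ.pred w)

 module Scale (set : Setting) where
  open Setting set

  15≤w : 15 ℕ.≤ w
  15≤w = ℕ.≤-trans (ℕ.m≤m+n 15 185) 200≤w

  -- ω = w, o = w², X = w⁴, and ι, i, Y are their reciprocals. Thus X is of order √N, and θX, called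
  -- `T` below, lies between 1/2 and 2.
  ω ι o i X Y : ℚ
  ω = ⌜ w ⌝
  ι = inv (ℕ.pred w)
  o = ω * ω
  i = ι * ι
  X = o * o
  Y = i * i

  1≤w : 1 ℕ.≤ w
  1≤w = ℕ.≤-trans (ℕ.s≤s ℕ.z≤n) 15≤w

  ωι : ω * ι ≡ 1ℚ
  ωι = go w 1≤w
   where
   go : ∀ w → 1 ℕ.≤ w → ⌜ w ⌝ * inv (ℕ.pred w) ≡ 1ℚ
   go (suc w) _ = ⌜*⌝-inv w

  0≤ι : 0ℚ ≤ ι
  0≤ι = 0≤inv (ℕ.pred w)
  0≤ω : 0ℚ ≤ ω
  0≤ω = 0≤⌜⌝ w
  1≤ω : 1ℚ ≤ ω
  1≤ω = ⌜⌝-mono 1≤w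
  0≤o : 0ℚ ≤ o
  0≤o = 0≤* 0≤ω 0≤ω
  0≤i : 0ℚ ≤ i
  0≤i = 0≤* 0≤ι 0≤ι
  0≤X : 0ℚ ≤ X
  0≤X = 0≤* 0≤o 0≤o
  0≤Y : 0ℚ ≤ Y
  0≤Y = 0≤* 0≤i 0≤i

  oi : o * i ≡ 1ℚ
  oi = trans (r ω ι) (trans (cong₂ _*_ ωι ωι) (*-identityˡ 1ℚ))
   where
   r = solve 2 (λ a b → a :* a :* (b :* b) := a :* b :* (a :* b)) refl
  XY : X * Y ≡ 1ℚ
  XY = trans (r o i) (trans (cong₂ _*_ oi oi) (*-identityˡ 1ℚ))
   where
   r = solve 2 (λ a b → a :* a :* (b :* b) := a :* b :* (a :* b)) refl
  Xi : X * i ≡ o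
  Xi = trans (*-assoc o o i) (trans (cong (o *_) oi) (*-identityʳ o))
  oY : o * Y ≡ i
  oY = trans (sym (*-assoc o i i)) (trans (cong (_* i) oi) (*-identityˡ i))

  1≤o : 1ℚ ≤ o
  1≤o = ≡≤ (sym (*-identityˡ 1ℚ)) (*-mono 0≤ω 0≤1 1≤ω 1≤ω)
  ω≤o : ω ≤ o
  ω≤o = ≡≤ (sym (*-identityˡ ω)) (*-monoʳ 0≤ω 1≤ω)
  1≤X : 1ℚ ≤ X
  1≤X = ≡≤ (sym (*-identityˡ 1ℚ)) (*-mono 0≤o 0≤1 1≤o 1≤o)
  0<X : 0ℚ < X
  0<X = <-≤-trans (positive⁻¹ 1ℚ) 1≤X
  15≤ω : ⌜ 15 ⌝ ≤ ω
  15≤ω = ⌜⌝-mono 15≤w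
  ι≤ : ι * ⌜ 15 ⌝ ≤ 1ℚ
  ι≤ = ≤≡ (*-monoˡ 0≤ι 15≤ω) (trans (*-comm ι ω) ωι)
  i≤ : i * ⌜ 225 ⌝ ≤ 1ℚ
  i≤ = ≡≤ (r ι) (≤≡ (*-mono 0≤1 (0≤* 0≤ι (0≤⌜⌝ 15)) ι≤ ι≤) (*-identityˡ 1ℚ))
   where
   r = solve 1 (λ a → a :* a :* # 225 := a :* # 15 :* (a :* # 15)) refl
  i≤1 : i ≤ 1ℚ
  i≤1 = ≤-trans (by (i * ⌜ 224 ⌝) (0≤* 0≤i (0≤⌜⌝ 224)) (r i)) i≤
   where
   r = solve 1 (λ a → a :+ a :* # 224 := a :* # 225) refl

  cast² : ⌜ w² w ⌝ ≡ o
  cast² = ⌜*⌝ w w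
  cast⁴ : ⌜ w⁴ w ⌝ ≡ X
  cast⁴ = trans (⌜*⌝ (w² w) (w² w)) (cong₂ _*_ cast² cast²)
  cast⁶ : ⌜ w⁶ w ⌝ ≡ X * o
  cast⁶ = trans (⌜*⌝ (w⁴ w) (w² w)) (cong₂ _*_ cast⁴ cast²)
  cast⁸ : ⌜ w⁸ w ⌝ ≡ X * X
  cast⁸ = trans (⌜*⌝ (w⁴ w) (w⁴ w)) (cong₂ _*_ cast⁴ cast⁴)

  4≤w² : 4 ℕ.≤ w² w
  4≤w² = ℕ.≤-trans (ℕ.s≤s (ℕ.s≤s (ℕ.s≤s (ℕ.s≤s ℕ.z≤n)))) (ℕ.*-mono-≤ 15≤w 15≤w)

  4w⁶≤w⁸ : 4 ℕ.* w⁶ w ℕ.≤ w⁸ w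
  4w⁶≤w⁸ = ℕ≤≡ (ℕ.*-monoˡ-≤ (w⁶ w) 4≤w²) (e (w² w))
   where
   e : ∀ a → a ℕ.* (a ℕ.* a ℕ.* a) ≡ a ℕ.* a ℕ.* (a ℕ.* a)
   e = ℕ-Ring.solve-∀

  w⁶≤w⁸ : w⁶ w ℕ.≤ w⁸ w
  w⁶≤w⁸ = ℕ.≤-trans (ℕ.m≤m+n (w⁶ w) _) 4w⁶≤w⁸

  -- Two lengths w⁶ below N: on the lower one the inherited drift becomes negligible, the upper one
  -- is the usable window.
  lo hi : ℕ
  lo = N ℕ.∸ (w⁶ w ℕ.+ w⁶ w)
  hi = N ℕ.+ w⁶ w

  2w⁶≤N : w⁶ w ℕ.+ w⁶ w ℕ.≤ N
  2w⁶≤N = ℕ.≤-trans (ℕ≤≡ (ℕ.m≤m+n (w⁶ w ℕ.+ w⁶ w) (w⁶ w ℕ.+ w⁶ w)) (e (w⁶ w))) (ℕ.≤-trans 4w⁶≤w⁸ N≥)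
   where
   e : ∀ a → a ℕ.+ a ℕ.+ (a ℕ.+ a) ≡ 4 ℕ.* a
   e = ℕ-Ring.solve-∀

  lo+ : lo ℕ.+ (w⁶ w ℕ.+ w⁶ w) ≡ N
  lo+ = ℕ.m∸n+n≡m 2w⁶≤N

  module In (n : ℕ) (lo≤n : lo ℕ.≤ n) (n≤hi : n ℕ.≤ hi) where
   N≤n+ : N ℕ.≤ n ℕ.+ (w⁶ w ℕ.+ w⁶ w)
   N≤n+ = ℕ≡≤ (sym lo+) (ℕ.+-monoˡ-≤ _ lo≤n)

   n≤3w⁸ : n ℕ.≤ 3 ℕ.* w⁸ w
   n≤3w⁸ = ℕ.≤-trans n≤hi (ℕ≤≡ (ℕ.+-mono-≤ N≤ w⁶≤w⁸) (e (w⁸ w)))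
    where
    e : ∀ a → 2 ℕ.* a ℕ.+ a ≡ 3 ℕ.* a
    e = ℕ-Ring.solve-∀

   w⁸≤2n : w⁸ w ℕ.≤ 2 ℕ.* n
   w⁸≤2n = ℕ.+-cancelʳ-≤ (w⁸ w) _ _ (ℕ≡≤ (e₁ (w⁸ w)) (ℕ.≤-trans (ℕ.*-monoʳ-≤ 2 (ℕ.≤-trans N≥ N≤n+))
     (ℕ≡≤ (e₂ n (w⁶ w)) (ℕ.+-monoʳ-≤ (2 ℕ.* n) 4w⁶≤w⁸))))
    where
    e₁ : ∀ a → a ℕ.+ a ≡ 2 ℕ.* a
    e₁ = ℕ-Ring.solve-∀
    e₂ : ∀ n a → 2 ℕ.* (n ℕ.+ (a ℕ.+ a)) ≡ 2 ℕ.* n ℕ.+ 4 ℕ.* a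
    e₂ = ℕ-Ring.solve-∀

   n≤3XX : ⌜ n ⌝ ≤ 3ℚ * (X * X)
   n≤3XX = ≤≡ (⌜⌝-mono n≤3w⁸) (trans (⌜*⌝ 3 (w⁸ w)) (cong (3ℚ *_) cast⁸))

   XX≤2n : X * X ≤ 2ℚ * ⌜ n ⌝
   XX≤2n = ≡≤ (sym cast⁸) (≤≡ (⌜⌝-mono w⁸≤2n) (⌜*⌝ 2 n))

   U≤ : Û n ≤ 3ℚ * (X * X) * p̂ n
   U≤ = ≤-trans (U≤np̂ n) (*-monoʳ (0≤p̂ n) n≤3XX)

   -- The choice K = w⁴ balances the two terms of `KS≤`.
   S≤ : Ŝ n ≤ 4ℚ * X * p̂ n
   S≤ = *-cancel-≤ 0<X (begin
    X * Ŝ n ≡⟨ trans (cong (_* Ŝ n) (sym cast⁴)) (sym (⌜*⌝ (w⁴ w) (S n))) ⟩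
    ⌜ w⁴ w ℕ.* S n ⌝ ≤⟨ ⌜⌝-mono (KS≤ n (w⁴ w)) ⟩
    ⌜ w⁴ w ℕ.* (w⁴ w ℕ.* P n) ℕ.+ U n ⌝ ≡⟨ trans (⌜+⌝ (w⁴ w ℕ.* (w⁴ w ℕ.* P n)) (U n)) (cong (_+ Û n) (trans (⌜*⌝ (w⁴ w) (w⁴ w ℕ.* P n)) (trans (cong (⌜ w⁴ w ⌝ *_) (⌜*⌝ (w⁴ w) (P n))) (cong (λ z → z * (z * p̂ n)) cast⁴)))) ⟩
    X * (X * p̂ n) + Û n ≤⟨ +-monoʳ-≤ (X * (X * p̂ n)) U≤ ⟩
    X * (X * p̂ n) + 3ℚ * (X * X) * p̂ n ≡⟨ r X (p̂ n) ⟩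
    X * (4ℚ * X * p̂ n) ∎)
    where
    r = solve 2 (λ X p → X :* (X :* p) :+ # 3 :* (X :* X) :* p := X :* (# 4 :* X :* p)) refl

   -- A crude logarithm from w ≤ 2^w. It is affordable: Har · S is then of order w⁵ p against n p of
   -- order w⁸ p.
   Har≤ : Har n ≤ ⌜ 11 ⌝ * ω
   Har≤ = begin
    Har n ≤⟨ Har-log (2 ℕ.+ k) (ℕ.≤-trans n≤3w⁸ (ℕ.≤-trans (ℕ.*-monoˡ-≤ (w⁸ w) (ℕ.n≤1+n 3)) (ℕ≤≡ (ℕ.*-monoʳ-≤ 4 w⁸≤) (e₁ (2 ℕ.^ k))))) ⟩
    1ℚ + ⌜ 2 ℕ.+ k ⌝ ≡⟨ cong (λ z → 1ℚ + z) (trans (⌜+⌝ 2 k) (cong (λ z → 2ℚ + z) (trans (⌜+⌝ (w₂ ℕ.+ w₂) (w₂ ℕ.+ w₂)) (trans (cong (λ z → z + z) (trans (⌜+⌝ w₂ w₂) (cong (λ z → z + z) (⌜+⌝ w w)))) (r₁ ω))))) ⟩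
    1ℚ + (2ℚ + 8ℚ * ω) ≤⟨ by (3ℚ * (ω - 1ℚ)) (0≤* 0≤3 (sub≥0 1≤ω)) (r₂ ω) ⟩
    ⌜ 11 ⌝ * ω ∎
    where
    w₂ k : ℕ
    w₂ = w ℕ.+ w
    k = (w₂ ℕ.+ w₂) ℕ.+ (w₂ ℕ.+ w₂)
    e₁ : ∀ a → 4 ℕ.* a ≡ 2 ℕ.* (2 ℕ.* a)
    e₁ = ℕ-Ring.solve-∀
    r₁ = solve 1 (λ a → a :+ a :+ (a :+ a) :+ (a :+ a :+ (a :+ a)) := # 8 :* a) refl
    r₂ = solve 1 (λ a → :1 :+ (# 2 :+ # 8 :* a) :+ # 3 :* (a :- :1) := # 11 :* a) refl
    double : ∀ {a} m → a ℕ.≤ 2 ℕ.^ m → a ℕ.* a ℕ.≤ 2 ℕ.^ (m ℕ.+ m)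
    double m h = ℕ≤≡ (ℕ.*-mono-≤ h h) (sym (ℕ.^-distribˡ-+-* 2 m m))
    n≤2^n : ∀ n → n ℕ.≤ 2 ℕ.^ n
    n≤2^n zero = ℕ.z≤n
    n≤2^n (suc n) = ℕ≤≡ (ℕ.+-mono-≤ (ℕ.m^n>0 2 n) (n≤2^n n)) (cong (2 ℕ.^ n ℕ.+_) (sym (ℕ.+-identityʳ (2 ℕ.^ n))))
    w⁸≤ : w⁸ w ℕ.≤ 2 ℕ.^ k
    w⁸≤ = double (w₂ ℕ.+ w₂) (double w₂ (double w (n≤2^n w)))

  θθXX≤3 : θ * θ * (X * X) ≤ 3ℚ
  θθXX≤3 = begin
   θ * θ * (X * X) ≤⟨ *-monoˡ (0≤* 0≤θ 0≤θ) (≡≤ (sym cast⁸) (⌜⌝-mono N≥)) ⟩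
   θ * θ * ⌜ N ⌝ ≡⟨ *-comm (θ * θ) ⌜ N ⌝ ⟩
   ⌜ N ⌝ * (θ * θ) ≤⟨ close⁻ˡ {⌜ N ⌝ * (θ * θ)} {ζ N} θ-near ⟩
   ζ N + i ≤⟨ +-mono-≤ (ζ≤2 N) i≤1 ⟩
   1ℚ + 1ℚ + 1ℚ ≡⟨ refl ⟩
   3ℚ ∎

  T : ℚ
  T = θ * X

  0≤T : 0ℚ ≤ T
  0≤T = 0≤* 0≤θ 0≤X

  TT≤3 : T * T ≤ 3ℚ
  TT≤3 = ≡≤ (r θ X) θθXX≤3
   where
   r = solve 2 (λ a b → a :* b :* (a :* b) := a :* a :* (b :* b)) refl

  T≤2 : T ≤ 2ℚ
  T≤2 = sq-≤ 0≤T 0≤2 (≤-trans TT≤3 (⌜⌝-mono {3} {4} (ℕ.n≤1+n 3)))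

  ½≤T : ½ ≤ T
  ½≤T = sq-≤ 0≤½ 0≤T (*-cancel-≤ {2ℚ} (0<⌜suc⌝ 1) (begin
   ½ ≤⟨ by (½ - i) (sub≥0 i≤½) (r₁ i) ⟩
   1ℚ - i ≤⟨ +-monoˡ-≤ (- i) (1≤ζ {N} (ℕ.≤-trans (ℕ.≤-trans (ℕ.s≤s ℕ.z≤n) (ℕ.*-mono-≤ w⁴≥1 w⁴≥1)) N≥)) ⟩
   ζ N - i ≤⟨ by _ (sub≥0 (close⁻ʳ {⌜ N ⌝ * (θ * θ)} {ζ N} θ-near)) (r₂ (ζ N) i (⌜ N ⌝ * (θ * θ))) ⟩
   ⌜ N ⌝ * (θ * θ) ≤⟨ *-monoʳ (0≤* 0≤θ 0≤θ) (≤≡ (⌜⌝-mono N≤) (trans (⌜*⌝ 2 (w⁸ w)) (cong (2ℚ *_) cast⁸))) ⟩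
   2ℚ * (X * X) * (θ * θ) ≡⟨ r₃ X θ ⟩
   2ℚ * (T * T) ∎))
   where
   w⁴≥1 : 1 ℕ.≤ w⁴ w
   w⁴≥1 = ℕ.*-mono-≤ (ℕ.*-mono-≤ 1≤w 1≤w) (ℕ.*-mono-≤ 1≤w 1≤w)
   i≤½ : i ≤ ½
   i≤½ = *-cancel-≤ {2ℚ} (0<⌜suc⌝ 1) (≤-trans (by (i * ⌜ 223 ⌝) (0≤* 0≤i (0≤⌜⌝ 223)) (r i)) i≤)
    where
    r = solve 1 (λ i → # 2 :* i :+ i :* # 223 := i :* # 225) refl
   r₁ = solve 1 (λ i → :½ :+ (:½ :- i) := :1 :- i) refl
   r₂ = solve 3 (λ z i n → z :- i :+ (n :+ i :- z) := n) refl
   r₃ = solve 2 (λ X θ → # 2 :* (X :* X) :* (θ :* θ) := # 2 :* (θ :* X :* (θ :* X))) refl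

  θ≤2Y : θ ≤ 2ℚ * Y
  θ≤2Y = begin
   θ ≡⟨ trans (sym (*-identityʳ θ)) (trans (cong (θ *_) (sym XY)) (sym (*-assoc θ X Y))) ⟩
   T * Y ≤⟨ *-monoʳ 0≤Y T≤2 ⟩
   2ℚ * Y ∎

  Y≤i : Y ≤ i
  Y≤i = ≤≡ (*-monoʳ 0≤i i≤1) (*-identityˡ i)

  θ≤1 : θ ≤ 1ℚ
  θ≤1 = ≤-trans θ≤2Y (≤-trans (*-monoˡ 0≤2 Y≤i) (≤-trans (by (i * ⌜ 223 ⌝) (0≤* 0≤i (0≤⌜⌝ 223)) (r i)) i≤))
   where
   r = solve 1 (λ i → # 2 :* i :+ i :* # 223 := i :* # 225) refl

  -- 104 = 2 · 48 + 8: an error 48 w⁵ p in the divisor sum, divided by n ≥ w⁸/2, and an error 8/w²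
  -- in replacing ζ(n) by nθ².
  ε : ℚ
  ε = ⌜ 104 ⌝ * i

  0≤ε : 0ℚ ≤ ε
  0≤ε = 0≤* (0≤⌜⌝ 104) 0≤i

  -- `nP≤` and `nP≥` are used with J = w⁴. Moving from N to n changes Nθ² by O(w⁶ θ²) = O(w^(-2)),
  -- which fixes the length of the window.
  near : ∀ n → lo ℕ.≤ n → n ℕ.≤ hi → ∣ p̂ n - θ * θ * Û n ∣ ≤ ε * p̂ n
  near n lo≤n n≤hi = *-cancel-≤ 0<n (begin
   ⌜ n ⌝ * ∣ p̂ n - θ * θ * Û n ∣ ≡⟨ trans (cong (_* ∣ p̂ n - θ * θ * Û n ∣) (sym (0≤p⇒∣p∣≡p (0≤⌜⌝ n)))) (sym (∣p*q∣≡∣p∣*∣q∣ ⌜ n ⌝ _)) ⟩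
   ∣ ⌜ n ⌝ * (p̂ n - θ * θ * Û n) ∣ ≡⟨ cong ∣_∣ (r₁ ⌜ n ⌝ (p̂ n) θ (Û n) (ζ n)) ⟩
   ∣ (⌜ n ⌝ * p̂ n - ζ n * Û n) + Û n * (ζ n - ⌜ n ⌝ * (θ * θ)) ∣ ≤⟨ ∣+∣ {⌜ n ⌝ * p̂ n - ζ n * Û n} first (∣*∣ (0≤Û n) second) ⟩
   ⌜ 48 ⌝ * (ω * X) * p̂ n + Û n * (8ℚ * i) ≤⟨ +-mono-≤ (*-monoʳ (0≤p̂ n) (*-monoˡ (0≤⌜⌝ 48) ωX≤)) (*-monoʳ (0≤* 0≤8 0≤i) (U≤np̂ n)) ⟩
   ⌜ 48 ⌝ * (2ℚ * ⌜ n ⌝ * i) * p̂ n + ⌜ n ⌝ * p̂ n * (8ℚ * i) ≡⟨ r₂ ⌜ n ⌝ i (p̂ n) ⟩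
   ⌜ n ⌝ * (ε * p̂ n) ∎)
   where
   open In n lo≤n n≤hi
   0<n : 0ℚ < ⌜ n ⌝
   0<n = <-≤-trans (0<* {½} (positive⁻¹ ½) (0<* 0<X 0<X)) (≤≡ (*-monoˡ {½} 0≤½ XX≤2n) (r ⌜ n ⌝))
    where
    r = solve 1 (λ n → :½ :* (# 2 :* n) := n) refl
   r₁ = solve 5 (λ n p θ u z → n :* (p :- θ :* θ :* u) := (n :* p :- z :* u) :+ u :* (z :- n :* (θ :* θ))) refl
   r₂ = solve 3 (λ n i p → # 48 :* (# 2 :* n :* i) :* p :+ n :* p :* (# 8 :* i) := n :* (# 104 :* i :* p)) refl
   ωX≤ : ω * X ≤ 2ℚ * ⌜ n ⌝ * i
   ωX≤ = begin
    ω * X ≤⟨ *-monoʳ 0≤X ω≤o ⟩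
    o * X ≡⟨ trans (*-comm o X) (trans (cong (X *_) (sym Xi)) (sym (*-assoc X X i))) ⟩
    X * X * i ≤⟨ *-monoʳ 0≤i XX≤2n ⟩
    2ℚ * ⌜ n ⌝ * i ∎
   j : ℕ
   j = ℕ.pred (w⁴ w)
   w⁴≥1 : 1 ℕ.≤ w⁴ w
   w⁴≥1 = ℕ.*-mono-≤ (ℕ.*-mono-≤ 1≤w 1≤w) (ℕ.*-mono-≤ 1≤w 1≤w)
   j-suc : suc j ≡ w⁴ w
   j-suc = go (w⁴ w) w⁴≥1
    where
    go : ∀ k → 1 ℕ.≤ k → suc (ℕ.pred k) ≡ k
    go (suc k) _ = refl
   inv-j : X * inv j ≡ 1ℚ
   inv-j = trans (cong (_* inv j) (trans (sym cast⁴) (cong ⌜_⌝ (sym j-suc)))) (⌜*⌝-inv j)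
   w⁴≤n : w⁴ w ℕ.≤ n
   w⁴≤n = ℕ.*-cancelˡ-≤ 2 (ℕ.≤-trans (ℕ.*-monoˡ-≤ (w⁴ w) 2≤w⁴) w⁸≤2n)
    where
    2≤w⁴ : 2 ℕ.≤ w⁴ w
    2≤w⁴ = ℕ.≤-trans (ℕ.s≤s (ℕ.s≤s ℕ.z≤n)) (ℕ.*-mono-≤ 4≤w² 4≤w²)
   w⁴≤N : w⁴ w ℕ.≤ N
   w⁴≤N = ℕ.≤-trans (ℕ≡≤ (sym (ℕ.*-identityˡ (w⁴ w))) (ℕ.*-monoˡ-≤ (w⁴ w) w⁴≥1)) N≥
   j≤Y : inv j ≤ Y
   j≤Y = ≤-reflexive (trans (sym (*-identityˡ (inv j))) (trans (cong (_* inv j) (sym XY)) (trans (r X Y (inv j)) (trans (cong (Y *_) inv-j) (*-identityʳ Y)))))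
    where
    r = solve 3 (λ a b c → a :* b :* c := b :* (a :* c)) refl
   HS : Har n * Ŝ n ≤ ⌜ 44 ⌝ * (ω * X) * p̂ n
   HS = ≤≡ (*-mono {Har n} {⌜ 11 ⌝ * ω} {Ŝ n} {4ℚ * X * p̂ n} (0≤* (0≤⌜⌝ 11) 0≤ω) (0≤Ŝ n) Har≤ S≤) (r ω X (p̂ n))
    where
    r = solve 3 (λ a b c → # 11 :* a :* (# 4 :* b :* c) := # 44 :* (a :* b) :* c) refl
   first : ∣ ⌜ n ⌝ * p̂ n - ζ n * Û n ∣ ≤ ⌜ 48 ⌝ * (ω * X) * p̂ n
   first = close {⌜ n ⌝ * p̂ n} {ζ n * Û n} up down
    where
    up : ⌜ n ⌝ * p̂ n ≤ ζ n * Û n + ⌜ 48 ⌝ * (ω * X) * p̂ n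
    up = ≤-trans (nP≤ n) (+-monoʳ-≤ (ζ n * Û n) (≤-trans HS (*-monoʳ (0≤p̂ n) (*-monoʳ (0≤* 0≤ω 0≤X) (⌜⌝-mono {44} {48} (ℕ.m≤m+n 44 4))))))
    down : ζ n * Û n ≤ ⌜ n ⌝ * p̂ n + ⌜ 48 ⌝ * (ω * X) * p̂ n
    down = begin
     ζ n * Û n ≤⟨ *-monoʳ (0≤Û n) (≤≡ (ζ-tail {j} {n} (ℕ≡≤ j-suc w⁴≤n)) (cong (λ k → ζ k + inv j) j-suc)) ⟩
     (ζ (w⁴ w) + inv j) * Û n ≡⟨ *-distribʳ-+ (Û n) (ζ (w⁴ w)) (inv j) ⟩
     ζ (w⁴ w) * Û n + inv j * Û n ≤⟨ +-mono-≤ (nP≥ n (w⁴ w) w⁴≤n) (*-monoˡ (0≤inv j) U≤) ⟩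
     ⌜ n ⌝ * p̂ n + (⌜ w⁴ w ⌝ * p̂ n + Har n * Ŝ n) + inv j * (3ℚ * (X * X) * p̂ n)
      ≤⟨ +-mono-≤ (+-monoʳ-≤ (⌜ n ⌝ * p̂ n) (+-mono-≤ (≤-reflexive (cong (_* p̂ n) cast⁴)) HS))
         (≤-reflexive (trans (r₃ (inv j) X (p̂ n)) (trans (cong (λ z → 3ℚ * z * X * p̂ n) inv-j) (r₄ X (p̂ n))))) ⟩
     ⌜ n ⌝ * p̂ n + (X * p̂ n + ⌜ 44 ⌝ * (ω * X) * p̂ n) + 3ℚ * X * p̂ n
      ≤⟨ by (4ℚ * ((ω - 1ℚ) * X * p̂ n)) (0≤* 0≤4 (0≤* (0≤* (sub≥0 1≤ω) 0≤X) (0≤p̂ n))) (r₅ ⌜ n ⌝ (p̂ n) X ω) ⟩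
     ⌜ n ⌝ * p̂ n + ⌜ 48 ⌝ * (ω * X) * p̂ n ∎
     where
     r₃ = solve 3 (λ j X p → j :* (# 3 :* (X :* X) :* p) := # 3 :* (X :* j) :* X :* p) refl
     r₄ = solve 2 (λ X p → # 3 :* :1 :* X :* p := # 3 :* X :* p) refl
     r₅ = solve 4 (λ n p X ω → n :* p :+ (X :* p :+ # 44 :* (ω :* X) :* p) :+ # 3 :* X :* p :+ # 4 :* ((ω :- :1) :* X :* p) := n :* p :+ # 48 :* (ω :* X) :* p) refl
   second : ∣ ζ n - ⌜ n ⌝ * (θ * θ) ∣ ≤ 8ℚ * i
   second = begin
    ∣ ζ n - ⌜ n ⌝ * (θ * θ) ∣ ≡⟨ cong ∣_∣ (r₆ (ζ n) (ζ N) ⌜ n ⌝ ⌜ N ⌝ θ) ⟩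
    ∣ (ζ n - ζ N) - (⌜ N ⌝ * (θ * θ) - ζ N) + θ * θ * (⌜ N ⌝ - ⌜ n ⌝) ∣
     ≤⟨ ∣+∣ {(ζ n - ζ N) - (⌜ N ⌝ * (θ * θ) - ζ N)} (∣-∣ {ζ n - ζ N} (≤-trans (ζ-close {j} {n} {N} (ℕ≡≤ j-suc w⁴≤n) (ℕ≡≤ j-suc w⁴≤N)) (≤-trans j≤Y Y≤i)) θ-near)
        (∣*∣ (0≤* 0≤θ 0≤θ) N-n) ⟩
    i + i + θ * θ * (2ℚ * (X * o)) ≡⟨ trans (cong (λ z → i + i + θ * θ * (2ℚ * (X * z))) (sym Xi)) (r₇ i θ X) ⟩
    i + i + 2ℚ * (θ * θ * (X * X)) * i ≤⟨ +-monoʳ-≤ (i + i) (*-monoʳ 0≤i (*-monoˡ 0≤2 θθXX≤3)) ⟩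
    i + i + 2ℚ * 3ℚ * i ≡⟨ r₈ i ⟩
    8ℚ * i ∎
    where
    r₆ = solve 5 (λ z z′ n m θ → z :- n :* (θ :* θ) := (z :- z′) :- (m :* (θ :* θ) :- z′) :+ θ :* θ :* (m :- n)) refl
    r₇ = solve 3 (λ i θ X → i :+ i :+ θ :* θ :* (# 2 :* (X :* (X :* i))) := i :+ i :+ # 2 :* (θ :* θ :* (X :* X)) :* i) refl
    r₈ = solve 1 (λ i → i :+ i :+ # 2 :* # 3 :* i := # 8 :* i) refl
    2Xo : ⌜ w⁶ w ℕ.+ w⁶ w ⌝ ≡ 2ℚ * (X * o)
    2Xo = trans (⌜+⌝ (w⁶ w) (w⁶ w)) (trans (cong (λ z → z + z) cast⁶) (r (X * o)))
     where
     r = solve 1 (λ a → a :+ a := # 2 :* a) refl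
    N-n : ∣ ⌜ N ⌝ - ⌜ n ⌝ ∣ ≤ 2ℚ * (X * o)
    N-n = close {⌜ N ⌝} {⌜ n ⌝}
     (≤≡ (⌜⌝-mono N≤n+) (trans (⌜+⌝ n _) (cong (λ z → ⌜ n ⌝ + z) 2Xo)))
     (≤≡ (⌜⌝-mono (ℕ.≤-trans n≤hi (ℕ.+-monoʳ-≤ N (ℕ.m≤m+n (w⁶ w) (w⁶ w))))) (trans (⌜+⌝ N _) (cong (λ z → ⌜ N ⌝ + z) 2Xo)))

  σ u δ : ℚ
  σ = 4ℚ * X
  u = 3ℚ * (X * X)
  δ = ⌜ 12 ⌝ * Y

  -- With n = w⁶ + m, U(n) contains t(w⁶) copies of p(m), and t(w⁶) ≥ w¹²/4, while U(n) ≤ 3w⁸ p(n).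
  decay : ∀ m → lo ℕ.≤ m → w⁶ w ℕ.+ m ℕ.≤ hi → p̂ m ≤ δ * p̂ (w⁶ w ℕ.+ m)
  decay m lo≤m n≤hi = *-cancel-≤ (0<* (0<* 0<X 0<X) 0<X) (begin
   X * X * X * p̂ m ≡⟨ cong (_* p̂ m) (trans (r₁ o) (trans (cong (λ z → z * z) (sym cast⁶)) (sym (⌜*⌝ (w⁶ w) (w⁶ w))))) ⟩
   ⌜ w⁶ w ℕ.* w⁶ w ⌝ * p̂ m ≤⟨ *-monoʳ (0≤p̂ m) (⌜⌝-mono (sq≤4t (w⁶ w) 2≤w⁶)) ⟩
   ⌜ 4 ℕ.* t (w⁶ w) ⌝ * p̂ m ≡⟨ trans (cong (_* p̂ m) (⌜*⌝ 4 (t (w⁶ w)))) (trans (*-assoc 4ℚ ⌜ t (w⁶ w) ⌝ (p̂ m)) (cong (4ℚ *_) (sym (⌜*⌝ (t (w⁶ w)) (P m))))) ⟩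
   4ℚ * ⌜ t (w⁶ w) ℕ.* P m ⌝ ≤⟨ *-monoˡ 0≤4 (⌜⌝-mono (ℕ≡≤ (cong (t (w⁶ w) ℕ.*_) (sym (sh-≥ (w⁶ w) P m))) (tP≤U n (w⁶ w)))) ⟩
   4ℚ * Û n ≤⟨ *-monoˡ 0≤4 U≤ ⟩
   4ℚ * (3ℚ * (X * X) * p̂ n) ≡⟨ r₂ X (p̂ n) ⟩
   ⌜ 12 ⌝ * 1ℚ * (X * X) * p̂ n ≡⟨ cong (λ z → ⌜ 12 ⌝ * z * (X * X) * p̂ n) (sym XY) ⟩
   ⌜ 12 ⌝ * (X * Y) * (X * X) * p̂ n ≡⟨ r₃ X Y (p̂ n) ⟩
   X * X * X * (δ * p̂ n) ∎)
   where
   n = w⁶ w ℕ.+ m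
   open In n (ℕ.≤-trans lo≤m (ℕ.m≤n+m m (w⁶ w))) n≤hi
   2≤w⁶ : 2 ℕ.≤ w⁶ w
   2≤w⁶ = ℕ.≤-trans (ℕ.s≤s (ℕ.s≤s ℕ.z≤n)) (ℕ.*-mono-≤ (ℕ.*-mono-≤ 4≤w² 4≤w²) 4≤w²)
   r₁ = solve 1 (λ o → o :* o :* (o :* o) :* (o :* o) := o :* o :* o :* (o :* o :* o)) refl
   r₂ = solve 2 (λ X p → # 4 :* (# 3 :* (X :* X) :* p) := # 12 :* :1 :* (X :* X) :* p) refl
   r₃ = solve 3 (λ X Y p → # 12 :* (X :* Y) :* (X :* X) :* p := X :* X :* X :* (# 12 :* Y :* p)) refl

  0≤σ : 0ℚ ≤ σ
  0≤σ = 0≤* 0≤4 0≤X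

  S≤σ : ∀ n → lo ℕ.≤ n → n ℕ.≤ hi → Ŝ n ≤ σ * p̂ n
  S≤σ n h h′ = In.S≤ n h h′

  U≤u : ∀ n → lo ℕ.≤ n → n ℕ.≤ hi → Û n ≤ u * p̂ n
  U≤u n h h′ = In.U≤ n h h′

  module Win = Window 0≤θ θ≤1 yθ 0≤y 0≤ε 0≤σ lo hi near S≤σ
  module G = Win.Gap u δ (0≤* 0≤3 (0≤* 0≤X 0≤X)) (0≤* (0≤⌜⌝ 12) 0≤Y) (w⁶ w) U≤u decay

  γ≤ : G.γ ≤ ⌜ 584 ⌝ * o
  γ≤ = begin
   G.γ ≡⟨ r₁ X Y i θ ⟩
   ⌜ 48 ⌝ * (X * Y) + ⌜ 36 ⌝ * (θ * X) * (X * Y) + ⌜ 416 ⌝ * (X * i) + ⌜ 16 ⌝ * (θ * X * (θ * X))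
                           ≡⟨ cong₂ (λ a b → ⌜ 48 ⌝ * a + ⌜ 36 ⌝ * T * a + ⌜ 416 ⌝ * b + ⌜ 16 ⌝ * (T * T)) XY Xi ⟩
   ⌜ 48 ⌝ * 1ℚ + ⌜ 36 ⌝ * T * 1ℚ + ⌜ 416 ⌝ * o + ⌜ 16 ⌝ * (T * T)
    ≤⟨ by (⌜ 36 ⌝ * (2ℚ - T) + ⌜ 16 ⌝ * (3ℚ - T * T) + ⌜ 168 ⌝ * (o - 1ℚ))
       (0≤+ (0≤+ (0≤* (0≤⌜⌝ 36) (sub≥0 T≤2)) (0≤* (0≤⌜⌝ 16) (sub≥0 TT≤3))) (0≤* (0≤⌜⌝ 168) (sub≥0 1≤o))) (r₂ T o) ⟩
   ⌜ 584 ⌝ * o ∎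
   where
   r₁ = solve 4 (λ X Y i θ → (# 4 :* X :+ θ :* (# 3 :* (X :* X))) :* (# 12 :* Y) :+ (# 104 :* i :+ θ :* θ :* (# 4 :* X)) :* (# 4 :* X) := # 48 :* (X :* Y) :+ # 36 :* (θ :* X) :* (X :* Y) :+ # 416 :* (X :* i) :+ # 16 :* (θ :* X :* (θ :* X))) refl
   r₂ = solve 2 (λ T o → # 48 :* :1 :+ # 36 :* T :* :1 :+ # 416 :* o :+ # 16 :* (T :* T) :+ (# 36 :* (# 2 :- T) :+ # 16 :* (# 3 :- T :* T) :+ # 168 :* (o :- :1)) := # 584 :* o) refl

  κ : ℚ
  κ = ⌜ 9552 ⌝ * i

  0≤κ : 0ℚ ≤ κ
  0≤κ = 0≤* (0≤⌜⌝ 9552) 0≤i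

  κ≤ : G.κ ≤ κ
  κ≤ = begin
   ε + θ * θ * (G.γ * σ) + ε ≤⟨ +-monoˡ-≤ ε (+-monoʳ-≤ ε (*-monoˡ (0≤* 0≤θ 0≤θ) (*-monoʳ 0≤σ γ≤))) ⟩
   ε + θ * θ * (⌜ 584 ⌝ * o * σ) + ε ≡⟨ trans (cong (λ z → ε + θ * θ * (⌜ 584 ⌝ * z * σ) + ε) (sym Xi)) (r₁ i θ X) ⟩
   ⌜ 208 ⌝ * i + ⌜ 2336 ⌝ * (θ * X * (θ * X)) * i ≤⟨ +-monoʳ-≤ (⌜ 208 ⌝ * i) (*-monoʳ 0≤i (*-monoˡ (0≤⌜⌝ 2336) TT≤3)) ⟩
   ⌜ 208 ⌝ * i + ⌜ 2336 ⌝ * 3ℚ * i ≤⟨ by (⌜ 2336 ⌝ * i) (0≤* (0≤⌜⌝ 2336) 0≤i) (r₂ i) ⟩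
   κ ∎
   where
   r₁ = solve 3 (λ i θ X → # 104 :* i :+ θ :* θ :* (# 584 :* (X :* i) :* (# 4 :* X)) :+ # 104 :* i := # 208 :* i :+ # 2336 :* (θ :* X :* (θ :* X)) :* i) refl
   r₂ = solve 1 (λ i → # 208 :* i :+ # 2336 :* # 3 :* i :+ # 2336 :* i := # 9552 :* i) refl

  above-lo : ∀ {n} → N ℕ.≤ w⁶ w ℕ.+ n → G.lo′ ℕ.≤ n
  above-lo {n} h = ℕ.+-cancelˡ-≤ (w⁶ w) _ _ (ℕ≡≤ (trans (e (w⁶ w) lo) lo+) h)
   where
   e : ∀ a b → a ℕ.+ (a ℕ.+ b) ≡ b ℕ.+ (a ℕ.+ a)
   e = ℕ-Ring.solve-∀

  lo≤ : ∀ {n} → N ℕ.≤ w⁶ w ℕ.+ n → lo ℕ.≤ n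
  lo≤ h = ℕ.≤-trans (ℕ.m≤n+m lo (w⁶ w)) (above-lo h)

  ratio : ∀ d n → N ℕ.≤ w⁶ w ℕ.+ n → d ℕ.+ n ℕ.≤ hi → ∣ p̂ n - pow y d * p̂ (d ℕ.+ n) ∣ ≤ κ * p̂ (d ℕ.+ n)
  ratio d n h h′ = ≤-trans (G.P-ratio d n (above-lo h) h′) (*-monoʳ (0≤p̂ (d ℕ.+ n)) κ≤)

  private
   γ′ : ℚ
   γ′ = ⌜ 3504 ⌝ * (i * Y)
   0≤γ′ : 0ℚ ≤ γ′
   0≤γ′ = 0≤* (0≤⌜⌝ 3504) (0≤* 0≤i 0≤Y)
   P≤U : ∀ n → lo ℕ.≤ n → n ℕ.≤ hi → G.γ * p̂ n ≤ γ′ * Û n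
   P≤U n h h′ = begin
    G.γ * p̂ n ≤⟨ *-monoʳ (0≤p̂ n) γ≤ ⟩
    ⌜ 584 ⌝ * o * p̂ n ≤⟨ *-monoˡ (0≤* (0≤⌜⌝ 584) 0≤o) p≤ ⟩
    ⌜ 584 ⌝ * o * (2ℚ * (θ * θ * Û n)) ≡⟨ r₁ o θ (Û n) ⟩
    ⌜ 1168 ⌝ * 1ℚ * 1ℚ * (o * (θ * θ)) * Û n ≡⟨ cong (λ z → ⌜ 1168 ⌝ * z * z * (o * (θ * θ)) * Û n) (sym XY) ⟩
    ⌜ 1168 ⌝ * (X * Y) * (X * Y) * (o * (θ * θ)) * Û n ≡⟨ trans (r₂ X Y o θ (Û n)) (cong (λ z → ⌜ 1168 ⌝ * (θ * θ * (X * X)) * (z * Y) * Û n) oY) ⟩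
    ⌜ 1168 ⌝ * (θ * θ * (X * X)) * (i * Y) * Û n ≤⟨ *-monoʳ (0≤Û n) (*-monoʳ (0≤* 0≤i 0≤Y) (*-monoˡ (0≤⌜⌝ 1168) θθXX≤3)) ⟩
    ⌜ 1168 ⌝ * 3ℚ * (i * Y) * Û n ≡⟨⟩
    γ′ * Û n ∎
    where
    r₁ = solve 3 (λ o θ u → # 584 :* o :* (# 2 :* (θ :* θ :* u)) := # 1168 :* :1 :* :1 :* (o :* (θ :* θ)) :* u) refl
    r₂ = solve 5 (λ X Y o θ u → # 1168 :* (X :* Y) :* (X :* Y) :* (o :* (θ :* θ)) :* u := # 1168 :* (θ :* θ :* (X :* X)) :* (o :* Y :* Y) :* u) refl
    p≤ : p̂ n ≤ 2ℚ * (θ * θ * Û n)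
    p≤ = by (2ℚ * (θ * θ * Û n + ε * p̂ n - p̂ n) + (1ℚ - i * ⌜ 225 ⌝) * p̂ n + ⌜ 17 ⌝ * i * p̂ n)
     (0≤+ (0≤+ (0≤* 0≤2 (sub≥0 (close⁻ˡ {p̂ n} {θ * θ * Û n} (near n h h′)))) (0≤* (sub≥0 i≤) (0≤p̂ n))) (0≤* (0≤* (0≤⌜⌝ 17) 0≤i) (0≤p̂ n))) (r (p̂ n) θ (Û n) i)
     where
     r = solve 4 (λ p θ u i → p :+ (# 2 :* (θ :* θ :* u :+ # 104 :* i :* p :- p) :+ (:1 :- i :* # 225) :* p :+ # 17 :* i :* p) := # 2 :* (θ :* θ :* u)) refl

  -- The second part of the error is of order d/w⁶. With d about ℓ²/2 it tends to 0 for ℓ = o(w³),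
  -- the source of the range o(N^(3/8)).
  ratio-near : ∀ d n → N ℕ.≤ w⁶ w ℕ.+ n → d ℕ.+ n ℕ.≤ hi → Near (⌜ 208 ⌝ * i + ⌜ d ⌝ * (⌜ 3504 ⌝ * (i * Y))) (p̂ n) (pow y d * p̂ (d ℕ.+ n))
  ratio-near d n h h′ = subst (λ k → Near k (p̂ n) (pow y d * p̂ (d ℕ.+ n))) (r i (⌜ d ⌝ * γ′)) (G.P-near γ′ 0≤γ′ P≤U d n (above-lo h) h′)
   where
   r = solve 2 (λ i a → # 104 :* i :+ a :+ # 104 :* i := # 208 :* i :+ a) refl

-- Convexity of p along triangular gaps

module Gaps where
 open QSeries hiding (Q; D; X; T; d)
 open PartialSums
 open import Data.Nat.Base
 open import Data.Nat.Properties
 open import Data.Nat.Solver using (module +-*-Solver)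
 open +-*-Solver using (solve; con; _:+_; _:*_; _:=_)

 P-∇₀ : ∀ n → P n ≡ sh 1 P n + ∇ n
 P-∇₀ zero = refl
 P-∇₀ (suc n) = P-∇ n

 sh-≤ : ∀ k n {f : Seq} {b} → (∀ m → k + m ≡ n → f m ≤ b) → sh k f n ≤ b
 sh-≤ zero n h = h n refl
 sh-≤ (suc k) zero h = z≤n
 sh-≤ (suc k) (suc n) h = sh-≤ k n λ m e → h m (cong suc e)

 ∇≤∇₂ : ∀ {m n} → m ≤ n → ∇ m ≤ ∇ (2 + n)
 ∇≤∇₂ h = ∇-mono₂ (+-monoʳ-≤ 2 h)

 -- A convex function lies above its tangents; starting at index 2 stays clear of the irregular ∇ 0.
 P-linear : ∀ k r → P (2 + r) + k * ∇ (2 + r) ≤ P (k + (2 + r))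
 P-linear zero r = ≤-reflexive (+-identityʳ _)
 P-linear (suc k) r = ≡≤ (e (P (2 + r)) (∇ (2 + r)) (k * ∇ (2 + r)))
  (≤≡ (+-mono-≤ (P-linear k r) (∇-mono (≤-trans (m≤n+m (2 + r) k) (n≤1+n _)))) (sym (P-∇ (k + (2 + r)))))
  where
  e = solve 3 (λ a b c → a :+ (b :+ c) := (a :+ c) :+ b) refl

 -- With the shift by 2, a chord of `P⁺` bounds the earlier ∇ at its left end for every index,
 -- including the irregular ∇ 0.
 P⁺ : Seq
 P⁺ n = P (2 + n)

 gap-difference : ∀ k k′ m → k ≤ k′ → k * sh k′ ∇ m + sh k′ P⁺ m ≤ P⁺ m
 gap-difference k k′ m k≤k′ = split (≤-<-connex k′ m)
  where
  e = solve 2 (λ k r → k :+ (con 2 :+ r) := con 2 :+ (k :+ r)) refl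
  at : ∀ r → k * sh k′ ∇ (k′ + r) + sh k′ P⁺ (k′ + r) ≤ P⁺ (k′ + r)
  at r = ≡≤ (trans (cong₂ (λ a b → k * a + b) (sh-≥ k′ ∇ r) (sh-≥ k′ P⁺ r)) (+-comm (k * ∇ r) _))
   (≤-trans (+-monoʳ-≤ (P⁺ r) (*-mono-≤ k≤k′ (∇≤∇₂ {r} ≤-refl))) (≤≡ (P-linear k′ r) (cong P (e k′ r))))
  split : k′ ≤ m ⊎ m < k′ → k * sh k′ ∇ m + sh k′ P⁺ m ≤ P⁺ m
  split (inj₁ k′≤m) = subst (λ m → k * sh k′ ∇ m + sh k′ P⁺ m ≤ P⁺ m) (m+[n∸m]≡n k′≤m) (at (m ∸ k′))
  split (inj₂ m<k′) = ≡≤ (trans (cong₂ (λ a b → k * a + b) (sh-< k′ ∇ m m<k′) (sh-< k′ P⁺ m m<k′)) (trans (+-identityʳ _) (*-zeroʳ k))) z≤n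

 -- The gap d above m is one shorter than the gap d + 1 below it, as between consecutive triangular
 -- numbers; ∇ m pays for the missing unit.
 convex : ∀ d m → P m + P m ≤ (P (d + m) + sh (suc d) P m) + ∇ m
 convex zero m = ≤-reflexive (trans (cong (P m +_) (P-∇₀ m)) (sym (+-assoc (P m) (sh 1 P m) (∇ m))))
 convex (suc d) m = ≤-trans (convex d m) (+-monoˡ-≤ (∇ m) (≤-trans (+-monoʳ-≤ (P (d + m)) step) (≤-reflexive (trans (e (P (d + m)) (∇ (suc d + m)) (sh (2 + d) P m))
   (cong (_+ sh (2 + d) P m) (sym (P-∇ (d + m))))))))
  where
  e = solve 3 (λ a b c → a :+ (b :+ c) := (a :+ b) :+ c) refl
  step : sh (suc d) P m ≤ ∇ (suc d + m) + sh (2 + d) P m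
  step = ≡≤ (trans (sh-cong (suc d) P-∇₀ m) (sh-⊕ (suc d) (sh 1 P) ∇ m))
   (≡≤ (+-comm (sh (suc d) (sh 1 P) m) _) (+-mono-≤
    (sh-≤ (suc d) m λ j e → ∇-mono₂ (≤-trans (s≤s (≤-trans (s≤s (m≤n+m j d)) (≡≤ e (m≤n+m m d)))) ≤-refl))
    (≤-reflexive (trans (sym (sh-+ (suc d) 1 P m)) (cong (λ k → sh k P m) (+-comm (suc d) 1))))))

 module Shifted (N ℓ : ℕ) where
  M : ℕ
  M = t (suc ℓ) + N

  open Compositions M public using (a; s; g; q; three-term; s≤a; a≤s)

  -- The offset between the triangular numbers of index i + ℓ and ℓ. Relative to it the sequence g
  -- becomes p(N - x i), with gaps ℓ + 1, ℓ + 2, ....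
  x : ℕ → ℕ
  x i = i * ℓ + t (suc i)

  x-suc : ∀ i → x (suc i) ≡ x i + (ℓ + suc i)
  x-suc i = e ℓ (i * ℓ) (t (suc i)) i
   where
   e = solve 4 (λ l a b i → (l :+ a) :+ (b :+ (con 1 :+ i)) := (a :+ b) :+ (l :+ (con 1 :+ i))) refl

  t-shift : ∀ i → t (suc (i + ℓ)) ≡ t (suc ℓ) + x i
  t-shift zero = sym (+-identityʳ _)
  t-shift (suc i) = trans (cong (_+ suc (i + ℓ)) (t-shift i)) (trans (e (t (suc ℓ)) (x i) i ℓ) (cong (t (suc ℓ) +_) (sym (x-suc i))))
   where
   e = solve 4 (λ a x i l → (a :+ x) :+ (con 1 :+ (i :+ l)) := a :+ (x :+ (l :+ (con 1 :+ i)))) refl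

  rebase : ∀ (f : Seq) i → sh (t (suc (i + ℓ))) f M ≡ sh (x i) f N
  rebase f i = trans (cong (λ k → sh k f M) (t-shift i)) (trans (sh-+ (t (suc ℓ)) (x i) f M) (sh-≥ (t (suc ℓ)) (sh (x i) f) N))

  G Q G⁺ : ℕ → ℕ
  G i = sh (x i) P N
  Q i = sh (x i) ∇ N
  G⁺ i = sh (x i) P⁺ N

  g≡G : ∀ i → g (i + ℓ) ≡ G i
  g≡G = rebase P

  q≡Q : ∀ i → q (i + ℓ) ≡ Q i
  q≡Q = rebase ∇

  D : ℕ
  D = ∇ (2 + N)

  Q≤D : ∀ i → Q i ≤ D
  Q≤D i = sh-≤ (x i) N λ m e → ∇≤∇₂ (≤≡ (m≤n+m m (x i)) e)

  sh-x : ∀ (f : Seq) i → sh (x (suc i)) f N ≡ sh (x i) (sh (ℓ + suc i) f) N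
  sh-x f i = trans (cong (λ k → sh k f N) (x-suc i)) (sh-+ (x i) (ℓ + suc i) f N)

  Q-difference : ∀ i → suc i * Q (suc i) + G⁺ (suc i) ≤ G⁺ i
  Q-difference i = ≤-trans (≤-reflexive (trans (cong₂ (λ a b → suc i * a + b) (sh-x ∇ i) (sh-x P⁺ i))
    (trans (cong (_+ sh (x i) (sh (ℓ + suc i) P⁺) N) (sym (sh-* (x i) (suc i) (sh (ℓ + suc i) ∇) N))) (sym (sh-⊕ (x i) _ _ N)))))
   (sh-mono (x i) (λ m → gap-difference (suc i) (ℓ + suc i) m (m≤n+m (suc i) ℓ)) N)

  -- The first w summands are bounded by D. Each later one carries a factor of at least w in
  -- `Q-difference`, whose right side telescopes.
  Q-sum : ∀ w K → w * Σ< K (λ i → Q (suc i)) ≤ w * (w * D) + P (2 + N)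
  Q-sum w K = ≤-trans (*-monoʳ-≤ w (≤-trans (m≤m+n _ _) (≡≤ (sym (Σ-append K w (λ i → Q (suc i)))) (≤-reflexive (cong (λ k → Σ< k (λ i → Q (suc i))) (+-comm K w))))))
   (≡≤ (trans (cong (w *_) (Σ-append w K (λ i → Q (suc i)))) (*-distribˡ-+ w _ _))
    (+-mono-≤ (*-monoʳ-≤ w (Σ-≤const w λ i _ → Q≤D (suc i))) (≤-trans (m≤m+n _ (G⁺ (w + K))) (≤-trans (tail K) (sh-antitone⁺ (x w))))))
   where
   sh-antitone⁺ : ∀ k → sh k P⁺ N ≤ P (2 + N)
   sh-antitone⁺ k = sh-antitone {0} {k} {P⁺} (λ n → P-increasing (2 + n)) z≤n N
   tail : ∀ K → w * Σ< K (λ r → Q (suc (w + r))) + G⁺ (w + K) ≤ G⁺ w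
   tail zero = ≤-reflexive (trans (cong (_+ G⁺ (w + 0)) (*-zeroʳ w)) (cong G⁺ (+-identityʳ w)))
   tail (suc K) = ≡≤ (trans (cong₂ (λ a b → a + G⁺ b) (*-distribˡ-+ w _ _) (+-suc w K)) (+-assoc (w * Σ< K (λ r → Q (suc (w + r)))) _ _))
    (≤-trans (+-monoʳ-≤ _ (≤-trans (+-monoˡ-≤ (G⁺ (suc (w + K))) (*-monoˡ-≤ (Q (suc (w + K))) (≤-trans (m≤m+n w K) (n≤1+n _)))) (Q-difference (w + K)))) (tail K))

  G-convex : ∀ i → G (suc i) + G (suc i) ≤ (G i + G (suc (suc i))) + Q (suc i)
  G-convex i = ≡≤ (trans (cong₂ _+_ (sh-x P i) (sh-x P i)) (sym (sh-⊕ (x i) _ _ N)))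
   (≤≡ (sh-mono (x i) base N) (trans (sh-⊕ (x i) _ _ N) (cong₂ _+_ (trans (sh-⊕ (x i) P (sh d (sh (suc d) P)) N) (cong (G i +_) G₂)) (sym (sh-x ∇ i)))))
   where
   d = ℓ + suc i
   G₂ : sh (x i) (sh d (sh (suc d) P)) N ≡ G (suc (suc i))
   G₂ = sym (trans (sh-x P (suc i)) (trans (cong (λ k → sh (x (suc i)) (sh k P) N) (+-suc ℓ (suc i))) (sh-x (sh (suc d) P) i)))
   base : ∀ n → sh d P n + sh d P n ≤ (P n + sh d (sh (suc d) P) n) + sh d ∇ n
   base n = go (≤-<-connex d n)
    where
    go : d ≤ n ⊎ n < d → sh d P n + sh d P n ≤ (P n + sh d (sh (suc d) P) n) + sh d ∇ n
    go (inj₂ n<d) = ≡≤ (cong₂ _+_ (sh-< d P n n<d) (sh-< d P n n<d)) z≤n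
    go (inj₁ d≤n) = subst (λ n → sh d P n + sh d P n ≤ (P n + sh d (sh (suc d) P) n) + sh d ∇ n) (m+[n∸m]≡n d≤n) (at (n ∸ d))
     where
     at : ∀ m → sh d P (d + m) + sh d P (d + m) ≤ (P (d + m) + sh d (sh (suc d) P) (d + m)) + sh d ∇ (d + m)
     at m = ≡≤ (cong₂ _+_ (sh-≥ d P m) (sh-≥ d P m)) (≤≡ (convex d m) (cong₂ _+_ (cong (P (d + m) +_) (sym (sh-≥ d (sh (suc d) P) m))) (sym (sh-≥ d ∇ m))))

  G-antitone : ∀ {i j} → x i ≤ x j → G j ≤ G i
  G-antitone h = sh-antitone P-increasing h N

  x-mono : ∀ i → x i ≤ x (suc i)
  x-mono i = ≤≡ (m≤m+n (x i) (ℓ + suc i)) (sym (x-suc i))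

  G-step : ∀ i → G (suc i) ≤ G i
  G-step i = G-antitone {i} {suc i} (x-mono i)

  G-first : P N ≤ G 1 + suc ℓ * D
  G-first = ≤≡ (go (suc ℓ)) (cong (λ k → sh k P N + suc ℓ * D) e)
   where
   e : suc ℓ ≡ x 1
   e = trans (+-comm 1 ℓ) (cong (_+ 1) (sym (+-identityʳ ℓ)))
   go : ∀ k → P N ≤ sh k P N + k * D
   go zero = ≤-reflexive (sym (+-identityʳ _))
   go (suc k) = ≤-trans (go k) (≤-trans (+-monoˡ-≤ (k * D) (≡≤ (trans (sh-cong k P-∇₀ N) (sh-⊕ k (sh 1 P) ∇ N))
     (+-mono-≤ (≤-reflexive (trans (sym (sh-+ k 1 P N)) (cong (λ j → sh j P N) (+-comm k 1)))) (sh-≤ k N λ m e → ∇≤∇₂ (≤≡ (m≤n+m m k) e)))))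
    (≤-reflexive (+-assoc (sh (suc k) P N) D (k * D))))

  G-vanish : ∀ i → N < i → G i ≡ 0
  G-vanish (suc i) h = sh-< (x (suc i)) P N (<-≤-trans h (≤-trans (m≤n+m (suc i) (t (suc i))) (m≤n+m _ (suc i * ℓ))))

  -- The sum of the G's is a lower Riemann sum for S.
  G-sum : ∀ b → suc b ≤ ℓ → ∀ k → suc b * Σ< k (λ i → G (suc i)) ≤ S N
  G-sum b b<ℓ k = ≤-trans (*-monoʳ-≤ (suc b) (≤-trans (part k) (Σ-mono N λ i → sh-antitone P-increasing (le i) N))) (gaps≤S N b)
   where
   le : ∀ i → suc b * suc i ≤ x (suc i)
   le i = ≤-trans (*-monoˡ-≤ (suc i) b<ℓ) (≡≤ (*-comm ℓ (suc i)) (m≤m+n _ _))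
   g₀ : ℕ → ℕ
   g₀ i = G (suc i)
   beyond : ∀ j → Σ< (N + j) g₀ ≡ Σ< N g₀
   beyond zero = cong (λ k → Σ< k g₀) (+-identityʳ N)
   beyond (suc j) = trans (cong (λ k → Σ< k g₀) (+-suc N j)) (trans (cong₂ _+_ (beyond j) (G-vanish (suc (N + j)) (s≤s (m≤m+n N j)))) (+-identityʳ _))
   part : ∀ k → Σ< k g₀ ≤ Σ< N g₀
   part k = ≤-trans (m≤m+n _ _) (≡≤ (trans (sym (Σ-append k N g₀)) (cong (λ j → Σ< j g₀) (+-comm k N))) (≤-reflexive (beyond k)))

-- Solving the recurrence uniformly in the rank

module UniformRank where
 open QSeries using (P; ∇; Σ<; sh; sh-≥; t)
 open PartialSums using (S; tP≤U; sP≤S)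
 open Gaps using (module Shifted; P-linear)
 open Rationals
 open LocalGrowth
 open ZetaSums
 open Scales
 open import Data.Integer.Base using (+_)
 open import Data.Rational.Properties
 open ≤-Reasoning

 -- B solves B i + B (i+1) + B (i+2) = G i + G (i+1) up to an error controlled by Q.
 module Recurrence (B G s Q : ℕ → ℚ) (0≤B : ∀ i → 0ℚ ≤ B i) (0≤s : ∀ i → 0ℚ ≤ s i) (0≤G : ∀ i → 0ℚ ≤ G i) (0≤Q : ∀ i → 0ℚ ≤ Q i)
  (three : ∀ i → B i + B (2 ℕ.+ i) + s (1 ℕ.+ i) ≡ G i + G (1 ℕ.+ i)) (s≤B : ∀ i → s (1 ℕ.+ i) ≤ B (1 ℕ.+ i))
  (B≤s : ∀ i → B i ≤ s i + (Q (1 ℕ.+ i) + Q (2 ℕ.+ i))) (z : ℚ) (0≤z : 0ℚ ≤ z) (z≤1 : z ≤ 1ℚ) where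

  c : ℚ
  c = 1ℚ + z + z * z

  0≤c : 0ℚ ≤ c
  0≤c = 0≤+ (0≤+ 0≤1 0≤z) (0≤* 0≤z 0≤z)

  zz≤1 : z * z ≤ 1ℚ
  zz≤1 = ≤≡ (*-mono 0≤1 0≤z z≤1 z≤1) (*-identityˡ 1ℚ)

  c≤3 : c ≤ 3ℚ
  c≤3 = +-mono-≤ (+-mono-≤ (≤-refl {1ℚ}) z≤1) zz≤1

  -- `X` is the deviation from the geometric solution, cleared of its denominator; `w` are the
  -- increments of G, and `v` vanishes where they have ratio z.
  X w v : ℕ → ℚ
  X i = c * B i - (1ℚ + z) * G i
  w i = G i - G (suc i)
  v i = z * w i - w (suc i)

  cost : ℕ → ℚ
  cost i = 2ℚ * ∣ v i ∣ + 3ℚ * (Q (2 ℕ.+ i) + Q (3 ℕ.+ i))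

  0≤cost : ∀ i → 0ℚ ≤ cost i
  0≤cost i = 0≤+ (0≤* 0≤2 (0≤∣p∣ (v i))) (0≤* 0≤3 (0≤+ (0≤Q (2 ℕ.+ i)) (0≤Q (3 ℕ.+ i))))

  private
   e : ℕ → ℚ
   e i = B (suc i) - s (suc i)

   e-abs : ∀ i → ∣ e i ∣ ≤ Q (2 ℕ.+ i) + Q (3 ℕ.+ i)
   e-abs i = ∣≥0∣ (sub≥0 (s≤B i)) (by _ (sub≥0 (B≤s (suc i))) (r (B (suc i)) (s (suc i)) (Q (2 ℕ.+ i) + Q (3 ℕ.+ i))))
    where
    r = solve 3 (λ b s q → b :- s :+ (s :+ q :- b) := q) refl

   -- Two consecutive relations, with s replaced by B up to the defects `e`, leave B(i) - B(i+3)
   -- after subtraction, since 1 + x + x² divides 1 - x³.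
   X-step : ∀ i → X i ≡ X (3 ℕ.+ i) + (z * v i + (1ℚ + z) * v (suc i) + c * (e i - e (suc i)))
   X-step i = trans (r (B i) (B (1 ℕ.+ i)) (B (2 ℕ.+ i)) (B (3 ℕ.+ i)) (s (1 ℕ.+ i)) (s (2 ℕ.+ i)) (G i) (G (1 ℕ.+ i)) (G (2 ℕ.+ i)) (G (3 ℕ.+ i)) z)
     (trans (cong₂ (λ a b → X (3 ℕ.+ i) + (z * v i + (1ℚ + z) * v (suc i) + c * (e i - e (suc i))) + c * (a - (G i + G (1 ℕ.+ i))) - c * (b - (G (1 ℕ.+ i) + G (2 ℕ.+ i))))
      (three i) (three (suc i))) (r₂ (X (3 ℕ.+ i) + (z * v i + (1ℚ + z) * v (suc i) + c * (e i - e (suc i)))) c (G i + G (1 ℕ.+ i)) (G (1 ℕ.+ i) + G (2 ℕ.+ i))))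
    where
    r₂ = solve 4 (λ x c a b → x :+ c :* (a :- a) :- c :* (b :- b) := x) refl
    r = solve 11 (λ b₀ b₁ b₂ b₃ s₁ s₂ g₀ g₁ g₂ g₃ z → (:1 :+ z :+ z :* z) :* b₀ :- (:1 :+ z) :* g₀ := ((:1 :+ z :+ z :* z) :* b₃ :- (:1 :+ z) :* g₃) :+ (z :* (z :* (g₀ :- g₁) :- (g₁ :- g₂)) :+ (:1 :+ z) :* (z :* (g₁ :- g₂) :- (g₂ :- g₃)) :+ (:1 :+ z :+ z :* z) :* ((b₁ :- s₁) :- (b₂ :- s₂))) :+ (:1 :+ z :+ z :* z) :* (b₀ :+ b₂ :+ s₁ :- (g₀ :+ g₁)) :- (:1 :+ z :+ z :* z) :* (b₁ :+ b₃ :+ s₂ :- (g₁ :+ g₂))) refl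

   X-bound : ∀ i → ∣ X i ∣ ≤ ∣ X (3 ℕ.+ i) ∣ + (cost i + cost (1 ℕ.+ i) + cost (2 ℕ.+ i))
   X-bound i = ≡≤ (cong ∣_∣ (X-step i)) (∣+∣ {X (3 ℕ.+ i)} ≤-refl (≤-trans (∣+∣ {z * v i + (1ℚ + z) * v (suc i)}
     (∣+∣ {z * v i} (∣*∣ 0≤z ≤-refl) (∣*∣ {1ℚ + z} (0≤+ 0≤1 0≤z) ≤-refl)) (∣*∣ 0≤c (∣-∣ {e i} (e-abs i) (e-abs (suc i)))))
     (≤-trans (+-mono-≤ (+-mono-≤ (*-monoʳ (0≤∣p∣ (v i)) (≤-trans z≤1 (⌜⌝-mono {1} {2} (ℕ.n≤1+n 1)))) (*-monoʳ (0≤∣p∣ (v (suc i))) (+-monoʳ-≤ 1ℚ z≤1)))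
           (*-monoʳ (0≤+ (0≤+ (0≤Q (2 ℕ.+ i)) (0≤Q (3 ℕ.+ i))) (0≤+ (0≤Q (3 ℕ.+ i)) (0≤Q (4 ℕ.+ i)))) c≤3))
      (by (cost (2 ℕ.+ i)) (0≤cost (2 ℕ.+ i)) (r ∣ v i ∣ ∣ v (suc i) ∣ (Q (2 ℕ.+ i) + Q (3 ℕ.+ i)) (Q (3 ℕ.+ i) + Q (4 ℕ.+ i)) (cost (2 ℕ.+ i)))))))
    where
    r = solve 5 (λ a b p q x → # 2 :* a :+ # 2 :* b :+ # 3 :* (p :+ q) :+ x := # 2 :* a :+ # 3 :* p :+ (# 2 :* b :+ # 3 :* q) :+ x) refl

  telescoped : ∀ J → ∣ X 0 ∣ ≤ ∣ X (J ℕ.* 3) ∣ + ∑< (J ℕ.* 3) cost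
  telescoped zero = ≤-reflexive (sym (+-identityʳ ∣ X 0 ∣))
  telescoped (suc J) = ≤-trans (telescoped J) (≤-trans (+-monoˡ-≤ (∑< (J ℕ.* 3) cost) (X-bound (J ℕ.* 3)))
   (≤-reflexive (r ∣ X (3 ℕ.+ J ℕ.* 3) ∣ (cost (J ℕ.* 3)) (cost (1 ℕ.+ J ℕ.* 3)) (cost (2 ℕ.+ J ℕ.* 3)) (∑< (J ℕ.* 3) cost))))
   where
   r = solve 5 (λ x a b c s → x :+ (a :+ b :+ c) :+ s := x :+ (s :+ a :+ b :+ c)) refl

  X-vanish : ∀ k → G k ≡ 0ℚ → G (suc k) ≡ 0ℚ → X k ≡ 0ℚ
  X-vanish k g g′ = trans (cong₂ (λ a b → c * a - (1ℚ + z) * b) B≡0 g) (r c z)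
   where
   r = solve 2 (λ c z → c :* :0 :- (:1 :+ z) :* :0 := :0) refl
   B≡0 : B k ≡ 0ℚ
   B≡0 = ≤-antisym (≤≡ (p≤p+q (B k) (0≤+ (0≤B (2 ℕ.+ k)) (0≤s (1 ℕ.+ k)))) (trans (sym (+-assoc (B k) _ _)) (trans (three k) (cong₂ _+_ g g′)))) (0≤B k)

  X-sum : ∀ J → G (J ℕ.* 3) ≡ 0ℚ → G (suc (J ℕ.* 3)) ≡ 0ℚ →
   ∣ X 0 ∣ ≤ 2ℚ * ∑< (J ℕ.* 3) (λ i → ∣ v i ∣) + 6ℚ * ∑< (2 ℕ.+ J ℕ.* 3) (λ i → Q (suc i))
  X-sum J g g′ = begin
   ∣ X 0 ∣ ≤⟨ telescoped J ⟩
   ∣ X K ∣ + ∑< K cost ≡⟨ cong₂ (λ a b → ∣ a ∣ + b) (X-vanish K g g′) (trans (∑-+ K _ _) (cong₂ _+_ (∑-* K 2ℚ _) (trans (∑-* K 3ℚ _) (cong (3ℚ *_) (∑-+ K _ _))))) ⟩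
   0ℚ + (2ℚ * ∑< K (λ i → ∣ v i ∣) + 3ℚ * (∑< K (λ i → Q (2 ℕ.+ i)) + ∑< K (λ i → Q (3 ℕ.+ i)))) ≡⟨ +-identityˡ _ ⟩
   2ℚ * ∑< K (λ i → ∣ v i ∣) + 3ℚ * (∑< K (λ i → Q (2 ℕ.+ i)) + ∑< K (λ i → Q (3 ℕ.+ i)))
    ≤⟨ +-monoʳ-≤ (2ℚ * ∑< K (λ i → ∣ v i ∣)) (*-monoˡ 0≤3 (+-mono-≤ (≤-trans le₁ (p≤p+q _ (0≤Q (2 ℕ.+ K)))) le₂)) ⟩
   2ℚ * ∑< K (λ i → ∣ v i ∣) + 3ℚ * (∑< (2 ℕ.+ K) (λ i → Q (suc i)) + ∑< (2 ℕ.+ K) (λ i → Q (suc i))) ≡⟨ r (∑< K (λ i → ∣ v i ∣)) (∑< (2 ℕ.+ K) (λ i → Q (suc i))) ⟩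
   2ℚ * ∑< K (λ i → ∣ v i ∣) + 6ℚ * ∑< (2 ℕ.+ K) (λ i → Q (suc i)) ∎
   where
   K = J ℕ.* 3
   r = solve 2 (λ a b → # 2 :* a :+ # 3 :* (b :+ b) := # 2 :* a :+ # 6 :* b) refl
   drop-head : ∀ k (f : ℕ → ℚ) → (∀ i → 0ℚ ≤ f i) → ∑< k (f ∘ suc) ≤ ∑< (suc k) f
   drop-head k f h = ≤≡ (by (f 0) (h 0) (+-comm (∑< k (f ∘ suc)) (f 0))) (sym (∑-head k f))
   le₁ : ∑< K (λ i → Q (2 ℕ.+ i)) ≤ ∑< (1 ℕ.+ K) (λ i → Q (suc i))
   le₁ = drop-head K (λ i → Q (suc i)) (λ i → 0≤Q (suc i))
   le₂ : ∑< K (λ i → Q (3 ℕ.+ i)) ≤ ∑< (2 ℕ.+ K) (λ i → Q (suc i))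
   le₂ = ≤-trans (drop-head K (λ i → Q (2 ℕ.+ i)) (λ i → 0≤Q (2 ℕ.+ i))) (drop-head (1 ℕ.+ K) (λ i → Q (suc i)) (λ i → 0≤Q (suc i)))

  B₀≤ : (∀ i → G (suc i) ≤ G i) → B 0 ≤ 2ℚ * G 0
  B₀≤ h = ≤-trans (p≤p+q (B 0) (0≤+ (0≤B 2) (0≤s 1))) (≡≤ (trans (sym (+-assoc (B 0) _ _)) (three 0)) (≤≡ (+-monoʳ-≤ (G 0) (h 0)) (r (G 0))))
   where
   r = solve 1 (λ a → a :+ a := # 2 :* a) refl

  -- The total variation of the increments is a telescoping sum, up to Q.
  variation : (∀ i → w (suc i) ≤ w i + Q (suc i)) → z ≡ 1ℚ → ∀ K → ∑< K (λ i → ∣ v i ∣) ≤ w 0 - w K + 2ℚ * ∑< K (λ i → Q (suc i))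
  variation h refl zero = ≤-reflexive (r (w 0))
   where
   r = solve 1 (λ a → :0 := a :- a :+ # 2 :* :0) refl
  variation h refl (suc K) = ≤≡ (+-mono-≤ (variation h refl K) one-step) (r (w 0) (w K) (w (suc K)) (Q (suc K)) (∑< K (λ i → Q (suc i))))
   where
   r = solve 5 (λ a b c q s → a :- b :+ # 2 :* s :+ (b :- c :+ # 2 :* q) := a :- c :+ # 2 :* (s :+ q)) refl
   one-step : ∣ v K ∣ ≤ w K - w (suc K) + 2ℚ * Q (suc K)
   one-step = ∣∣≤ (by (2ℚ * Q (suc K)) (0≤* 0≤2 (0≤Q (suc K))) (r₁ (w K) (w (suc K)) (Q (suc K))))
           (by (2ℚ * (w K + Q (suc K) - w (suc K))) (0≤* 0≤2 (sub≥0 (h K))) (r₂ (w K) (w (suc K)) (Q (suc K))))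
    where
    r₁ = solve 3 (λ a b q → :1 :* a :- b :+ # 2 :* q := a :- b :+ # 2 :* q) refl
    r₂ = solve 3 (λ a b q → :- (:1 :* a :- b) :+ # 2 :* (a :+ q :- b) := a :- b :+ # 2 :* q) refl

  0≤w : (∀ i → G (suc i) ≤ G i) → ∀ i → 0ℚ ≤ w i
  0≤w h i = sub≥0 (h i)

  tail-variation : (∀ i → G (suc i) ≤ G i) → ∀ I K → ∑< K (λ r → ∣ v (I ℕ.+ r) ∣) ≤ (G I - G (I ℕ.+ K)) + (G (suc I) - G (suc (I ℕ.+ K)))
  tail-variation h I zero = ≤-reflexive (trans (r (G I) (G (suc I))) (cong (λ k → (G I - G k) + (G (suc I) - G (suc k))) (sym (ℕ.+-identityʳ I))))
   where
   r = solve 2 (λ a b → :0 := (a :- a) :+ (b :- b)) refl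
  tail-variation h I (suc K) = ≤-trans (+-mono-≤ (tail-variation h I K) (∣-∣ {z * w i} (∣≥0∣ (0≤* 0≤z (0≤w h i)) (≤≡ (*-monoʳ (0≤w h i) z≤1) (*-identityˡ (w i)))) (∣≥0∣ (0≤w h (suc i)) ≤-refl)))
    (≤-reflexive (trans (r (G I) (G i) (G (suc I)) (G (suc i)) (G (suc (suc i)))) (cong (λ k → (G I - G k) + (G (suc I) - G (suc k))) (sym (ℕ.+-suc I K)))))
   where
   i = I ℕ.+ K
   r = solve 5 (λ a b c d e → (a :- b) :+ (c :- d) :+ ((b :- d) :+ (d :- e)) := (a :- d) :+ (c :- e)) refl

  -- Below I the values G are compared with the ratio z; from I on the increments are bounded by
  -- their size, which telescopes to multiples of G(I).
  cut-variation : (∀ i → G (suc i) ≤ G i) → ∀ I K → ∑< (I ℕ.+ K) (λ i → ∣ v i ∣) ≤ 2ℚ * ∑< I (λ i → ∣ z * G i - G (suc i) ∣) + 4ℚ * G I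
  cut-variation h I K = begin
   ∑< (I ℕ.+ K) (λ i → ∣ v i ∣) ≡⟨ ∑-append I K _ ⟩
   ∑< I (λ i → ∣ v i ∣) + ∑< K (λ r → ∣ v (I ℕ.+ r) ∣) ≤⟨ +-mono-≤ (∑-mono I λ i → ≡≤ (cong ∣_∣ (r₁ (G i) (G (suc i)) (G (suc (suc i))) z)) (∣-∣ {u i} ≤-refl ≤-refl)) (tail-variation h I K) ⟩
   ∑< I (λ i → ∣ u i ∣ + ∣ u (suc i) ∣) + ((G I - G (I ℕ.+ K)) + (G (suc I) - G (suc (I ℕ.+ K))))
    ≤⟨ +-mono-≤ (≤-reflexive (∑-+ I _ _)) (+-mono-≤ (sub-≤ {G I} (0≤G (I ℕ.+ K))) (≤-trans (sub-≤ {G (suc I)} (0≤G (suc (I ℕ.+ K)))) (h I))) ⟩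
   ∑< I (λ i → ∣ u i ∣) + ∑< I (λ i → ∣ u (suc i) ∣) + (G I + G I)
    ≤⟨ +-monoˡ-≤ (G I + G I) (+-monoʳ-≤ (∑< I (λ i → ∣ u i ∣)) (≤-trans (by ∣ u 0 ∣ (0≤∣p∣ (u 0)) (trans (+-comm (∑< I (λ i → ∣ u (suc i) ∣)) ∣ u 0 ∣) (sym (∑-head I (λ i → ∣ u i ∣))))) (+-monoʳ-≤ (∑< I (λ i → ∣ u i ∣)) uI))) ⟩
   ∑< I (λ i → ∣ u i ∣) + (∑< I (λ i → ∣ u i ∣) + (G I + G I)) + (G I + G I) ≡⟨ r₂ (∑< I (λ i → ∣ u i ∣)) (G I) ⟩
   2ℚ * ∑< I (λ i → ∣ u i ∣) + 4ℚ * G I ∎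
   where
   u : ℕ → ℚ
   u i = z * G i - G (suc i)
   r₁ = solve 4 (λ a b c z → z :* (a :- b) :- (b :- c) := (z :* a :- b) :- (z :* b :- c)) refl
   r₂ = solve 2 (λ s g → s :+ (s :+ (g :+ g)) :+ (g :+ g) := # 2 :* s :+ # 4 :* g) refl
   uI : ∣ u I ∣ ≤ G I + G I
   uI = ∣-∣ {z * G I} (∣≥0∣ (0≤* 0≤z (0≤G I)) (≤≡ (*-monoʳ (0≤G I) z≤1) (*-identityˡ (G I)))) (∣≥0∣ (0≤G (suc I)) (h I))

 module Core (set : Setting) where
  open Setting set
  open Scale set public

  ι200 : ι * ⌜ 200 ⌝ ≤ 1ℚ
  ι200 = ≤≡ (*-monoˡ 0≤ι (⌜⌝-mono 200≤w)) (trans (*-comm ι ω) ωι)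

  i40000 : i * ⌜ 40000 ⌝ ≤ 1ℚ
  i40000 = ≡≤ (r ι) (≤≡ (*-mono 0≤1 (0≤* 0≤ι (0≤⌜⌝ 200)) ι200 ι200) (*-identityˡ 1ℚ))
   where
   r = solve 1 (λ a → a :* a :* # 40000 := a :* # 200 :* (a :* # 200)) refl

  ι≤1 : ι ≤ 1ℚ
  ι≤1 = inv≤1 (ℕ.pred w)

  ωi : ω * i ≡ ι
  ωi = trans (sym (*-assoc ω ι ι)) (trans (cong (_* ι) ωι) (*-identityˡ ι))

  -- The threshold w³ between the regimes: for ℓ ≤ w³ the ratio y^ℓ is within O(1/w) of 1, and for ℓ
  -- ≥ w³ the sum of the G is of order w p.
  h : ℕ
  h = w ℕ.* w² w

  cast-h : ⌜ h ⌝ ≡ ω * o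
  cast-h = trans (⌜*⌝ w (w² w)) (cong (ω *_) cast²)

  ωωo : ω * (ω * o) ≡ X
  ωωo = sym (*-assoc ω ω o)

  ωoθ : ω * o * θ ≡ ι * T
  ωoθ = trans (sym (*-identityˡ (ω * o * θ))) (trans (cong (_* (ω * o * θ)) (sym ωι)) (r ω ι θ))
   where
   r = solve 3 (λ ω ι θ → ω :* ι :* (ω :* (ω :* ω) :* θ) := ι :* (θ :* (ω :* ω :* (ω :* ω)))) refl

  2≤h : 2 ℕ.≤ h
  2≤h = ℕ.≤-trans (ℕ.m≤m+n 2 _) (ℕ.*-mono-≤ 200≤w (ℕ.*-mono-≤ 200≤w 200≤w))

  h+2≤w⁶ : h ℕ.+ 2 ℕ.≤ w⁶ w
  h+2≤w⁶ = ℕ.≤-trans (ℕ.+-monoʳ-≤ h 2≤h) (ℕ≤≡ (ℕ≡≤ (e₁ h) (ℕ.*-monoˡ-≤ h 2≤h)) (e₂ w))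
   where
   e₁ : ∀ a → a ℕ.+ a ≡ 2 ℕ.* a
   e₁ = ℕ-Ring.solve-∀
   e₂ : ∀ w → (w ℕ.* (w ℕ.* w)) ℕ.* (w ℕ.* (w ℕ.* w)) ≡ (w ℕ.* w ℕ.* (w ℕ.* w)) ℕ.* (w ℕ.* w)
   e₂ = ℕ-Ring.solve-∀

  module Centre (n : ℕ) (n≥ : N ℕ.≤ w⁶ w ℕ.+ n) (n≤ : n ℕ.≤ N) where
   private
    m = h ℕ.+ (2 ℕ.+ n)
    m≤hi : m ℕ.≤ hi
    m≤hi = ℕ≡≤ (sym (ℕ.+-assoc h 2 n)) (ℕ≤≡ (ℕ.+-mono-≤ h+2≤w⁶ n≤) (ℕ.+-comm (w⁶ w) N))

   p̂m≤ : p̂ m ≤ 2ℚ * p̂ n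
   p̂m≤ = subst (λ k → p̂ k ≤ 2ℚ * p̂ n) (ℕ.+-assoc h 2 n) (by
     (2ℚ * (p̂ n + κ * p̂ d - z * p̂ d) + 2ℚ * ((z - (1ℚ - ⌜ h ℕ.+ 2 ⌝ * θ)) * p̂ d) + 2ℚ * ((⌜ 1 ⌝ * ½ - (⌜ h ℕ.+ 2 ⌝ * θ + κ)) * p̂ d))
     (0≤+ (0≤+ (0≤* 0≤2 (sub≥0 (close⁻ʳ {p̂ n} {z * p̂ d} (ratio (h ℕ.+ 2) n n≥ (subst (ℕ._≤ hi) (sym (ℕ.+-assoc h 2 n)) m≤hi)))))
          (0≤* 0≤2 (0≤* (sub≥0 (pow-lower 0≤θ yθ 0≤y (h ℕ.+ 2))) (0≤p̂ d))))
        (0≤* 0≤2 (0≤* (sub≥0 small′) (0≤p̂ d))))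
     (r (p̂ n) (p̂ d) z (⌜ h ℕ.+ 2 ⌝ * θ) κ))
    where
    d = h ℕ.+ 2 ℕ.+ n
    z = pow y (h ℕ.+ 2)
    r = solve 5 (λ p q z a k → q :+ (# 2 :* (p :+ k :* q :- z :* q) :+ # 2 :* ((z :- (:1 :- a)) :* q) :+ # 2 :* ((# 1 :* :½ :- (a :+ k)) :* q)) := # 2 :* p) refl
    small′ : ⌜ h ℕ.+ 2 ⌝ * θ + κ ≤ ⌜ 1 ⌝ * ½
    small′ = begin
     ⌜ h ℕ.+ 2 ⌝ * θ + κ ≤⟨ +-monoˡ-≤ κ (*-monoʳ 0≤θ (≤≡ (⌜⌝-mono (ℕ.+-monoʳ-≤ h 2≤h)) (trans (⌜+⌝ h h) (cong (λ a → a + a) cast-h)))) ⟩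
     (ω * o + ω * o) * θ + κ ≡⟨ cong (_+ κ) (trans (*-distribʳ-+ θ (ω * o) (ω * o)) (cong (λ a → a + a) ωoθ)) ⟩
     ι * T + ι * T + κ ≤⟨ by ((ι + ι) * (2ℚ - T) + ¼′ * (1ℚ - ι * ⌜ 200 ⌝) + ¼′ * (1ℚ - i * ⌜ 40000 ⌝) + ⌜ 46 ⌝ * ι + ⌜ 448 ⌝ * i)
                            (0≤+ (0≤+ (0≤+ (0≤+ (0≤* (0≤+ 0≤ι 0≤ι) (sub≥0 T≤2)) (0≤* 0≤¼ (sub≥0 ι200))) (0≤* 0≤¼ (sub≥0 i40000))) (0≤* (0≤⌜⌝ 46) 0≤ι)) (0≤* (0≤⌜⌝ 448) 0≤i)) (r₂ ι T i) ⟩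
     ⌜ 1 ⌝ * ½ ∎
     where
     ¼′ : ℚ
     ¼′ = ½ * ½
     0≤¼ : 0ℚ ≤ ¼′
     0≤¼ = <⇒≤ (positive⁻¹ (½ * ½))
     r₂ = solve 3 (λ ι T i → ι :* T :+ ι :* T :+ # 9552 :* i :+ ((ι :+ ι) :* (# 2 :- T) :+ (:½ :* :½) :* (:1 :- ι :* # 200) :+ (:½ :* :½) :* (:1 :- i :* # 40000) :+ # 46 :* ι :+ # 448 :* i) := # 1 :* :½) refl

   p̂2≤ : p̂ (2 ℕ.+ n) ≤ 2ℚ * p̂ n
   p̂2≤ = ≤-trans (p̂-mono h (2 ℕ.+ n)) p̂m≤

   D̂ : ℚ
   D̂ = ⌜ ∇ (2 ℕ.+ n) ⌝

   0≤D̂ : 0ℚ ≤ D̂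
   0≤D̂ = 0≤⌜⌝ (∇ (2 ℕ.+ n))

   -- By convexity the difference is at most the mean slope over the next w³ steps. On that stretch
   -- p grows by a factor 1 + O(1/w), and the error κ = O(w^(-2)) is of smaller order.
   XD≤ : X * D̂ ≤ ⌜ 19108 ⌝ * p̂ n
   XD≤ = begin
    X * D̂ ≡⟨ trans (cong (_* D̂) (sym ωωo)) (trans (*-assoc ω (ω * o) D̂) (cong (λ a → ω * (a * D̂)) (sym cast-h))) ⟩
    ω * (⌜ h ⌝ * D̂) ≤⟨ *-monoˡ 0≤ω hD ⟩
    ω * ((⌜ h ⌝ * θ + κ) * p̂ m) ≡⟨ trans (cong (λ a → ω * ((a * θ + κ) * p̂ m)) cast-h) (trans (r₁ ω o θ i (p̂ m)) (cong₂ (λ a b → (θ * a + ⌜ 9552 ⌝ * b) * p̂ m) ωωo ωi)) ⟩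
    (T + ⌜ 9552 ⌝ * ι) * p̂ m ≤⟨ *-mono {T + ⌜ 9552 ⌝ * ι} {2ℚ + ⌜ 9552 ⌝ * 1ℚ} (0≤+ 0≤2 (0≤* (0≤⌜⌝ 9552) 0≤1)) (0≤p̂ m) (+-mono-≤ T≤2 (*-monoˡ (0≤⌜⌝ 9552) ι≤1)) p̂m≤ ⟩
    (2ℚ + ⌜ 9552 ⌝ * 1ℚ) * (2ℚ * p̂ n) ≡⟨ r₂ (p̂ n) ⟩
    ⌜ 19108 ⌝ * p̂ n ∎
    where
    r₁ = solve 5 (λ ω o θ i p → ω :* ((ω :* o :* θ :+ # 9552 :* i) :* p) := (θ :* (ω :* (ω :* o)) :+ # 9552 :* (ω :* i)) :* p) refl
    r₂ = solve 1 (λ p → (# 2 :+ # 9552 :* :1) :* (# 2 :* p) := # 19108 :* p) refl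
    z = pow y h
    hD : ⌜ h ⌝ * D̂ ≤ (⌜ h ⌝ * θ + κ) * p̂ m
    hD = by ((p̂ m - (p̂ (2 ℕ.+ n) + ⌜ h ⌝ * D̂)) + (p̂ (2 ℕ.+ n) + κ * p̂ m - z * p̂ m) + (z - (1ℚ - ⌜ h ⌝ * θ)) * p̂ m)
     (0≤+ (0≤+ (sub≥0 (≡≤ (trans (cong (λ a → p̂ (2 ℕ.+ n) + a) (sym (⌜*⌝ h (∇ (2 ℕ.+ n))))) (sym (⌜+⌝ (P (2 ℕ.+ n)) _))) (⌜⌝-mono (P-linear h n))))
          (sub≥0 (close⁻ʳ {p̂ (2 ℕ.+ n)} {z * p̂ m} (ratio h (2 ℕ.+ n) (ℕ.≤-trans n≥ (ℕ.+-monoʳ-≤ (w⁶ w) (ℕ.m≤n+m n 2))) m≤hi))))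
        (0≤* (sub≥0 (pow-lower 0≤θ yθ 0≤y h)) (0≤p̂ m)))
     (r (p̂ m) (p̂ (2 ℕ.+ n)) (⌜ h ⌝ * D̂) κ z (⌜ h ⌝ * θ))
     where
     r = solve 6 (λ a b d k z e → d :+ ((a :- (b :+ d)) :+ (b :+ k :* a :- z :* a) :+ (z :- (:1 :- e)) :* a) := (e :+ k) :* a) refl

   module Rank (ℓ : ℕ) where
    open Shifted n ℓ renaming (x to xs; G to Gℕ; Q to Qℕ)

    B Ĝ ŝ Q̂ : ℕ → ℚ
    B i = ⌜ a (i ℕ.+ ℓ) ⌝
    Ĝ i = ⌜ Gℕ i ⌝
    ŝ i = ⌜ s (i ℕ.+ ℓ) ⌝
    Q̂ i = ⌜ Qℕ i ⌝

    three : ∀ i → B i + B (2 ℕ.+ i) + ŝ (1 ℕ.+ i) ≡ Ĝ i + Ĝ (1 ℕ.+ i)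
    three i = trans (trans (cong (_+ ŝ (1 ℕ.+ i)) (sym (⌜+⌝ (a (i ℕ.+ ℓ)) _))) (sym (⌜+⌝ (a (i ℕ.+ ℓ) ℕ.+ a (2 ℕ.+ i ℕ.+ ℓ)) _)))
     (trans (cong ⌜_⌝ (trans (three-term (i ℕ.+ ℓ)) (cong₂ ℕ._+_ (g≡G i) (g≡G (suc i))))) (⌜+⌝ (Gℕ i) (Gℕ (suc i))))

    s≤B : ∀ i → ŝ (1 ℕ.+ i) ≤ B (1 ℕ.+ i)
    s≤B i = ⌜⌝-mono (s≤a (i ℕ.+ ℓ))

    B≤s : ∀ i → B i ≤ ŝ i + (Q̂ (1 ℕ.+ i) + Q̂ (2 ℕ.+ i))
    B≤s i = ≤-trans (⌜⌝-mono (a≤s (i ℕ.+ ℓ))) (≤-reflexive (trans (⌜+⌝ (s (i ℕ.+ ℓ)) _) (cong (λ b → ŝ i + b)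
     (trans (cong₂ (λ a b → ⌜ a ℕ.+ b ⌝) (q≡Q (suc i)) (q≡Q (suc (suc i)))) (⌜+⌝ (Qℕ (suc i)) (Qℕ (suc (suc i))))))))

    0≤B : ∀ i → 0ℚ ≤ B i
    0≤B i = 0≤⌜⌝ (a (i ℕ.+ ℓ))
    0≤Ĝ : ∀ i → 0ℚ ≤ Ĝ i
    0≤Ĝ i = 0≤⌜⌝ (Gℕ i)
    0≤ŝ : ∀ i → 0ℚ ≤ ŝ i
    0≤ŝ i = 0≤⌜⌝ (s (i ℕ.+ ℓ))
    0≤Q̂ : ∀ i → 0ℚ ≤ Q̂ i
    0≤Q̂ i = 0≤⌜⌝ (Qℕ i)

    module Rec = Recurrence B Ĝ ŝ Q̂ 0≤B 0≤ŝ 0≤Ĝ 0≤Q̂ three s≤B B≤s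

    Ĝ-step : ∀ i → Ĝ (suc i) ≤ Ĝ i
    Ĝ-step i = ⌜⌝-mono (G-step i)

    Ĝ-vanish : ∀ i → n ℕ.< i → Ĝ i ≡ 0ℚ
    Ĝ-vanish i h = cong ⌜_⌝ (G-vanish i h)

    K : ℕ
    K = suc n ℕ.* 3

    n<K : n ℕ.< K
    n<K = ℕ.m≤m*n (suc n) 3

    Q̂-sum : ∀ k → ω * ∑< k (λ i → Q̂ (suc i)) ≤ ⌜ 19110 ⌝ * p̂ n
    Q̂-sum k = begin
     ω * ∑< k (λ i → Q̂ (suc i)) ≡⟨ trans (cong (ω *_) (sym (⌜Σ⌝ k (λ i → Qℕ (suc i))))) (sym (⌜*⌝ w _)) ⟩
     ⌜ w ℕ.* Σ< k (λ i → Qℕ (suc i)) ⌝ ≤⟨ ⌜⌝-mono (Q-sum w k) ⟩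
     ⌜ w ℕ.* (w ℕ.* D) ℕ.+ P (2 ℕ.+ n) ⌝ ≡⟨ trans (⌜+⌝ (w ℕ.* (w ℕ.* D)) _) (cong (_+ p̂ (2 ℕ.+ n)) (trans (⌜*⌝ w (w ℕ.* D)) (trans (cong (ω *_) (⌜*⌝ w D)) (sym (*-assoc ω ω D̂))))) ⟩
     o * D̂ + p̂ (2 ℕ.+ n) ≤⟨ +-mono-≤ (*-monoʳ 0≤D̂ (≡≤ (sym (*-identityˡ o)) (*-monoʳ 0≤o 1≤o))) p̂2≤ ⟩
     X * D̂ + 2ℚ * p̂ n ≤⟨ +-monoˡ-≤ (2ℚ * p̂ n) XD≤ ⟩
     ⌜ 19108 ⌝ * p̂ n + 2ℚ * p̂ n ≡⟨ r (p̂ n) ⟩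
     ⌜ 19110 ⌝ * p̂ n ∎
     where
     r = solve 1 (λ a → # 19108 :* a :+ # 2 :* a := # 19110 :* a) refl

    V̂ : ℚ
    V̂ = B 0

    V̂≤ : V̂ ≤ 2ℚ * p̂ n
    V̂≤ = Rec.B₀≤ 1ℚ 0≤1 ≤-refl Ĝ-step

    -- The ratio z = 1 is used, for which convexity alone bounds the total variation by the first
    -- increment; that increment is at most (ℓ+1) D.
    small-rank : ℓ ℕ.≤ h → ω * ∣ 3ℚ * V̂ - 2ℚ * p̂ n ∣ ≤ ⌜ 267532 ⌝ * p̂ n
    small-rank ℓ≤h = begin
     ω * ∣ 3ℚ * V̂ - 2ℚ * p̂ n ∣ ≤⟨ *-monoˡ 0≤ω (X-sum (suc n) (Ĝ-vanish K n<K) (Ĝ-vanish (suc K) (ℕ.m≤n⇒m≤1+n n<K))) ⟩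
     ω * (2ℚ * ∑< K (λ i → ∣ v i ∣) + 6ℚ * ΣQ) ≤⟨ *-monoˡ 0≤ω (+-monoˡ-≤ (6ℚ * ΣQ) (*-monoˡ 0≤2 (≤-trans (variation w-step refl K)
                                (+-mono-≤ (sub-≤ {Rec.w 1ℚ 0≤1 ≤-refl 0} (0≤w Ĝ-step K)) (*-monoˡ 0≤2 ΣQ≤))))) ⟩
     ω * (2ℚ * (Rec.w 1ℚ 0≤1 ≤-refl 0 + 2ℚ * ΣQ) + 6ℚ * ΣQ) ≡⟨ r₁ ω (Rec.w 1ℚ 0≤1 ≤-refl 0) ΣQ ⟩
     2ℚ * (ω * Rec.w 1ℚ 0≤1 ≤-refl 0) + ⌜ 10 ⌝ * (ω * ΣQ) ≤⟨ +-mono-≤ (*-monoˡ 0≤2 ωw₀) (*-monoˡ (0≤⌜⌝ 10) (Q̂-sum (2 ℕ.+ K))) ⟩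
     2ℚ * (2ℚ * (⌜ 19108 ⌝ * p̂ n)) + ⌜ 10 ⌝ * (⌜ 19110 ⌝ * p̂ n) ≡⟨ r₂ (p̂ n) ⟩
     ⌜ 267532 ⌝ * p̂ n ∎
     where
     open Rec 1ℚ 0≤1 ≤-refl using (X-sum; variation; v; 0≤w)
     ΣQ : ℚ
     ΣQ = ∑< (2 ℕ.+ K) (λ i → Q̂ (suc i))
     ΣQ≤ : ∑< K (λ i → Q̂ (suc i)) ≤ ΣQ
     ΣQ≤ = ≤-trans (p≤p+q _ (0≤⌜⌝ (Qℕ (suc K)))) (p≤p+q _ (0≤⌜⌝ (Qℕ (suc (suc K)))))
     r₁ = solve 3 (λ ω a q → ω :* (# 2 :* (a :+ # 2 :* q) :+ # 6 :* q) := # 2 :* (ω :* a) :+ # 10 :* (ω :* q)) refl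
     r₂ = solve 1 (λ a → # 2 :* (# 2 :* (# 19108 :* a)) :+ # 10 :* (# 19110 :* a) := # 267532 :* a) refl
     w-step : ∀ i → Ĝ (suc i) - Ĝ (suc (suc i)) ≤ Ĝ i - Ĝ (suc i) + Q̂ (suc i)
     w-step i = by _ (sub≥0 (subst₂ _≤_ (⌜+⌝ (Gℕ (suc i)) _) (trans (⌜+⌝ (Gℕ i ℕ.+ Gℕ (suc (suc i))) _) (cong (_+ Q̂ (suc i)) (⌜+⌝ (Gℕ i) _))) (⌜⌝-mono (G-convex i)))) (r (Ĝ i) (Ĝ (suc i)) (Ĝ (suc (suc i))) (Q̂ (suc i)))
      where
      r = solve 4 (λ a b c q → b :- c :+ (a :+ c :+ q :- (b :+ b)) := a :- b :+ q) refl
     ωw₀ : ω * (p̂ n - Ĝ 1) ≤ 2ℚ * (⌜ 19108 ⌝ * p̂ n)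
     ωw₀ = begin
      ω * (p̂ n - Ĝ 1) ≤⟨ *-monoˡ 0≤ω (by _ (sub≥0 (≤≡ (⌜⌝-mono G-first) (trans (⌜+⌝ (Gℕ 1) _) (cong (λ b → Ĝ 1 + b) (⌜*⌝ (suc ℓ) D))))) (r (p̂ n) (Ĝ 1) (⌜ suc ℓ ⌝ * D̂))) ⟩
      ω * (⌜ suc ℓ ⌝ * D̂) ≤⟨ *-monoˡ 0≤ω (*-monoʳ 0≤D̂ (≤≡ (⌜⌝-mono (ℕ.+-mono-≤ (ℕ.≤-trans (ℕ.n≤1+n 1) 2≤h) ℓ≤h)) (trans (⌜+⌝ h h) (cong (λ b → b + b) cast-h)))) ⟩
      ω * ((ω * o + ω * o) * D̂) ≡⟨ trans (r₃ ω (ω * o) D̂) (cong (λ b → 2ℚ * (b * D̂)) ωωo) ⟩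
      2ℚ * (X * D̂) ≤⟨ *-monoˡ 0≤2 XD≤ ⟩
      2ℚ * (⌜ 19108 ⌝ * p̂ n) ∎
      where
      r = solve 3 (λ a b c → a :- b :+ (b :+ c :- a) := c) refl
      r₃ = solve 3 (λ ω b d → ω :* ((b :+ b) :* d) := # 2 :* (ω :* b :* d)) refl

  module Main (ℓ : ℕ) where
   module C = Centre N (ℕ.m≤n+m N (w⁶ w)) ℕ.≤-refl
   open C.Rank ℓ
   open Shifted N ℓ using (sh-x; G-sum; x-mono; x-suc) renaming (x to xs; G to Gℕ)

   z : ℚ
   z = pow y ℓ

   0≤z : 0ℚ ≤ z
   0≤z = 0≤pow 0≤y ℓ

   z≤1 : z ≤ 1ℚ
   z≤1 = pow≤1 0≤y (y≤1 0≤θ yθ 0≤y) ℓ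

   open Rec z 0≤z z≤1 using (X-sum; cut-variation; v)

   private
    Error : ℚ
    Error = ∣ (1ℚ + z + z * z) * V̂ - (1ℚ + z) * p̂ N ∣

   -- Passing from ratio 1 to y^ℓ costs a multiple of 1 - y^ℓ ≤ ℓθ = O(1/w).
   small-rank′ : ℓ ℕ.≤ h → ω * Error ≤ ⌜ 267546 ⌝ * p̂ N
   small-rank′ ℓ≤h = begin
    ω * Error ≡⟨ cong (λ a → ω * ∣ a ∣) (r₁ V̂ (p̂ N) z) ⟩
    ω * ∣ 3ℚ * V̂ - 2ℚ * p̂ N - (1ℚ - z) * ((2ℚ + z) * V̂ - p̂ N) ∣
     ≤⟨ *-monoˡ 0≤ω (∣-∣ {3ℚ * V̂ - 2ℚ * p̂ N} ≤-refl (∣*∣ (sub≥0 z≤1) bound)) ⟩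
    ω * (∣ 3ℚ * V̂ - 2ℚ * p̂ N ∣ + (1ℚ - z) * (⌜ 7 ⌝ * p̂ N)) ≡⟨ r₂ ω ∣ 3ℚ * V̂ - 2ℚ * p̂ N ∣ (1ℚ - z) (p̂ N) ⟩
    ω * ∣ 3ℚ * V̂ - 2ℚ * p̂ N ∣ + ⌜ 7 ⌝ * (ω * (1ℚ - z)) * p̂ N ≤⟨ +-mono-≤ (small-rank ℓ≤h) (*-monoʳ (0≤p̂ N) (*-monoˡ (0≤⌜⌝ 7) ω1-z)) ⟩
    ⌜ 267532 ⌝ * p̂ N + ⌜ 7 ⌝ * 2ℚ * p̂ N ≡⟨ r₃ (p̂ N) ⟩
    ⌜ 267546 ⌝ * p̂ N ∎
    where
    r₁ = solve 3 (λ v p z → (:1 :+ z :+ z :* z) :* v :- (:1 :+ z) :* p := # 3 :* v :- # 2 :* p :- (:1 :- z) :* ((# 2 :+ z) :* v :- p)) refl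
    r₂ = solve 4 (λ ω a b p → ω :* (a :+ b :* (# 7 :* p)) := ω :* a :+ # 7 :* (ω :* b) :* p) refl
    r₃ = solve 1 (λ p → # 267532 :* p :+ # 7 :* # 2 :* p := # 267546 :* p) refl
    bound : ∣ (2ℚ + z) * V̂ - p̂ N ∣ ≤ ⌜ 7 ⌝ * p̂ N
    bound = ≤-trans (∣-∣ {(2ℚ + z) * V̂} (∣≥0∣ (0≤* {2ℚ + z} (0≤+ 0≤2 0≤z) (0≤B 0))
      (*-mono {2ℚ + z} {3ℚ} 0≤3 (0≤B 0) (+-monoʳ-≤ 2ℚ z≤1) V̂≤)) (∣≥0∣ (0≤p̂ N) ≤-refl)) (≤-reflexive (r (p̂ N)))
     where
     r = solve 1 (λ p → # 3 :* (# 2 :* p) :+ p := # 7 :* p) refl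
    ω1-z : ω * (1ℚ - z) ≤ 2ℚ
    ω1-z = begin
     ω * (1ℚ - z) ≤⟨ *-monoˡ 0≤ω (by _ (sub≥0 (pow-lower 0≤θ yθ 0≤y ℓ)) (r z (⌜ ℓ ⌝ * θ))) ⟩
     ω * (⌜ ℓ ⌝ * θ) ≤⟨ *-monoˡ 0≤ω (*-monoʳ 0≤θ (≤≡ (⌜⌝-mono ℓ≤h) cast-h)) ⟩
     ω * (ω * o * θ) ≡⟨ trans (cong (ω *_) ωoθ) (trans (sym (*-assoc ω ι T)) (trans (cong (_* T) ωι) (*-identityˡ T))) ⟩
     T ≤⟨ T≤2 ⟩
     2ℚ ∎
     where
     r = solve 2 (λ z a → :1 :- z :+ (z :- (:1 :- a)) := a) refl

   module Large (h≤ℓ : h ℕ.≤ ℓ) where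
    w⁵ : ℕ
    w⁵ = w⁴ w ℕ.* w
    instance
     ℓ≢0 : ℕ.NonZero ℓ
     ℓ≢0 = ℕ.>-nonZero (ℕ.≤-trans (ℕ.≤-trans (ℕ.n≤1+n 1) 2≤h) h≤ℓ)
     h≢0 : ℕ.NonZero h
     h≢0 = ℕ.>-nonZero (ℕ.≤-trans (ℕ.n≤1+n 1) 2≤h)
    -- The cut r + 1 is the first index i with iℓ > w⁵. As w⁵ is w times the order w⁴ of S/p, G has
    -- dropped to O(p/w) there.
    r : ℕ
    r = w⁵ ℕ./ ℓ
    rℓ≤ : r ℕ.* ℓ ℕ.≤ w⁵
    rℓ≤ = ℕ.m/n*n≤m w⁵ ℓ
    w⁵< : w⁵ ℕ.≤ suc r ℕ.* ℓ
    w⁵< = ℕ≡≤ (ℕ.m≡m%n+[m/n]*n w⁵ ℓ) (ℕ.+-monoˡ-≤ (r ℕ.* ℓ) (ℕ.<⇒≤ (ℕ.m%n<n w⁵ ℓ)))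
    r≤w² : r ℕ.≤ w² w
    r≤w² = ℕ.*-cancelʳ-≤ r (w² w) h (ℕ.≤-trans (ℕ.*-monoʳ-≤ r h≤ℓ) (ℕ≤≡ rℓ≤ (e w)))
     where
     e : ∀ w → (w ℕ.* w ℕ.* (w ℕ.* w)) ℕ.* w ≡ w ℕ.* w ℕ.* (w ℕ.* (w ℕ.* w))
     e = ℕ-Ring.solve-∀
    1≤w² : 1 ℕ.≤ w² w
    1≤w² = ℕ.≤-trans (ℕ.s≤s ℕ.z≤n) 4≤w²
    suc-i≤ : ∀ {i} → i ℕ.≤ r → suc i ℕ.≤ 2 ℕ.* w² w
    suc-i≤ i≤r = ℕ≤≡ (ℕ.+-mono-≤ 1≤w² (ℕ.≤-trans i≤r r≤w²)) (cong (w² w ℕ.+_) (sym (ℕ.+-identityʳ (w² w))))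
    xs≤ : ∀ {i} → i ℕ.≤ r → xs i ℕ.≤ w⁵ ℕ.+ 4 ℕ.* w⁴ w
    xs≤ {i} i≤r = ℕ.+-mono-≤ (ℕ.≤-trans (ℕ.*-monoˡ-≤ ℓ i≤r) rℓ≤)
      (ℕ.≤-trans (ℕ.≤-trans (ℕ.≤-trans (ℕ.m≤m+n (t (suc i)) _) (ℕ≤≡ (ℕ.m≤m+n _ (suc i)) (2t+r (suc i)))) (ℕ.*-mono-≤ (suc-i≤ i≤r) (suc-i≤ i≤r)))
       (ℕ.≤-reflexive (e (w² w))))
     where
     e : ∀ a → 2 ℕ.* a ℕ.* (2 ℕ.* a) ≡ 4 ℕ.* (a ℕ.* a)
     e = ℕ-Ring.solve-∀
    w⁴≤w⁵ : w⁴ w ℕ.≤ w⁵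
    w⁴≤w⁵ = ℕ≡≤ (sym (ℕ.*-identityʳ (w⁴ w))) (ℕ.*-monoʳ-≤ (w⁴ w) 1≤w)
    w²≤w⁴ : w² w ℕ.≤ w⁴ w
    w²≤w⁴ = ℕ≡≤ (sym (ℕ.*-identityʳ (w² w))) (ℕ.*-monoʳ-≤ (w² w) 1≤w²)
    28w⁵≤w⁶ : 28 ℕ.* w⁵ ℕ.≤ w⁶ w
    28w⁵≤w⁶ = ℕ≤≡ (ℕ.*-monoˡ-≤ w⁵ (ℕ.≤-trans (ℕ.m≤m+n 28 172) 200≤w)) (e w)
     where
     e : ∀ w → w ℕ.* ((w ℕ.* w ℕ.* (w ℕ.* w)) ℕ.* w) ≡ (w ℕ.* w ℕ.* (w ℕ.* w)) ℕ.* (w ℕ.* w)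
     e = ℕ-Ring.solve-∀
    xs≤w⁶ : ∀ {i} → i ℕ.≤ r → xs i ℕ.≤ w⁶ w
    xs≤w⁶ i≤r = ℕ.≤-trans (xs≤ i≤r) (ℕ.≤-trans (ℕ.+-monoʳ-≤ w⁵ (ℕ.*-monoʳ-≤ 4 w⁴≤w⁵)) (ℕ.≤-trans (ℕ.*-monoˡ-≤ w⁵ (ℕ.m≤m+n 5 23)) 28w⁵≤w⁶))

    κ₂ : ℚ
    κ₂ = ⌜ 9556 ⌝ * i

    module Step (j : ℕ) (j≤r : j ℕ.≤ r) where
     d : ℕ
     d = ℓ ℕ.+ suc j

     -- The window reaches far enough for `ratio`. The true gap exceeds ℓ by j + 1 ≤ 2w², which
     -- alters the power of y by O(w^(-2)) only.
     medium : 4 ℕ.* ℓ ℕ.≤ w⁶ w → ∀ m → xs j ℕ.+ m ≡ N → ∣ z * p̂ m - ⌜ sh d P m ⌝ ∣ ≤ κ₂ * p̂ m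
     medium 4ℓ≤ m e = subst (λ m → ∣ z * p̂ m - ⌜ sh d P m ⌝ ∣ ≤ κ₂ * p̂ m) d+m′ (begin
       ∣ z * p̂ (d ℕ.+ m′) - ⌜ sh d P (d ℕ.+ m′) ⌝ ∣ ≡⟨ cong (λ a → ∣ z * p̂ (d ℕ.+ m′) - ⌜ a ⌝ ∣) (sh-≥ d P m′) ⟩
       ∣ z * p̂ (d ℕ.+ m′) - p̂ m′ ∣ ≡⟨ cong ∣_∣ (r₁ (z * p̂ (d ℕ.+ m′)) (pow y d * p̂ (d ℕ.+ m′)) (p̂ m′)) ⟩
       ∣ (z * p̂ (d ℕ.+ m′) - pow y d * p̂ (d ℕ.+ m′)) - (p̂ m′ - pow y d * p̂ (d ℕ.+ m′)) ∣ ≤⟨ ∣-∣ {z * p̂ (d ℕ.+ m′) - pow y d * p̂ (d ℕ.+ m′)} first (ratio d m′ N≤′ hi≥) ⟩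
       4ℚ * i * p̂ (d ℕ.+ m′) + κ * p̂ (d ℕ.+ m′) ≡⟨ r₂ i (p̂ (d ℕ.+ m′)) ⟩
       κ₂ * p̂ (d ℕ.+ m′) ∎)
      where
      total : xs j ℕ.+ d ℕ.≤ w⁶ w
      total = ℕ.*-cancelˡ-≤ 4 (ℕ.≤-trans (ℕ.*-monoʳ-≤ 4 (ℕ.+-mono-≤ (xs≤ j≤r) (ℕ.+-monoʳ-≤ ℓ (suc-i≤ j≤r))))
       (ℕ≡≤ (e₁ w⁵ (w⁴ w) ℓ (w² w)) (ℕ.≤-trans (ℕ.+-mono-≤ (ℕ.+-mono-≤ (ℕ.+-monoʳ-≤ (4 ℕ.* w⁵) (ℕ.*-monoʳ-≤ 16 w⁴≤w⁵)) 4ℓ≤) (ℕ.*-monoʳ-≤ 8 (ℕ.≤-trans w²≤w⁴ w⁴≤w⁵)))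
        (ℕ≡≤ (e₂ w⁵ (w⁶ w)) (ℕ.≤-trans (ℕ.+-monoˡ-≤ (w⁶ w) 28w⁵≤w⁶) (ℕ≤≡ (ℕ.m≤m+n _ (w⁶ w ℕ.+ w⁶ w)) (e₃ (w⁶ w))))))))
       where
       e₁ : ∀ a b l c → 4 ℕ.* ((a ℕ.+ 4 ℕ.* b) ℕ.+ (l ℕ.+ 2 ℕ.* c)) ≡ ((4 ℕ.* a ℕ.+ 16 ℕ.* b) ℕ.+ 4 ℕ.* l) ℕ.+ 8 ℕ.* c
       e₁ = ℕ-Ring.solve-∀
       e₂ : ∀ a b → ((4 ℕ.* a ℕ.+ 16 ℕ.* a) ℕ.+ b) ℕ.+ 8 ℕ.* a ≡ 28 ℕ.* a ℕ.+ b
       e₂ = ℕ-Ring.solve-∀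
       e₃ : ∀ b → (b ℕ.+ b) ℕ.+ (b ℕ.+ b) ≡ 4 ℕ.* b
       e₃ = ℕ-Ring.solve-∀
      d≤m : d ℕ.≤ m
      d≤m = ℕ.+-cancelˡ-≤ (xs j) _ _ (ℕ.≤-trans total (ℕ≤≡ (ℕ.≤-trans (ℕ.m≤m+n (w⁶ w) (w⁶ w)) 2w⁶≤N) (sym e)))
      m′ : ℕ
      m′ = m ℕ.∸ d
      d+m′ : d ℕ.+ m′ ≡ m
      d+m′ = ℕ.m+[n∸m]≡n d≤m
      N≤′ : N ℕ.≤ w⁶ w ℕ.+ m′
      N≤′ = ℕ≡≤ (trans (sym e) (trans (cong (xs j ℕ.+_) (sym d+m′)) (sym (ℕ.+-assoc (xs j) d m′)))) (ℕ.+-monoˡ-≤ m′ total)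
      hi≥ : d ℕ.+ m′ ℕ.≤ hi
      hi≥ = ℕ≡≤ d+m′ (ℕ.≤-trans (ℕ.m≤n+m m (xs j)) (ℕ≡≤ e (ℕ.m≤m+n N (w⁶ w))))
      r₁ = solve 3 (λ a b c → a :- c := (a :- b) :- (c :- b)) refl
      r₂ = solve 2 (λ i p → # 4 :* i :* p :+ # 9552 :* i :* p := # 9556 :* i :* p) refl
      q = pow y (suc j)
      first : ∣ z * p̂ (d ℕ.+ m′) - pow y d * p̂ (d ℕ.+ m′) ∣ ≤ 4ℚ * i * p̂ (d ℕ.+ m′)
      first = begin
       ∣ z * p̂ (d ℕ.+ m′) - pow y d * p̂ (d ℕ.+ m′) ∣ ≡⟨ cong ∣_∣ (trans (cong (λ a → z * p̂ (d ℕ.+ m′) - a * p̂ (d ℕ.+ m′)) (pow-+ y ℓ (suc j))) (r₃ z q (p̂ (d ℕ.+ m′)))) ⟩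
       ∣ z * (1ℚ - q) * p̂ (d ℕ.+ m′) ∣ ≤⟨ ∣≥0∣ (0≤* (0≤* 0≤z (sub≥0 q≤1)) (0≤p̂ (d ℕ.+ m′))) (*-monoʳ (0≤p̂ (d ℕ.+ m′)) le) ⟩
       4ℚ * i * p̂ (d ℕ.+ m′) ∎
       where
       q≤1 : q ≤ 1ℚ
       q≤1 = pow≤1 0≤y (y≤1 0≤θ yθ 0≤y) (suc j)
       r₃ = solve 3 (λ z q p → z :* p :- z :* q :* p := z :* (:1 :- q) :* p) refl
       le : z * (1ℚ - q) ≤ 4ℚ * i
       le = begin
        z * (1ℚ - q) ≤⟨ *-monoʳ (sub≥0 q≤1) z≤1 ⟩
        1ℚ * (1ℚ - q) ≤⟨ by _ (sub≥0 (pow-lower 0≤θ yθ 0≤y (suc j))) (r₄ q (⌜ suc j ⌝ * θ)) ⟩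
        ⌜ suc j ⌝ * θ ≤⟨ *-monoʳ 0≤θ (≤≡ (⌜⌝-mono (suc-i≤ j≤r)) (trans (⌜*⌝ 2 (w² w)) (cong (2ℚ *_) (trans cast² (sym Xi))))) ⟩
        2ℚ * (X * i) * θ ≡⟨ r₅ X i θ ⟩
        2ℚ * T * i ≤⟨ *-monoʳ 0≤i (*-monoˡ 0≤2 T≤2) ⟩
        2ℚ * 2ℚ * i ≡⟨⟩
        4ℚ * i ∎
        where
        r₄ = solve 2 (λ q a → :1 :* (:1 :- q) :+ (q :- (:1 :- a)) := a) refl
        r₅ = solve 3 (λ X i θ → # 2 :* (X :* i) :* θ := # 2 :* (θ :* X) :* i) refl

     -- The window may be left here, but both quantities are then O(w^(-2)) p(m) separately.
     huge : w⁶ w ℕ.≤ 4 ℕ.* ℓ → ∀ m → xs j ℕ.+ m ≡ N → ∣ z * p̂ m - ⌜ sh d P m ⌝ ∣ ≤ κ₂ * p̂ m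
     huge w⁶≤ m e = begin
      ∣ z * p̂ m - ⌜ sh d P m ⌝ ∣ ≤⟨ ∣-∣ {z * p̂ m} (∣≥0∣ (0≤* 0≤z (0≤p̂ m)) (*-monoʳ (0≤p̂ m) z≤)) (∣≥0∣ (0≤⌜⌝ (sh d P m)) sh≤) ⟩
      8ℚ * i * p̂ m + ⌜ 192 ⌝ * Y * p̂ m ≤⟨ by (⌜ 192 ⌝ * (i - Y) * p̂ m + ⌜ 9356 ⌝ * i * p̂ m) (0≤+ (0≤* (0≤* (0≤⌜⌝ 192) (sub≥0 Y≤i)) (0≤p̂ m)) (0≤* (0≤* (0≤⌜⌝ 9356) 0≤i) (0≤p̂ m))) (r₁ i Y (p̂ m)) ⟩
      κ₂ * p̂ m ∎
      where
      r₁ = solve 3 (λ i Y p → # 8 :* i :* p :+ # 192 :* Y :* p :+ (# 192 :* (i :- Y) :* p :+ # 9356 :* i :* p) := # 9556 :* i :* p) refl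
      4ℓ : X * o ≤ 4ℚ * ⌜ ℓ ⌝
      4ℓ = ≡≤ (sym cast⁶) (≤≡ (⌜⌝-mono w⁶≤) (⌜*⌝ 4 ℓ))
      z≤ : z ≤ 8ℚ * i
      z≤ = begin
       z ≡⟨ trans (sym (*-identityʳ z)) (trans (cong (z *_) (sym oi)) (sym (*-assoc z o i))) ⟩
       z * o * i ≤⟨ *-monoʳ 0≤i (*-monoˡ 0≤z o≤) ⟩
       z * (8ℚ * (⌜ ℓ ⌝ * θ)) * i ≤⟨ *-monoʳ {i} {z * (8ℚ * (⌜ ℓ ⌝ * θ))} {8ℚ} 0≤i (by (8ℚ * z + 8ℚ * (1ℚ - z * (1ℚ + ⌜ ℓ ⌝ * θ))) (0≤+ (0≤* 0≤8 0≤z) (0≤* 0≤8 (sub≥0 (pow-upper 0≤θ yθ 0≤y ℓ)))) (r₂ z (⌜ ℓ ⌝ * θ))) ⟩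
       8ℚ * i ∎
       where
       r₂ = solve 2 (λ z a → z :* (# 8 :* a) :+ (# 8 :* z :+ # 8 :* (:1 :- z :* (:1 :+ a))) := # 8) refl
       o≤ : o ≤ 8ℚ * (⌜ ℓ ⌝ * θ)
       o≤ = by (2ℚ * ((T - ½) * o) + 2ℚ * ((4ℚ * ⌜ ℓ ⌝ - X * o) * θ)) (0≤+ (0≤* 0≤2 (0≤* (sub≥0 ½≤T) 0≤o)) (0≤* 0≤2 (0≤* (sub≥0 4ℓ) 0≤θ))) (r₃ o θ X ⌜ ℓ ⌝)
        where
        r₃ = solve 4 (λ o θ X l → o :+ (# 2 :* ((θ :* X :- :½) :* o) :+ # 2 :* ((# 4 :* l :- X :* o) :* θ)) := # 8 :* (l :* θ)) refl
      N≤m : N ℕ.≤ w⁶ w ℕ.+ m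
      N≤m = ℕ≡≤ (sym e) (ℕ.+-monoˡ-≤ m (xs≤w⁶ j≤r))
      m≤hi : m ℕ.≤ hi
      m≤hi = ℕ.≤-trans (ℕ.m≤n+m m (xs j)) (ℕ≡≤ e (ℕ.m≤m+n N (w⁶ w)))
      wd : w⁶ w ℕ.* w⁶ w ℕ.≤ 64 ℕ.* t d
      wd = ℕ.≤-trans (ℕ.*-mono-≤ w⁶≤4d w⁶≤4d) (ℕ≡≤ (e₁ d) (ℕ≤≡ (ℕ.*-monoʳ-≤ 16 (sq≤4t d (ℕ.≤-trans 2≤h (ℕ.≤-trans h≤ℓ (ℕ.m≤m+n ℓ (suc j)))))) (e₂ (t d))))
       where
       w⁶≤4d : w⁶ w ℕ.≤ 4 ℕ.* d
       w⁶≤4d = ℕ.≤-trans w⁶≤ (ℕ.*-monoʳ-≤ 4 (ℕ.m≤m+n ℓ (suc j)))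
       e₁ : ∀ d → 4 ℕ.* d ℕ.* (4 ℕ.* d) ≡ 16 ℕ.* (d ℕ.* d)
       e₁ = ℕ-Ring.solve-∀
       e₂ : ∀ d → 16 ℕ.* (4 ℕ.* d) ≡ 64 ℕ.* d
       e₂ = ℕ-Ring.solve-∀
      sh≤ : ⌜ sh d P m ⌝ ≤ ⌜ 192 ⌝ * Y * p̂ m
      sh≤ = *-cancel-≤ (0<* (0<* 0<X 0<X) 0<X) (begin
       X * X * X * ⌜ sh d P m ⌝ ≡⟨ cong (_* ⌜ sh d P m ⌝) (trans (r₂ o) (trans (cong (λ z → z * z) (sym cast⁶)) (sym (⌜*⌝ (w⁶ w) (w⁶ w))))) ⟩
       ⌜ w⁶ w ℕ.* w⁶ w ⌝ * ⌜ sh d P m ⌝ ≤⟨ *-monoʳ (0≤⌜⌝ (sh d P m)) (⌜⌝-mono wd) ⟩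
       ⌜ 64 ℕ.* t d ⌝ * ⌜ sh d P m ⌝ ≡⟨ trans (cong (_* ⌜ sh d P m ⌝) (⌜*⌝ 64 (t d))) (trans (*-assoc ⌜ 64 ⌝ ⌜ t d ⌝ ⌜ sh d P m ⌝) (cong (⌜ 64 ⌝ *_) (sym (⌜*⌝ (t d) (sh d P m))))) ⟩
       ⌜ 64 ⌝ * ⌜ t d ℕ.* sh d P m ⌝ ≤⟨ *-monoˡ (0≤⌜⌝ 64) (≤-trans (⌜⌝-mono (tP≤U m d)) (U≤u m (lo≤ N≤m) m≤hi)) ⟩
       ⌜ 64 ⌝ * (3ℚ * (X * X) * p̂ m) ≡⟨ r₃ X (p̂ m) ⟩
       ⌜ 192 ⌝ * 1ℚ * (X * X) * p̂ m ≡⟨ cong (λ a → ⌜ 192 ⌝ * a * (X * X) * p̂ m) (sym XY) ⟩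
       ⌜ 192 ⌝ * (X * Y) * (X * X) * p̂ m ≡⟨ r₄ X Y (p̂ m) ⟩
       X * X * X * (⌜ 192 ⌝ * Y * p̂ m) ∎)
       where
       r₂ = solve 1 (λ o → o :* o :* (o :* o) :* (o :* o) := o :* o :* o :* (o :* o :* o)) refl
       r₃ = solve 2 (λ X p → # 64 :* (# 3 :* (X :* X) :* p) := # 192 :* :1 :* (X :* X) :* p) refl
       r₄ = solve 3 (λ X Y p → # 192 :* (X :* Y) :* (X :* X) :* p := X :* X :* X :* (# 192 :* Y :* p)) refl

     step : ∣ z * Ĝ j - Ĝ (suc j) ∣ ≤ κ₂ * Ĝ j
     step = subst₂ (λ a b → ∣ z * ⌜ a ⌝ - ⌜ b ⌝ ∣ ≤ κ₂ * ⌜ a ⌝) (at P) (trans (at (sh d P)) (sym (sh-x P j))) (pick (ℕ.≤-total (4 ℕ.* ℓ) (w⁶ w)))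
      where
      m = N ℕ.∸ xs j
      e : xs j ℕ.+ m ≡ N
      e = ℕ.m+[n∸m]≡n (ℕ.≤-trans (xs≤w⁶ j≤r) (ℕ.≤-trans (ℕ.m≤m+n (w⁶ w) (w⁶ w)) 2w⁶≤N))
      at : ∀ f → f m ≡ sh (xs j) f N
      at f = trans (sym (sh-≥ (xs j) f m)) (cong (sh (xs j) f) e)
      pick : 4 ℕ.* ℓ ℕ.≤ w⁶ w ⊎ w⁶ w ℕ.≤ 4 ℕ.* ℓ → ∣ z * p̂ m - ⌜ sh d P m ⌝ ∣ ≤ κ₂ * p̂ m
      pick (inj₁ le) = medium le m e
      pick (inj₂ ge) = huge ge m e

    I : ℕ
    I = suc r

    S≤N : Ŝ N ≤ 4ℚ * X * p̂ N
    S≤N = S≤σ N (lo≤ (ℕ.m≤n+m N (w⁶ w))) (ℕ.m≤m+n N (w⁶ w))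

    -- After the first value this is a lower Riemann sum of mesh w³ for S = O(w⁴ p). Hence errors κ₂
    -- = O(w^(-2)) per step add up to O(1/w).
    ΣG : ∑< I Ĝ ≤ ⌜ 5 ⌝ * ω * p̂ N
    ΣG = begin
     ∑< I Ĝ ≡⟨ ∑-head r Ĝ ⟩
     p̂ N + ∑< r (λ i → Ĝ (suc i)) ≤⟨ +-monoʳ-≤ (p̂ N) (*-cancel-≤ (0<* 0<ω (<-≤-trans (positive⁻¹ 1ℚ) 1≤o)) (begin
       ω * o * ∑< r (λ i → Ĝ (suc i)) ≡⟨ trans (cong₂ _*_ (sym cast-h) (sym (⌜Σ⌝ r (λ i → Gℕ (suc i))))) (sym (⌜*⌝ h _)) ⟩
       ⌜ h ℕ.* Σ< r (λ i → Gℕ (suc i)) ⌝ ≤⟨ ⌜⌝-mono (G-sum′ h refl) ⟩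
       Ŝ N ≤⟨ S≤N ⟩
       4ℚ * X * p̂ N ≡⟨ r₁ ω (p̂ N) ⟩
       ω * o * (4ℚ * ω * p̂ N) ∎)) ⟩
     p̂ N + 4ℚ * ω * p̂ N ≤⟨ by ((ω - 1ℚ) * p̂ N) (0≤* (sub≥0 1≤ω) (0≤p̂ N)) (r₂ ω (p̂ N)) ⟩
     ⌜ 5 ⌝ * ω * p̂ N ∎
     where
     0<ω : 0ℚ < ω
     0<ω = <-≤-trans (positive⁻¹ 1ℚ) 1≤ω
     r₁ = solve 2 (λ ω p → # 4 :* (ω :* ω :* (ω :* ω)) :* p := ω :* (ω :* ω) :* (# 4 :* ω :* p)) refl
     r₂ = solve 2 (λ ω p → p :+ # 4 :* ω :* p :+ (ω :- :1) :* p := # 5 :* ω :* p) refl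
     G-sum′ : ∀ k → k ≡ h → k ℕ.* Σ< r (λ i → Gℕ (suc i)) ℕ.≤ S N
     G-sum′ zero _ = ℕ.z≤n
     G-sum′ (suc b) e = G-sum b (ℕ≡≤ e h≤ℓ) r

    ωG : ω * Ĝ I ≤ 4ℚ * p̂ N
    ωG = *-cancel-≤ 0<X (begin
     X * (ω * Ĝ I) ≡⟨ trans (sym (*-assoc X ω (Ĝ I))) (cong (_* Ĝ I) (sym (trans (⌜*⌝ (w⁴ w) w) (cong (_* ω) cast⁴)))) ⟩
     ⌜ w⁵ ⌝ * Ĝ I ≡⟨ sym (⌜*⌝ w⁵ (Gℕ I)) ⟩
     ⌜ w⁵ ℕ.* Gℕ I ⌝ ≤⟨ ⌜⌝-mono (ℕ.≤-trans (ℕ.*-monoˡ-≤ (Gℕ I) (ℕ.≤-trans w⁵< (ℕ.m≤m+n (suc r ℕ.* ℓ) (t (suc I))))) (sP≤S N (xs I))) ⟩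
     Ŝ N ≤⟨ S≤N ⟩
     4ℚ * X * p̂ N ≡⟨ r₁ X (p̂ N) ⟩
     X * (4ℚ * p̂ N) ∎)
     where
     r₁ = solve 2 (λ X p → # 4 :* X :* p := X :* (# 4 :* p)) refl

    variation-bound : ω * ∑< K (λ i → ∣ v i ∣) ≤ ⌜ 95576 ⌝ * p̂ N
    variation-bound = begin
     ω * ∑< K (λ i → ∣ v i ∣) ≤⟨ *-monoˡ 0≤ω (≤-trans (more I) (cut-variation Ĝ-step I K)) ⟩
     ω * (2ℚ * ∑< I (λ i → ∣ z * Ĝ i - Ĝ (suc i) ∣) + 4ℚ * Ĝ I) ≤⟨ *-monoˡ 0≤ω (+-monoˡ-≤ (4ℚ * Ĝ I) (*-monoˡ 0≤2
        (≤-trans (∑-mono< I λ j j<I → Step.step j (ℕ.≤-pred j<I)) (≡≤ (∑-* I κ₂ Ĝ) (*-monoˡ (0≤* (0≤⌜⌝ 9556) 0≤i) ΣG))))) ⟩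
     ω * (2ℚ * (κ₂ * (⌜ 5 ⌝ * ω * p̂ N)) + 4ℚ * Ĝ I) ≡⟨ trans (r₁ ω i (p̂ N) (Ĝ I)) (cong (λ a → ⌜ 95560 ⌝ * a * p̂ N + 4ℚ * (ω * Ĝ I)) oi) ⟩
     ⌜ 95560 ⌝ * 1ℚ * p̂ N + 4ℚ * (ω * Ĝ I) ≤⟨ +-monoʳ-≤ (⌜ 95560 ⌝ * 1ℚ * p̂ N) (*-monoˡ 0≤4 ωG) ⟩
     ⌜ 95560 ⌝ * 1ℚ * p̂ N + 4ℚ * (4ℚ * p̂ N) ≡⟨ r₂ (p̂ N) ⟩
     ⌜ 95576 ⌝ * p̂ N ∎
     where
     r₁ = solve 4 (λ ω i p g → ω :* (# 2 :* (# 9556 :* i :* (# 5 :* ω :* p)) :+ # 4 :* g) := # 95560 :* (ω :* ω :* i) :* p :+ # 4 :* (ω :* g)) refl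
     r₂ = solve 1 (λ p → # 95560 :* :1 :* p :+ # 4 :* (# 4 :* p) := # 95576 :* p) refl
     more : ∀ j → ∑< K (λ i → ∣ v i ∣) ≤ ∑< (j ℕ.+ K) (λ i → ∣ v i ∣)
     more zero = ≤-refl
     more (suc j) = ≤-trans (more j) (p≤p+q _ (0≤∣p∣ (v (j ℕ.+ K))))

    large-rank : ω * Error ≤ ⌜ 305812 ⌝ * p̂ N
    large-rank = begin
     ω * Error ≤⟨ *-monoˡ 0≤ω (X-sum (suc N) (Ĝ-vanish K n<K) (Ĝ-vanish (suc K) (ℕ.m≤n⇒m≤1+n n<K))) ⟩
     ω * (2ℚ * ∑< K (λ i → ∣ v i ∣) + 6ℚ * ∑< (2 ℕ.+ K) (λ i → Q̂ (suc i))) ≡⟨ r₁ ω (∑< K (λ i → ∣ v i ∣)) (∑< (2 ℕ.+ K) (λ i → Q̂ (suc i))) ⟩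
     2ℚ * (ω * ∑< K (λ i → ∣ v i ∣)) + 6ℚ * (ω * ∑< (2 ℕ.+ K) (λ i → Q̂ (suc i))) ≤⟨ +-mono-≤ (*-monoˡ 0≤2 variation-bound) (*-monoˡ 0≤6 (Q̂-sum (2 ℕ.+ K))) ⟩
     2ℚ * (⌜ 95576 ⌝ * p̂ N) + 6ℚ * (⌜ 19110 ⌝ * p̂ N) ≡⟨ r₂ (p̂ N) ⟩
     ⌜ 305812 ⌝ * p̂ N ∎
     where
     r₁ = solve 3 (λ ω a b → ω :* (# 2 :* a :+ # 6 :* b) := # 2 :* (ω :* a) :+ # 6 :* (ω :* b)) refl
     r₂ = solve 1 (λ p → # 2 :* (# 95576 :* p) :+ # 6 :* (# 19110 :* p) := # 305812 :* p) refl

   uniform : ω * ∣ (1ℚ + z + z * z) * V̂ - (1ℚ + z) * p̂ N ∣ ≤ ⌜ 305812 ⌝ * p̂ N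
   uniform = pick (ℕ.≤-total ℓ h)
    where
    pick : ℓ ℕ.≤ h ⊎ h ℕ.≤ ℓ → ω * Error ≤ ⌜ 305812 ⌝ * p̂ N
    pick (inj₁ le) = ≤-trans (small-rank′ le) (*-monoʳ (0≤p̂ N) (⌜⌝-mono {267546} {305812} (ℕ.m≤m+n 267546 38266)))
    pick (inj₂ ge) = Large.large-rank ge

-- ζ(2) = π²/6 from the Leibniz series

module Basel where
 open Rationals
 open ZetaSums using (inv; 0≤inv; inv≤1; ζ; Har; ζ-close)
 open import Data.Integer.Base using (+_)
 open import Data.Rational.Properties
 open ≤-Reasoning

 alt : (ℕ → ℚ) → ℕ → ℚ
 alt b n = ∑< n (λ j → sign j * b j)

 alt-tail : ∀ {b} → (∀ j → 0ℚ ≤ b j) → (∀ j → b (suc j) ≤ b j) → ∀ k m → ∃ λ a → 0ℚ ≤ a × a ≤ b m × alt b (m ℕ.+ k) ≡ alt b m + sign m * a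
 alt-tail {b} 0≤b dec zero m = 0ℚ , ≤-refl , 0≤b m , trans (cong (alt b) (ℕ.+-identityʳ m)) (r (alt b m) (sign m))
  where
  r = solve 2 (λ l s → l := l :+ s :* :0) refl
 alt-tail {b} 0≤b dec (suc k) m with alt-tail 0≤b dec k (suc m)
 ... | a , 0≤a , a≤ , e = b m - a , sub≥0 (≤-trans a≤ (dec m)) , sub-≤ 0≤a , trans (cong (alt b) (ℕ.+-suc m k)) (trans e (r (alt b m) (sign m) (b m) a))
  where
  r = solve 4 (λ l s b a → l :+ s :* b :+ :- s :* a := l :+ s :* (b :- a)) refl

 alt-close : ∀ {b} → (∀ j → 0ℚ ≤ b j) → (∀ j → b (suc j) ≤ b j) → ∀ k m → ∣ alt b (m ℕ.+ k) - alt b m ∣ ≤ b m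
 alt-close {b} 0≤b dec k m with alt-tail 0≤b dec k m
 ... | a , 0≤a , a≤ , e = begin
  ∣ alt b (m ℕ.+ k) - alt b m ∣ ≡⟨ cong ∣_∣ (trans (cong (_- alt b m) e) (r (alt b m) (sign m * a))) ⟩
  ∣ sign m * a ∣ ≡⟨ trans (∣p*q∣≡∣p∣*∣q∣ (sign m) a) (trans (cong₂ _*_ (∣sign∣ m) (0≤p⇒∣p∣≡p 0≤a)) (*-identityˡ a)) ⟩
  a ≤⟨ a≤ ⟩
  b m ∎
  where
  r = solve 2 (λ l x → l :+ x :- l := x) refl

 inv-dec : ∀ j → inv (suc j) ≤ inv j
 inv-dec j = inv-antitone (ℕ.n≤1+n j)

 0≤odd : ∀ k → 0ℚ ≤ odd⁻¹ k
 0≤odd k = 0≤inv (2 ℕ.* k)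

 odd-dec : ∀ j → odd⁻¹ (suc j) ≤ odd⁻¹ j
 odd-dec j = inv-antitone (ℕ.*-monoʳ-≤ 2 (ℕ.n≤1+n j))

 odd≤inv : ∀ k → odd⁻¹ k ≤ inv k
 odd≤inv k = inv-antitone (ℕ.m≤m+n k (k ℕ.+ 0))

 sign-+ : ∀ m n → sign (m ℕ.+ n) ≡ sign m * sign n
 sign-+ zero n = sym (*-identityˡ (sign n))
 sign-+ (suc m) n = trans (cong -_ (sign-+ m n)) (neg-distribˡ-* (sign m) (sign n))

 sign² : ∀ n → sign n * sign n ≡ 1ℚ
 sign² zero = refl
 sign² (suc n) = trans (r (sign n)) (sign² n)
  where
  r = solve 1 (λ s → :- s :* :- s := s :* s) refl

 ⌜odd⌝ : ∀ k → ⌜ suc (2 ℕ.* k) ⌝ ≡ 1ℚ + 2ℚ * ⌜ k ⌝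
 ⌜odd⌝ k = trans (⌜suc⌝ (2 ℕ.* k)) (cong (λ x → 1ℚ + x) (⌜*⌝ 2 k))

 odd-inv : ∀ k → (1ℚ + 2ℚ * ⌜ k ⌝) * odd⁻¹ k ≡ 1ℚ
 odd-inv k = trans (cong (_* odd⁻¹ k) (sym (⌜odd⌝ k))) (⌜*⌝-inv (2 ℕ.* k))

 suc-inv : ∀ k → (1ℚ + ⌜ k ⌝) * inv k ≡ 1ℚ
 suc-inv k = trans (cong (_* inv k) (sym (⌜suc⌝ k))) (⌜*⌝-inv k)

 private
  pf : ∀ a b s x y z → a * x ≡ 1ℚ → b * y ≡ 1ℚ → (2ℚ * b + s * a) * z ≡ 1ℚ → x * y ≡ z * (2ℚ * x + s * y)
  pf a b s x y z ax by′ cz = sym (begin-equality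
   z * (2ℚ * x + s * y) ≡⟨ cong₂ (λ u v → z * (2ℚ * u + s * v)) (sym (*-identityˡ x)) (sym (*-identityˡ y)) ⟩
   z * (2ℚ * (1ℚ * x) + s * (1ℚ * y)) ≡⟨ cong₂ (λ u v → z * (2ℚ * (u * x) + s * (v * y))) (sym by′) (sym ax) ⟩
   z * (2ℚ * (b * y * x) + s * (a * x * y)) ≡⟨ r a b s x y z ⟩
   (2ℚ * b + s * a) * z * (x * y) ≡⟨ cong (_* (x * y)) cz ⟩
   1ℚ * (x * y) ≡⟨ *-identityˡ (x * y) ⟩
   x * y ∎)
   where
   r = solve 6 (λ a b s x y z → z :* (# 2 :* (b :* y :* x) :+ s :* (a :* x :* y)) := (# 2 :* b :+ s :* a) :* z :* (x :* y)) refl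

 pf⁺ : ∀ i m → odd⁻¹ i * inv m ≡ odd⁻¹ (suc (i ℕ.+ m)) * (2ℚ * odd⁻¹ i + 1ℚ * inv m)
 pf⁺ i m = pf (1ℚ + 2ℚ * ⌜ i ⌝) (1ℚ + ⌜ m ⌝) 1ℚ (odd⁻¹ i) (inv m) (odd⁻¹ (suc (i ℕ.+ m))) (odd-inv i) (suc-inv m)
  (trans (cong (_* odd⁻¹ (suc (i ℕ.+ m))) (trans (r ⌜ i ⌝ ⌜ m ⌝) (cong (λ x → 1ℚ + 2ℚ * x) (sym (trans (⌜suc⌝ (i ℕ.+ m)) (cong (λ x → 1ℚ + x) (⌜+⌝ i m))))))) (odd-inv (suc (i ℕ.+ m))))
  where
  r = solve 2 (λ i m → # 2 :* (:1 :+ m) :+ :1 :* (:1 :+ # 2 :* i) := :1 :+ # 2 :* (:1 :+ (i :+ m))) refl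

 pf⁻ : ∀ n i → odd⁻¹ i * inv (n ℕ.+ i) ≡ odd⁻¹ n * (2ℚ * odd⁻¹ i + - 1ℚ * inv (n ℕ.+ i))
 pf⁻ n i = pf (1ℚ + 2ℚ * ⌜ i ⌝) (1ℚ + ⌜ n ℕ.+ i ⌝) (- 1ℚ) (odd⁻¹ i) (inv (n ℕ.+ i)) (odd⁻¹ n) (odd-inv i) (suc-inv (n ℕ.+ i))
  (trans (cong (_* odd⁻¹ n) (trans (cong (λ x → 2ℚ * (1ℚ + x) + - 1ℚ * (1ℚ + 2ℚ * ⌜ i ⌝)) (⌜+⌝ n i)) (r ⌜ i ⌝ ⌜ n ⌝))) (odd-inv n))
  where
  r = solve 2 (λ i n → # 2 :* (:1 :+ (n :+ i)) :+ :- :1 :* (:1 :+ # 2 :* i) := :1 :+ # 2 :* n) refl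

 ∑-reverse : ∀ n (f : ℕ → ℚ) → ∑< n (λ i → f (n ℕ.∸ suc i)) ≡ ∑< n f
 ∑-reverse zero f = refl
 ∑-reverse (suc n) f = trans (∑-head n (λ i → f (n ℕ.∸ i))) (trans (cong (λ x → f n + x) (∑-reverse n f)) (+-comm (f n) (∑< n f)))

 L Q η : ℕ → ℚ
 L = leibniz
 Q n = ∑< n (λ k → odd⁻¹ k * odd⁻¹ k)
 η = alt inv

 -- The remainder in 2L² ≈ Σ 1/(2k+1)². Its second factors are blocks of the alternating harmonic
 -- series, hence small.
 E : ℕ → ℚ
 E n = ∑< n (λ i → odd⁻¹ i * (η (n ℕ.+ i) - η (n ℕ.∸ suc i)))

 -- Partial fractions turn the double sum L² into single alternating sums.
 E-step : ∀ n → E (suc n) ≡ E n + (4ℚ * (sign n * odd⁻¹ n) * L n + odd⁻¹ n * odd⁻¹ n)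
 E-step n = begin-equality
  ∑< n (λ i → odd⁻¹ i * (η (suc n ℕ.+ i) - η (n ℕ.∸ i))) + odd⁻¹ n * (η (suc n ℕ.+ n) - η (n ℕ.∸ n))
   ≡⟨ cong₂ _+_ (∑-cong< n term) (cong (λ k → odd⁻¹ n * (η (suc n ℕ.+ n) - η k)) (ℕ.n∸n≡0 n)) ⟩
  ∑< n (λ i → odd⁻¹ i * (η (n ℕ.+ i) - η (n ℕ.∸ suc i)) + c * (4ℚ * (sign i * odd⁻¹ i)) + odd⁻¹ n * (sign (n ℕ.∸ suc i) * - inv (n ℕ.∸ suc i)) + odd⁻¹ n * (- (sign (n ℕ.+ i) * inv (n ℕ.+ i)))) + odd⁻¹ n * (η (suc n ℕ.+ n) - 0ℚ)
   ≡⟨ cong (_+ odd⁻¹ n * (η (suc n ℕ.+ n) - 0ℚ)) split ⟩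
  E n + c * (4ℚ * L n) + odd⁻¹ n * - η n + odd⁻¹ n * - (η (n ℕ.+ n) - η n) + odd⁻¹ n * (η (suc n ℕ.+ n) - 0ℚ)
   ≡⟨ cong (λ x → E n + c * (4ℚ * L n) + odd⁻¹ n * - η n + odd⁻¹ n * - (η (n ℕ.+ n) - η n) + odd⁻¹ n * (x - 0ℚ)) last ⟩
  E n + c * (4ℚ * L n) + odd⁻¹ n * - η n + odd⁻¹ n * - (η (n ℕ.+ n) - η n) + odd⁻¹ n * (η (n ℕ.+ n) + 1ℚ * odd⁻¹ n - 0ℚ)
   ≡⟨ r (E n) c (L n) (odd⁻¹ n) (η n) (η (n ℕ.+ n)) ⟩
  E n + (4ℚ * c * L n + odd⁻¹ n * odd⁻¹ n) ∎
  where
  c = sign n * odd⁻¹ n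
  r = solve 6 (λ e c l o h k → e :+ c :* (# 4 :* l) :+ o :* :- h :+ o :* :- (k :- h) :+ o :* (k :+ :1 :* o :- :0) := e :+ (# 4 :* c :* l :+ o :* o)) refl
  last : η (suc n ℕ.+ n) ≡ η (n ℕ.+ n) + 1ℚ * odd⁻¹ n
  last = cong₂ (λ s k → η (n ℕ.+ n) + s * inv k) (trans (sign-+ n n) (sign² n)) (cong (n ℕ.+_) (sym (ℕ.+-identityʳ n)))
  term : ∀ i → i ℕ.< n → odd⁻¹ i * (η (suc n ℕ.+ i) - η (n ℕ.∸ i)) ≡
   odd⁻¹ i * (η (n ℕ.+ i) - η (n ℕ.∸ suc i)) + c * (4ℚ * (sign i * odd⁻¹ i)) + odd⁻¹ n * (sign (n ℕ.∸ suc i) * - inv (n ℕ.∸ suc i)) + odd⁻¹ n * (- (sign (n ℕ.+ i) * inv (n ℕ.+ i)))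
  term i i<n = begin-equality
   odd⁻¹ i * (η (suc n ℕ.+ i) - η (n ℕ.∸ i))
    ≡⟨ cong (λ k → odd⁻¹ i * (η (suc n ℕ.+ i) - η k)) n∸i ⟩
   odd⁻¹ i * (η (n ℕ.+ i) + sign (n ℕ.+ i) * inv (n ℕ.+ i) - (η m + sign m * inv m))
    ≡⟨ r₁ (odd⁻¹ i) (η (n ℕ.+ i)) (sign (n ℕ.+ i)) (inv (n ℕ.+ i)) (η m) (sign m) (inv m) ⟩
   odd⁻¹ i * (η (n ℕ.+ i) - η m) + sign (n ℕ.+ i) * (odd⁻¹ i * inv (n ℕ.+ i)) - sign m * (odd⁻¹ i * inv m)
    ≡⟨ cong₂ (λ x y → odd⁻¹ i * (η (n ℕ.+ i) - η m) + sign (n ℕ.+ i) * x - sign m * y) (pf⁻ n i) (trans (pf⁺ i m) (cong (λ k → odd⁻¹ k * (2ℚ * odd⁻¹ i + 1ℚ * inv m)) n≡)) ⟩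
   odd⁻¹ i * (η (n ℕ.+ i) - η m) + sign (n ℕ.+ i) * (odd⁻¹ n * (2ℚ * odd⁻¹ i + - 1ℚ * inv (n ℕ.+ i))) - sign m * (odd⁻¹ n * (2ℚ * odd⁻¹ i + 1ℚ * inv m))
    ≡⟨ r₂ (odd⁻¹ i) (η (n ℕ.+ i) - η m) (sign (n ℕ.+ i)) (odd⁻¹ n) (inv (n ℕ.+ i)) (sign m) (inv m) ⟩
   odd⁻¹ i * (η (n ℕ.+ i) - η m) + odd⁻¹ n * (2ℚ * ((sign (n ℕ.+ i) - sign m) * odd⁻¹ i)) + odd⁻¹ n * (sign m * - inv m) + odd⁻¹ n * (- (sign (n ℕ.+ i) * inv (n ℕ.+ i)))
    ≡⟨ cong₂ (λ x y → odd⁻¹ i * (η (n ℕ.+ i) - η m) + odd⁻¹ n * (2ℚ * ((x - y) * odd⁻¹ i)) + odd⁻¹ n * (sign m * - inv m) + odd⁻¹ n * (- (sign (n ℕ.+ i) * inv (n ℕ.+ i)))) (sign-+ n i) sign-m ⟩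
   odd⁻¹ i * (η (n ℕ.+ i) - η m) + odd⁻¹ n * (2ℚ * ((sign n * sign i - - (sign n * sign i)) * odd⁻¹ i)) + odd⁻¹ n * (sign m * - inv m) + odd⁻¹ n * (- (sign (n ℕ.+ i) * inv (n ℕ.+ i)))
    ≡⟨ cong (λ x → odd⁻¹ i * (η (n ℕ.+ i) - η m) + x + odd⁻¹ n * (sign m * - inv m) + odd⁻¹ n * (- (sign (n ℕ.+ i) * inv (n ℕ.+ i)))) (r₃ (sign n) (sign i) (odd⁻¹ i) (odd⁻¹ n)) ⟩
   odd⁻¹ i * (η (n ℕ.+ i) - η m) + c * (4ℚ * (sign i * odd⁻¹ i)) + odd⁻¹ n * (sign m * - inv m) + odd⁻¹ n * (- (sign (n ℕ.+ i) * inv (n ℕ.+ i))) ∎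
   where
   m = n ℕ.∸ suc i
   n≡ : suc (i ℕ.+ m) ≡ n
   n≡ = ℕ.m+[n∸m]≡n i<n
   n∸i : n ℕ.∸ i ≡ suc m
   n∸i = trans (cong (ℕ._∸ i) (trans (sym n≡) (sym (ℕ.+-suc i m)))) (ℕ.m+n∸m≡n i (suc m))
   sign-m : sign m ≡ - (sign n * sign i)
   sign-m = sym (trans (cong (λ k → - (sign k * sign i)) (sym n≡)) (trans (cong (λ x → - (- x * sign i)) (sign-+ i m)) (trans (rs (sign i) (sign m)) (trans (cong (_* sign m) (sign² i)) (*-identityˡ (sign m))))))
    where
    rs = solve 2 (λ a b → :- (:- (a :* b) :* a) := a :* a :* b) refl
   r₁ = solve 7 (λ o h s x k u y → o :* (h :+ s :* x :- (k :+ u :* y)) := o :* (h :- k) :+ s :* (o :* x) :- u :* (o :* y)) refl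
   r₂ = solve 7 (λ o e s n x u y → o :* e :+ s :* (n :* (# 2 :* o :+ :- :1 :* x)) :- u :* (n :* (# 2 :* o :+ :1 :* y)) := o :* e :+ n :* (# 2 :* ((s :- u) :* o)) :+ n :* (u :* :- y) :+ n :* (:- (s :* x))) refl
   r₃ = solve 4 (λ s u o n → n :* (# 2 :* ((s :* u :- :- (s :* u)) :* o)) := s :* n :* (# 4 :* (u :* o))) refl
  split : ∑< n (λ i → odd⁻¹ i * (η (n ℕ.+ i) - η (n ℕ.∸ suc i)) + c * (4ℚ * (sign i * odd⁻¹ i)) + odd⁻¹ n * (sign (n ℕ.∸ suc i) * - inv (n ℕ.∸ suc i)) + odd⁻¹ n * (- (sign (n ℕ.+ i) * inv (n ℕ.+ i))))
     ≡ E n + c * (4ℚ * L n) + odd⁻¹ n * - η n + odd⁻¹ n * - (η (n ℕ.+ n) - η n)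
  split = trans (∑-+ n _ _) (cong₂ _+_ (trans (∑-+ n _ _) (cong₂ _+_ (trans (∑-+ n _ _) (cong (λ x → E n + x) (trans (∑-* n c _) (cong (c *_) (∑-* n 4ℚ _)))))
    (trans (∑-* n (odd⁻¹ n) _) (cong (odd⁻¹ n *_) (trans (∑-reverse n (λ k → sign k * - inv k)) lower)))))
    (trans (∑-* n (odd⁻¹ n) _) (cong (odd⁻¹ n *_) upper)))
   where
   ∑-neg : ∀ k (f : ℕ → ℚ) → ∑< k (λ i → - f i) ≡ - ∑< k f
   ∑-neg zero f = refl
   ∑-neg (suc k) f = trans (cong (_+ - f k) (∑-neg k f)) (sym (neg-distrib-+ (∑< k f) (f k)))
   lower : ∑< n (λ k → sign k * - inv k) ≡ - η n
   lower = trans (∑-cong n λ k → sym (neg-distribʳ-* (sign k) (inv k))) (∑-neg n _)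
   upper : ∑< n (λ i → - (sign (n ℕ.+ i) * inv (n ℕ.+ i))) ≡ - (η (n ℕ.+ n) - η n)
   upper = trans (∑-neg n _) (cong -_ (trans (r₄ (∑< n (λ i → sign (n ℕ.+ i) * inv (n ℕ.+ i))) (η n)) (cong (_- η n) (sym (∑-append n n (λ j → sign j * inv j))))))
    where
    r₄ = solve 2 (λ a b → a := b :+ a :- b) refl

 E≡ : ∀ n → E n ≡ 2ℚ * (L n * L n) - Q n
 E≡ zero = refl
 E≡ (suc n) = trans (E-step n) (trans (cong (_+ (4ℚ * (sign n * odd⁻¹ n) * L n + odd⁻¹ n * odd⁻¹ n)) (E≡ n))
  (trans (cong (λ x → 2ℚ * (L n * L n) - Q n + (4ℚ * (sign n * odd⁻¹ n) * L n + x)) one)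
  (r (L n) (Q n) (sign n) (odd⁻¹ n))) ⟨trans⟩ cong (λ x → 2ℚ * (L (suc n) * L (suc n)) - (Q n + x)) two)
  where
  _⟨trans⟩_ : ∀ {a b c : ℚ} → a ≡ b → b ≡ c → a ≡ c
  _⟨trans⟩_ = trans
  one : odd⁻¹ n * odd⁻¹ n ≡ sign n * odd⁻¹ n * (sign n * odd⁻¹ n)
  one = sym (trans (r₀ (sign n) (odd⁻¹ n)) (trans (cong (_* (odd⁻¹ n * odd⁻¹ n)) (sign² n)) (*-identityˡ _)))
   where
   r₀ = solve 2 (λ s o → s :* o :* (s :* o) := s :* s :* (o :* o)) refl
  two : sign n * odd⁻¹ n * (sign n * odd⁻¹ n) ≡ odd⁻¹ n * odd⁻¹ n
  two = sym one
  r = solve 4 (λ l q s o → # 2 :* (l :* l) :- q :+ (# 4 :* (s :* o) :* l :+ s :* o :* (s :* o)) := # 2 :* ((l :+ s :* o) :* (l :+ s :* o)) :- (q :+ s :* o :* (s :* o))) refl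

 -- An alternating block is at most its first term 1/(n-i), and 1/((2i+1)(n-i)) splits over the
 -- common denominator 2n + 1.
 E-bound : ∀ n → ∣ E n ∣ ≤ 3ℚ * Har n * odd⁻¹ n
 E-bound n = begin
  ∣ E n ∣ ≤⟨ ∑-abs n _ ⟩
  ∑< n (λ i → ∣ odd⁻¹ i * (η (n ℕ.+ i) - η (n ℕ.∸ suc i)) ∣) ≤⟨ ∑-mono< n term ⟩
  ∑< n (λ i → odd⁻¹ n * (2ℚ * inv i + inv (n ℕ.∸ suc i))) ≡⟨ trans (∑-* n (odd⁻¹ n) _) (cong (odd⁻¹ n *_) (trans (∑-+ n _ _) (cong₂ _+_ (∑-* n 2ℚ inv) (∑-reverse n inv)))) ⟩
  odd⁻¹ n * (2ℚ * Har n + Har n) ≡⟨ r (odd⁻¹ n) (Har n) ⟩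
  3ℚ * Har n * odd⁻¹ n ∎
  where
  r = solve 2 (λ o h → o :* (# 2 :* h :+ h) := # 3 :* h :* o) refl
  term : ∀ i → i ℕ.< n → ∣ odd⁻¹ i * (η (n ℕ.+ i) - η (n ℕ.∸ suc i)) ∣ ≤ odd⁻¹ n * (2ℚ * inv i + inv (n ℕ.∸ suc i))
  term i i<n = begin
   ∣ odd⁻¹ i * (η (n ℕ.+ i) - η m) ∣ ≤⟨ ∣*∣ (0≤odd i) (subst (λ k → ∣ η k - η m ∣ ≤ inv m) e (alt-close 0≤inv inv-dec (suc (i ℕ.+ i)) m)) ⟩
   odd⁻¹ i * inv m ≡⟨ trans (pf⁺ i m) (cong (λ k → odd⁻¹ k * (2ℚ * odd⁻¹ i + 1ℚ * inv m)) n≡) ⟩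
   odd⁻¹ n * (2ℚ * odd⁻¹ i + 1ℚ * inv m) ≤⟨ *-monoˡ (0≤odd n) (+-mono-≤ (*-monoˡ 0≤2 (odd≤inv i)) (≤-reflexive (*-identityˡ (inv m)))) ⟩
   odd⁻¹ n * (2ℚ * inv i + inv m) ∎
   where
   m = n ℕ.∸ suc i
   n≡ : suc (i ℕ.+ m) ≡ n
   n≡ = ℕ.m+[n∸m]≡n i<n
   e : m ℕ.+ suc (i ℕ.+ i) ≡ n ℕ.+ i
   e = trans (e′ m i) (cong (ℕ._+ i) n≡)
    where
    e′ : ∀ m i → m ℕ.+ suc (i ℕ.+ i) ≡ suc (i ℕ.+ m) ℕ.+ i
    e′ = ℕ-Ring.solve-∀

 -- A bound 2√n for the harmonic sum at squares n; it keeps logarithms out of the rate of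
 -- convergence.
 Har-square : ∀ k → Har (suc k ℕ.* suc k) ≤ 2ℚ * ⌜ suc k ⌝
 Har-square k = begin
  Har (suc k ℕ.* suc k) ≡⟨ ∑-append (suc k) (k ℕ.* suc k) inv ⟩
  Har (suc k) + ∑< (k ℕ.* suc k) (λ r → inv (suc k ℕ.+ r)) ≤⟨ +-mono-≤ (≤≡ (∑-mono (suc k) inv≤1) (trans (∑-const (suc k) 1ℚ) (*-identityʳ ⌜ suc k ⌝)))
    (≤≡ (∑-mono (k ℕ.* suc k) λ r → inv-antitone {k} {suc k ℕ.+ r} (ℕ.≤-trans (ℕ.n≤1+n k) (ℕ.m≤m+n (suc k) r))) (∑-const (k ℕ.* suc k) (inv k))) ⟩
  ⌜ suc k ⌝ + ⌜ k ℕ.* suc k ⌝ * inv k ≡⟨ cong (λ x → ⌜ suc k ⌝ + x) (trans (cong (_* inv k) (⌜*⌝ k (suc k))) (trans (*-assoc ⌜ k ⌝ ⌜ suc k ⌝ (inv k)) (trans (cong (⌜ k ⌝ *_) (⌜*⌝-inv k)) (*-identityʳ ⌜ k ⌝)))) ⟩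
  ⌜ suc k ⌝ + ⌜ k ⌝ ≤⟨ +-monoʳ-≤ ⌜ suc k ⌝ (⌜⌝-mono (ℕ.n≤1+n k)) ⟩
  ⌜ suc k ⌝ + ⌜ suc k ⌝ ≡⟨ r ⌜ suc k ⌝ ⟩
  2ℚ * ⌜ suc k ⌝ ∎
  where
  r = solve 1 (λ a → a :+ a := # 2 :* a) refl

 -- The even terms of ζ(2n) sum to ζ(n)/4, and the odd ones remain.
 Q-ζ : ∀ n → 4ℚ * Q n ≡ 4ℚ * ζ (n ℕ.+ n) - ζ n
 Q-ζ zero = refl
 Q-ζ (suc n) = begin-equality
  4ℚ * (Q n + odd⁻¹ n * odd⁻¹ n) ≡⟨ *-distribˡ-+ 4ℚ (Q n) _ ⟩
  4ℚ * Q n + 4ℚ * (odd⁻¹ n * odd⁻¹ n) ≡⟨ cong (_+ 4ℚ * (odd⁻¹ n * odd⁻¹ n)) (Q-ζ n) ⟩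
  4ℚ * ζ (n ℕ.+ n) - ζ n + 4ℚ * (odd⁻¹ n * odd⁻¹ n) ≡⟨ r₁ (ζ (n ℕ.+ n)) (ζ n) (odd⁻¹ n) (2ℚ * inv (suc (n ℕ.+ n))) ⟩
  4ℚ * (ζ (n ℕ.+ n) + odd⁻¹ n * odd⁻¹ n) + 2ℚ * inv (suc (n ℕ.+ n)) * (2ℚ * inv (suc (n ℕ.+ n))) - ζ n - 2ℚ * inv (suc (n ℕ.+ n)) * (2ℚ * inv (suc (n ℕ.+ n)))
   ≡⟨ cong (λ x → 4ℚ * (ζ (n ℕ.+ n) + odd⁻¹ n * odd⁻¹ n) + 2ℚ * inv (suc (n ℕ.+ n)) * (2ℚ * inv (suc (n ℕ.+ n))) - ζ n - x * x) half ⟩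
  4ℚ * (ζ (n ℕ.+ n) + odd⁻¹ n * odd⁻¹ n) + 2ℚ * inv (suc (n ℕ.+ n)) * (2ℚ * inv (suc (n ℕ.+ n))) - ζ n - inv n * inv n
   ≡⟨ r₂ (ζ (n ℕ.+ n)) (ζ n) (odd⁻¹ n) (inv (suc (n ℕ.+ n))) (inv n) ⟩
  4ℚ * (ζ (n ℕ.+ n) + odd⁻¹ n * odd⁻¹ n + inv (suc (n ℕ.+ n)) * inv (suc (n ℕ.+ n))) - (ζ n + inv n * inv n)
   ≡⟨ cong₂ (λ k z → 4ℚ * (ζ (n ℕ.+ n) + inv k * inv k + inv (suc (n ℕ.+ n)) * inv (suc (n ℕ.+ n))) - z) (cong (n ℕ.+_) (ℕ.+-identityʳ n)) refl ⟩
  4ℚ * ζ (suc (suc (n ℕ.+ n))) - ζ (suc n) ≡⟨ cong (λ k → 4ℚ * ζ k - ζ (suc n)) (cong suc (sym (ℕ.+-suc n n))) ⟩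
  4ℚ * ζ (suc n ℕ.+ suc n) - ζ (suc n) ∎
  where
  r₁ = solve 4 (λ z z′ o x → # 4 :* z :- z′ :+ # 4 :* (o :* o) := # 4 :* (z :+ o :* o) :+ x :* x :- z′ :- x :* x) refl
  r₂ = solve 5 (λ z z′ o x y → # 4 :* (z :+ o :* o) :+ # 2 :* x :* (# 2 :* x) :- z′ :- y :* y := # 4 :* (z :+ o :* o :+ x :* x) :- (z′ :+ y :* y)) refl
  half : 2ℚ * inv (suc (n ℕ.+ n)) ≡ inv n
  half = begin-equality
   2ℚ * x ≡⟨ sym (*-identityʳ _) ⟩
   2ℚ * x * 1ℚ ≡⟨ cong (2ℚ * x *_) (sym (suc-inv n)) ⟩
   2ℚ * x * ((1ℚ + ⌜ n ⌝) * inv n) ≡⟨ r x ⌜ n ⌝ (inv n) ⟩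
   (1ℚ + (1ℚ + (⌜ n ⌝ + ⌜ n ⌝))) * x * inv n ≡⟨ cong (λ a → (1ℚ + a) * x * inv n) (sym (trans (⌜suc⌝ (n ℕ.+ n)) (cong (λ a → 1ℚ + a) (⌜+⌝ n n)))) ⟩
   (1ℚ + ⌜ suc (n ℕ.+ n) ⌝) * x * inv n ≡⟨ cong (_* inv n) (suc-inv (suc (n ℕ.+ n))) ⟩
   1ℚ * inv n ≡⟨ *-identityˡ (inv n) ⟩
   inv n ∎
   where
   x = inv (suc (n ℕ.+ n))
   r = solve 3 (λ x n v → # 2 :* x :* ((:1 :+ n) :* v) := (:1 :+ (:1 :+ (n :+ n))) :* x :* v) refl

 L-abs : ∀ n → ∣ L n ∣ ≤ 1ℚ
 L-abs n = ≡≤ (cong ∣_∣ (sym (r (L n)))) (alt-close 0≤odd odd-dec n 0)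
  where
  r = solve 1 (λ a → a :- :0 := a) refl

 -- L at k + 1 is compared with L at n = (k+1)², where `E-bound` becomes 6/(k+1). The constant is 16
 -- + 24 + 5: change of L, remainder E, tails of ζ.
 basel : ∀ N k → N ℕ.≤ k → ∣ 8ℚ * (L (suc k) * L (suc k)) - 3ℚ * ζ (suc N) ∣ ≤ ⌜ 45 ⌝ * inv N
 basel N k N≤k = begin
  ∣ 8ℚ * (L (suc k) * L (suc k)) - 3ℚ * ζ (suc N) ∣
   ≡⟨ cong ∣_∣ (trans (r₁ (L (suc k)) (L n) (Q n) (ζ (suc N)) ) (cong (λ q → 8ℚ * ((L (suc k) + L n) * (L (suc k) - L n)) + 4ℚ * (2ℚ * (L n * L n) - Q n) + (q - 3ℚ * ζ (suc N))) (Q-ζ n))) ⟩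
  ∣ 8ℚ * ((L (suc k) + L n) * (L (suc k) - L n)) + 4ℚ * (2ℚ * (L n * L n) - Q n) + (4ℚ * ζ (n ℕ.+ n) - ζ n - 3ℚ * ζ (suc N)) ∣
   ≤⟨ ∣+∣ {8ℚ * ((L (suc k) + L n) * (L (suc k) - L n)) + 4ℚ * (2ℚ * (L n * L n) - Q n)} (∣+∣ {8ℚ * ((L (suc k) + L n) * (L (suc k) - L n))} (∣*∣ 0≤8 first) (∣*∣ 0≤4 second)) third ⟩
  8ℚ * (2ℚ * inv N) + 4ℚ * (6ℚ * inv N) + (4ℚ * inv N + inv N)
   ≡⟨ r₂ (inv N) ⟩
  ⌜ 45 ⌝ * inv N ∎
  where
  n = suc k ℕ.* suc k
  r₁ = solve 4 (λ a b q z → # 8 :* (a :* a) :- # 3 :* z := # 8 :* ((a :+ b) :* (a :- b)) :+ # 4 :* (# 2 :* (b :* b) :- q) :+ (# 4 :* q :- # 3 :* z)) refl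
  r₂ = solve 1 (λ i → # 8 :* (# 2 :* i) :+ # 4 :* (# 6 :* i) :+ (# 4 :* i :+ i) := # 45 :* i) refl
  N<n : suc N ℕ.≤ n
  N<n = ℕ.≤-trans (ℕ.s≤s N≤k) (ℕ.m≤m*n (suc k) (suc k))
  first : ∣ (L (suc k) + L n) * (L (suc k) - L n) ∣ ≤ 2ℚ * inv N
  first = ≡≤ (∣p*q∣≡∣p∣*∣q∣ (L (suc k) + L n) (L (suc k) - L n)) (*-mono {∣ L (suc k) + L n ∣} {2ℚ} 0≤2 (0≤∣p∣ _) (∣+∣ {L (suc k)} (L-abs (suc k)) (L-abs n))
   (≡≤ (∣p-q∣≡∣q-p∣ (L (suc k)) (L n)) (≤-trans (alt-close 0≤odd odd-dec (k ℕ.* suc k) (suc k)) (≤-trans (odd≤inv (suc k)) (inv-antitone (ℕ.≤-trans N≤k (ℕ.n≤1+n k)))))))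
  second : ∣ 2ℚ * (L n * L n) - Q n ∣ ≤ 6ℚ * inv N
  second = begin
   ∣ 2ℚ * (L n * L n) - Q n ∣ ≡⟨ cong ∣_∣ (sym (E≡ n)) ⟩
   ∣ E n ∣ ≤⟨ E-bound n ⟩
   3ℚ * Har n * odd⁻¹ n ≤⟨ *-mono {3ℚ * Har n} {3ℚ * (2ℚ * ⌜ suc k ⌝)} (0≤* 0≤3 (0≤* 0≤2 (0≤⌜⌝ (suc k)))) (0≤odd n) (*-monoˡ 0≤3 (Har-square k)) odd≤ ⟩
   3ℚ * (2ℚ * ⌜ suc k ⌝) * (inv k * inv k) ≡⟨ trans (r ⌜ suc k ⌝ (inv k)) (trans (cong (λ a → 6ℚ * a * inv k) (⌜*⌝-inv k)) (cong (_* inv k) (*-identityʳ 6ℚ))) ⟩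
   6ℚ * inv k ≤⟨ *-monoˡ 0≤6 (inv-antitone N≤k) ⟩
   6ℚ * inv N ∎
   where
   r = solve 2 (λ a i → # 3 :* (# 2 :* a) :* (i :* i) := # 6 :* (a :* i) :* i) refl
   odd≤ : odd⁻¹ n ≤ inv k * inv k
   odd≤ = ≤≡ (inv-antitone {ℕ.pred n} {2 ℕ.* n} (ℕ.≤-trans (ℕ.pred[n]≤n) (ℕ.m≤m+n n (n ℕ.+ 0)))) inv-n
    where
    inv-n : inv (ℕ.pred n) ≡ inv k * inv k
    inv-n = sym (begin-equality
     inv k * inv k ≡⟨ sym (*-identityʳ _) ⟩
     inv k * inv k * 1ℚ ≡⟨ cong (inv k * inv k *_) (sym (⌜*⌝-inv (ℕ.pred n))) ⟩
     inv k * inv k * (⌜ n ⌝ * inv (ℕ.pred n)) ≡⟨ cong (λ a → inv k * inv k * (a * inv (ℕ.pred n))) (⌜*⌝ (suc k) (suc k)) ⟩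
     inv k * inv k * (⌜ suc k ⌝ * ⌜ suc k ⌝ * inv (ℕ.pred n)) ≡⟨ r₃ (inv k) ⌜ suc k ⌝ (inv (ℕ.pred n)) ⟩
     ⌜ suc k ⌝ * inv k * (⌜ suc k ⌝ * inv k) * inv (ℕ.pred n) ≡⟨ cong (λ a → a * a * inv (ℕ.pred n)) (⌜*⌝-inv k) ⟩
     1ℚ * 1ℚ * inv (ℕ.pred n) ≡⟨ *-identityˡ (inv (ℕ.pred n)) ⟩
     inv (ℕ.pred n) ∎)
     where
     r₃ = solve 3 (λ i a x → i :* i :* (a :* a :* x) := a :* i :* (a :* i) :* x) refl
  third : ∣ 4ℚ * ζ (n ℕ.+ n) - ζ n - 3ℚ * ζ (suc N) ∣ ≤ 4ℚ * inv N + inv N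
  third = ≡≤ (cong ∣_∣ (r (ζ (n ℕ.+ n)) (ζ n) (ζ (suc N)))) (∣-∣ {4ℚ * (ζ (n ℕ.+ n) - ζ (suc N))} (∣*∣ 0≤4 (ζ-close {N} (ℕ.≤-trans N<n (ℕ.m≤m+n n n)) ℕ.≤-refl)) (ζ-close {N} N<n ℕ.≤-refl))
   where
   r = solve 3 (λ a b c → # 4 :* a :- b :- # 3 :* c := # 4 :* (a :- c) :- (b :- c)) refl

-- Wallis' product from binomial weights

module Wallis where
 open Rationals
 open ZetaSums using (inv; 0≤inv)
 open Basel using (alt; alt-close; L; odd-inv; odd≤inv; 0≤odd; odd-dec)
 open import Data.Rational.Properties
 open ≤-Reasoning

 -- v n k = C(2n+1, n-k) / C(2n+1, n)
 v : ℕ → ℕ → ℚ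
 v n zero = 1ℚ
 v n (suc k) = v n k * ((⌜ n ⌝ - ⌜ k ⌝) * inv (suc (n ℕ.+ k)))

 ⌜2+⌝ : ∀ n k → ⌜ suc (suc (n ℕ.+ k)) ⌝ ≡ 2ℚ + ⌜ n ⌝ + ⌜ k ⌝
 ⌜2+⌝ n k = trans (⌜+⌝ 2 (n ℕ.+ k)) (trans (cong (λ x → 2ℚ + x) (⌜+⌝ n k)) (sym (+-assoc 2ℚ ⌜ n ⌝ ⌜ k ⌝)))

 inv-2+ : ∀ n k → (2ℚ + ⌜ n ⌝ + ⌜ k ⌝) * inv (suc (n ℕ.+ k)) ≡ 1ℚ
 inv-2+ n k = trans (cong (_* inv (suc (n ℕ.+ k))) (sym (⌜2+⌝ n k))) (⌜*⌝-inv (suc (n ℕ.+ k)))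

 v-rec : ∀ n k → (2ℚ + ⌜ n ⌝ + ⌜ k ⌝) * v n (suc k) ≡ (⌜ n ⌝ - ⌜ k ⌝) * v n k
 v-rec n k = trans (r (2ℚ + ⌜ n ⌝ + ⌜ k ⌝) (v n k) (⌜ n ⌝ - ⌜ k ⌝) (inv (suc (n ℕ.+ k)))) (trans (cong (λ x → x * ((⌜ n ⌝ - ⌜ k ⌝) * v n k)) (inv-2+ n k)) (*-identityˡ _))
  where
  r = solve 4 (λ a v b i → a :* (v :* (b :* i)) := a :* i :* (b :* v)) refl

 v-vanish : ∀ n → v n (suc n) ≡ 0ℚ
 v-vanish n = r (v n n) ⌜ n ⌝ (inv (suc (n ℕ.+ n)))
  where
  r = solve 3 (λ v n i → v :* ((n :- n) :* i) := :0) refl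

 0≤v : ∀ n k → k ℕ.≤ suc n → 0ℚ ≤ v n k
 0≤v n zero _ = 0≤1
 0≤v n (suc k) (ℕ.s≤s k≤n) = 0≤* (0≤v n k (ℕ.m≤n⇒m≤1+n k≤n)) (0≤* (sub≥0 (⌜⌝-mono k≤n)) (0≤inv (suc (n ℕ.+ k))))

 v-beyond : ∀ n j → v n (suc n ℕ.+ j) ≡ 0ℚ
 v-beyond n zero = trans (cong (v n) (ℕ.+-identityʳ (suc n))) (v-vanish n)
 v-beyond n (suc j) = trans (cong (v n) (ℕ.+-suc (suc n) j)) (trans (cong (_* ((⌜ n ⌝ - ⌜ suc n ℕ.+ j ⌝) * inv (suc (n ℕ.+ (suc n ℕ.+ j))))) (v-beyond n j)) (*-zeroˡ ((⌜ n ⌝ - ⌜ suc n ℕ.+ j ⌝) * inv (suc (n ℕ.+ (suc n ℕ.+ j))))))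

 0≤v′ : ∀ n k → 0ℚ ≤ v n k
 0≤v′ n k = split (ℕ.≤-<-connex k (suc n))
  where
  split : k ℕ.≤ suc n ⊎ suc n ℕ.< k → 0ℚ ≤ v n k
  split (inj₁ h) = 0≤v n k h
  split (inj₂ h) = ≤-reflexive (sym (trans (cong (v n) (sym (ℕ.m+[n∸m]≡n (ℕ.<⇒≤ h)))) (v-beyond n (k ℕ.∸ suc n))))

 v-drop : ∀ n k → v n k - v n (suc k) ≡ v n k * ((2ℚ * ⌜ k ⌝ + 2ℚ) * inv (suc (n ℕ.+ k)))
 v-drop n k = trans (cong (λ x → x - v n (suc k)) (trans (sym (*-identityʳ (v n k))) (cong (v n k *_) (sym (inv-2+ n k))))) (r (v n k) ⌜ n ⌝ ⌜ k ⌝ (inv (suc (n ℕ.+ k))))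
  where
  r = solve 4 (λ v n k i → v :* ((# 2 :+ n :+ k) :* i) :- v :* ((n :- k) :* i) := v :* ((# 2 :* k :+ # 2) :* i)) refl

 v-dec : ∀ n k → v n (suc k) ≤ v n k
 v-dec n k = by (v n k - v n (suc k)) (≤≡ (0≤* (0≤v′ n k) (0≤* (0≤+ (0≤* 0≤2 (0≤⌜⌝ k)) 0≤2) (0≤inv (suc (n ℕ.+ k))))) (sym (v-drop n k))) (r (v n k) (v n (suc k)))
  where
  r = solve 2 (λ a b → b :+ (a :- b) := a) refl

 v≤1 : ∀ n k → v n k ≤ 1ℚ
 v≤1 n zero = ≤-refl
 v≤1 n (suc k) = ≤-trans (v-dec n k) (v≤1 n k)

 -- The drop from k to k + 1 is at most 2(k+1)/(n+1), and these bounds sum to k(k+1)/(n+1).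
 v-lower : ∀ n k → 1ℚ - ⌜ k ⌝ * (1ℚ + ⌜ k ⌝) * inv n ≤ v n k
 v-lower n zero = ≤-reflexive (r (inv n))
  where
  r = solve 1 (λ i → :1 :- :0 :* (:1 :+ :0) :* i := :1) refl
 v-lower n (suc k) = begin
  1ℚ - ⌜ suc k ⌝ * (1ℚ + ⌜ suc k ⌝) * inv n ≡⟨ trans (cong (λ a → 1ℚ - a * (1ℚ + a) * inv n) (⌜suc⌝ k)) (r₁ ⌜ k ⌝ (inv n)) ⟩
  1ℚ - ⌜ k ⌝ * (1ℚ + ⌜ k ⌝) * inv n - 1ℚ * ((2ℚ * ⌜ k ⌝ + 2ℚ) * inv n) ≤⟨ +-mono-≤ (v-lower n k) (neg-antimono-≤ (*-mono {v n k} {1ℚ} 0≤1 (0≤* 0≤2k (0≤inv (suc (n ℕ.+ k)))) (v≤1 n k)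
                                     (*-monoˡ 0≤2k (inv-antitone (ℕ.≤-trans (ℕ.m≤m+n n k) (ℕ.n≤1+n _)))))) ⟩
  v n k - v n k * ((2ℚ * ⌜ k ⌝ + 2ℚ) * inv (suc (n ℕ.+ k))) ≡⟨ trans (cong (λ x → v n k - x) (sym (v-drop n k))) (r₂ (v n k) (v n (suc k))) ⟩
  v n (suc k) ∎
  where
  0≤2k : 0ℚ ≤ 2ℚ * ⌜ k ⌝ + 2ℚ
  0≤2k = 0≤+ (0≤* 0≤2 (0≤⌜⌝ k)) 0≤2
  r₁ = solve 2 (λ k i → :1 :- (:1 :+ k) :* (:1 :+ (:1 :+ k)) :* i := :1 :- k :* (:1 :+ k) :* i :- :1 :* ((# 2 :* k :+ # 2) :* i)) refl
  r₂ = solve 2 (λ a b → a :- (a :- b) := b) refl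

 -- `X n` is half a binomial row divided by its largest entry, 4^n / C(2n+1, n). The terms of `Y n`
 -- tend to those of the Leibniz series.
 X Y : ℕ → ℚ
 X n = ∑< (suc n) (v n)
 Y n = alt (λ k → v n k * odd⁻¹ k) (suc n)

 private
  cancel≡ : ∀ {c a b} → 0ℚ < c → c * a ≡ c * b → a ≡ b
  cancel≡ h e = ≤-antisym (*-cancel-≤ h (≤-reflexive e)) (*-cancel-≤ h (≤-reflexive (sym e)))

 v-shift : ∀ n k → v n k * ((1ℚ + ⌜ n ⌝) * (2ℚ + ⌜ n ⌝)) ≡ v (suc n) k * ((1ℚ + ⌜ n ⌝ - ⌜ k ⌝) * (2ℚ + ⌜ n ⌝ + ⌜ k ⌝))
 v-shift n zero = r ⌜ n ⌝
  where
  r = solve 1 (λ n → :1 :* ((:1 :+ n) :* (# 2 :+ n)) := :1 :* ((:1 :+ n :- :0) :* (# 2 :+ n :+ :0))) refl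
 v-shift n (suc k) = begin-equality
  v n k * ((a - b) * i₁) * ((1ℚ + a) * (2ℚ + a)) ≡⟨ r₁ (v n k) (a - b) i₁ ((1ℚ + a) * (2ℚ + a)) ⟩
  v n k * ((1ℚ + a) * (2ℚ + a)) * ((a - b) * i₁) ≡⟨ cong (_* ((a - b) * i₁)) (v-shift n k) ⟩
  v (suc n) k * ((1ℚ + a - b) * (2ℚ + a + b)) * ((a - b) * i₁) ≡⟨ r₂ (v (suc n) k) a b i₁ ⟩
  v (suc n) k * ((1ℚ + a - b) * (a - b)) * ((2ℚ + a + b) * i₁) ≡⟨ cong (v (suc n) k * ((1ℚ + a - b) * (a - b)) *_) (trans (inv-2+ n k) (sym (inv-2+ (suc n) k))) ⟩
  v (suc n) k * ((1ℚ + a - b) * (a - b)) * ((2ℚ + ⌜ suc n ⌝ + b) * i₂) ≡⟨ cong (λ x → v (suc n) k * ((1ℚ + a - b) * (a - b)) * ((2ℚ + x + b) * i₂)) (⌜suc⌝ n) ⟩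
  v (suc n) k * ((1ℚ + a - b) * (a - b)) * ((2ℚ + (1ℚ + a) + b) * i₂) ≡⟨ r₃ (v (suc n) k) a b i₂ ⟩
  v (suc n) k * ((1ℚ + a - b) * i₂) * ((1ℚ + a - (1ℚ + b)) * (2ℚ + a + (1ℚ + b))) ≡⟨ cong₂ (λ x z → v (suc n) k * ((x - b) * i₂) * ((1ℚ + a - z) * (2ℚ + a + z))) (sym (⌜suc⌝ n)) (sym (⌜suc⌝ k)) ⟩
  v (suc n) (suc k) * ((1ℚ + a - ⌜ suc k ⌝) * (2ℚ + a + ⌜ suc k ⌝)) ∎
  where
  a = ⌜ n ⌝
  b = ⌜ k ⌝
  i₁ = inv (suc (n ℕ.+ k))
  i₂ = inv (suc (suc n ℕ.+ k))
  r₁ = solve 4 (λ v x i c → v :* (x :* i) :* c := v :* c :* (x :* i)) refl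
  r₂ = solve 4 (λ v a b i → v :* ((:1 :+ a :- b) :* (# 2 :+ a :+ b)) :* ((a :- b) :* i) := v :* ((:1 :+ a :- b) :* (a :- b)) :* ((# 2 :+ a :+ b) :* i)) refl
  r₃ = solve 4 (λ v a b i → v :* ((:1 :+ a :- b) :* (a :- b)) :* ((# 2 :+ (:1 :+ a) :+ b) :* i) := v :* ((:1 :+ a :- b) :* i) :* ((:1 :+ a :- (:1 :+ b)) :* (# 2 :+ a :+ (:1 :+ b)))) refl

 -- A telescoping certificate: by `v-rec` each summand is a difference of consecutive right sides.
 -- At K = n + 1 it gives the second moment of the weights.
 moment : ∀ n K → ∑< K (λ k → v n k * (2ℚ * (⌜ k ⌝ * (1ℚ + ⌜ k ⌝)) - ⌜ n ⌝)) ≡ - (⌜ K ⌝ * ((⌜ n ⌝ + ⌜ K ⌝ + 1ℚ) * v n K))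
 moment n zero = r (⌜ n ⌝ + 0ℚ + 1ℚ)
  where
  r = solve 1 (λ a → :0 := :- (:0 :* (a :* :1))) refl
 moment n (suc K) = begin-equality
  ∑< K _ + v n K * (2ℚ * (k * (1ℚ + k)) - a) ≡⟨ cong (_+ v n K * (2ℚ * (k * (1ℚ + k)) - a)) (moment n K) ⟩
  - (k * ((a + k + 1ℚ) * v n K)) + v n K * (2ℚ * (k * (1ℚ + k)) - a) ≡⟨ r₁ k a (v n K) ⟩
  - ((1ℚ + k) * ((a - k) * v n K)) ≡⟨ cong (λ x → - ((1ℚ + k) * x)) (sym (v-rec n K)) ⟩
  - ((1ℚ + k) * ((2ℚ + a + k) * v n (suc K))) ≡⟨ r₂ k a (v n (suc K)) ⟩
  - ((1ℚ + k) * ((a + (1ℚ + k) + 1ℚ) * v n (suc K))) ≡⟨ cong (λ x → - (x * ((a + x + 1ℚ) * v n (suc K)))) (sym (⌜suc⌝ K)) ⟩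
  - (⌜ suc K ⌝ * ((a + ⌜ suc K ⌝ + 1ℚ) * v n (suc K))) ∎
  where
  a = ⌜ n ⌝
  k = ⌜ K ⌝
  r₁ = solve 3 (λ k a v → :- (k :* ((a :+ k :+ :1) :* v)) :+ v :* (# 2 :* (k :* (:1 :+ k)) :- a) := :- ((:1 :+ k) :* ((a :- k) :* v))) refl
  r₂ = solve 3 (λ k a v → :- ((:1 :+ k) :* ((# 2 :+ a :+ k) :* v)) := :- ((:1 :+ k) :* ((a :+ (:1 :+ k) :+ :1) :* v))) refl

 moment-0 : ∀ n → ∑< (suc n) (λ k → v n k * (2ℚ * (⌜ k ⌝ * (1ℚ + ⌜ k ⌝)) - ⌜ n ⌝)) ≡ 0ℚ
 moment-0 n = trans (moment n (suc n)) (trans (cong (λ x → - (⌜ suc n ⌝ * ((⌜ n ⌝ + ⌜ suc n ⌝ + 1ℚ) * x))) (v-vanish n)) (r ⌜ suc n ⌝ (⌜ n ⌝ + ⌜ suc n ⌝ + 1ℚ)))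
  where
  r = solve 2 (λ a b → :- (a :* (b :* :0)) := :0) refl

 alternating : ∀ n K → ⌜ n ⌝ * ∑< K (λ k → sign k * (v n k * (1ℚ + 2ℚ * ⌜ k ⌝))) ≡ - (sign K * (⌜ K ⌝ * ((⌜ n ⌝ + ⌜ K ⌝ + 1ℚ) * v n K)))
 alternating n zero = r ⌜ n ⌝ (⌜ n ⌝ + 0ℚ + 1ℚ)
  where
  r = solve 2 (λ n a → n :* :0 := :- (:1 :* (:0 :* (a :* :1)))) refl
 alternating n (suc K) = begin-equality
  a * (∑< K _ + s * (v n K * (1ℚ + 2ℚ * k))) ≡⟨ trans (*-distribˡ-+ a (∑< K _) _) (cong (_+ a * (s * (v n K * (1ℚ + 2ℚ * k)))) (alternating n K)) ⟩
  - (s * (k * ((a + k + 1ℚ) * v n K))) + a * (s * (v n K * (1ℚ + 2ℚ * k))) ≡⟨ r₁ k a s (v n K) ⟩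
  - (- s * ((1ℚ + k) * ((a - k) * v n K))) ≡⟨ cong (λ x → - (- s * ((1ℚ + k) * x))) (sym (v-rec n K)) ⟩
  - (- s * ((1ℚ + k) * ((2ℚ + a + k) * v n (suc K)))) ≡⟨ r₂ k a s (v n (suc K)) ⟩
  - (- s * ((1ℚ + k) * ((a + (1ℚ + k) + 1ℚ) * v n (suc K)))) ≡⟨ cong (λ x → - (- s * (x * ((a + x + 1ℚ) * v n (suc K))))) (sym (⌜suc⌝ K)) ⟩
  - (- s * (⌜ suc K ⌝ * ((a + ⌜ suc K ⌝ + 1ℚ) * v n (suc K)))) ∎
  where
  a = ⌜ n ⌝
  k = ⌜ K ⌝
  s = sign K
  r₁ = solve 4 (λ k a s v → :- (s :* (k :* ((a :+ k :+ :1) :* v))) :+ a :* (s :* (v :* (:1 :+ # 2 :* k))) := :- (:- s :* ((:1 :+ k) :* ((a :- k) :* v)))) refl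
  r₂ = solve 4 (λ k a s v → :- (:- s :* ((:1 :+ k) :* ((# 2 :+ a :+ k) :* v))) := :- (:- s :* ((:1 :+ k) :* ((a :+ (:1 :+ k) :+ :1) :* v)))) refl

 alternating-0 : ∀ n → ∑< (suc (suc n)) (λ k → sign k * (v (suc n) k * (1ℚ + 2ℚ * ⌜ k ⌝))) ≡ 0ℚ
 alternating-0 n = cancel≡ (0<⌜suc⌝ n) (trans (alternating (suc n) (suc (suc n))) (trans (cong (λ x → - (sign (suc (suc n)) * (⌜ suc (suc n) ⌝ * ((⌜ suc n ⌝ + ⌜ suc (suc n) ⌝ + 1ℚ) * x)))) (v-vanish (suc n)))
   (r (sign (suc (suc n))) ⌜ suc (suc n) ⌝ (⌜ suc n ⌝ + ⌜ suc (suc n) ⌝ + 1ℚ) ⌜ suc n ⌝)))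
  where
  r = solve 4 (λ s a b c → :- (s :* (a :* (b :* :0))) := c :* :0) refl

 -- `v-shift` expresses row n through row n + 1 with factors depending on k; after summation these
 -- are removed by `moment-0`, and in `Y-rec` by `alternating-0`.
 X-rec : ∀ n → (3ℚ + 2ℚ * ⌜ n ⌝) * X (suc n) ≡ 2ℚ * (2ℚ + ⌜ n ⌝) * X n
 X-rec n = cancel≡ (<-≤-trans (positive⁻¹ 1ℚ) (p≤p+q 1ℚ (0≤⌜⌝ n))) (begin-equality
  (1ℚ + a) * ((3ℚ + 2ℚ * a) * X (suc n)) ≡⟨ trans (sym (*-assoc (1ℚ + a) (3ℚ + 2ℚ * a) (X (suc n)))) (sym (∑-* K c (v m))) ⟩
  ∑< K (λ k → c * v m k) ≡⟨ ∑-cong K term ⟩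
  ∑< K (λ k → 2ℚ * ((1ℚ + a) * (2ℚ + a)) * v n k + v m k * (2ℚ * (⌜ k ⌝ * (1ℚ + ⌜ k ⌝)) - ⌜ m ⌝)) ≡⟨ trans (∑-+ K _ _) (cong₂ _+_ (∑-* K (2ℚ * ((1ℚ + a) * (2ℚ + a))) (v n)) (moment-0 m)) ⟩
  2ℚ * ((1ℚ + a) * (2ℚ + a)) * (X n + v n (suc n)) + 0ℚ ≡⟨ trans (cong (λ x → 2ℚ * ((1ℚ + a) * (2ℚ + a)) * (X n + x) + 0ℚ) (v-vanish n)) (r₁ a (X n)) ⟩
  (1ℚ + a) * (2ℚ * (2ℚ + a) * X n) ∎)
  where
  a = ⌜ n ⌝
  m = suc n
  K = suc m
  c = (1ℚ + a) * (3ℚ + 2ℚ * a)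
  r₁ = solve 2 (λ a x → # 2 :* ((:1 :+ a) :* (# 2 :+ a)) :* (x :+ :0) :+ :0 := (:1 :+ a) :* (# 2 :* (# 2 :+ a) :* x)) refl
  term : ∀ k → c * v m k ≡ 2ℚ * ((1ℚ + a) * (2ℚ + a)) * v n k + v m k * (2ℚ * (⌜ k ⌝ * (1ℚ + ⌜ k ⌝)) - ⌜ m ⌝)
  term k = trans (r₂ a (v m k) ⌜ k ⌝) (sym (cong₂ _+_ (trans (r₃ (v n k) ((1ℚ + a) * (2ℚ + a))) (cong (2ℚ *_) (v-shift n k))) (cong (λ x → v m k * (2ℚ * (⌜ k ⌝ * (1ℚ + ⌜ k ⌝)) - x)) (⌜suc⌝ n))))
   where
   r₂ = solve 3 (λ a v k → (:1 :+ a) :* (# 3 :+ # 2 :* a) :* v := # 2 :* (v :* ((:1 :+ a :- k) :* (# 2 :+ a :+ k))) :+ v :* (# 2 :* (k :* (:1 :+ k)) :- (:1 :+ a))) refl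
   r₃ = solve 2 (λ v c → # 2 :* c :* v := # 2 :* (v :* c)) refl

 Y-rec : ∀ n → (3ℚ + 2ℚ * ⌜ n ⌝) * (3ℚ + 2ℚ * ⌜ n ⌝) * Y (suc n) ≡ 4ℚ * ((1ℚ + ⌜ n ⌝) * (2ℚ + ⌜ n ⌝)) * Y n
 Y-rec n = begin-equality
  c * c * Y m ≡⟨ sym (∑-* K (c * c) _) ⟩
  ∑< K (λ k → c * c * (sign k * (v m k * odd⁻¹ k))) ≡⟨ ∑-cong K term ⟩
  ∑< K (λ k → 4ℚ * e * (sign k * (v n k * odd⁻¹ k)) + sign k * (v m k * (1ℚ + 2ℚ * ⌜ k ⌝))) ≡⟨ trans (∑-+ K _ _) (cong₂ _+_ (∑-* K (4ℚ * e) _) (alternating-0 n)) ⟩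
  4ℚ * e * (Y n + sign (suc n) * (v n (suc n) * odd⁻¹ (suc n))) + 0ℚ ≡⟨ trans (cong (λ x → 4ℚ * e * (Y n + sign (suc n) * (x * odd⁻¹ (suc n))) + 0ℚ) (v-vanish n)) (r₁ (4ℚ * e) (Y n) (sign (suc n)) (odd⁻¹ (suc n))) ⟩
  4ℚ * e * Y n ∎
  where
  a = ⌜ n ⌝
  m = suc n
  K = suc m
  c = 3ℚ + 2ℚ * a
  e = (1ℚ + a) * (2ℚ + a)
  r₁ = solve 4 (λ e y s o → e :* (y :+ s :* (:0 :* o)) :+ :0 := e :* y) refl
  term : ∀ k → c * c * (sign k * (v m k * odd⁻¹ k)) ≡ 4ℚ * e * (sign k * (v n k * odd⁻¹ k)) + sign k * (v m k * (1ℚ + 2ℚ * ⌜ k ⌝))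
  term k = begin-equality
   c * c * (s * (v m k * o)) ≡⟨ r₂ a s (v m k) o b ⟩
   4ℚ * (v m k * ((1ℚ + a - b) * (2ℚ + a + b))) * (s * o) + s * (v m k * (1ℚ + 2ℚ * b)) * ((1ℚ + 2ℚ * b) * o) ≡⟨ cong₂ (λ x z → 4ℚ * x * (s * o) + s * (v m k * (1ℚ + 2ℚ * b)) * z) (sym (v-shift n k)) (odd-inv k) ⟩
   4ℚ * (v n k * e) * (s * o) + s * (v m k * (1ℚ + 2ℚ * b)) * 1ℚ ≡⟨ r₃ (v n k) e s o (s * (v m k * (1ℚ + 2ℚ * b))) ⟩
   4ℚ * e * (s * (v n k * o)) + s * (v m k * (1ℚ + 2ℚ * b)) ∎
   where
   s = sign k
   o = odd⁻¹ k
   b = ⌜ k ⌝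
   r₂ = solve 5 (λ a s v o b → (# 3 :+ # 2 :* a) :* (# 3 :+ # 2 :* a) :* (s :* (v :* o)) := # 4 :* (v :* ((:1 :+ a :- b) :* (# 2 :+ a :+ b))) :* (s :* o) :+ s :* (v :* (:1 :+ # 2 :* b)) :* ((:1 :+ # 2 :* b) :* o)) refl
   r₃ = solve 5 (λ v e s o x → # 4 :* (v :* e) :* (s :* o) :+ x :* :1 := # 4 :* e :* (s :* (v :* o)) :+ x) refl

 -- Both sides satisfy the same first-order recurrence in n and agree at 0.
 X²≡Y : ∀ n → X n * X n ≡ (1ℚ + ⌜ n ⌝) * Y n
 X²≡Y zero = refl
 X²≡Y (suc n) = cancel≡ (0<* 0<c 0<c) (begin-equality
  c * c * (X (suc n) * X (suc n)) ≡⟨ r₁ c (X (suc n)) ⟩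
  c * X (suc n) * (c * X (suc n)) ≡⟨ cong (λ x → x * x) (X-rec n) ⟩
  2ℚ * b * X n * (2ℚ * b * X n) ≡⟨ r₂ b (X n) ⟩
  4ℚ * (b * b) * (X n * X n) ≡⟨ cong (4ℚ * (b * b) *_) (X²≡Y n) ⟩
  4ℚ * (b * b) * ((1ℚ + a) * Y n) ≡⟨ r₃ a b (Y n) ⟩
  b * (4ℚ * ((1ℚ + a) * b) * Y n) ≡⟨ cong (b *_) (sym (Y-rec n)) ⟩
  b * (c * c * Y (suc n)) ≡⟨ r₄ a (c * c) (Y (suc n)) ⟩
  c * c * ((1ℚ + (1ℚ + a)) * Y (suc n)) ≡⟨ cong (λ x → c * c * ((1ℚ + x) * Y (suc n))) (sym (⌜suc⌝ n)) ⟩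
  c * c * ((1ℚ + ⌜ suc n ⌝) * Y (suc n)) ∎)
  where
  a = ⌜ n ⌝
  b = 2ℚ + a
  c = 3ℚ + 2ℚ * a
  0<c : 0ℚ < c
  0<c = <-≤-trans (0<⌜suc⌝ 2) (p≤p+q 3ℚ (0≤* 0≤2 (0≤⌜⌝ n)))
  r₁ = solve 2 (λ c x → c :* c :* (x :* x) := c :* x :* (c :* x)) refl
  r₂ = solve 2 (λ b x → # 2 :* b :* x :* (# 2 :* b :* x) := # 4 :* (b :* b) :* (x :* x)) refl
  r₃ = solve 3 (λ a b y → # 4 :* (b :* b) :* ((:1 :+ a) :* y) := b :* (# 4 :* ((:1 :+ a) :* b) :* y)) refl
  r₄ = solve 3 (λ a c y → (# 2 :+ a) :* (c :* y) := c :* ((:1 :+ (:1 :+ a)) :* y)) refl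

 -- The part of Y from J on alternates and is at most 1/(J+1); each earlier term is within J/(n+1)
 -- of the Leibniz term.
 Y-close : ∀ n J → J ℕ.≤ suc n → ∣ Y n - L J ∣ ≤ inv J + ⌜ J ⌝ * (⌜ J ⌝ * inv n)
 Y-close n J J≤ = ≡≤ (cong ∣_∣ (r (Y n) (alt b J) (L J))) (∣+∣ {Y n - alt b J} first second)
  where
  b : ℕ → ℚ
  b k = v n k * odd⁻¹ k
  r = solve 3 (λ a b c → a :- c := (a :- b) :+ (b :- c)) refl
  0≤b : ∀ k → 0ℚ ≤ b k
  0≤b k = 0≤* (0≤v′ n k) (0≤odd k)
  b-dec : ∀ k → b (suc k) ≤ b k
  b-dec k = *-mono (0≤v′ n k) (0≤odd (suc k)) (v-dec n k) (odd-dec k)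
  first : ∣ Y n - alt b J ∣ ≤ inv J
  first = ≤-trans (subst (λ k → ∣ alt b k - alt b J ∣ ≤ b J) (ℕ.m+[n∸m]≡n J≤) (alt-close 0≤b b-dec (suc n ℕ.∸ J) J))
   (≤-trans (*-monoʳ (0≤odd J) (v≤1 n J)) (≡≤ (*-identityˡ _) (odd≤inv J)))
  ∑-sub : ∀ k (f g : ℕ → ℚ) → ∑< k f - ∑< k g ≡ ∑< k (λ i → f i - g i)
  ∑-sub zero f g = refl
  ∑-sub (suc k) f g = trans (r′ (∑< k f) (f k) (∑< k g) (g k)) (cong (_+ (f k - g k)) (∑-sub k f g))
   where
   r′ = solve 4 (λ a b c d → a :+ b :- (c :+ d) := a :- c :+ (b :- d)) refl
  second : ∣ alt b J - L J ∣ ≤ ⌜ J ⌝ * (⌜ J ⌝ * inv n)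
  second = begin
   ∣ alt b J - L J ∣ ≡⟨ cong ∣_∣ (∑-sub J _ _) ⟩
   ∣ ∑< J (λ k → sign k * b k - sign k * odd⁻¹ k) ∣ ≤⟨ ∑-abs J _ ⟩
   ∑< J (λ k → ∣ sign k * b k - sign k * odd⁻¹ k ∣) ≤⟨ ∑-mono< J term ⟩
   ∑< J (λ _ → ⌜ J ⌝ * inv n) ≡⟨ ∑-const J _ ⟩
   ⌜ J ⌝ * (⌜ J ⌝ * inv n) ∎
   where
   term : ∀ k → k ℕ.< J → ∣ sign k * b k - sign k * odd⁻¹ k ∣ ≤ ⌜ J ⌝ * inv n
   term k k<J = begin
    ∣ sign k * b k - sign k * odd⁻¹ k ∣ ≡⟨ cong ∣_∣ (r₁ (sign k) (v n k) (odd⁻¹ k)) ⟩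
    ∣ sign k * - ((1ℚ - v n k) * odd⁻¹ k) ∣ ≡⟨ trans (∣p*q∣≡∣p∣*∣q∣ (sign k) _) (trans (cong₂ _*_ (∣sign∣ k) (trans (∣-p∣≡∣p∣ _) (0≤p⇒∣p∣≡p (0≤* (sub≥0 (v≤1 n k)) (0≤odd k))))) (*-identityˡ _)) ⟩
    (1ℚ - v n k) * odd⁻¹ k ≤⟨ *-monoʳ {odd⁻¹ k} {1ℚ - v n k} (0≤odd k) (by _ (sub≥0 (v-lower n k)) (r₂ (v n k) (c * (1ℚ + c) * inv n))) ⟩
    c * (1ℚ + c) * inv n * odd⁻¹ k ≤⟨ *-monoʳ (0≤odd k) (*-monoʳ (0≤inv n) (*-monoˡ (0≤⌜⌝ k) (by c (0≤⌜⌝ k) (r₃ c)))) ⟩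
    c * (1ℚ + 2ℚ * c) * inv n * odd⁻¹ k ≡⟨ trans (r₄ c (inv n) (odd⁻¹ k)) (trans (cong (λ x → c * inv n * x) (odd-inv k)) (*-identityʳ _)) ⟩
    c * inv n ≤⟨ *-monoʳ (0≤inv n) (⌜⌝-mono (ℕ.<⇒≤ k<J)) ⟩
    ⌜ J ⌝ * inv n ∎
    where
    c = ⌜ k ⌝
    r₁ = solve 3 (λ s v o → s :* (v :* o) :- s :* o := s :* :- ((:1 :- v) :* o)) refl
    r₂ = solve 2 (λ v a → :1 :- v :+ (v :- (:1 :- a)) := a) refl
    r₃ = solve 1 (λ c → :1 :+ c :+ c := :1 :+ # 2 :* c) refl
    r₄ = solve 3 (λ c i o → c :* (:1 :+ # 2 :* c) :* i :* o := c :* i :* ((:1 :+ # 2 :* c) :* o)) refl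

-- The total count as a sum of values of p

module TotalCount where
 open QSeries using (P; P-increasing; Σ<; sh; sh-≥; sh-antitone; t)
 open PartialSums using (S; U; sS≤U)
 open Gaps using (module Shifted)
 open Rationals
 open LocalGrowth
 open ZetaSums
 open Scales
 open UniformRank
 open import Data.Integer.Base using (+_)
 open import Data.Rational.Properties
 open ≤-Reasoning

 module Total (B G s Q : ℕ → ℚ) (0≤B : ∀ i → 0ℚ ≤ B i) (0≤s : ∀ i → 0ℚ ≤ s i) (0≤G : ∀ i → 0ℚ ≤ G i) (0≤Q : ∀ i → 0ℚ ≤ Q i)
  (three : ∀ i → B i + B (2 ℕ.+ i) + s (1 ℕ.+ i) ≡ G i + G (1 ℕ.+ i)) (s≤B : ∀ i → s (1 ℕ.+ i) ≤ B (1 ℕ.+ i))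
  (B≤s : ∀ i → B i ≤ s i + (Q (1 ℕ.+ i) + Q (2 ℕ.+ i))) where

  -- The three-term relation is summed over its index with each s traded for B, so three times the
  -- sum of B becomes twice the sum of G up to boundary terms and defects.
  total : ∀ K → B 0 + 3ℚ * ∑< K (B ∘ suc) + G 0 + B (suc K) ≡ B 1 + B K + 2ℚ * ∑< K G + G K + ∑< K (λ i → B (suc i) - s (suc i))
  total zero = r (B 0) (B 1) (G 0)
   where
   r = solve 3 (λ a b g → a :+ # 3 :* :0 :+ g :+ b := b :+ a :+ # 2 :* :0 :+ g :+ :0) refl
  total (suc K) = begin-equality
   B 0 + 3ℚ * (A + B (suc K)) + G 0 + B (suc (suc K)) ≡⟨ r₁ (B 0) A (B (suc K)) (G 0) (B (suc (suc K))) ⟩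
   (B 0 + 3ℚ * A + G 0 + B (suc K)) + 2ℚ * B (suc K) + B (suc (suc K)) ≡⟨ cong (λ x → x + 2ℚ * B (suc K) + B (suc (suc K))) (total K) ⟩
   B 1 + B K + 2ℚ * ΣG + G K + Σe + 2ℚ * B (suc K) + B (suc (suc K)) ≡⟨ r₂ (B 1) (B K) ΣG (G K) Σe (B (suc K)) (B (suc (suc K))) (s (suc K)) ⟩
   B 1 + B (suc K) + 2ℚ * ΣG + G K + Σe + (B K + B (suc (suc K)) + s (suc K)) + (B (suc K) - s (suc K)) ≡⟨ cong (λ x → B 1 + B (suc K) + 2ℚ * ΣG + G K + Σe + x + (B (suc K) - s (suc K))) (three K) ⟩
   B 1 + B (suc K) + 2ℚ * ΣG + G K + Σe + (G K + G (suc K)) + (B (suc K) - s (suc K)) ≡⟨ r₃ (B 1) (B (suc K)) ΣG (G K) Σe (G (suc K)) (B (suc K) - s (suc K)) ⟩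
   B 1 + B (suc K) + 2ℚ * (ΣG + G K) + G (suc K) + (Σe + (B (suc K) - s (suc K))) ∎
   where
   A = ∑< K (B ∘ suc)
   ΣG = ∑< K G
   Σe = ∑< K (λ i → B (suc i) - s (suc i))
   r₁ = solve 5 (λ a x b g c → a :+ # 3 :* (x :+ b) :+ g :+ c := (a :+ # 3 :* x :+ g :+ b) :+ # 2 :* b :+ c) refl
   r₂ = solve 8 (λ a b g h e c d s → a :+ b :+ # 2 :* g :+ h :+ e :+ # 2 :* c :+ d := a :+ c :+ # 2 :* g :+ h :+ e :+ (b :+ d :+ s) :+ (c :- s)) refl
   r₃ = solve 7 (λ a b g h e k f → a :+ b :+ # 2 :* g :+ h :+ e :+ (h :+ k) :+ f := a :+ b :+ # 2 :* (g :+ h) :+ k :+ (e :+ f)) refl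

  excess : ∀ K → ∑< K (λ i → B (suc i) - s (suc i)) ≤ ∑< K (λ i → Q (2 ℕ.+ i) + Q (3 ℕ.+ i))
  excess K = ∑-mono K λ i → by _ (sub≥0 (B≤s (suc i))) (r (B (suc i)) (s (suc i)) (Q (2 ℕ.+ i) + Q (3 ℕ.+ i)))
   where
   r = solve 3 (λ b s q → b :- s :+ (s :+ q :- b) := q) refl

  0≤excess : ∀ K → 0ℚ ≤ ∑< K (λ i → B (suc i) - s (suc i))
  0≤excess K = 0≤∑ K λ i → sub≥0 (s≤B i)

 floor₂ : ∀ θ → 0ℚ < θ → ∃ λ n → ⌜ n ⌝ * θ ≤ 2ℚ × 2ℚ < ⌜ suc n ⌝ * θ
 floor₂ θ 0<θ = go (suc K) (<-≤-trans (≤-<-trans (proj₂ A) (≤-<-trans (≤-reflexive (*-comm θ ⌜ K ⌝)) (*-monoˡ-<-pos θ {{positive 0<θ}} (lt K)))) ≤-refl)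
  where
  A = archimedean 2ℚ 0<θ
  K = proj₁ A
  lt : ∀ k → ⌜ k ⌝ < ⌜ suc k ⌝
  lt k = subst₂ _<_ (+-identityˡ ⌜ k ⌝) (sym (⌜suc⌝ k)) (+-monoˡ-< ⌜ k ⌝ (positive⁻¹ 1ℚ))
  go : ∀ k → 2ℚ < ⌜ k ⌝ * θ → ∃ λ n → ⌜ n ⌝ * θ ≤ 2ℚ × 2ℚ < ⌜ suc n ⌝ * θ
  go zero h with () ← <-irrefl refl (<-≤-trans (<-≤-trans (0<⌜suc⌝ 1) (<⇒≤ h)) (≤-reflexive (*-zeroˡ θ)))
  go (suc k) h with ⌜ k ⌝ * θ ≤? 2ℚ
  ... | yes le = k , le , h
  ... | no gt = go k (≰⇒> gt)

 module Core₂ (set : Setting) (τ : ℕ) (w≡ : Setting.w set ≡ w⁴ τ) where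
  open Setting set
  open Core set public

  1≤τ : 1 ℕ.≤ τ
  1≤τ = go τ (subst (200 ℕ.≤_) w≡ 200≤w)
   where
   go : ∀ τ → 200 ℕ.≤ w⁴ τ → 1 ℕ.≤ τ
   go (suc τ) _ = ℕ.s≤s ℕ.z≤n

  -- τ = w^(1/4) is a slowly growing spare factor; b = 1/τ becomes the error of the Gaussian law.
  a b : ℚ
  a = ⌜ τ ⌝
  b = inv (ℕ.pred τ)

  0≤a : 0ℚ ≤ a
  0≤a = 0≤⌜⌝ τ
  0≤b : 0ℚ ≤ b
  0≤b = 0≤inv (ℕ.pred τ)
  1≤a : 1ℚ ≤ a
  1≤a = ⌜⌝-mono 1≤τ
  b≤1 : b ≤ 1ℚ
  b≤1 = inv≤1 (ℕ.pred τ)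

  ab : a * b ≡ 1ℚ
  ab = go τ 1≤τ
   where
   go : ∀ τ → 1 ℕ.≤ τ → ⌜ τ ⌝ * inv (ℕ.pred τ) ≡ 1ℚ
   go (suc τ) _ = ⌜*⌝-inv τ

  ω≡ : ω ≡ a * a * (a * a)
  ω≡ = trans (cong ⌜_⌝ w≡) (trans (⌜*⌝ (τ ℕ.* τ) (τ ℕ.* τ)) (cong (λ x → x * x) (⌜*⌝ τ τ)))

  ι≡ : ι ≡ b * b * (b * b)
  ι≡ = begin-equality
   ι ≡⟨ sym (*-identityʳ ι) ⟩
   ι * 1ℚ ≡⟨ cong (ι *_) (sym ab⁴) ⟩
   ι * (a * b * (a * b) * (a * b * (a * b))) ≡⟨ r ι a b ⟩
   a * a * (a * a) * ι * (b * b * (b * b)) ≡⟨ cong (λ x → x * ι * (b * b * (b * b))) (sym ω≡) ⟩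
   ω * ι * (b * b * (b * b)) ≡⟨ trans (cong (_* (b * b * (b * b))) ωι) (*-identityˡ _) ⟩
   b * b * (b * b) ∎
   where
   ab⁴ : a * b * (a * b) * (a * b * (a * b)) ≡ 1ℚ
   ab⁴ = cong (λ x → x * x * (x * x)) ab
   r = solve 3 (λ i a b → i :* (a :* b :* (a :* b) :* (a :* b :* (a :* b))) := a :* a :* (a :* a) :* i :* (b :* b :* (b :* b))) refl

  bb≤b : b * b ≤ b
  bb≤b = ≤≡ (*-monoˡ 0≤b b≤1) (*-identityʳ b)
  0≤bb : 0ℚ ≤ b * b
  0≤bb = 0≤* 0≤b 0≤b
  b⁴≤bb : b * b * (b * b) ≤ b * b
  b⁴≤bb = ≤≡ (*-monoˡ 0≤bb (≤-trans bb≤b b≤1)) (*-identityʳ (b * b))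
  ι≤bb : ι ≤ b * b
  ι≤bb = ≡≤ ι≡ b⁴≤bb
  ι≤b : ι ≤ b
  ι≤b = ≤-trans ι≤bb bb≤b
  i≤ι : i ≤ ι
  i≤ι = ≤≡ (*-monoˡ 0≤ι ι≤1) (*-identityʳ ι)
  -- The sum over k is concentrated on k of order w², where θk² is of order 1; the cutoff lies a
  -- factor τ beyond.
  K₀ : ℕ
  K₀ = w² w ℕ.* τ

  cast-K₀ : ⌜ K₀ ⌝ ≡ o * a
  cast-K₀ = trans (⌜*⌝ (w² w) τ) (cong (_* a) cast²)

  w²≥1 : 1 ℕ.≤ w² w
  w²≥1 = ℕ.≤-trans (ℕ.s≤s ℕ.z≤n) 4≤w²

  1≤K₀ : 1 ℕ.≤ K₀
  1≤K₀ = ℕ.*-mono-≤ w²≥1 1≤τ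

  K₀²≤w⁶ : suc K₀ ℕ.* suc K₀ ℕ.≤ w⁶ w ℕ.+ w⁶ w
  K₀²≤w⁶ = ℕ.≤-trans (ℕ.*-mono-≤ le le) (ℕ≡≤ (e₁ K₀) (ℕ.≤-trans (ℕ.*-monoʳ-≤ 4 K₀²) (ℕ.≤-trans (ℕ.*-monoˡ-≤ (w⁴ w ℕ.* w) (ℕ.≤-trans (ℕ.m≤m+n 4 196) 200≤w)) (ℕ≡≤ (e₂ w) (ℕ.m≤m+n (w⁶ w) (w⁶ w))))))
   where
   le : suc K₀ ℕ.≤ 2 ℕ.* K₀
   le = ℕ≤≡ (ℕ.+-monoˡ-≤ K₀ 1≤K₀) (cong (K₀ ℕ.+_) (sym (ℕ.+-identityʳ K₀)))
   e₁ : ∀ k → 2 ℕ.* k ℕ.* (2 ℕ.* k) ≡ 4 ℕ.* (k ℕ.* k)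
   e₁ = ℕ-Ring.solve-∀
   e₂ : ∀ w → w ℕ.* ((w ℕ.* w ℕ.* (w ℕ.* w)) ℕ.* w) ≡ (w ℕ.* w ℕ.* (w ℕ.* w)) ℕ.* (w ℕ.* w)
   e₂ = ℕ-Ring.solve-∀
   K₀² : K₀ ℕ.* K₀ ℕ.≤ w⁴ w ℕ.* w
   K₀² = ℕ≡≤ (e₃ (w² w) τ) (ℕ.*-monoʳ-≤ (w⁴ w) (ℕ≤≡ (ℕ≡≤ (sym (ℕ.*-identityʳ (τ ℕ.* τ))) (ℕ.*-monoʳ-≤ (τ ℕ.* τ) (ℕ.*-mono-≤ 1≤τ 1≤τ))) (sym w≡)))
    where
    e₃ : ∀ a b → a ℕ.* b ℕ.* (a ℕ.* b) ≡ a ℕ.* a ℕ.* (b ℕ.* b)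
    e₃ = ℕ-Ring.solve-∀

  t≤w⁶ : ∀ {k} → k ℕ.≤ K₀ → t (suc k) ℕ.≤ w⁶ w
  t≤w⁶ {k} k≤ = ℕ.*-cancelˡ-≤ 2 (ℕ.≤-trans (ℕ.m≤m+n _ (suc k)) (ℕ≡≤ (2t+r (suc k)) (ℕ.≤-trans (ℕ.*-mono-≤ (ℕ.s≤s k≤) (ℕ.s≤s k≤))
   (ℕ≤≡ K₀²≤w⁶ (cong (w⁶ w ℕ.+_) (sym (ℕ.+-identityʳ (w⁶ w))))))))

  module C = Centre N (ℕ.m≤n+m N (w⁶ w)) ℕ.≤-refl
  open C.Rank 0 using (B; Ĝ; ŝ; Q̂; 0≤B; 0≤Ĝ; 0≤ŝ; 0≤Q̂; three; s≤B; B≤s; Ĝ-step; Ĝ-vanish; Q̂-sum; V̂≤)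
  open Shifted N 0 using () renaming (x to xs; G to Gℕ)
  module To = Total B Ĝ ŝ Q̂ 0≤B 0≤ŝ 0≤Ĝ 0≤Q̂ three s≤B B≤s

  pN : ℚ
  pN = p̂ N

  0≤pN : 0ℚ ≤ pN
  0≤pN = 0≤p̂ N

  xs≡ : ∀ k → xs k ≡ t (suc k)
  xs≡ k = cong (ℕ._+ t (suc k)) (ℕ.*-zeroʳ k)

  Ĝ≤p : ∀ k → Ĝ k ≤ pN
  Ĝ≤p k = ⌜⌝-mono (sh-antitone {0} {xs k} P-increasing ℕ.z≤n N)

  Γ Vtot : ℚ
  Γ = ∑< (suc N) Ĝ
  Vtot = B 0 + 2ℚ * ∑< (suc N) (B ∘ suc)

  B-vanish : ∀ k → N ℕ.< k → B k ≡ 0ℚ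
  B-vanish k h = ≤-antisym (≤≡ (p≤p+q (B k) (0≤+ (0≤B (2 ℕ.+ k)) (0≤ŝ (1 ℕ.+ k)))) (trans (sym (+-assoc (B k) _ _)) (trans (three k) (cong₂ _+_ (Ĝ-vanish k h) (Ĝ-vanish (suc k) (ℕ.m≤n⇒m≤1+n h)))))) (0≤B k)

  B₁≤ : B 1 ≤ 2ℚ * pN
  B₁≤ = ≤-trans (p≤p+q (B 1) (0≤+ (0≤B 3) (0≤ŝ 2))) (≡≤ (trans (sym (+-assoc (B 1) _ _)) (three 1)) (≤≡ (+-mono-≤ (Ĝ≤p 1) (Ĝ≤p 2)) (r pN)))
   where
   r = solve 1 (λ a → a :+ a := # 2 :* a) refl

  ΣQ≤ : ∀ k → ∑< k (λ i → Q̂ (suc i)) ≤ ⌜ 96 ⌝ * pN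
  ΣQ≤ k = begin
   s ≡⟨ trans (sym (*-identityˡ s)) (cong (_* s) (sym (trans (*-comm ι ω) ωι))) ⟩
   ι * ω * s ≡⟨ *-assoc ι ω s ⟩
   ι * (ω * s) ≤⟨ *-monoˡ 0≤ι (Q̂-sum k) ⟩
   ι * (⌜ 19110 ⌝ * pN) ≤⟨ by (⌜ 96 ⌝ * ((1ℚ - ι * ⌜ 200 ⌝) * pN) + ⌜ 90 ⌝ * (ι * pN)) (0≤+ (0≤* (0≤⌜⌝ 96) (0≤* (sub≥0 ι200) 0≤pN)) (0≤* (0≤⌜⌝ 90) (0≤* 0≤ι 0≤pN))) (r ι pN) ⟩
   ⌜ 96 ⌝ * pN ∎
   where
   s = ∑< k (λ i → Q̂ (suc i))
   r = solve 2 (λ i p → i :* (# 19110 :* p) :+ (# 96 :* ((:1 :- i :* # 200) :* p) :+ # 90 :* (i :* p)) := # 96 :* p) refl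

  -- This is `total` taken twice, with B(0) added because nonzero ranks count for both signs. The
  -- defects are bounded by sums of Q.
  Vtot-Γ : ∣ 3ℚ * Vtot - 4ℚ * Γ ∣ ≤ ⌜ 400 ⌝ * pN
  Vtot-Γ = begin
   ∣ 3ℚ * Vtot - 4ℚ * Γ ∣ ≡⟨ cong ∣_∣ eq ⟩
   ∣ (B 0 + 2ℚ * B 1 + 2ℚ * Σe) - 2ℚ * pN ∣ ≤⟨ ∣-∣ {B 0 + 2ℚ * B 1 + 2ℚ * Σe} (∣≥0∣ (0≤+ (0≤+ (0≤B 0) (0≤* 0≤2 (0≤B 1))) (0≤* 0≤2 (To.0≤excess (suc N))))
                           (+-mono-≤ (+-mono-≤ V̂≤ (*-monoˡ 0≤2 B₁≤)) (*-monoˡ 0≤2 Σe≤))) (∣≥0∣ (0≤* 0≤2 0≤pN) ≤-refl) ⟩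
   2ℚ * pN + 2ℚ * (2ℚ * pN) + 2ℚ * (⌜ 96 ⌝ * pN + ⌜ 96 ⌝ * pN) + 2ℚ * pN ≤⟨ by (8ℚ * pN) (0≤* 0≤8 0≤pN) (r₀ pN) ⟩
   ⌜ 400 ⌝ * pN ∎
   where
   Σe = ∑< (suc N) (λ i → B (suc i) - ŝ (suc i))
   r₀ = solve 1 (λ p → # 2 :* p :+ # 2 :* (# 2 :* p) :+ # 2 :* (# 96 :* p :+ # 96 :* p) :+ # 2 :* p :+ # 8 :* p := # 400 :* p) refl
   drop-head : ∀ k (f : ℕ → ℚ) → (∀ i → 0ℚ ≤ f i) → ∑< k (f ∘ suc) ≤ ∑< (suc k) f
   drop-head k f h = ≤≡ (by (f 0) (h 0) (+-comm (∑< k (f ∘ suc)) (f 0))) (sym (∑-head k f))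
   Σe≤ : Σe ≤ ⌜ 96 ⌝ * pN + ⌜ 96 ⌝ * pN
   Σe≤ = ≤-trans (To.excess (suc N)) (≡≤ (∑-+ (suc N) _ _) (+-mono-≤
    (≤-trans (drop-head (suc N) (λ i → Q̂ (suc i)) (λ i → 0≤Q̂ (suc i))) (ΣQ≤ (suc (suc N))))
    (≤-trans (≤-trans (drop-head (suc N) (λ i → Q̂ (2 ℕ.+ i)) (λ i → 0≤Q̂ (2 ℕ.+ i))) (drop-head (suc (suc N)) (λ i → Q̂ (suc i)) (λ i → 0≤Q̂ (suc i)))) (ΣQ≤ (suc (suc (suc N)))))))
   tot : B 0 + 3ℚ * ∑< (suc N) (B ∘ suc) + pN + 0ℚ ≡ B 1 + 0ℚ + 2ℚ * Γ + 0ℚ + Σe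
   tot = subst₂ (λ u g → B 0 + 3ℚ * ∑< (suc N) (B ∘ suc) + pN + u ≡ B 1 + 0ℚ + 2ℚ * Γ + g + Σe) (B-vanish (suc (suc N)) (ℕ.m≤n⇒m≤1+n ℕ.≤-refl)) (Ĝ-vanish (suc N) ℕ.≤-refl)
    (subst (λ u → B 0 + 3ℚ * ∑< (suc N) (B ∘ suc) + pN + B (suc (suc N)) ≡ B 1 + u + 2ℚ * Γ + Ĝ (suc N) + Σe) (B-vanish (suc N) ℕ.≤-refl) (To.total (suc N)))
   eq : 3ℚ * Vtot - 4ℚ * Γ ≡ (B 0 + 2ℚ * B 1 + 2ℚ * Σe) - 2ℚ * pN
   eq = trans (r₁ (B 0) (∑< (suc N) (B ∘ suc)) Γ pN) (trans (cong (λ x → 2ℚ * x + B 0 - 2ℚ * pN - 4ℚ * Γ) tot) (r₂ (B 0) (B 1) Γ Σe pN))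
    where
    r₁ = solve 4 (λ b s g p → # 3 :* (b :+ # 2 :* s) :- # 4 :* g := # 2 :* (b :+ # 3 :* s :+ p :+ :0) :+ b :- # 2 :* p :- # 4 :* g) refl
    r₂ = solve 5 (λ b b₁ g e p → # 2 :* (b₁ :+ :0 :+ # 2 :* g :+ :0 :+ e) :+ b :- # 2 :* p :- # 4 :* g := (b :+ # 2 :* b₁ :+ # 2 :* e) :- # 2 :* p) refl

  yT : ℕ → ℚ
  yT k = pow y (t (suc k))

  k₀ : ℚ
  k₀ = o * a

  0≤k₀ : 0ℚ ≤ k₀
  0≤k₀ = 0≤* 0≤o 0≤a

  0<a : 0ℚ < a
  0<a = <-≤-trans (positive⁻¹ 1ℚ) 1≤a

  0<o : 0ℚ < o
  0<o = <-≤-trans (positive⁻¹ 1ℚ) 1≤o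

  w⁶≤N : w⁶ w ℕ.≤ N
  w⁶≤N = ℕ.≤-trans (ℕ.m≤m+n (w⁶ w) (w⁶ w)) 2w⁶≤N

  ratio-at : ∀ d → d ℕ.≤ w⁶ w → ∣ ⌜ sh d P N ⌝ - pow y d * pN ∣ ≤ κ * pN
  ratio-at d d≤ = subst (λ k → ∣ ⌜ sh d P k ⌝ - pow y d * p̂ k ∣ ≤ κ * p̂ k) e
    (subst (λ q → ∣ ⌜ q ⌝ - pow y d * p̂ (d ℕ.+ m) ∣ ≤ κ * p̂ (d ℕ.+ m)) (sym (sh-≥ d P m))
     (ratio d m (ℕ≡≤ (sym e) (ℕ.+-monoˡ-≤ m d≤)) (ℕ≡≤ e (ℕ.m≤m+n N (w⁶ w)))))
   where
   m = N ℕ.∸ d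
   e : d ℕ.+ m ≡ N
   e = ℕ.m+[n∸m]≡n (ℕ.≤-trans d≤ w⁶≤N)

  ∑-sub : ∀ k (f g : ℕ → ℚ) → ∑< k f - ∑< k g ≡ ∑< k (λ i → f i - g i)
  ∑-sub zero f g = refl
  ∑-sub (suc k) f g = trans (r (∑< k f) (f k) (∑< k g) (g k)) (cong (_+ (f k - g k)) (∑-sub k f g))
   where
   r = solve 4 (λ a b c d → a :+ b :- (c :+ d) := a :- c :+ (b :- d)) refl

  ∑-close : ∀ k (f g : ℕ → ℚ) c → (∀ i → i ℕ.< k → ∣ f i - g i ∣ ≤ c) → ∣ ∑< k f - ∑< k g ∣ ≤ ⌜ k ⌝ * c
  ∑-close k f g c h = ≡≤ (cong ∣_∣ (∑-sub k f g)) (≤-trans (∑-abs k _) (≤≡ (∑-mono< k h) (∑-const k c)))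

  Ψ₀ : ℚ
  Ψ₀ = ∑< K₀ yT

  head-bound : ∣ ∑< K₀ Ĝ - pN * Ψ₀ ∣ ≤ ⌜ 9552 ⌝ * a * pN
  head-bound = begin
   ∣ ∑< K₀ Ĝ - pN * Ψ₀ ∣ ≡⟨ cong (λ x → ∣ ∑< K₀ Ĝ - x ∣) (sym (∑-* K₀ pN yT)) ⟩
   ∣ ∑< K₀ Ĝ - ∑< K₀ (λ k → pN * yT k) ∣ ≤⟨ ∑-close K₀ Ĝ (λ k → pN * yT k) (κ * pN) (λ k k<K → subst (λ x → ∣ Ĝ k - x ∣ ≤ κ * pN) (*-comm (yT k) pN)
                            (subst (λ x → ∣ ⌜ sh x P N ⌝ - yT k * pN ∣ ≤ κ * pN) (sym (xs≡ k)) (ratio-at (t (suc k)) (t≤w⁶ (ℕ.<⇒≤ k<K))))) ⟩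
   ⌜ K₀ ⌝ * (κ * pN) ≡⟨ trans (cong (_* (κ * pN)) cast-K₀) (trans (r o a i pN) (cong (λ x → ⌜ 9552 ⌝ * (x * a) * pN) oi)) ⟩
   ⌜ 9552 ⌝ * (1ℚ * a) * pN ≡⟨ cong (λ x → ⌜ 9552 ⌝ * x * pN) (*-identityˡ a) ⟩
   ⌜ 9552 ⌝ * a * pN ∎
   where
   r = solve 4 (λ o a i p → o :* a :* (# 9552 :* i :* p) := # 9552 :* (o :* i :* a) :* p) refl

  K₀≤N : K₀ ℕ.≤ N
  K₀≤N = ℕ.≤-trans (ℕ.≤-trans (ℕ.n≤1+n K₀) (ℕ.m≤m*n (suc K₀) (suc K₀))) (ℕ.≤-trans K₀²≤w⁶ 2w⁶≤N)

  module Tail where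
   n′ : ℕ
   n′ = N ℕ.∸ t (suc K₀)
   e′ : t (suc K₀) ℕ.+ n′ ≡ N
   e′ = ℕ.m+[n∸m]≡n (ℕ.≤-trans (t≤w⁶ ℕ.≤-refl) w⁶≤N)
   module Sh = Shifted n′ K₀

   Ĝ-rebase : ∀ r → Ĝ (K₀ ℕ.+ r) ≡ ⌜ Sh.G r ⌝
   Ĝ-rebase r = cong ⌜_⌝ (trans (cong₂ (λ x m → sh x P m) (trans (xs≡ (K₀ ℕ.+ r)) (cong (λ k → t (suc k)) (ℕ.+-comm K₀ r))) (sym e′)) (Sh.rebase P r))

   rest : ∀ k → ℚ
   rest k = ∑< k (λ i → ⌜ Sh.G (suc i) ⌝)

   -- Beyond K₀ all gaps exceed K₀, so K₀ times the rest is at most S(n′). In turn U(N) dominates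
   -- t(K₀+1) S(n′), and U(N) = O(w⁸ p).
   rest-bound : ∀ k → rest k ≤ 6ℚ * (o * (b * b * b)) * pN
   rest-bound k = *-cancel-≤ (0<* (0<* 0<k 0<k) 0<k) (begin
    k₀ * k₀ * k₀ * rest k ≡⟨ *-assoc (k₀ * k₀) k₀ (rest k) ⟩
    k₀ * k₀ * (k₀ * rest k) ≤⟨ *-mono {k₀ * k₀} {2ℚ * ⌜ t (suc K₀) ⌝} {k₀ * rest k} {Ŝ n′} (0≤* 0≤2 (0≤⌜⌝ (t (suc K₀)))) (0≤* 0≤k₀ (0≤∑ k λ i → 0≤⌜⌝ (Sh.G (suc i)))) k²≤ kr≤ ⟩
    2ℚ * ⌜ t (suc K₀) ⌝ * Ŝ n′ ≡⟨ trans (*-assoc 2ℚ ⌜ t (suc K₀) ⌝ (Ŝ n′)) (cong (2ℚ *_) (sym (⌜*⌝ (t (suc K₀)) (S n′)))) ⟩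
    2ℚ * ⌜ t (suc K₀) ℕ.* S n′ ⌝ ≤⟨ *-monoˡ 0≤2 (≤-trans (⌜⌝-mono TS≤U) (U≤u N (lo≤ (ℕ.m≤n+m N (w⁶ w))) (ℕ.m≤m+n N (w⁶ w)))) ⟩
    2ℚ * (3ℚ * (X * X) * pN) ≡⟨ trans (r₁ o pN) (cong (λ x → 6ℚ * (o * o * (o * o)) * (x * x * x) * pN) (sym ab)) ⟩
    6ℚ * (o * o * (o * o)) * (a * b * (a * b) * (a * b)) * pN ≡⟨ r₂ o a b pN ⟩
    k₀ * k₀ * k₀ * (6ℚ * (o * (b * b * b)) * pN) ∎)
    where
    0<k : 0ℚ < k₀
    0<k = 0<* 0<o 0<a
    r₁ = solve 2 (λ o p → # 2 :* (# 3 :* (o :* o :* (o :* o)) :* p) := # 6 :* (o :* o :* (o :* o)) :* (:1 :* :1 :* :1) :* p) refl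
    r₂ = solve 4 (λ o a b p → # 6 :* (o :* o :* (o :* o)) :* (a :* b :* (a :* b) :* (a :* b)) :* p := o :* a :* (o :* a) :* (o :* a) :* (# 6 :* (o :* (b :* b :* b)) :* p)) refl
    k²≤ : k₀ * k₀ ≤ 2ℚ * ⌜ t (suc K₀) ⌝
    k²≤ = ≡≤ (trans (cong (λ x → x * x) (sym cast-K₀)) (sym (⌜*⌝ K₀ K₀))) (≤≡ (⌜⌝-mono (ℕ.+-cancelʳ-≤ (suc K₀) _ _ (ℕ≤≡ (ℕ≤≡ (ℕ.m≤m+n _ K₀) (e K₀)) (sym (2t+r (suc K₀)))))) (⌜*⌝ 2 (t (suc K₀))))
     where
     e : ∀ k → k ℕ.* k ℕ.+ suc k ℕ.+ k ≡ suc k ℕ.* suc k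
     e = ℕ-Ring.solve-∀
    kr≤ : k₀ * rest k ≤ Ŝ n′
    kr≤ = ≡≤ (trans (cong₂ _*_ (sym cast-K₀) (sym (⌜Σ⌝ k (λ i → Sh.G (suc i))))) (sym (⌜*⌝ K₀ _))) (⌜⌝-mono (go K₀ refl))
     where
     go : ∀ j → j ≡ K₀ → j ℕ.* Σ< k (λ i → Sh.G (suc i)) ℕ.≤ S n′
     go zero _ = ℕ.z≤n
     go (suc j) e = Sh.G-sum j (ℕ.≤-reflexive e) k
    TS≤U : t (suc K₀) ℕ.* S n′ ℕ.≤ U N
    TS≤U = ℕ≡≤ (cong (t (suc K₀) ℕ.*_) (trans (sym (sh-≥ (t (suc K₀)) S n′)) (cong (sh (t (suc K₀)) S) e′))) (sS≤U (t (suc K₀)) N)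

   tail-bound : ∑< (suc (N ℕ.∸ K₀)) (λ r → Ĝ (K₀ ℕ.+ r)) ≤ pN + 6ℚ * (o * (b * b * b)) * pN
   tail-bound = ≡≤ (trans (∑-head (N ℕ.∸ K₀) _) (cong (λ x → Ĝ (K₀ ℕ.+ 0) + x) (∑-cong (N ℕ.∸ K₀) λ r → Ĝ-rebase (suc r)))) (+-mono-≤ (Ĝ≤p (K₀ ℕ.+ 0)) (rest-bound (N ℕ.∸ K₀)))

   0≤tail : 0ℚ ≤ ∑< (suc (N ℕ.∸ K₀)) (λ r → Ĝ (K₀ ℕ.+ r))
   0≤tail = 0≤∑ (suc (N ℕ.∸ K₀)) λ r → 0≤Ĝ (K₀ ℕ.+ r)

   Γ-split : Γ ≡ ∑< K₀ Ĝ + ∑< (suc (N ℕ.∸ K₀)) (λ r → Ĝ (K₀ ℕ.+ r))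
   Γ-split = trans (cong (λ k → ∑< k Ĝ) (sym (trans (ℕ.+-suc K₀ (N ℕ.∸ K₀)) (cong suc (ℕ.m+[n∸m]≡n K₀≤N))))) (∑-append K₀ (suc (N ℕ.∸ K₀)) Ĝ)

-- Binomial weights against powers of 1/(1+θ)

module WallisGaussian where
 open QSeries using (t)
 open Rationals
 open ZetaSums
 open Wallis using (v; v≤1; 0≤v′; inv-2+)
 open import Data.Integer.Base using (+_)
 open import Data.Rational.Properties
 open ≤-Reasoning

 -- n is about 2/θ because the ratio of consecutive weights, 1 - 2(k+1)/(n+k+2), is to match
 -- y^(k+1), which is close to 1 - (k+1)θ.
 module Comparison (θ y : ℚ) (0≤θ : 0ℚ ≤ θ) (yθ : y * (1ℚ + θ) ≡ 1ℚ) (0≤y : 0ℚ ≤ y) (θ≤1 : θ ≤ 1ℚ) (n K₀ : ℕ)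
  (nθ≤ : (1ℚ + ⌜ n ⌝) * θ ≤ 2ℚ) (nθ≥ : 2ℚ ≤ (2ℚ + ⌜ n ⌝) * θ) where

  n̂ k₀ : ℚ
  n̂ = ⌜ n ⌝
  k₀ = ⌜ K₀ ⌝

  0≤n̂ : 0ℚ ≤ n̂
  0≤n̂ = 0≤⌜⌝ n

  0≤k₀ : 0ℚ ≤ k₀
  0≤k₀ = 0≤⌜⌝ K₀

  yT : ℕ → ℚ
  yT k = pow y (t (suc k))

  nθ≥′ : 2ℚ ≤ (1ℚ + n̂) * θ + θ
  nθ≥′ = ≤≡ nθ≥ (r n̂ θ)
   where
   r = solve 2 (λ n θ → (# 2 :+ n) :* θ := (:1 :+ n) :* θ :+ θ) refl

  inv-n≤θ : inv n ≤ θ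
  inv-n≤θ = begin
   inv n ≡⟨ sym (*-identityʳ (inv n)) ⟩
   inv n * 1ℚ ≤⟨ *-monoˡ (0≤inv n) (by ((1ℚ - θ) + ((1ℚ + n̂) * θ + θ - 2ℚ)) (0≤+ (sub≥0 θ≤1) (sub≥0 nθ≥′)) (r₁ θ ((1ℚ + n̂) * θ))) ⟩
   inv n * ((1ℚ + n̂) * θ) ≡⟨ trans (r₂ (inv n) n̂ θ) (trans (cong (_* θ) (trans (cong (_* inv n) (sym (⌜suc⌝ n))) (⌜*⌝-inv n))) (*-identityˡ θ)) ⟩
   θ ∎
   where
   r₁ = solve 2 (λ θ x → :1 :+ ((:1 :- θ) :+ (x :+ θ :- # 2)) := x) refl
   r₂ = solve 3 (λ i n θ → i :* ((:1 :+ n) :* θ) := (:1 :+ n) :* i :* θ) refl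

  -- The ratios of consecutive v's and of consecutive yT's agree to second order.
  v-yT : ∀ k → k ℕ.≤ K₀ → ∣ v n k - yT k ∣ ≤ ⌜ k ⌝ * (2ℚ * (k₀ * k₀) * (θ * θ))
  v-yT zero _ = ≤-reflexive (sym (*-zeroˡ (2ℚ * (k₀ * k₀) * (θ * θ))))
  v-yT (suc k) k<K = begin
   ∣ v n k * ρ - yT (suc k) ∣ ≡⟨ cong ∣_∣ (trans (cong (λ x → v n k * ρ - x) (pow-+ y (t (suc k)) (suc k))) (r₁ (v n k) ρ (yT k) z)) ⟩
   ∣ (v n k - yT k) * z + v n k * (ρ - z) ∣ ≤⟨ ∣+∣ {(v n k - yT k) * z} (≡≤ (cong ∣_∣ (*-comm (v n k - yT k) z)) (∣*∣ 0≤z (v-yT k (ℕ.<⇒≤ k<K)))) (∣*∣ (0≤v′ n k) ρ-z) ⟩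
   z * (⌜ k ⌝ * E) + v n k * E ≤⟨ +-mono-≤ (*-monoʳ (0≤* (0≤⌜⌝ k) 0≤E) z≤1) (*-monoʳ 0≤E (v≤1 n k)) ⟩
   1ℚ * (⌜ k ⌝ * E) + 1ℚ * E ≡⟨ trans (r₂ ⌜ k ⌝ E) (cong (_* E) (sym (⌜suc⌝ k))) ⟩
   ⌜ suc k ⌝ * E ∎
   where
   I q ρ z E : ℚ
   I = inv (suc (n ℕ.+ k))
   q = 1ℚ + ⌜ k ⌝
   ρ = (n̂ - ⌜ k ⌝) * I
   z = pow y (suc k)
   E = 2ℚ * (k₀ * k₀) * (θ * θ)
   0≤z : 0ℚ ≤ z
   0≤z = 0≤pow 0≤y (suc k)
   z≤1 : z ≤ 1ℚ
   z≤1 = pow≤1 0≤y (y≤1 0≤θ yθ 0≤y) (suc k)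
   0≤θθ : 0ℚ ≤ θ * θ
   0≤θθ = 0≤* 0≤θ 0≤θ
   0≤E : 0ℚ ≤ E
   0≤E = 0≤* (0≤* 0≤2 (0≤* 0≤k₀ 0≤k₀)) 0≤θθ
   r₁ = solve 4 (λ v p u z → v :* p :- u :* z := (v :- u) :* z :+ v :* (p :- z)) refl
   r₂ = solve 2 (λ k E → :1 :* (k :* E) :+ :1 :* E := (:1 :+ k) :* E) refl
   0≤I : 0ℚ ≤ I
   0≤I = 0≤inv (suc (n ℕ.+ k))
   I≤θ : I ≤ θ
   I≤θ = ≤-trans (inv-antitone {n} {suc (n ℕ.+ k)} (ℕ.≤-trans (ℕ.m≤m+n n k) (ℕ.n≤1+n _))) inv-n≤θ
   0≤q : 0ℚ ≤ q
   0≤q = 0≤+ 0≤1 (0≤⌜⌝ k)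
   1≤q : 1ℚ ≤ q
   1≤q = p≤p+q 1ℚ (0≤⌜⌝ k)
   q≤k₀ : q ≤ k₀
   q≤k₀ = ≡≤ (sym (⌜suc⌝ k)) (⌜⌝-mono k<K)
   qqθθ≤ : q * q * (θ * θ) ≤ k₀ * k₀ * (θ * θ)
   qqθθ≤ = *-monoʳ 0≤θθ (*-mono 0≤k₀ 0≤q q≤k₀ q≤k₀)
   cI : (2ℚ + n̂ + ⌜ k ⌝) * I ≡ 1ℚ
   cI = inv-2+ n k
   lower : 1ℚ - q * θ ≤ z
   lower = subst (λ x → 1ℚ - x * θ ≤ z) (⌜suc⌝ k) (pow-lower 0≤θ yθ 0≤y (suc k))
   upper : z ≤ 1ℚ - q * θ + q * q * (θ * θ)
   upper = *-cancel-≤ {1ℚ + q * θ} (<-≤-trans (positive⁻¹ 1ℚ) (p≤p+q 1ℚ (0≤* 0≤q 0≤θ))) (≡≤ (*-comm (1ℚ + q * θ) z) (≤-trans (subst (λ x → z * (1ℚ + x * θ) ≤ 1ℚ) (⌜suc⌝ k) (pow-upper 0≤θ yθ 0≤y (suc k)))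
    (by (q * θ * (q * q * (θ * θ))) (0≤* (0≤* 0≤q 0≤θ) (0≤* (0≤* 0≤q 0≤q) 0≤θθ)) (r₃ q θ))))
    where
    r₃ = solve 2 (λ q θ → :1 :+ q :* θ :* (q :* q :* (θ :* θ)) := (:1 :+ q :* θ) :* (:1 :- q :* θ :+ q :* q :* (θ :* θ))) refl
   ρ≡ : ρ ≡ 1ℚ - 2ℚ * q * I
   ρ≡ = trans (r₄ n̂ ⌜ k ⌝ I) (cong (λ x → x - 2ℚ * q * I) cI)
    where
    r₄ = solve 3 (λ n k i → (n :- k) :* i := (# 2 :+ n :+ k) :* i :- # 2 :* (:1 :+ k) :* i) refl
   θ≡ : θ ≡ I * ((1ℚ + n̂) * θ + q * θ)
   θ≡ = trans (sym (*-identityˡ θ)) (trans (cong (_* θ) (sym cI)) (r₅ n̂ ⌜ k ⌝ I θ))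
    where
    r₅ = solve 4 (λ n k i θ → (# 2 :+ n :+ k) :* i :* θ := i :* ((:1 :+ n) :* θ :+ (:1 :+ k) :* θ)) refl
   θ-2I : θ - 2ℚ * I ≤ q * (θ * θ)
   θ-2I = begin
    θ - 2ℚ * I ≡⟨ cong (_- 2ℚ * I) θ≡ ⟩
    I * ((1ℚ + n̂) * θ + q * θ) - 2ℚ * I ≤⟨ by (I * (2ℚ - (1ℚ + n̂) * θ) + (θ - I) * (q * θ)) (0≤+ (0≤* 0≤I (sub≥0 nθ≤)) (0≤* (sub≥0 I≤θ) (0≤* 0≤q 0≤θ))) (r₆ I ((1ℚ + n̂) * θ) q θ) ⟩
    q * (θ * θ) ∎
    where
    r₆ = solve 4 (λ I x q θ → I :* (x :+ q :* θ) :- # 2 :* I :+ (I :* (# 2 :- x) :+ (θ :- I) :* (q :* θ)) := q :* (θ :* θ)) refl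
   2I-θ : 2ℚ * I - θ ≤ θ * θ
   2I-θ = begin
    2ℚ * I - θ ≡⟨ cong (λ x → 2ℚ * I - x) θ≡ ⟩
    2ℚ * I - I * ((1ℚ + n̂) * θ + q * θ) ≤⟨ by (I * ((1ℚ + n̂) * θ + θ - 2ℚ) + I * (q * θ) + (θ - I) * θ) (0≤+ (0≤+ (0≤* 0≤I (sub≥0 nθ≥′)) (0≤* 0≤I (0≤* 0≤q 0≤θ))) (0≤* (sub≥0 I≤θ) 0≤θ)) (r₇ I ((1ℚ + n̂) * θ) q θ) ⟩
    θ * θ ∎
    where
    r₇ = solve 4 (λ I x q θ → # 2 :* I :- I :* (x :+ q :* θ) :+ (I :* (x :+ θ :- # 2) :+ I :* (q :* θ) :+ (θ :- I) :* θ) := θ :* θ) refl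
   ρ-z : ∣ ρ - z ∣ ≤ E
   ρ-z = subst (λ x → ∣ x - z ∣ ≤ E) (sym ρ≡) (close {1ℚ - 2ℚ * q * I} {z}
    (by ((z - (1ℚ - q * θ)) + q * (q * (θ * θ) - (θ - 2ℚ * I)) + (k₀ * k₀ * (θ * θ) - q * q * (θ * θ)) + k₀ * k₀ * (θ * θ))
      (0≤+ (0≤+ (0≤+ (sub≥0 lower) (0≤* 0≤q (sub≥0 θ-2I))) (sub≥0 qqθθ≤)) (0≤* (0≤* 0≤k₀ 0≤k₀) 0≤θθ)) (r₈ z q θ I k₀))
    (by ((1ℚ - q * θ + q * q * (θ * θ) - z) + q * (θ * θ - (2ℚ * I - θ)) + 2ℚ * (k₀ * k₀ * (θ * θ) - q * q * (θ * θ)) + q * ((q - 1ℚ) * (θ * θ)))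
      (0≤+ (0≤+ (0≤+ (sub≥0 upper) (0≤* 0≤q (sub≥0 2I-θ))) (0≤* 0≤2 (sub≥0 qqθθ≤))) (0≤* 0≤q (0≤* (sub≥0 1≤q) 0≤θθ))) (r₉ z q θ I k₀)))
    where
    r₈ = solve 5 (λ z q θ I k → :1 :- # 2 :* q :* I :+ ((z :- (:1 :- q :* θ)) :+ q :* (q :* (θ :* θ) :- (θ :- # 2 :* I)) :+ (k :* k :* (θ :* θ) :- q :* q :* (θ :* θ)) :+ k :* k :* (θ :* θ)) := z :+ # 2 :* (k :* k) :* (θ :* θ)) refl
    r₉ = solve 5 (λ z q θ I k → z :+ ((:1 :- q :* θ :+ q :* q :* (θ :* θ) :- z) :+ q :* (θ :* θ :- (# 2 :* I :- θ)) :+ # 2 :* (k :* k :* (θ :* θ) :- q :* q :* (θ :* θ)) :+ q :* ((q :- :1) :* (θ :* θ))) := :1 :- # 2 :* q :* I :+ # 2 :* (k :* k) :* (θ :* θ)) refl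

-- The proportion of compositions of a given rank

module RankDistribution where
 open QSeries using (t; module Compositions)
 open Rationals
 open LocalGrowth
 open ZetaSums
 open Scales
 open TotalCount
 open WallisGaussian
 open Basel using (alt; alt-close; L; odd≤inv; 0≤odd; odd-dec)
 open Wallis using (v; v-dec; v≤1; 0≤v′; moment-0; X²≡Y; Y-close)
 open import Data.Integer.Base using (+_)
 open import Data.Rational.Properties
 open ≤-Reasoning

 module Core₃ (set : Setting) (τ : ℕ) (w≡ : Setting.w set ≡ w⁴ τ)
  (n : ℕ) (nθ≤ : (1ℚ + ⌜ n ⌝) * Setting.θ set ≤ 2ℚ) (nθ≥ : 2ℚ ≤ (2ℚ + ⌜ n ⌝) * Setting.θ set) where
  open Setting set
  open Core₂ set τ w≡ public
  module Cmp = Comparison θ y 0≤θ yθ 0≤y θ≤1 n K₀ nθ≤ nθ≥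

  n̂ : ℚ
  n̂ = ⌜ n ⌝

  0≤n̂ : 0ℚ ≤ n̂
  0≤n̂ = 0≤⌜⌝ n

  X≤n : X ≤ 2ℚ + n̂
  X≤n = *-cancel-≤ {2ℚ * Y} (0<* (0<⌜suc⌝ 1) 0<Y) (begin
   2ℚ * Y * X ≡⟨ trans (*-assoc 2ℚ Y X) (trans (cong (2ℚ *_) (trans (*-comm Y X) XY)) (*-identityʳ 2ℚ)) ⟩
   2ℚ ≤⟨ nθ≥ ⟩
   (2ℚ + n̂) * θ ≤⟨ *-monoˡ (0≤+ 0≤2 0≤n̂) θ≤2Y ⟩
   (2ℚ + n̂) * (2ℚ * Y) ≡⟨ *-comm (2ℚ + n̂) (2ℚ * Y) ⟩
   2ℚ * Y * (2ℚ + n̂) ∎)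
   where
   0<ι : 0ℚ < ι
   0<ι = 0<inv (ℕ.pred w)
   0<Y : 0ℚ < Y
   0<Y = 0<* (0<* 0<ι 0<ι) (0<* 0<ι 0<ι)

  n≤4X : n̂ ≤ 4ℚ * X
  n≤4X = by (1ℚ + 2ℚ * ((1ℚ + n̂) * (T - ½)) + 2ℚ * (X * (2ℚ - (1ℚ + n̂) * θ))) (0≤+ (0≤+ 0≤1 (0≤* 0≤2 (0≤* (0≤+ 0≤1 0≤n̂) (sub≥0 ½≤T)))) (0≤* 0≤2 (0≤* 0≤X (sub≥0 nθ≤)))) (r n̂ θ X)
   where
   r = solve 3 (λ n θ X → n :+ (:1 :+ # 2 :* ((:1 :+ n) :* (θ :* X :- :½)) :+ # 2 :* (X :* (# 2 :- (:1 :+ n) :* θ))) := # 4 :* X) refl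

  K₀<n : K₀ ℕ.≤ suc n
  K₀<n = ℕ.≤-pred (ℕ.≤-trans (ℕ.≤-trans (ℕ.+-monoˡ-≤ K₀ w²≥1) (ℕ≡≤ (e (w² w) τ) (ℕ.*-monoʳ-≤ (w² w) sτ≤))) (⌜⌝-reflect {w⁴ w} {2 ℕ.+ n} (≡≤ cast⁴ (≤≡ X≤n (sym (⌜+⌝ 2 n))))))
   where
   e : ∀ a b → a ℕ.+ a ℕ.* b ≡ a ℕ.* suc b
   e = ℕ-Ring.solve-∀
   sτ≤ : suc τ ℕ.≤ w² w
   sτ≤ = ℕ.≤-trans (ℕ.+-mono-≤ 1≤ττ ℕ.≤-refl) (ℕ.≤-trans (ℕ.≤-trans (ℕ.+-monoʳ-≤ (τ ℕ.* τ) (ℕ≡≤ (sym (ℕ.*-identityʳ τ)) (ℕ.*-monoʳ-≤ τ 1≤τ))) (ℕ≡≤ (e₂ (τ ℕ.* τ)) (ℕ.*-monoˡ-≤ (τ ℕ.* τ) (ℕ.≤-trans (ℕ.m≤m+n 2 198) 200≤w)))) (ℕ.*-monoʳ-≤ w (ℕ≡≤ (sym (ℕ.*-identityʳ (τ ℕ.* τ))) (ℕ≤≡ (ℕ.*-monoʳ-≤ (τ ℕ.* τ) 1≤ττ) (sym w≡)))))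
    where
    1≤ττ : 1 ℕ.≤ τ ℕ.* τ
    1≤ττ = ℕ.*-mono-≤ 1≤τ 1≤τ
    e₂ : ∀ a → a ℕ.+ a ≡ 2 ℕ.* a
    e₂ = ℕ-Ring.solve-∀

  W Yn : ℚ
  W = Wallis.X n
  Yn = Wallis.Y n

  0≤W : 0ℚ ≤ W
  0≤W = 0≤∑ (suc n) (0≤v′ n)

  k₀≡ : ⌜ K₀ ⌝ * ⌜ K₀ ⌝ ≡ X * (a * a)
  k₀≡ = trans (cong (λ x → x * x) cast-K₀) (r o a)
   where
   r = solve 2 (λ o a → o :* a :* (o :* a) := o :* o :* (a :* a)) refl

  -- K₀ errors of at most 2K₀³θ² give 2K₀⁴θ² = 2τ⁴ (θX)². By w = τ⁴ this is O(w), whereas W is of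
  -- order w².
  head-v : ∣ ∑< K₀ (v n) - Ψ₀ ∣ ≤ 6ℚ * ω
  head-v = begin
   ∣ ∑< K₀ (v n) - Ψ₀ ∣ ≤⟨ ∑-close K₀ (v n) yT (k * E) (λ j j<K → ≤-trans (Cmp.v-yT j (ℕ.<⇒≤ j<K)) (*-monoʳ 0≤E (⌜⌝-mono (ℕ.<⇒≤ j<K)))) ⟩
   k * (k * (2ℚ * (k * k) * (θ * θ))) ≡⟨ trans (r₁ k (θ * θ)) (cong (λ x → 2ℚ * (x * x) * (θ * θ)) k₀≡) ⟩
   2ℚ * (X * (a * a) * (X * (a * a))) * (θ * θ) ≡⟨ trans (r₂ X (a * a) (θ * θ)) (cong (λ x → 2ℚ * x * (θ * θ * (X * X))) (sym ω≡)) ⟩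
   2ℚ * ω * (θ * θ * (X * X)) ≤⟨ *-monoˡ (0≤* 0≤2 0≤ω) θθXX≤3 ⟩
   2ℚ * ω * 3ℚ ≡⟨ r₃ ω ⟩
   6ℚ * ω ∎
   where
   k E : ℚ
   k = ⌜ K₀ ⌝
   E = 2ℚ * (k * k) * (θ * θ)
   0≤E : 0ℚ ≤ E
   0≤E = 0≤* (0≤* 0≤2 (0≤* (0≤⌜⌝ K₀) (0≤⌜⌝ K₀))) (0≤* 0≤θ 0≤θ)
   r₁ = solve 2 (λ k t → k :* (k :* (# 2 :* (k :* k) :* t)) := # 2 :* (k :* k :* (k :* k)) :* t) refl
   r₂ = solve 3 (λ X a t → # 2 :* (X :* a :* (X :* a)) :* t := # 2 :* (a :* a) :* (t :* (X :* X))) refl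
   r₃ = solve 1 (λ w → # 2 :* w :* # 3 := # 6 :* w) refl

  j : ℕ
  j = suc n ℕ.∸ K₀

  Wt : ℚ
  Wt = ∑< j (λ r → v n (K₀ ℕ.+ r))

  0≤Wt : 0ℚ ≤ Wt
  0≤Wt = 0≤∑ j λ r → 0≤v′ n (K₀ ℕ.+ r)

  split : ∀ f → ∑< (suc n) f ≡ ∑< K₀ f + ∑< j (λ r → f (K₀ ℕ.+ r))
  split f = trans (cong (λ k → ∑< k f) (sym (ℕ.m+[n∸m]≡n K₀<n))) (∑-append K₀ j f)

  -- Chebyshev's inequality: by `moment-0` the weighted sum of 2k(k+1) is nW, with n = O(X).
  tail-v : Wt ≤ 2ℚ * (b * b) * W
  tail-v = *-cancel-≤ {2ℚ * (X * (a * a))} (0<* (0<⌜suc⌝ 1) (0<* 0<X (0<* 0<a 0<a))) (begin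
   2ℚ * (X * (a * a)) * Wt ≡⟨ trans (cong (λ x → 2ℚ * x * Wt) (sym k₀≡)) (sym (∑-* j (2ℚ * (k * k)) (λ r → v n (K₀ ℕ.+ r)))) ⟩
   ∑< j (λ r → 2ℚ * (k * k) * v n (K₀ ℕ.+ r)) ≤⟨ ∑-mono j (λ r → *-monoʳ (0≤v′ n (K₀ ℕ.+ r)) (grow (K₀ ℕ.+ r) (ℕ.m≤m+n K₀ r))) ⟩
   ∑< j (λ r → f (K₀ ℕ.+ r)) ≤⟨ by (∑< K₀ f) (0≤∑ K₀ 0≤f) (trans (+-comm (∑< j (λ r → f (K₀ ℕ.+ r))) (∑< K₀ f)) (sym (split f))) ⟩
   ∑< (suc n) f ≡⟨ Σf ⟩
   n̂ * W ≤⟨ *-monoʳ 0≤W n≤4X ⟩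
   4ℚ * X * W ≡⟨ trans (r₁ X W) (cong (λ x → 2ℚ * (X * (x * x)) * (2ℚ * W)) (sym ab)) ⟩
   2ℚ * (X * (a * b * (a * b))) * (2ℚ * W) ≡⟨ r₂ X a b W ⟩
   2ℚ * (X * (a * a)) * (2ℚ * (b * b) * W) ∎)
   where
   k : ℚ
   k = ⌜ K₀ ⌝
   f : ℕ → ℚ
   f l = 2ℚ * (⌜ l ⌝ * (1ℚ + ⌜ l ⌝)) * v n l
   0≤f : ∀ l → 0ℚ ≤ f l
   0≤f l = 0≤* (0≤* 0≤2 (0≤* (0≤⌜⌝ l) (0≤+ 0≤1 (0≤⌜⌝ l)))) (0≤v′ n l)
   grow : ∀ l → K₀ ℕ.≤ l → 2ℚ * (k * k) ≤ 2ℚ * (⌜ l ⌝ * (1ℚ + ⌜ l ⌝))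
   grow l h = *-monoˡ 0≤2 (*-mono (0≤⌜⌝ l) (0≤⌜⌝ K₀) (⌜⌝-mono h) (≤≡ (⌜⌝-mono (ℕ.m≤n⇒m≤1+n h)) (⌜suc⌝ l)))
   Σf : ∑< (suc n) f ≡ n̂ * W
   Σf = begin-equality
    ∑< (suc n) f ≡⟨ ∑-cong (suc n) (λ l → r (v n l) (2ℚ * (⌜ l ⌝ * (1ℚ + ⌜ l ⌝))) n̂) ⟩
    ∑< (suc n) (λ l → v n l * (2ℚ * (⌜ l ⌝ * (1ℚ + ⌜ l ⌝)) - n̂) + n̂ * v n l) ≡⟨ trans (∑-+ (suc n) (λ l → v n l * (2ℚ * (⌜ l ⌝ * (1ℚ + ⌜ l ⌝)) - n̂)) (λ l → n̂ * v n l)) (cong₂ _+_ (moment-0 n) (∑-* (suc n) n̂ (v n))) ⟩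
    0ℚ + n̂ * W ≡⟨ +-identityˡ (n̂ * W) ⟩
    n̂ * W ∎
    where
    r = solve 3 (λ v x n → x :* v := v :* (x :- n) :+ n :* v) refl
   r₁ = solve 2 (λ X W → # 4 :* X :* W := # 2 :* (X :* (:1 :* :1)) :* (# 2 :* W)) refl
   r₂ = solve 4 (λ X a b W → # 2 :* (X :* (a :* b :* (a :* b))) :* (# 2 :* W) := # 2 :* (X :* (a :* a)) :* (# 2 :* (b :* b) :* W)) refl

  ½≤Yn : ½ ≤ Yn
  ½≤Yn = by ((Yn + c 1 - alt c 1) + (½ - c 1)) (0≤+ (sub≥0 (close⁻ʳ {Yn} {alt c 1} (alt-close 0≤c c-dec n 1))) (sub≥0 c₁≤)) (r Yn (c 1))
   where
   c : ℕ → ℚ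
   c k = v n k * odd⁻¹ k
   0≤c : ∀ k → 0ℚ ≤ c k
   0≤c k = 0≤* (0≤v′ n k) (0≤odd k)
   c-dec : ∀ k → c (suc k) ≤ c k
   c-dec k = *-mono (0≤v′ n k) (0≤odd (suc k)) (v-dec n k) (odd-dec k)
   c₁≤ : c 1 ≤ ½
   c₁≤ = ≤≡ (*-mono 0≤1 (0≤odd 1) (v≤1 n 1) (odd≤inv 1)) (*-identityˡ ½)
   r = solve 2 (λ y c → :½ :+ ((y :+ c :- (:0 :+ :1 :* (:1 :* :1))) :+ (:½ :- c)) := y) refl

  0≤Yn : 0ℚ ≤ Yn
  0≤Yn = ≤-trans 0≤½ ½≤Yn

  -- W² = (n+1) Y with Y ≥ 1/2 and n + 2 ≥ X.
  o≤2W : o ≤ 2ℚ * W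
  o≤2W = sq-≤ 0≤o (0≤* 0≤2 0≤W) (begin
   o * o ≤⟨ by ((2ℚ + n̂ - X) + n̂ + 4ℚ * ((1ℚ + n̂) * (Yn - ½))) (0≤+ (0≤+ (sub≥0 X≤n) 0≤n̂) (0≤* 0≤4 (0≤* (0≤+ 0≤1 0≤n̂) (sub≥0 ½≤Yn)))) (r X n̂ Yn) ⟩
   4ℚ * ((1ℚ + n̂) * Yn) ≡⟨ trans (cong (4ℚ *_) (sym (X²≡Y n))) (r₂ W) ⟩
   2ℚ * W * (2ℚ * W) ∎)
   where
   r = solve 3 (λ X n y → X :+ ((# 2 :+ n :- X) :+ n :+ # 4 :* ((:1 :+ n) :* (y :- :½))) := # 4 :* ((:1 :+ n) :* y)) refl
   r₂ = solve 1 (λ w → # 4 :* (w :* w) := # 2 :* w :* (# 2 :* w)) refl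

  ω≤bo : ω ≤ b * o
  ω≤bo = begin
   ω ≡⟨ sym (*-identityˡ ω) ⟩
   1ℚ * ω ≡⟨ cong (_* ω) (sym (trans (*-comm ι ω) ωι)) ⟩
   ι * ω * ω ≤⟨ *-monoʳ 0≤ω (*-monoʳ 0≤ω ι≤b) ⟩
   b * ω * ω ≡⟨ *-assoc b ω ω ⟩
   b * o ∎

  bW : ℚ
  bW = b * W

  0≤bW : 0ℚ ≤ bW
  0≤bW = 0≤* 0≤b 0≤W

  bo≤ : b * o ≤ 2ℚ * bW
  bo≤ = ≤≡ (*-monoˡ 0≤b o≤2W) (r b W)
   where
   r = solve 2 (λ b w → b :* (# 2 :* w) := # 2 :* (b :* w)) refl

  a≤ω : a ≤ ω
  a≤ω = ≤-trans (≡≤ (sym (*-identityʳ a)) (≤≡ (*-mono 0≤a 0≤1 ≤-refl 1≤a) (sym (*-identityʳ (a * a))))) (≤≡ (*-mono (0≤* 0≤a 0≤a) 0≤1 ≤-refl (≤-trans 1≤a (≡≤ (sym (*-identityʳ a)) (*-monoˡ 0≤a 1≤a)))) (sym ω≡))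

  open Tail using (tail-bound; 0≤tail; Γ-split)
  open C.Rank 0 using (Ĝ)

  -- The heads of both sums are compared through Ψ₀, and the two tails are estimated separately.
  Γ-W : ∣ Γ - pN * W ∣ ≤ ⌜ 19132 ⌝ * bW * pN
  Γ-W = begin
   ∣ Γ - pN * W ∣ ≡⟨ cong ∣_∣ (trans (cong₂ (λ g x → g - pN * x) Γ-split (split (v n))) (r₀ A tail pN vs Wt Ψ₀)) ⟩
   ∣ (A - pN * Ψ₀) + tail - pN * (vs - Ψ₀) - pN * Wt ∣ ≤⟨ ∣-∣ {(A - pN * Ψ₀) + tail - pN * (vs - Ψ₀)} (∣-∣ {(A - pN * Ψ₀) + tail} (∣+∣ {A - pN * Ψ₀} head-bound (∣≥0∣ 0≤tail tail-bound)) (∣*∣ 0≤pN head-v)) (∣≥0∣ (0≤* 0≤pN 0≤Wt) (*-monoˡ 0≤pN tail-v)) ⟩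
   ⌜ 9552 ⌝ * a * pN + (pN + 6ℚ * (o * (b * b * b)) * pN) + pN * (6ℚ * ω) + pN * (2ℚ * (b * b) * W)
    ≤⟨ by (((⌜ 9552 ⌝ * (c - a) + (c - 1ℚ)) + (6ℚ * (o * (b - b * b * b)) + 6ℚ * (c - ω)) + (2ℚ * ((b - b * b) * W) + 6ℚ * (c - b * o))) * pN + (⌜ 19132 ⌝ - ⌜ 19132 ⌝) * bW * pN)
       (0≤+ (0≤* (0≤+ (0≤+ (0≤+ (0≤* (0≤⌜⌝ 9552) (sub≥0 a≤c)) (sub≥0 (≤-trans 1≤a a≤c))) (0≤+ (0≤* 0≤6 (0≤* 0≤o (sub≥0 bbb≤b))) (0≤* 0≤6 (sub≥0 (≤-trans ω≤bo bo≤)))))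
          (0≤+ (0≤* 0≤2 (0≤* (sub≥0 bb≤b) 0≤W)) (0≤* 0≤6 (sub≥0 bo≤)))) 0≤pN) (0≤* (0≤* (≤-reflexive (sym (+-inverseʳ ⌜ 19132 ⌝))) 0≤bW) 0≤pN)) (r₁ a b o ω W pN) ⟩
   ⌜ 19132 ⌝ * bW * pN ∎
   where
   A = ∑< K₀ Ĝ
   tail = ∑< (suc (N ℕ.∸ K₀)) (λ r → Ĝ (K₀ ℕ.+ r))
   vs = ∑< K₀ (v n)
   c : ℚ
   c = 2ℚ * bW
   a≤c : a ≤ c
   a≤c = ≤-trans a≤ω (≤-trans ω≤bo bo≤)
   bbb≤b : b * b * b ≤ b
   bbb≤b = ≤≡ (*-monoʳ 0≤b (≤-trans bb≤b b≤1)) (*-identityˡ b)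
   r₀ = solve 6 (λ A t p v W Ψ → (A :+ t) :- p :* (v :+ W) := (A :- p :* Ψ) :+ t :- p :* (v :- Ψ) :- p :* W) refl
   r₁ = solve 6 (λ a b o ω W p → # 9552 :* a :* p :+ (p :+ # 6 :* (o :* (b :* b :* b)) :* p) :+ p :* (# 6 :* ω) :+ p :* (# 2 :* (b :* b) :* W) :+ (((# 9552 :* (# 2 :* (b :* W) :- a) :+ (# 2 :* (b :* W) :- :1)) :+ (# 6 :* (o :* (b :- b :* b :* b)) :+ # 6 :* (# 2 :* (b :* W) :- ω)) :+ (# 2 :* ((b :- b :* b) :* W) :+ # 6 :* (# 2 :* (b :* W) :- b :* o))) :* p :+ (# 19132 :- # 19132) :* (b :* W) :* p) := # 19132 :* (b :* W) :* p) refl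

  0≤Vtot : 0ℚ ≤ Vtot
  0≤Vtot = 0≤+ (0≤B 0) (0≤* 0≤2 (0≤∑ (suc N) λ k → 0≤B (suc k)))
   where open C.Rank 0 using (0≤B)

  Vtot-near : Near (⌜ 19332 ⌝ * b) (4ℚ * (pN * W)) (3ℚ * Vtot)
  Vtot-near = near-abs (0≤* (0≤⌜⌝ 19332) 0≤b) (0≤* 0≤4 (0≤* 0≤pN 0≤W)) (0≤* 0≤3 0≤Vtot) (begin
   ∣ 4ℚ * (pN * W) - 3ℚ * Vtot ∣ ≡⟨ trans (∣p-q∣≡∣q-p∣ (4ℚ * (pN * W)) (3ℚ * Vtot)) (cong ∣_∣ (r₀ Vtot Γ (pN * W))) ⟩
   ∣ (3ℚ * Vtot - 4ℚ * Γ) + 4ℚ * (Γ - pN * W) ∣ ≤⟨ ∣+∣ {3ℚ * Vtot - 4ℚ * Γ} Vtot-Γ (∣*∣ {4ℚ} 0≤4 Γ-W) ⟩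
   ⌜ 400 ⌝ * pN + 4ℚ * (⌜ 19132 ⌝ * bW * pN) ≤⟨ by (⌜ 400 ⌝ * ((2ℚ * bW - 1ℚ) * pN)) (0≤* (0≤⌜⌝ 400) (0≤* (sub≥0 (≤-trans 1≤a (≤-trans a≤ω (≤-trans ω≤bo bo≤)))) 0≤pN)) (r₁ b W pN) ⟩
   ⌜ 19332 ⌝ * b * (4ℚ * (pN * W)) ∎)
   where
   r₀ = solve 3 (λ V G x → # 3 :* V :- # 4 :* x := (# 3 :* V :- # 4 :* G) :+ # 4 :* (G :- x)) refl
   r₁ = solve 3 (λ b W p → # 400 :* p :+ # 4 :* (# 19132 :* (b :* W) :* p) :+ # 400 :* ((# 2 :* (b :* W) :- :1) :* p) := # 19332 :* b :* (# 4 :* (p :* W))) refl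

  -- s quantifies the smallness of the rank: ℓ/w³ ≤ 1/(s+1). Here the total is N itself, so the
  -- reference value is p at N minus the triangular number.
  module Small (s ℓ : ℕ) (sℓ≤h : suc s ℕ.* ℓ ℕ.≤ h) where
   d N′ : ℕ
   d = t (suc ℓ)
   N′ = N ℕ.∸ d

   d≤ℓ² : ∀ ℓ → t (suc ℓ) ℕ.≤ ℓ ℕ.* ℓ
   d≤ℓ² zero = ℕ.z≤n
   d≤ℓ² (suc ℓ) = ℕ.≤-trans (ℕ.+-monoˡ-≤ (suc ℓ) (d≤ℓ² ℓ)) (ℕ≤≡ (ℕ.m≤m+n _ ℓ) (e ℓ))
    where
    e : ∀ l → l ℕ.* l ℕ.+ suc l ℕ.+ l ≡ suc l ℕ.* suc l
    e = ℕ-Ring.solve-∀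

   ℓ≤h : ℓ ℕ.≤ h
   ℓ≤h = ℕ.≤-trans (ℕ.m≤m+n ℓ (s ℕ.* ℓ)) sℓ≤h

   d≤w⁶ : d ℕ.≤ w⁶ w
   d≤w⁶ = ℕ.≤-trans (d≤ℓ² ℓ) (ℕ≤≡ (ℕ.*-mono-≤ ℓ≤h ℓ≤h) (e w))
    where
    e : ∀ w → w ℕ.* (w ℕ.* w) ℕ.* (w ℕ.* (w ℕ.* w)) ≡ (w ℕ.* w ℕ.* (w ℕ.* w)) ℕ.* (w ℕ.* w)
    e = ℕ-Ring.solve-∀

   d+N′ : d ℕ.+ N′ ≡ N
   d+N′ = ℕ.m+[n∸m]≡n (ℕ.≤-trans d≤w⁶ w⁶≤N)

   N≤ʷ : N ℕ.≤ w⁶ w ℕ.+ N′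
   N≤ʷ = ℕ≡≤ (sym d+N′) (ℕ.+-monoˡ-≤ N′ d≤w⁶)

   module C′ = Centre N′ N≤ʷ (ℕ.m∸n≤m N d)

   Vℓ σ′ q : ℚ
   Vℓ = ⌜ Compositions.a N ℓ ⌝
   σ′ = inv s
   q = p̂ N′

   0≤Vℓ : 0ℚ ≤ Vℓ
   0≤Vℓ = 0≤⌜⌝ (Compositions.a N ℓ)
   0≤σ′ : 0ℚ ≤ σ′
   0≤σ′ = 0≤inv s
   0≤q : 0ℚ ≤ q
   0≤q = 0≤p̂ N′

   rank : ω * ∣ 3ℚ * Vℓ - 2ℚ * q ∣ ≤ ⌜ 267532 ⌝ * q
   rank = subst (λ M → ω * ∣ 3ℚ * ⌜ Compositions.a M ℓ ⌝ - 2ℚ * q ∣ ≤ ⌜ 267532 ⌝ * q) d+N′ (C′.Rank.small-rank ℓ ℓ≤h)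

   rank-near : Near (⌜ 133766 ⌝ * b) (2ℚ * q) (3ℚ * Vℓ)
   rank-near = near-abs (0≤* (0≤⌜⌝ 133766) 0≤b) (0≤* 0≤2 0≤q) (0≤* 0≤3 0≤Vℓ) (begin
    ∣ 2ℚ * q - 3ℚ * Vℓ ∣ ≡⟨ trans (∣p-q∣≡∣q-p∣ (2ℚ * q) (3ℚ * Vℓ)) (trans (sym (*-identityˡ E)) (cong (_* E) (sym (trans (*-comm ι ω) ωι)))) ⟩
    ι * ω * E ≡⟨ *-assoc ι ω E ⟩
    ι * (ω * E) ≤⟨ *-monoˡ 0≤ι rank ⟩
    ι * (⌜ 267532 ⌝ * q) ≤⟨ *-monoʳ (0≤* (0≤⌜⌝ 267532) 0≤q) ι≤b ⟩
    b * (⌜ 267532 ⌝ * q) ≡⟨ r b q ⟩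
    ⌜ 133766 ⌝ * b * (2ℚ * q) ∎)
    where
    E = ∣ 3ℚ * Vℓ - 2ℚ * q ∣
    r = solve 2 (λ b q → b :* (# 267532 :* q) := # 133766 :* b :* (# 2 :* q)) refl

   dY≤ : ⌜ d ⌝ * (i * Y) ≤ σ′
   dY≤ = begin
    ⌜ d ⌝ * (i * Y) ≤⟨ *-monoʳ (0≤* 0≤i 0≤Y) (≤≡ (⌜⌝-mono (d≤ℓ² ℓ)) (⌜*⌝ ℓ ℓ)) ⟩
    ⌜ ℓ ⌝ * ⌜ ℓ ⌝ * (i * Y) ≤⟨ *-monoʳ (0≤* 0≤i 0≤Y) (*-mono (0≤* 0≤σ′ 0≤ωo) (0≤⌜⌝ ℓ) ℓ≤ ℓ≤) ⟩
    σ′ * (ω * o) * (σ′ * (ω * o)) * (i * Y) ≡⟨ trans (r σ′ ω ι) (cong (λ x → σ′ * σ′ * (x * x * x * (x * x * x))) ωι) ⟩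
    σ′ * σ′ * (1ℚ * 1ℚ * 1ℚ * (1ℚ * 1ℚ * 1ℚ)) ≡⟨ *-identityʳ (σ′ * σ′) ⟩
    σ′ * σ′ ≤⟨ *-monoˡ 0≤σ′ (inv≤1 s) ⟩
    σ′ * 1ℚ ≡⟨ *-identityʳ σ′ ⟩
    σ′ ∎
    where
    0≤ωo : 0ℚ ≤ ω * o
    0≤ωo = 0≤* 0≤ω 0≤o
    r = solve 3 (λ s w i → s :* (w :* (w :* w)) :* (s :* (w :* (w :* w))) :* (i :* i :* (i :* i :* (i :* i))) := s :* s :* (w :* i :* (w :* i) :* (w :* i) :* (w :* i :* (w :* i) :* (w :* i)))) refl
    ℓ≤ : ⌜ ℓ ⌝ ≤ σ′ * (ω * o)
    ℓ≤ = begin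
     ⌜ ℓ ⌝ ≡⟨ trans (sym (*-identityˡ ⌜ ℓ ⌝)) (cong (_* ⌜ ℓ ⌝) (sym (trans (*-comm σ′ ⌜ suc s ⌝) (⌜*⌝-inv s)))) ⟩
     σ′ * ⌜ suc s ⌝ * ⌜ ℓ ⌝ ≡⟨ trans (*-assoc σ′ ⌜ suc s ⌝ ⌜ ℓ ⌝) (cong (σ′ *_) (sym (⌜*⌝ (suc s) ℓ))) ⟩
     σ′ * ⌜ suc s ℕ.* ℓ ⌝ ≤⟨ *-monoˡ 0≤σ′ (≤≡ (⌜⌝-mono sℓ≤h) cast-h) ⟩
     σ′ * (ω * o) ∎

   yd : ℚ
   yd = pow y d

   0≤yd : 0ℚ ≤ yd
   0≤yd = 0≤pow 0≤y d

   p-near : Near (⌜ 208 ⌝ * b + ⌜ 3504 ⌝ * σ′) q (yd * pN)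
   p-near = near-weaken (+-mono-≤ (*-monoˡ (0≤⌜⌝ 208) (≤-trans i≤ι ι≤b)) (≡≤ (r ⌜ d ⌝ (i * Y)) (*-monoˡ (0≤⌜⌝ 3504) dY≤))) 0≤q (0≤* 0≤yd 0≤pN)
    (subst (λ M → Near (⌜ 208 ⌝ * i + ⌜ d ⌝ * (⌜ 3504 ⌝ * (i * Y))) q (yd * p̂ M)) d+N′ (ratio-near d N′ N≤ʷ (ℕ≡≤ d+N′ (ℕ.m≤m+n N (w⁶ w)))))
    where
    r = solve 2 (λ d y → d :* (# 3504 :* y) := # 3504 :* (d :* y)) refl

   -- The chain is 2W · 3V ≈ 4W p(N′) ≈ y^d · 4W p(N) ≈ y^d · 3 Vtot; the errors of its links add.
   proportion : Near (⌜ 153306 ⌝ * b + ⌜ 3504 ⌝ * σ′) (Vℓ * (2ℚ * W)) (yd * Vtot)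
   proportion = near-cancel {c = 3ℚ} (0<⌜suc⌝ 2) (subst₂ (Near _) (r₁ Vℓ W) (r₂ yd Vtot)
     (subst (λ k → Near k (2ℚ * W * (3ℚ * Vℓ)) (yd * (3ℚ * Vtot))) (r₀ b σ′)
      (near-trans (0≤+ 0≤κ₁ 0≤κ₂) 0≤κ₃ (0≤* 0≤2W (0≤* 0≤3 0≤Vℓ)) (0≤* 0≤yd (0≤* 0≤3 0≤Vtot))
       (near-trans 0≤κ₁ 0≤κ₂ (0≤* 0≤2W (0≤* 0≤3 0≤Vℓ)) (0≤* 0≤yd (0≤* 0≤4 (0≤* 0≤pN 0≤W)))
        (near-scale 0≤2W 0≤κ₁ (0≤* 0≤3 0≤Vℓ) (0≤* 0≤2 0≤q) (near-sym rank-near))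
        (subst₂ (Near _) (r₃ W q) (r₄ W yd pN) (near-scale (0≤* 0≤4 0≤W) 0≤κ₂ 0≤q (0≤* 0≤yd 0≤pN) p-near)))
       (near-scale 0≤yd 0≤κ₃ (0≤* 0≤4 (0≤* 0≤pN 0≤W)) (0≤* 0≤3 0≤Vtot) Vtot-near))))
    where
    0≤2W : 0ℚ ≤ 2ℚ * W
    0≤2W = 0≤* 0≤2 0≤W
    0≤κ₁ : 0ℚ ≤ ⌜ 133766 ⌝ * b
    0≤κ₁ = 0≤* (0≤⌜⌝ 133766) 0≤b
    0≤κ₂ : 0ℚ ≤ ⌜ 208 ⌝ * b + ⌜ 3504 ⌝ * σ′
    0≤κ₂ = 0≤+ (0≤* (0≤⌜⌝ 208) 0≤b) (0≤* (0≤⌜⌝ 3504) 0≤σ′)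
    0≤κ₃ : 0ℚ ≤ ⌜ 19332 ⌝ * b
    0≤κ₃ = 0≤* (0≤⌜⌝ 19332) 0≤b
    r₀ = solve 2 (λ b s → # 133766 :* b :+ (# 208 :* b :+ # 3504 :* s) :+ # 19332 :* b := # 153306 :* b :+ # 3504 :* s) refl
    r₁ = solve 2 (λ V W → # 2 :* W :* (# 3 :* V) := # 3 :* (V :* (# 2 :* W))) refl
    r₂ = solve 2 (λ y V → y :* (# 3 :* V) := # 3 :* (y :* V)) refl
    r₃ = solve 2 (λ W q → # 4 :* W :* q := # 2 :* W :* (# 2 :* q)) refl
    r₄ = solve 3 (λ W y p → # 4 :* W :* (y :* p) := y :* (# 4 :* (p :* W))) refl

  Y≤b : Y ≤ b
  Y≤b = ≤-trans Y≤i (≤-trans i≤ι ι≤b)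

  τ≤n : τ ℕ.≤ suc n
  τ≤n = ℕ.≤-trans (ℕ.m≤n*m τ (w² w) {{ℕ.>-nonZero w²≥1}}) K₀<n

  Yn-L : ∀ k → τ ℕ.≤ k → ∣ Yn - L k ∣ ≤ 4ℚ * b
  Yn-L k τ≤k = begin
   ∣ Yn - L k ∣ ≡⟨ cong ∣_∣ (r₀ Yn (L τ) (L k)) ⟩
   ∣ (Yn - L τ) - (L k - L τ) ∣ ≤⟨ ∣-∣ {Yn - L τ} (Y-close n τ τ≤n) (subst (λ m → ∣ L m - L τ ∣ ≤ inv τ) (ℕ.m+[n∸m]≡n τ≤k) (≤-trans (alt-close 0≤odd odd-dec (k ℕ.∸ τ) τ) (odd≤inv τ))) ⟩
   inv τ + a * (a * inv n) + inv τ ≤⟨ +-mono-≤ (+-mono-≤ invτ≤b aa≤) invτ≤b ⟩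
   b + 2ℚ * b + b ≡⟨ r₁ b ⟩
   4ℚ * b ∎
   where
   r₀ = solve 3 (λ a b c → a :- c := (a :- b) :- (c :- b)) refl
   r₁ = solve 1 (λ b → b :+ # 2 :* b :+ b := # 4 :* b) refl
   invτ≤b : inv τ ≤ b
   invτ≤b = inv-antitone (ℕ.pred[n]≤n {τ})
   aa≤ : a * (a * inv n) ≤ 2ℚ * b
   aa≤ = begin
    a * (a * inv n) ≤⟨ *-monoˡ 0≤a (*-monoˡ 0≤a (≤-trans Cmp.inv-n≤θ θ≤2Y)) ⟩
    a * (a * (2ℚ * Y)) ≤⟨ *-monoˡ 0≤a (*-monoˡ 0≤a (*-monoˡ 0≤2 (≤-trans Y≤i (*-mono 0≤bb 0≤ι ι≤bb ι≤b)))) ⟩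
    a * (a * (2ℚ * (b * b * b))) ≡⟨ trans (r₂ a b) (cong (λ x → 2ℚ * (x * x * b)) ab) ⟩
    2ℚ * (1ℚ * 1ℚ * b) ≡⟨ cong (2ℚ *_) (*-identityˡ b) ⟩
    2ℚ * b ∎
    where
    r₂ = solve 2 (λ a b → a :* (a :* (# 2 :* (b :* b :* b))) := # 2 :* (a :* b :* (a :* b) :* b)) refl

  0≤L : ∀ k → 1 ℕ.≤ k → 0ℚ ≤ L k
  0≤L (suc k) _ = by ((L (suc k) + odd⁻¹ 1 - L 1) + (1ℚ - odd⁻¹ 1)) (0≤+ (sub≥0 (close⁻ʳ {L (suc k)} {L 1} (alt-close 0≤odd odd-dec k 1))) (sub≥0 (≤-trans (odd≤inv 1) (inv≤1 1)))) (r (L (suc k)) (odd⁻¹ 1))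
   where
   r = solve 2 (λ l o → :0 :+ ((l :+ o :- (:0 :+ :1 :* :1)) :+ (:1 :- o)) := l) refl

  -- W² = (n+1) Y, where (n+1) θ is near 2 and Y is near the Leibniz sum.
  W²θ-near : ∀ k → τ ℕ.≤ k → Near (⌜ 10 ⌝ * b) (W * W * θ) (2ℚ * L k)
  W²θ-near k τ≤k = subst₂ (λ κ x → Near κ x (2ℚ * L k)) (r₀ b) (trans (r₁ n̂ θ Yn) (cong (_* θ) (sym (X²≡Y n))))
    (near-* (0≤* 0≤2 0≤b) (0≤* 0≤8 0≤b) 0≤nθ 0≤2 0≤Yn (0≤L k (ℕ.≤-trans 1≤τ τ≤k))
     (near-sym (near-abs (0≤* 0≤2 0≤b) 0≤2 0≤nθ (≤-trans (close {2ℚ} {(1ℚ + n̂) * θ} Cmp.nθ≥′ (≤-trans nθ≤ (p≤p+q 2ℚ 0≤θ)))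
      (≤-trans θ≤2Y (≤-trans (*-monoˡ 0≤2 Y≤b) (by (2ℚ * b) (0≤* 0≤2 0≤b) (r₂ b)))))))
     (near-abs (0≤* 0≤8 0≤b) 0≤Yn (0≤L k (ℕ.≤-trans 1≤τ τ≤k)) (≤-trans (Yn-L k τ≤k) (by (8ℚ * (b * (Yn - ½))) (0≤* 0≤8 (0≤* 0≤b (sub≥0 ½≤Yn))) (r₃ b Yn)))))
   where
   0≤nθ : 0ℚ ≤ (1ℚ + n̂) * θ
   0≤nθ = 0≤* (0≤+ 0≤1 0≤n̂) 0≤θ
   r₀ = solve 1 (λ b → # 2 :* b :+ # 8 :* b := # 10 :* b) refl
   r₁ = solve 3 (λ n θ y → (:1 :+ n) :* θ :* y := (:1 :+ n) :* y :* θ) refl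
   r₂ = solve 1 (λ b → # 2 :* b :+ # 2 :* b := # 2 :* b :* # 2) refl
   r₃ = solve 2 (λ b y → # 4 :* b :+ # 8 :* (b :* (y :- :½)) := # 8 :* b :* y) refl

-- Partial sums of the exponential between powers

module ExpBounds where
 open Rationals
 open ZetaSums using (inv; 0≤inv; inv≤1)
 open import Data.Rational.Properties
 open ≤-Reasoning

 cauchy-product : (f g : ℕ → ℚ) → ℕ → ℚ
 cauchy-product f g zero = f 0 * g 0
 cauchy-product f g (suc n) = f 0 * g (suc n) + cauchy-product (f ∘ suc) g n

 private
  cv = cauchy-product

 cv-cong : ∀ {f f′} g → (∀ i → f i ≡ f′ i) → ∀ n → cv f g n ≡ cv f′ g n
 cv-cong g h zero = cong (_* g 0) (h 0)
 cv-cong g h (suc n) = cong₂ _+_ (cong (_* g (suc n)) (h 0)) (cv-cong g (h ∘ suc) n)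

 cv-+ : ∀ f f′ g n → cv (λ i → f i + f′ i) g n ≡ cv f g n + cv f′ g n
 cv-+ f f′ g zero = *-distribʳ-+ (g 0) (f 0) (f′ 0)
 cv-+ f f′ g (suc n) = trans (cong (λ x → (f 0 + f′ 0) * g (suc n) + x) (cv-+ (f ∘ suc) (f′ ∘ suc) g n)) (r (f 0) (f′ 0) (g (suc n)) (cv (f ∘ suc) g n) (cv (f′ ∘ suc) g n))
  where
  r = solve 5 (λ a b c d e → (a :+ b) :* c :+ (d :+ e) := a :* c :+ d :+ (b :* c :+ e)) refl

 cv-* : ∀ c f g n → cv (λ i → c * f i) g n ≡ c * cv f g n
 cv-* c f g zero = *-assoc c (f 0) (g 0)
 cv-* c f g (suc n) = trans (cong (λ x → c * f 0 * g (suc n) + x) (cv-* c (f ∘ suc) g n)) (r c (f 0) (g (suc n)) (cv (f ∘ suc) g n))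
  where
  r = solve 4 (λ c a b d → c :* a :* b :+ c :* d := c :* (a :* b :+ d)) refl

 weighted : (ℕ → ℚ) → ℕ → ℚ
 weighted f i = ⌜ i ⌝ * f i

 cv-weighted : ∀ f g n → ⌜ n ⌝ * cv f g n ≡ cv (weighted f) g n + cv f (weighted g) n
 cv-weighted f g zero = r (f 0) (g 0)
  where
  r = solve 2 (λ a b → :0 :* (a :* b) := :0 :* a :* b :+ a :* (:0 :* b)) refl
 cv-weighted f g (suc n) = begin-equality
  ⌜ suc n ⌝ * (f 0 * g (suc n) + C) ≡⟨ cong (_* (f 0 * g (suc n) + C)) (⌜suc⌝ n) ⟩
  (1ℚ + ⌜ n ⌝) * (f 0 * g (suc n) + C) ≡⟨ r₁ ⌜ n ⌝ (f 0) (g (suc n)) C ⟩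
  f 0 * ((1ℚ + ⌜ n ⌝) * g (suc n)) + C + ⌜ n ⌝ * C ≡⟨ cong₂ (λ a b → f 0 * (a * g (suc n)) + C + b) (sym (⌜suc⌝ n)) (cv-weighted f′ g n) ⟩
  f 0 * weighted g (suc n) + C + (cv (weighted f′) g n + cv f′ (weighted g) n) ≡⟨ r₂ (f 0) (weighted g (suc n)) C (cv (weighted f′) g n) (cv f′ (weighted g) n) (g (suc n)) ⟩
  0ℚ * f 0 * g (suc n) + (C + cv (weighted f′) g n) + (f 0 * weighted g (suc n) + cv f′ (weighted g) n) ≡⟨ cong (λ a → 0ℚ * f 0 * g (suc n) + a + (f 0 * weighted g (suc n) + cv f′ (weighted g) n)) (sym (trans (cv-cong g e n) (cv-+ f′ (weighted f′) g n))) ⟩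
  cv (weighted f) g (suc n) + cv f (weighted g) (suc n) ∎
  where
  f′ = f ∘ suc
  C = cv f′ g n
  e : ∀ i → ⌜ suc i ⌝ * f′ i ≡ f′ i + ⌜ i ⌝ * f′ i
  e i = trans (cong (_* f′ i) (⌜suc⌝ i)) (r ⌜ i ⌝ (f′ i))
   where
   r = solve 2 (λ a b → (:1 :+ a) :* b := b :+ a :* b) refl
  r₁ = solve 4 (λ n f g c → (:1 :+ n) :* (f :* g :+ c) := f :* ((:1 :+ n) :* g) :+ c :+ n :* c) refl
  r₂ = solve 6 (λ f g c d e h → f :* g :+ c :+ (d :+ e) := :0 :* f :* h :+ (c :+ d) :+ (f :* g :+ e)) refl

 expTerm-weighted : ∀ x j → ⌜ suc j ⌝ * expTerm x (suc j) ≡ x * expTerm x j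
 expTerm-weighted x j = trans (r ⌜ suc j ⌝ (expTerm x j) x (inv j)) (trans (cong (_* (x * expTerm x j)) (⌜*⌝-inv j)) (*-identityˡ (x * expTerm x j)))
  where
  r = solve 4 (λ n t x i → n :* (t :* (x :* i)) := n :* i :* (x :* t)) refl

 -- Weighting by the index is a derivation of the Cauchy product, so both sides satisfy (n+1) c(n+1)
 -- = (a+b) c(n).
 cv-exp : ∀ a b n → cv (expTerm a) (expTerm b) n ≡ expTerm (a + b) n
 cv-exp a b zero = *-identityˡ 1ℚ
 cv-exp a b (suc n) = begin-equality
  C (suc n) ≡⟨ trans (sym (*-identityˡ (C (suc n)))) (cong (_* C (suc n)) (sym (trans (*-comm (inv n) ⌜ suc n ⌝) (⌜*⌝-inv n)))) ⟩
  inv n * ⌜ suc n ⌝ * C (suc n) ≡⟨ *-assoc (inv n) ⌜ suc n ⌝ (C (suc n)) ⟩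
  inv n * (⌜ suc n ⌝ * C (suc n)) ≡⟨ cong (inv n *_) (trans (cv-weighted f g (suc n)) (cong₂ _+_ left (right f n))) ⟩
  inv n * (a * C n + b * C n) ≡⟨ cong (λ c → inv n * (a * c + b * c)) (cv-exp a b n) ⟩
  inv n * (a * E + b * E) ≡⟨ r (inv n) a b E ⟩
  E * ((a + b) * inv n) ∎
  where
  f = expTerm a
  g = expTerm b
  C = cv f g
  E = expTerm (a + b) n
  left : cv (weighted f) g (suc n) ≡ a * C n
  left = trans (cong₂ _+_ (trans (cong (_* g (suc n)) (*-zeroˡ 1ℚ)) (*-zeroˡ (g (suc n)))) (trans (cv-cong g (expTerm-weighted a) n) (cv-* a f g n))) (+-identityˡ (a * C n))
  right : ∀ f m → cv f (weighted g) (suc m) ≡ b * cv f g m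
  right f zero = trans (cong (λ x → f 0 * x + f 1 * (0ℚ * 1ℚ)) (expTerm-weighted b 0)) (r (f 0) b (f 1))
   where
   r = solve 3 (λ f b h → f :* (b :* :1) :+ h :* (:0 :* :1) := b :* (f :* :1)) refl
  right f (suc m) = trans (cong₂ (λ x z → f 0 * x + z) (expTerm-weighted b (suc m)) (right (f ∘ suc) m)) (r (f 0) b (g (suc m)) (cv (f ∘ suc) g m))
   where
   r = solve 4 (λ f b t c → f :* (b :* t) :+ b :* c := b :* (f :* t :+ c)) refl
  r = solve 4 (λ i a b e → i :* (a :* e :+ b :* e) := e :* ((a :+ b) :* i)) refl

 expSum-+ : ∀ a b k → expSum (a + b) k ≡ ∑< k (cv (expTerm a) (expTerm b))
 expSum-+ a b k = ∑-cong k λ n → sym (cv-exp a b n)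

 ∑-cv : ∀ f g k → ∑< (suc k) (cv f g) ≡ f 0 * ∑< (suc k) g + ∑< k (cv (f ∘ suc) g)
 ∑-cv f g k = trans (∑-head k (cv f g)) (trans (cong (λ x → f 0 * g 0 + x) (trans (∑-+ k (λ n → f 0 * g (suc n)) (cv (f ∘ suc) g)) (cong (_+ ∑< k (cv (f ∘ suc) g)) (∑-* k (f 0) (g ∘ suc)))))
  (trans (r (f 0) (g 0) (∑< k (g ∘ suc)) (∑< k (cv (f ∘ suc) g))) (cong (λ x → f 0 * x + ∑< k (cv (f ∘ suc) g)) (sym (∑-head k g)))))
  where
  r = solve 4 (λ f g s c → f :* g :+ (f :* s :+ c) := f :* (g :+ s) :+ c) refl

 -- For k ≤ m, the part of the k × m rectangle of products outside the triangle summed by the Cauchy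
 -- product.
 excess : (f g : ℕ → ℚ) (k m : ℕ) → ℚ
 excess f g k m = ∑< k f * ∑< m g - ∑< k (cv f g)

 excess-suc : ∀ f g k m → excess f g (suc k) m ≡ f 0 * (∑< m g - ∑< (suc k) g) + excess (f ∘ suc) g k m
 excess-suc f g k m = trans (cong₂ (λ a b → a * ∑< m g - b) (∑-head k f) (∑-cv f g k)) (r (f 0) (∑< k (f ∘ suc)) (∑< m g) (∑< (suc k) g) (∑< k (cv (f ∘ suc) g)))
  where
  r = solve 5 (λ f s m g c → (f :+ s) :* m :- (f :* g :+ c) := f :* (m :- g) :+ (s :* m :- c)) refl

 excess-dominated : ∀ {f F g G : ℕ → ℚ} m → (∀ i → ∣ f i ∣ ≤ F i) → (∀ j → j ℕ.≤ m → ∣ ∑< m g - ∑< j g ∣ ≤ ∑< m G - ∑< j G) →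
  ∀ k → k ℕ.≤ m → ∣ excess f g k m ∣ ≤ excess F G k m
 excess-dominated {f} {F} {g} {G} m h hg zero _ = ≤-reflexive (trans (cong ∣_∣ (r (∑< m g))) (sym (r (∑< m G))))
  where
  r = solve 1 (λ a → :0 :* a :- :0 := :0) refl
 excess-dominated {f} {F} {g} {G} m h hg (suc k) k<m = begin
  ∣ excess f g (suc k) m ∣ ≡⟨ cong ∣_∣ (excess-suc f g k m) ⟩
  ∣ f 0 * (∑< m g - ∑< (suc k) g) + excess (f ∘ suc) g k m ∣ ≤⟨ ∣+∣ {f 0 * (∑< m g - ∑< (suc k) g)} head (excess-dominated m (h ∘ suc) hg k (ℕ.<⇒≤ k<m)) ⟩
  F 0 * (∑< m G - ∑< (suc k) G) + excess (F ∘ suc) G k m ≡⟨ sym (excess-suc F G k m) ⟩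
  excess F G (suc k) m ∎
  where
  head : ∣ f 0 * (∑< m g - ∑< (suc k) g) ∣ ≤ F 0 * (∑< m G - ∑< (suc k) G)
  head = ≡≤ (∣p*q∣≡∣p∣*∣q∣ (f 0) (∑< m g - ∑< (suc k) g)) (*-mono (≤-trans (0≤∣p∣ (f 0)) (h 0)) (0≤∣p∣ (∑< m g - ∑< (suc k) g)) (h 0) (hg (suc k) k<m))

 ∑-grow : ∀ {g : ℕ → ℚ} → (∀ i → 0ℚ ≤ g i) → ∀ {j m} → j ℕ.≤ m → ∑< j g ≤ ∑< m g
 ∑-grow {g} h {j} {m} j≤m = subst (λ k → ∑< j g ≤ ∑< k g) (ℕ.m+[n∸m]≡n j≤m) (by (∑< (m ℕ.∸ j) (λ r → g (j ℕ.+ r))) (0≤∑ (m ℕ.∸ j) λ r → h (j ℕ.+ r)) (sym (∑-append j (m ℕ.∸ j) g)))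

 0≤cv : ∀ {f g} → (∀ i → 0ℚ ≤ f i) → (∀ i → 0ℚ ≤ g i) → ∀ n → 0ℚ ≤ cv f g n
 0≤cv h hg zero = 0≤* (h 0) (hg 0)
 0≤cv h hg (suc n) = 0≤+ (0≤* (h 0) (hg (suc n))) (0≤cv (h ∘ suc) hg n)

 0≤excess : ∀ {f g : ℕ → ℚ} m → (∀ i → 0ℚ ≤ f i) → (∀ i → 0ℚ ≤ g i) → ∀ k → k ℕ.≤ m → 0ℚ ≤ excess f g k m
 0≤excess {f} {g} m h hg k k≤m = ≤-trans (0≤∣p∣ _) (excess-dominated m (λ i → ∣≥0∣ (h i) ≤-refl) (λ j j≤m → ∣≥0∣ (sub≥0 (∑-grow hg j≤m)) ≤-refl) k k≤m)

 -- The k × m rectangle lies inside the triangle of size k + m.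
 product≤ : ∀ {f g : ℕ → ℚ} → (∀ i → 0ℚ ≤ f i) → (∀ i → 0ℚ ≤ g i) → ∀ k m → ∑< k f * ∑< m g ≤ ∑< (k ℕ.+ m) (cv f g)
 product≤ {f} {g} h hg zero m = ≡≤ (*-zeroˡ (∑< m g)) (0≤∑ m (0≤cv h hg))
 product≤ {f} {g} h hg (suc k) m = begin
  ∑< (suc k) f * ∑< m g ≡⟨ trans (cong (_* ∑< m g) (∑-head k f)) (*-distribʳ-+ (∑< m g) (f 0) (∑< k (f ∘ suc))) ⟩
  f 0 * ∑< m g + ∑< k (f ∘ suc) * ∑< m g ≤⟨ +-mono-≤ (*-monoˡ (h 0) (∑-grow hg (ℕ.≤-trans (ℕ.m≤n+m m k) (ℕ.n≤1+n _)))) (product≤ (h ∘ suc) hg k m) ⟩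
  f 0 * ∑< (suc (k ℕ.+ m)) g + ∑< (k ℕ.+ m) (cv (f ∘ suc) g) ≡⟨ sym (∑-cv f g (k ℕ.+ m)) ⟩
  ∑< (suc k ℕ.+ m) (cv f g) ∎

 0≤T : ∀ {x} → 0ℚ ≤ x → ∀ j → 0ℚ ≤ expTerm x j
 0≤T h zero = 0≤1
 0≤T h (suc j) = 0≤* (0≤T h j) (0≤* h (0≤inv j))

 expSum-0 : ∀ k → expSum 0ℚ (suc k) ≡ 1ℚ
 expSum-0 zero = refl
 expSum-0 (suc k) = trans (cong₂ _+_ (expSum-0 k) (trans (cong (expTerm 0ℚ k *_) (*-zeroˡ (inv k))) (*-zeroʳ (expTerm 0ℚ k)))) (+-identityʳ 1ℚ)

 -- The Cauchy product at a + (-a) is 1, and the excess is dominated by a block of the series at 2B.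
 -- The bound is uniform in a, which matters because a will vary with the number of terms.
 expSum-inverse : ∀ B a → ∣ a ∣ ≤ ⌜ B ⌝ → ∀ k → ∣ expSum a (suc k) * expSum (- a) (suc k) - 1ℚ ∣ ≤ expSum ⌜ B ℕ.+ B ⌝ (suc k ℕ.+ suc k) - expSum ⌜ B ℕ.+ B ⌝ (suc k)
 expSum-inverse B a h k = begin
  ∣ expSum a m * expSum (- a) m - 1ℚ ∣ ≡⟨ cong (λ x → ∣ expSum a m * expSum (- a) m - x ∣) (sym (trans (sym (expSum-+ a (- a) m)) (trans (cong (λ x → expSum x m) (+-inverseʳ a)) (expSum-0 k)))) ⟩
  ∣ excess (expTerm a) (expTerm (- a)) m m ∣ ≤⟨ excess-dominated m (expTerm-dominated B a h) (λ j j≤m → subst (λ l → ∣ expSum (- a) l - expSum (- a) j ∣ ≤ expSum ⌜ B ⌝ l - expSum ⌜ B ⌝ j) (ℕ.m+[n∸m]≡n j≤m) (expSum-tail B (- a) (≡≤ (∣-p∣≡∣p∣ a) h) (m ℕ.∸ j) j)) m ℕ.≤-refl ⟩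
  excess (expTerm ⌜ B ⌝) (expTerm ⌜ B ⌝) m m ≤⟨ +-monoˡ-≤ (- ∑< m (cv (expTerm ⌜ B ⌝) (expTerm ⌜ B ⌝))) (product≤ (0≤expTerm B) (0≤expTerm B) m m) ⟩
  ∑< (m ℕ.+ m) (cv (expTerm ⌜ B ⌝) (expTerm ⌜ B ⌝)) - ∑< m (cv (expTerm ⌜ B ⌝) (expTerm ⌜ B ⌝)) ≡⟨ cong₂ _-_ (e (m ℕ.+ m)) (e m) ⟩
  expSum ⌜ B ℕ.+ B ⌝ (m ℕ.+ m) - expSum ⌜ B ℕ.+ B ⌝ m ∎
  where
  m = suc k
  e : ∀ l → ∑< l (cv (expTerm ⌜ B ⌝) (expTerm ⌜ B ⌝)) ≡ expSum ⌜ B ℕ.+ B ⌝ l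
  e l = trans (sym (expSum-+ ⌜ B ⌝ ⌜ B ⌝ l)) (cong (λ x → expSum x l) (sym (⌜+⌝ B B)))

 suc-* : ∀ ℓ x → ⌜ suc ℓ ⌝ * x ≡ x + ⌜ ℓ ⌝ * x
 suc-* ℓ x = trans (cong (_* x) (⌜suc⌝ ℓ)) (r ⌜ ℓ ⌝ x)
  where
  r = solve 2 (λ a b → (:1 :+ a) :* b := b :+ a :* b) refl

 -- A factor 1 + x is a partial sum of length 2 and lengthens the product by two terms, hence the 2ℓ
 -- + 1.
 pow≤expSum : ∀ {x} → 0ℚ ≤ x → ∀ ℓ j → pow (1ℚ + x) ℓ ≤ expSum (⌜ ℓ ⌝ * x) (suc (ℓ ℕ.+ ℓ ℕ.+ j))
 pow≤expSum {x} 0≤x zero j = ≤-reflexive (sym (trans (cong (λ a → expSum a (suc j)) (*-zeroˡ x)) (expSum-0 j)))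
 pow≤expSum {x} 0≤x (suc ℓ) j = begin
  (1ℚ + x) * pow (1ℚ + x) ℓ ≤⟨ *-monoˡ (0≤+ 0≤1 0≤x) (pow≤expSum 0≤x ℓ j) ⟩
  (1ℚ + x) * expSum (⌜ ℓ ⌝ * x) k ≡⟨ cong (_* expSum (⌜ ℓ ⌝ * x) k) (r x) ⟩
  expSum x 2 * expSum (⌜ ℓ ⌝ * x) k ≤⟨ product≤ (0≤T 0≤x) (0≤T (0≤* (0≤⌜⌝ ℓ) 0≤x)) 2 k ⟩
  ∑< (2 ℕ.+ k) (cv (expTerm x) (expTerm (⌜ ℓ ⌝ * x))) ≡⟨ trans (sym (expSum-+ x (⌜ ℓ ⌝ * x) (2 ℕ.+ k))) (cong₂ expSum (sym (suc-* ℓ x)) (cong suc (e ℓ j))) ⟩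
  expSum (⌜ suc ℓ ⌝ * x) (suc (suc ℓ ℕ.+ suc ℓ ℕ.+ j)) ∎
  where
  k = suc (ℓ ℕ.+ ℓ ℕ.+ j)
  e : ∀ ℓ j → suc (suc (ℓ ℕ.+ ℓ ℕ.+ j)) ≡ suc ℓ ℕ.+ suc ℓ ℕ.+ j
  e ℓ j = cong (λ z → suc (z ℕ.+ j)) (sym (ℕ.+-suc ℓ ℓ))
  r = solve 1 (λ x → :1 :+ x := :0 :+ :1 :+ :1 :* (x :* :1)) refl

 -- Each term is at most x times the preceding one, so the sum e satisfies e ≤ 1 + x e.
 expSum-geometric : ∀ {x} → 0ℚ ≤ x → ∀ k → (1ℚ - x) * expSum x k ≤ 1ℚ
 expSum-geometric {x} 0≤x k = by (1ℚ + x * expSum x k - expSum x k) (sub≥0 (≤-trans (p≤p+q (expSum x k) (0≤T 0≤x k)) (step k))) (r x (expSum x k))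
  where
  r = solve 2 (λ x e → (:1 :- x) :* e :+ (:1 :+ x :* e :- e) := :1) refl
  step : ∀ k → expSum x (suc k) ≤ 1ℚ + x * expSum x k
  step k = begin
   expSum x (suc k) ≡⟨ ∑-head k (expTerm x) ⟩
   1ℚ + ∑< k (λ j → expTerm x (suc j)) ≤⟨ +-monoʳ-≤ 1ℚ (∑-mono k λ j → ≤≡ (*-monoˡ (0≤T 0≤x j) (*-monoˡ 0≤x (inv≤1 j))) (r₂ (expTerm x j) x)) ⟩
   1ℚ + ∑< k (λ j → x * expTerm x j) ≡⟨ cong (λ z → 1ℚ + z) (∑-* k x (expTerm x)) ⟩
   1ℚ + x * expSum x k ∎
   where
   r₂ = solve 2 (λ t x → t :* (x :* :1) := x :* t) refl

 pow*expSum≤1 : ∀ {x} → 0ℚ ≤ x → x ≤ 1ℚ → ∀ ℓ k → pow (1ℚ - x) ℓ * expSum (⌜ ℓ ⌝ * x) k ≤ 1ℚ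
 pow*expSum≤1 {x} 0≤x x≤1 zero zero = 0≤1
 pow*expSum≤1 {x} 0≤x x≤1 zero (suc k) = ≤-reflexive (trans (*-identityˡ _) (trans (cong (λ a → expSum a (suc k)) (*-zeroˡ x)) (expSum-0 k)))
 pow*expSum≤1 {x} 0≤x x≤1 (suc ℓ) k = begin
  (1ℚ - x) * q * expSum (⌜ suc ℓ ⌝ * x) k ≡⟨ cong ((1ℚ - x) * q *_) (trans (cong (λ a → expSum a k) (suc-* ℓ x)) (expSum-+ x a k)) ⟩
  (1ℚ - x) * q * ∑< k (cv (expTerm x) (expTerm a)) ≤⟨ *-monoˡ (0≤* 0≤1-x 0≤q) (by (excess (expTerm x) (expTerm a) k k) (0≤excess k (0≤T 0≤x) (0≤T 0≤a) k ℕ.≤-refl) (r₁ (∑< k (cv (expTerm x) (expTerm a))) (expSum x k * expSum a k))) ⟩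
  (1ℚ - x) * q * (expSum x k * expSum a k) ≡⟨ r₂ (1ℚ - x) q (expSum x k) (expSum a k) ⟩
  (1ℚ - x) * expSum x k * (q * expSum a k) ≤⟨ *-mono 0≤1 (0≤* 0≤q (0≤∑ k (0≤T 0≤a))) (expSum-geometric 0≤x k) (pow*expSum≤1 0≤x x≤1 ℓ k) ⟩
  1ℚ * 1ℚ ≡⟨ *-identityˡ 1ℚ ⟩
  1ℚ ∎
  where
  q = pow (1ℚ - x) ℓ
  a = ⌜ ℓ ⌝ * x
  0≤a : 0ℚ ≤ a
  0≤a = 0≤* (0≤⌜⌝ ℓ) 0≤x
  0≤1-x : 0ℚ ≤ 1ℚ - x
  0≤1-x = sub≥0 x≤1
  0≤q : 0ℚ ≤ q
  0≤q = 0≤pow 0≤1-x ℓ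
  r₁ = solve 2 (λ a b → a :+ (b :- a) := b) refl
  r₂ = solve 4 (λ a b c d → a :* b :* (c :* d) := a :* c :* (b :* d)) refl

 -- (1 - x)^ℓ ≤ e^(-ℓx) ≤ (1 + x)^(-ℓ), in terms of the approximants.
 exp-bounds : ∀ B ℓ ε → 0ℚ < ε → ∃ λ K → ∀ k → K ℕ.≤ k → ∀ x y → 0ℚ ≤ x → x ≤ 1ℚ → ⌜ ℓ ⌝ * x ≤ ⌜ B ⌝ → y * (1ℚ + x) ≡ 1ℚ → 0ℚ ≤ y →
  expSum (- (⌜ ℓ ⌝ * x)) k ≤ pow y ℓ + ε × pow (1ℚ - x) ℓ ≤ expSum (- (⌜ ℓ ⌝ * x)) k + ε
 exp-bounds B ℓ ε 0<ε = suc (ℓ ℕ.+ ℓ) ℕ.+ proj₁ C , main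
  where
  C = expSum-ℕ-cauchy (B ℕ.+ B) ε 0<ε
  main : ∀ k → suc (ℓ ℕ.+ ℓ) ℕ.+ proj₁ C ℕ.≤ k → ∀ x y → 0ℚ ≤ x → x ≤ 1ℚ → ⌜ ℓ ⌝ * x ≤ ⌜ B ⌝ → y * (1ℚ + x) ≡ 1ℚ → 0ℚ ≤ y →
   expSum (- (⌜ ℓ ⌝ * x)) k ≤ pow y ℓ + ε × pow (1ℚ - x) ℓ ≤ expSum (- (⌜ ℓ ⌝ * x)) k + ε
  main zero () x y 0≤x x≤1 aB yx 0≤y
  main (suc k) K≤k x y 0≤x x≤1 aB yx 0≤y = *-cancel-≤ 0<e⁺ upper , *-cancel-≤ 0<e⁺ lower
   where
   m = suc k
   a e⁺ e⁻ z : ℚ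
   a = ⌜ ℓ ⌝ * x
   e⁺ = expSum a m
   e⁻ = expSum (- a) m
   z = pow y ℓ
   0≤a : 0ℚ ≤ a
   0≤a = 0≤* (0≤⌜⌝ ℓ) 0≤x
   inverse′ : ∣ e⁺ * e⁻ - 1ℚ ∣ ≤ ε
   inverse′ = ≤-trans (expSum-inverse B a (∣≥0∣ 0≤a aB) k) (≤-trans (p≤∣p∣ _) (proj₂ C (m ℕ.+ m) m (ℕ.≤-trans (ℕ.m≤n+m (proj₁ C) (suc (ℓ ℕ.+ ℓ))) (ℕ.≤-trans K≤k (ℕ.m≤m+n m m))) (ℕ.≤-trans (ℕ.m≤n+m (proj₁ C) (suc (ℓ ℕ.+ ℓ))) K≤k)))
   grows : pow (1ℚ + x) ℓ ≤ e⁺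
   grows = subst (λ j → pow (1ℚ + x) ℓ ≤ expSum a j) (ℕ.m+[n∸m]≡n {suc (ℓ ℕ.+ ℓ)} (ℕ.≤-trans (ℕ.m≤m+n _ (proj₁ C)) K≤k)) (pow≤expSum 0≤x ℓ (m ℕ.∸ suc (ℓ ℕ.+ ℓ)))
   zp : z * pow (1ℚ + x) ℓ ≡ 1ℚ
   zp = trans (sym (pow-*-distrib y (1ℚ + x) ℓ)) (trans (cong (λ q → pow q ℓ) yx) (pow-1 ℓ))
    where
    pow-1 : ∀ n → pow 1ℚ n ≡ 1ℚ
    pow-1 zero = refl
    pow-1 (suc n) = trans (*-identityˡ (pow 1ℚ n)) (pow-1 n)
   1≤ze : 1ℚ ≤ z * e⁺
   1≤ze = ≡≤ (sym zp) (*-monoˡ (0≤pow 0≤y ℓ) grows)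
   1≤e⁺ : 1ℚ ≤ e⁺
   1≤e⁺ = ≡≤ (sym (+-identityˡ 1ℚ)) (∑-grow (0≤T 0≤a) {1} {m} (ℕ.s≤s ℕ.z≤n))
   0<e⁺ : 0ℚ < e⁺
   0<e⁺ = <-≤-trans (positive⁻¹ 1ℚ) 1≤e⁺
   upper : e⁺ * e⁻ ≤ e⁺ * (z + ε)
   upper = by ((1ℚ + ε - e⁺ * e⁻) + (z * e⁺ - 1ℚ) + ε * (e⁺ - 1ℚ)) (0≤+ (0≤+ (sub≥0 (close⁻ˡ {e⁺ * e⁻} {1ℚ} inverse′)) (sub≥0 1≤ze)) (0≤* (<⇒≤ 0<ε) (sub≥0 1≤e⁺))) (r e⁺ e⁻ ε z)
    where
    r = solve 4 (λ e f ε z → e :* f :+ ((:1 :+ ε :- e :* f) :+ (z :* e :- :1) :+ ε :* (e :- :1)) := e :* (z :+ ε)) refl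
   lower : e⁺ * pow (1ℚ - x) ℓ ≤ e⁺ * (e⁻ + ε)
   lower = by ((1ℚ - pow (1ℚ - x) ℓ * e⁺) + (e⁺ * e⁻ + ε - 1ℚ) + ε * (e⁺ - 1ℚ)) (0≤+ (0≤+ (sub≥0 (pow*expSum≤1 0≤x x≤1 ℓ m)) (sub≥0 (close⁻ʳ {e⁺ * e⁻} {1ℚ} inverse′))) (0≤* (<⇒≤ 0<ε) (sub≥0 1≤e⁺))) (r e⁺ e⁻ ε (pow (1ℚ - x) ℓ))
    where
    r = solve 4 (λ e f ε p → e :* p :+ ((:1 :- p :* e) :+ (e :* f :+ ε :- :1) :+ ε :* (e :- :1)) := e :* (f :+ ε)) refl

-- Rational approximants of roots and of π/√N

module RootBounds where
 open Rationals
 open LocalGrowth using (Near; near-abs; near-√; near-trans; near-sym; near-scale; near-weaken)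
 open ZetaSums using (inv; 0≤inv; inv≤1; ζ; ζ-close)
 open Basel using (L; basel; alt-close; odd≤inv; 0≤odd; odd-dec)
 open import Data.Rational.Properties
 open ≤-Reasoning

 module _ (d : ℕ) .{{_ : ℕ.NonZero d}} (n k : ℕ) where
  private
   ν : ℕ
   ν = rootNum d n k

   pow-1 : ∀ n → pow 1ℚ n ≡ 1ℚ
   pow-1 zero = refl
   pow-1 (suc n) = trans (*-identityˡ (pow 1ℚ n)) (pow-1 n)

   cancel : ⌜ n ℕ.* suc k ℕ.^ d ⌝ * pow (inv k) d ≡ ⌜ n ⌝
   cancel = begin-equality
    ⌜ n ℕ.* suc k ℕ.^ d ⌝ * pow (inv k) d ≡⟨ cong (_* pow (inv k) d) (trans (⌜*⌝ n (suc k ℕ.^ d)) (cong (⌜ n ⌝ *_) (⌜⌝-pow (suc k) d))) ⟩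
    ⌜ n ⌝ * pow ⌜ suc k ⌝ d * pow (inv k) d ≡⟨ *-assoc ⌜ n ⌝ (pow ⌜ suc k ⌝ d) (pow (inv k) d) ⟩
    ⌜ n ⌝ * (pow ⌜ suc k ⌝ d * pow (inv k) d) ≡⟨ cong (⌜ n ⌝ *_) (trans (sym (pow-*-distrib ⌜ suc k ⌝ (inv k) d)) (trans (cong (λ x → pow x d) (⌜*⌝-inv k)) (pow-1 d))) ⟩
    ⌜ n ⌝ * 1ℚ ≡⟨ *-identityʳ ⌜ n ⌝ ⟩
    ⌜ n ⌝ ∎

  0≤rootSeq : 0ℚ ≤ rootSeq d n k
  0≤rootSeq = 0≤* (0≤⌜⌝ ν) (0≤inv k)

  rootSeq-≤ : pow (rootSeq d n k) d ≤ ⌜ n ⌝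
  rootSeq-≤ = begin
   pow (⌜ ν ⌝ * inv k) d ≡⟨ trans (pow-*-distrib ⌜ ν ⌝ (inv k) d) (cong (_* pow (inv k) d) (sym (⌜⌝-pow ν d))) ⟩
   ⌜ ν ℕ.^ d ⌝ * pow (inv k) d ≤⟨ *-monoʳ (0≤pow (0≤inv k) d) (⌜⌝-mono (proj₁ (⌊root⌋-spec d (n ℕ.* suc k ℕ.^ d)))) ⟩
   ⌜ n ℕ.* suc k ℕ.^ d ⌝ * pow (inv k) d ≡⟨ cancel ⟩
   ⌜ n ⌝ ∎

  module _ .{{_ : ℕ.NonZero n}} where
   1≤rootSeq : 1ℚ ≤ rootSeq d n k
   1≤rootSeq = Positiveᴿ.bound≤ (root-positive d n) k ℕ.z≤n

   -- Rounding loses less than 1/(k+1), which is also a relative error because the approximant is at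
   -- least 1.
   rootSeq-≥ : ⌜ n ⌝ ≤ pow (rootSeq d n k) d * pow (1ℚ + inv k) d
   rootSeq-≥ = begin
    ⌜ n ⌝ ≡⟨ sym cancel ⟩
    ⌜ n ℕ.* suc k ℕ.^ d ⌝ * pow (inv k) d ≤⟨ *-monoʳ (0≤pow (0≤inv k) d) (⌜⌝-mono (ℕ.<⇒≤ (proj₂ (⌊root⌋-spec d (n ℕ.* suc k ℕ.^ d))))) ⟩
    ⌜ suc ν ℕ.^ d ⌝ * pow (inv k) d ≡⟨ trans (cong (_* pow (inv k) d) (⌜⌝-pow (suc ν) d)) (sym (pow-*-distrib ⌜ suc ν ⌝ (inv k) d)) ⟩
    pow (⌜ suc ν ⌝ * inv k) d ≤⟨ pow-mono (0≤* (0≤⌜⌝ (suc ν)) (0≤inv k)) step d ⟩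
    pow (rootSeq d n k * (1ℚ + inv k)) d ≡⟨ pow-*-distrib (rootSeq d n k) (1ℚ + inv k) d ⟩
    pow (rootSeq d n k) d * pow (1ℚ + inv k) d ∎
    where
    r = solve 2 (λ v i → (:1 :+ v) :* i :+ (v :* i :- :1) :* i := v :* i :* (:1 :+ i)) refl
    step : ⌜ suc ν ⌝ * inv k ≤ rootSeq d n k * (1ℚ + inv k)
    step = ≡≤ (cong (_* inv k) (⌜suc⌝ ν)) (by ((rootSeq d n k - 1ℚ) * inv k) (0≤* (sub≥0 1≤rootSeq) (0≤inv k)) (r ⌜ ν ⌝ (inv k)))

 ρ : (d n k : ℕ) → ℚ
 ρ = rootSeq

 -- For i = 1/(k+1) one has (1+i)² ≤ 1 + 3i, as i ≤ 1; likewise the 15 for fourth powers is 2⁴ - 1.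
 square-near : ∀ n k .{{_ : ℕ.NonZero n}} → ∣ ρ 2 n k * ρ 2 n k - ⌜ n ⌝ ∣ ≤ 3ℚ * inv k * (ρ 2 n k * ρ 2 n k)
 square-near n k = close {ρ 2 n k * ρ 2 n k} {⌜ n ⌝}
   (≡≤ (r₀ (ρ 2 n k)) (≤-trans (rootSeq-≤ 2 n k) (p≤p+q ⌜ n ⌝ (0≤* (0≤* 0≤3 (0≤inv k)) (0≤* 0≤ρ 0≤ρ)))))
   (≤-trans (rootSeq-≥ 2 n k) (by (inv k * (1ℚ - inv k) * (ρ 2 n k * ρ 2 n k)) (0≤* (0≤* (0≤inv k) (sub≥0 (inv≤1 k))) (0≤* 0≤ρ 0≤ρ)) (r (ρ 2 n k) (inv k))))
  where
  0≤ρ = 0≤rootSeq 2 n k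
  r₀ = solve 1 (λ x → x :* x := x :* (x :* :1)) refl
  r = solve 2 (λ x i → x :* (x :* :1) :* ((:1 :+ i) :* ((:1 :+ i) :* :1)) :+ i :* (:1 :- i) :* (x :* x) := x :* x :+ # 3 :* i :* (x :* x)) refl

 fourth-near : ∀ n k .{{_ : ℕ.NonZero n}} → ∣ ρ 4 n k * ρ 4 n k * (ρ 4 n k * ρ 4 n k) - ⌜ n ⌝ ∣ ≤ ⌜ 15 ⌝ * inv k * (ρ 4 n k * ρ 4 n k * (ρ 4 n k * ρ 4 n k))
 fourth-near n k = close {x⁴} {⌜ n ⌝}
   (≡≤ (r₀ x) (≤-trans (rootSeq-≤ 4 n k) (p≤p+q ⌜ n ⌝ (0≤* (0≤* (0≤⌜⌝ 15) 0≤i) 0≤x⁴))))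
   (≤-trans (rootSeq-≥ 4 n k) (by ((⌜ 11 ⌝ * (i * (1ℚ - i)) + ⌜ 5 ⌝ * (i * i * (1ℚ - i)) + i * i * i * (1ℚ - i)) * x⁴)
    (0≤* (0≤+ (0≤+ (0≤* (0≤⌜⌝ 11) (0≤* 0≤i 0≤1-i)) (0≤* (0≤⌜⌝ 5) (0≤* (0≤* 0≤i 0≤i) 0≤1-i))) (0≤* (0≤* (0≤* 0≤i 0≤i) 0≤i) 0≤1-i)) 0≤x⁴) (r x i)))
  where
  x i x⁴ : ℚ
  x = ρ 4 n k
  i = inv k
  x⁴ = x * x * (x * x)
  0≤i : 0ℚ ≤ i
  0≤i = 0≤inv k
  0≤1-i : 0ℚ ≤ 1ℚ - i
  0≤1-i = sub≥0 (inv≤1 k)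
  0≤x⁴ : 0ℚ ≤ x⁴
  0≤x⁴ = 0≤* (0≤sq x) (0≤sq x)
  r₀ = solve 1 (λ x → x :* x :* (x :* x) := x :* (x :* (x :* (x :* :1)))) refl
  r = solve 2 (λ x i → x :* (x :* (x :* (x :* :1))) :* ((:1 :+ i) :* ((:1 :+ i) :* ((:1 :+ i) :* ((:1 :+ i) :* :1)))) :+ (# 11 :* (i :* (:1 :- i)) :+ # 5 :* (i :* i :* (:1 :- i)) :+ i :* i :* i :* (:1 :- i)) :* (x :* x :* (x :* x)) := x :* x :* (x :* x) :+ # 15 :* i :* (x :* x :* (x :* x))) refl

 module _ {c q : ℚ} (0<c : 0ℚ < c) (c≤q : c ≤ q) where
  private
   c⊔q⁺ : Positive (c ⊔ q)
   c⊔q⁺ = positive (<-≤-trans 0<c (p≤p⊔q c q))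

  recip-inverse : q * recip c 0<c q ≡ 1ℚ
  recip-inverse = subst (λ z → z * recip c 0<c q ≡ 1ℚ) (p≤q⇒p⊔q≡q c≤q) (*-inverseʳ (c ⊔ q) {{pos⇒nonZero (c ⊔ q) {{c⊔q⁺}}}})

  0<recip : 0ℚ < recip c 0<c q
  0<recip = positive⁻¹ _ {{1/pos⇒pos (c ⊔ q) {{c⊔q⁺}}}}

  0≤recip : 0ℚ ≤ recip c 0<c q
  0≤recip = <⇒≤ 0<recip

 0<1 : 0ℚ < 1ℚ
 0<1 = positive⁻¹ 1ℚ

 module Root (n k : ℕ) .{{n≢0 : ℕ.NonZero n}} where
  r₂ R : ℚ
  r₂ = rootSeq 2 n k
  R = recip 1ℚ 0<1 r₂

  rR : r₂ * R ≡ 1ℚ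
  rR = recip-inverse 0<1 (1≤rootSeq 2 n k)

  0≤R : 0ℚ ≤ R
  0≤R = 0≤recip 0<1 (1≤rootSeq 2 n k)

  nRR : ∣ ⌜ n ⌝ * (R * R) - 1ℚ ∣ ≤ 3ℚ * inv k
  nRR = begin
   ∣ ⌜ n ⌝ * (R * R) - 1ℚ ∣ ≡⟨ cong ∣_∣ (trans (cong (λ x → ⌜ n ⌝ * (R * R) - x * x) (sym rR)) (r ⌜ n ⌝ R r₂)) ⟩
   ∣ R * R * (⌜ n ⌝ - r₂ * r₂) ∣ ≤⟨ ∣*∣ (0≤* 0≤R 0≤R) (≡≤ (∣p-q∣≡∣q-p∣ ⌜ n ⌝ (r₂ * r₂)) (square-near n k)) ⟩
   R * R * (3ℚ * inv k * (r₂ * r₂)) ≡⟨ trans (r′ R r₂ (inv k)) (cong (λ x → 3ℚ * inv k * (x * x)) rR) ⟩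
   3ℚ * inv k * (1ℚ * 1ℚ) ≡⟨ *-identityʳ (3ℚ * inv k) ⟩
   3ℚ * inv k ∎
   where
   r = solve 3 (λ n R x → n :* (R :* R) :- x :* R :* (x :* R) := R :* R :* (n :- x :* x)) refl
   r′ = solve 3 (λ R x i → R :* R :* (# 3 :* i :* (x :* x)) := # 3 :* i :* (x :* R :* (x :* R))) refl

 L-range : ∀ k → 0ℚ ≤ L (suc k) × L (suc k) ≤ 2ℚ × ½ ≤ L (suc k)
 L-range k = ≤-trans 0≤½ low , ≤-trans (close⁻ˡ {L (suc k)} {L 1} h) (≤-trans (+-monoʳ-≤ (L 1) (≤-trans (odd≤inv 1) (inv≤1 1))) ≤-refl) , low
  where
  h : ∣ L (suc k) - L 1 ∣ ≤ odd⁻¹ 1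
  h = alt-close 0≤odd odd-dec k 1
  r = solve 2 (λ l o → :½ :+ ((l :+ o :- (:0 :+ :1 :* :1)) :+ (:½ :- o)) := l) refl
  low : ½ ≤ L (suc k)
  low = by ((L (suc k) + odd⁻¹ 1 - L 1) + (½ - odd⁻¹ 1)) (0≤+ (sub≥0 (close⁻ʳ {L (suc k)} {L 1} h)) (sub≥0 (odd≤inv 1))) (r (L (suc k)) (odd⁻¹ 1))

 -- The k-th approximant of π/√N, a rational that can serve as the frequency θ.
 Θ : (N k : ℕ) → ℚ
 Θ N k = seq π k * recip 1ℚ 0<1 (rootSeq 2 N k)

 0≤Θ : ∀ N k .{{_ : ℕ.NonZero N}} → 0ℚ ≤ Θ N (suc k)
 0≤Θ N k = 0≤* (0≤* 0≤4 (proj₁ (L-range k))) (Root.0≤R N (suc k))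

 6N≢0 : ∀ N → .{{ℕ.NonZero N}} → ℕ.NonZero (6 ℕ.* N)
 6N≢0 N = ℕ.m*n≢0 6 N

 -- π²/6 = ζ(2)
 Θ-near : ∀ N .{{_ : ℕ.NonZero N}} ε → 0ℚ < ε → ∃ λ K → ∀ k → K ℕ.≤ k →
  ∣ ⌜ N ⌝ * (Θ (6 ℕ.* N) k * Θ (6 ℕ.* N) k) - ζ N ∣ ≤ inv (ℕ.pred N) + ε
 Θ-near N ε 0<ε = 2 ℕ.+ proj₁ S₁ ℕ.+ N , main
  where
  S₁ = small ⌜ 60 ⌝ 0<ε
  main : ∀ k → 2 ℕ.+ proj₁ S₁ ℕ.+ N ℕ.≤ k → ∣ ⌜ N ⌝ * (Θ (6 ℕ.* N) k * Θ (6 ℕ.* N) k) - ζ N ∣ ≤ inv (ℕ.pred N) + ε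
  main (suc zero) (ℕ.s≤s ())
  main (suc (suc k)) (ℕ.s≤s (ℕ.s≤s K≤k)) = begin
   ∣ ⌜ N ⌝ * (4ℚ * l * R * (4ℚ * l * R)) - ζ N ∣ ≡⟨ cong ∣_∣ (r₁ ⌜ N ⌝ l R (ζ N) (ζ (suc j)) third third≡) ⟩
   ∣ 8ℚ * (l * l) * third * (6ℚ * ⌜ N ⌝ * (R * R) - 1ℚ) + third * (8ℚ * (l * l) - 3ℚ * ζ (suc j)) + (ζ (suc j) - ζ N) ∣
    ≤⟨ ∣+∣ {8ℚ * (l * l) * third * (6ℚ * ⌜ N ⌝ * (R * R) - 1ℚ) + third * (8ℚ * (l * l) - 3ℚ * ζ (suc j))}
       (∣+∣ {8ℚ * (l * l) * third * (6ℚ * ⌜ N ⌝ * (R * R) - 1ℚ)} (∣*∣ 0≤c (subst (λ x → ∣ x * (R * R) - 1ℚ ∣ ≤ 3ℚ * inv (suc (suc k))) (⌜*⌝ 6 N) (Root.nRR (6 ℕ.* N) (suc (suc k)) {{6N≢0 N}}))) (∣*∣ 0≤third (basel j (suc k) (ℕ.n≤1+n k))))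
       (ζ-close {ℕ.pred N} (ℕ.≤-trans (suc-pred≤ N) (ℕ.m≤n⇒m≤1+n N≤j)) (suc-pred≤ N)) ⟩
   8ℚ * (l * l) * third * (3ℚ * inv (suc (suc k))) + third * (⌜ 45 ⌝ * inv j) + inv (ℕ.pred N)
    ≤⟨ +-monoˡ-≤ (inv (ℕ.pred N)) (+-monoˡ-≤ (third * (⌜ 45 ⌝ * inv j)) (*-mono {q = 8ℚ * (2ℚ * 2ℚ) * third} (0≤* (0≤⌜⌝ 32) 0≤third) (0≤* 0≤3 (0≤inv (suc (suc k))))
       (*-monoʳ 0≤third (*-monoˡ 0≤8 (*-mono 0≤2 0≤l l≤2 l≤2))) (*-monoˡ 0≤3 (inv-antitone (ℕ.≤-trans (ℕ.n≤1+n k) (ℕ.n≤1+n (suc k))))))) ⟩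
   8ℚ * (2ℚ * 2ℚ) * third * (3ℚ * inv j) + third * (⌜ 45 ⌝ * inv j) + inv (ℕ.pred N)
    ≤⟨ by (⌜ 13 ⌝ * inv j + (ε - ⌜ 60 ⌝ * inv j)) (0≤+ (0≤* (0≤⌜⌝ 13) (0≤inv j)) (sub≥0 (proj₂ S₁ j (ℕ.≤-trans (ℕ.m≤m+n (proj₁ S₁) N) K≤k)))) (trans (r₂ third (inv j) (inv (ℕ.pred N)) ε) (trans (cong (λ x → x * inv j * ⌜ 47 ⌝ + (ε - ⌜ 47 ⌝ * inv j) + inv (ℕ.pred N)) third≡) (r₃ (inv j) ε (inv (ℕ.pred N))))) ⟩
   inv (ℕ.pred N) + ε ∎
   where
   j = k
   l R third : ℚ
   l = L (suc (suc k))
   R = recip 1ℚ 0<1 (rootSeq 2 (6 ℕ.* N) (suc (suc k)))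
   third = inv 2
   third≡ : 3ℚ * third ≡ 1ℚ
   third≡ = ⌜*⌝-inv 2
   0≤third : 0ℚ ≤ third
   0≤third = 0≤inv 2
   0≤l : 0ℚ ≤ l
   0≤l = proj₁ (L-range (suc k))
   l≤2 : l ≤ 2ℚ
   l≤2 = proj₁ (proj₂ (L-range (suc k)))
   0≤c : 0ℚ ≤ 8ℚ * (l * l) * third
   0≤c = 0≤* (0≤* 0≤8 (0≤* 0≤l 0≤l)) 0≤third
   N≤j : N ℕ.≤ j
   N≤j = ℕ.≤-trans (ℕ.m≤n+m N (proj₁ S₁)) K≤k
   suc-pred≤ : ∀ N .{{_ : ℕ.NonZero N}} → suc (ℕ.pred N) ℕ.≤ N
   suc-pred≤ N = ℕ.≤-reflexive (ℕ.suc-pred N)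
   r₁ : ∀ n l R z y h → 3ℚ * h ≡ 1ℚ → n * (4ℚ * l * R * (4ℚ * l * R)) - z ≡ 8ℚ * (l * l) * h * (6ℚ * n * (R * R) - 1ℚ) + h * (8ℚ * (l * l) - 3ℚ * y) + (y - z)
   r₁ n l R z y h e = trans (s₁ n l R z y) (trans (cong (λ x → x * (⌜ 16 ⌝ * n * (l * l) * (R * R)) + (y - x * y) - z) (sym e)) (s₂ n l R z y h))
    where
    s₁ = solve 5 (λ n l R z y → n :* (# 4 :* l :* R :* (# 4 :* l :* R)) :- z := :1 :* (# 16 :* n :* (l :* l) :* (R :* R)) :+ (y :- :1 :* y) :- z) refl
    s₂ = solve 6 (λ n l R z y h → # 3 :* h :* (# 16 :* n :* (l :* l) :* (R :* R)) :+ (y :- # 3 :* h :* y) :- z := # 8 :* (l :* l) :* h :* (# 6 :* n :* (R :* R) :- :1) :+ h :* (# 8 :* (l :* l) :- # 3 :* y) :+ (y :- z)) refl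
   r₂ = solve 4 (λ h i p ε → # 8 :* (# 2 :* # 2) :* h :* (# 3 :* i) :+ h :* (# 45 :* i) :+ p :+ (# 13 :* i :+ (ε :- # 60 :* i)) := # 3 :* h :* i :* # 47 :+ (ε :- # 47 :* i) :+ p) refl
   r₃ = solve 3 (λ i ε p → :1 :* i :* # 47 :+ (ε :- # 47 :* i) :+ p := p :+ ε) refl

 24N≢0 : ∀ N → .{{ℕ.NonZero N}} → ℕ.NonZero (24 ℕ.* N)
 24N≢0 N = ℕ.m*n≢0 24 N

 module _ (N k : ℕ) .{{N≢0 : ℕ.NonZero N}} where
  private
   i r₆ r₂₄ r₄ : ℚ
   i = inv k
   r₆ = rootSeq 2 (6 ℕ.* N) k
   r₂₄ = rootSeq 2 (24 ℕ.* N) k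
   r₄ = rootSeq 4 (24 ℕ.* N) k

   0≤i : 0ℚ ≤ i
   0≤i = 0≤inv k
   0≤r₆ : 0ℚ ≤ r₆
   0≤r₆ = 0≤rootSeq 2 (6 ℕ.* N) k
   0≤r₂₄ : 0ℚ ≤ r₂₄
   0≤r₂₄ = 0≤rootSeq 2 (24 ℕ.* N) k
   0≤r₄ : 0ℚ ≤ r₄
   0≤r₄ = 0≤rootSeq 4 (24 ℕ.* N) k
   0≤2r₆ : 0ℚ ≤ 2ℚ * r₆
   0≤2r₆ = 0≤* 0≤2 0≤r₆
   0≤24N : 0ℚ ≤ ⌜ 24 ℕ.* N ⌝
   0≤24N = 0≤⌜⌝ (24 ℕ.* N)
   0≤3i : 0ℚ ≤ 3ℚ * i
   0≤3i = 0≤* 0≤3 0≤i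
   0≤15i : 0ℚ ≤ ⌜ 15 ⌝ * i
   0≤15i = 0≤* (0≤⌜⌝ 15) 0≤i

   scaled₆ : Near (3ℚ * i) (2ℚ * r₆ * (2ℚ * r₆)) ⌜ 24 ℕ.* N ⌝
   scaled₆ = subst₂ (Near (3ℚ * i)) (r r₆) (trans (sym (⌜*⌝ 4 (6 ℕ.* N))) (cong ⌜_⌝ (sym (ℕ.*-assoc 4 6 N))))
    (near-scale 0≤4 0≤3i (0≤* 0≤r₆ 0≤r₆) (0≤⌜⌝ (6 ℕ.* N)) (near-abs 0≤3i (0≤* 0≤r₆ 0≤r₆) (0≤⌜⌝ (6 ℕ.* N)) (square-near (6 ℕ.* N) k {{6N≢0 N}})))
    where
    r = solve 1 (λ x → # 4 :* (x :* x) := # 2 :* x :* (# 2 :* x)) refl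

  root₂₄-near : Near (⌜ 18 ⌝ * inv k) (2ℚ * rootSeq 2 (6 ℕ.* N) k) (rootSeq 2 (24 ℕ.* N) k)
  root₂₄-near = near-weaken (by (⌜ 12 ⌝ * i) (0≤* (0≤⌜⌝ 12) 0≤i) (r i)) 0≤2r₆ 0≤r₂₄ (near-√ (0≤+ 0≤3i 0≤3i) 0≤2r₆ 0≤r₂₄
   (near-trans 0≤3i 0≤3i (0≤* 0≤2r₆ 0≤2r₆) (0≤* 0≤r₂₄ 0≤r₂₄) scaled₆ (near-sym (near-abs 0≤3i (0≤* 0≤r₂₄ 0≤r₂₄) 0≤24N (square-near (24 ℕ.* N) k {{24N≢0 N}})))))
   where
   r = solve 1 (λ i → # 3 :* i :+ # 3 :* i :+ # 12 :* i := # 18 :* i) refl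

  root₄-near : Near (⌜ 18 ⌝ * inv k) (2ℚ * rootSeq 2 (6 ℕ.* N) k) (rootSeq 4 (24 ℕ.* N) k * rootSeq 4 (24 ℕ.* N) k)
  root₄-near = subst (λ κ → Near κ (2ℚ * r₆) (r₄ * r₄)) (r i) (near-√ (0≤+ 0≤3i 0≤15i) 0≤2r₆ 0≤r₄²
   (near-trans 0≤3i 0≤15i (0≤* 0≤2r₆ 0≤2r₆) (0≤* 0≤r₄² 0≤r₄²) scaled₆ (near-sym (near-abs 0≤15i (0≤* 0≤r₄² 0≤r₄²) 0≤24N (fourth-near (24 ℕ.* N) k {{24N≢0 N}})))))
   where
   0≤r₄² : 0ℚ ≤ r₄ * r₄
   0≤r₄² = 0≤* 0≤r₄ 0≤r₄
   r = solve 1 (λ i → # 3 :* i :+ # 15 :* i := # 18 :* i) refl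

-- Choice of w and τ for a given N

module ScaleChoice where
 open Rationals
 open ZetaSums using (inv; 0≤inv; ζ)
 open Scales using (w²; w⁴; w⁸)
 open RootBounds
 open import Data.Rational.Properties

 -- Bernoulli's inequality for (1 - 1/(m+1))^j
 bernoulli-ℕ : ∀ m j → suc m ℕ.^ j ℕ.* suc m ℕ.≤ m ℕ.^ j ℕ.* suc m ℕ.+ j ℕ.* suc m ℕ.^ j
 bernoulli-ℕ m zero = ℕ.m≤m+n (1 ℕ.* suc m) 0
 bernoulli-ℕ m (suc j) = begin
  suc m ℕ.* q ℕ.* suc m ≡⟨ ℕ.*-assoc (suc m) q (suc m) ⟩
  suc m ℕ.* (q ℕ.* suc m) ≤⟨ ℕ.*-monoʳ-≤ (suc m) (bernoulli-ℕ m j) ⟩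
  suc m ℕ.* (p′ ℕ.* suc m ℕ.+ j ℕ.* q) ≡⟨ e₁ m p′ j q ⟩
  m ℕ.* p′ ℕ.* suc m ℕ.+ (p′ ℕ.* suc m ℕ.+ j ℕ.* (suc m ℕ.* q)) ≤⟨ ℕ.+-monoʳ-≤ (m ℕ.* p′ ℕ.* suc m) (ℕ.+-monoˡ-≤ (j ℕ.* (suc m ℕ.* q)) (ℕ≤≡ (ℕ.*-monoˡ-≤ (suc m) (ℕ.^-monoˡ-≤ j (ℕ.n≤1+n m))) (ℕ.*-comm q (suc m)))) ⟩
  m ℕ.* p′ ℕ.* suc m ℕ.+ (suc m ℕ.* q ℕ.+ j ℕ.* (suc m ℕ.* q)) ∎
  where
  open ℕ.≤-Reasoning
  q = suc m ℕ.^ j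
  p′ = m ℕ.^ j
  e₁ : ∀ m p j q → suc m ℕ.* (p ℕ.* suc m ℕ.+ j ℕ.* q) ≡ m ℕ.* p ℕ.* suc m ℕ.+ (p ℕ.* suc m ℕ.+ j ℕ.* (suc m ℕ.* q))
  e₁ = ℕ-Ring.solve-∀

 -- For j = 32 the hypothesis reads m ≥ 63. This is the origin of 63, and it keeps N between w⁸ and
 -- 2w⁸ although τ is rounded down.
 double : ∀ m j → j ℕ.+ j ℕ.≤ suc m → suc m ℕ.^ j ℕ.≤ 2 ℕ.* m ℕ.^ j
 double m j h = ℕ.*-cancelʳ-≤ q (2 ℕ.* p′) (suc m) (ℕ.+-cancelʳ-≤ (q ℕ.* suc m) (q ℕ.* suc m) (2 ℕ.* p′ ℕ.* suc m) (begin
  q ℕ.* suc m ℕ.+ q ℕ.* suc m ≤⟨ ℕ.+-mono-≤ (bernoulli-ℕ m j) (bernoulli-ℕ m j) ⟩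
  (p′ ℕ.* suc m ℕ.+ j ℕ.* q) ℕ.+ (p′ ℕ.* suc m ℕ.+ j ℕ.* q) ≡⟨ e p′ (suc m) j q ⟩
  2 ℕ.* p′ ℕ.* suc m ℕ.+ q ℕ.* (j ℕ.+ j) ≤⟨ ℕ.+-monoʳ-≤ (2 ℕ.* p′ ℕ.* suc m) (ℕ.*-monoʳ-≤ q h) ⟩
  2 ℕ.* p′ ℕ.* suc m ℕ.+ q ℕ.* suc m ∎))
  where
  open ℕ.≤-Reasoning
  q = suc m ℕ.^ j
  p′ = m ℕ.^ j
  e : ∀ p s j q → (p ℕ.* s ℕ.+ j ℕ.* q) ℕ.+ (p ℕ.* s ℕ.+ j ℕ.* q) ≡ 2 ℕ.* p ℕ.* s ℕ.+ q ℕ.* (j ℕ.+ j)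
  e = ℕ-Ring.solve-∀

 record Scaled (N : ℕ) : Set where
  field
   τ w : ℕ
   w≡ : w ≡ w⁴ τ
   200≤w : 200 ℕ.≤ w
   N≥ : w⁸ w ℕ.≤ N
   N≤ : N ℕ.≤ 2 ℕ.* w⁸ w

 ^≡w⁴ : ∀ x → x ℕ.^ 4 ≡ w⁴ x
 ^≡w⁴ = e
  where
  e : ∀ x → x ℕ.* (x ℕ.* (x ℕ.* (x ℕ.* 1))) ≡ x ℕ.* x ℕ.* (x ℕ.* x)
  e = ℕ-Ring.solve-∀

 w³² : ∀ x → w⁸ (w⁴ x) ≡ ((x ℕ.^ 4) ℕ.^ 4) ℕ.^ 2
 w³² x = sym (trans (e ((x ℕ.^ 4) ℕ.^ 4)) (cong (λ y → y ℕ.* y) (trans (^≡w⁴ (x ℕ.^ 4)) (cong w⁴ (^≡w⁴ x)))))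
  where
  e : ∀ x → x ℕ.^ 2 ≡ x ℕ.* x
  e x = cong (x ℕ.*_) (ℕ.*-identityʳ x)

 -- The exponent is a variable so that powers with exponent 32 are not unfolded.
 scaled-at : ∀ d .{{_ : ℕ.NonZero d}} → (∀ x → w⁸ (w⁴ x) ≡ x ℕ.^ d) → d ℕ.+ d ℕ.≤ 64 → ∀ N T → 63 ℕ.≤ T → T ℕ.^ d ℕ.≤ N → ∃ λ (S : Scaled N) → T ℕ.≤ Scaled.τ S
 scaled-at d w^ d+d≤ N T 63≤T h = go (⌊root⌋ d N) (⌊root⌋-spec d N)
  where
  go : ∀ τ → τ ℕ.^ d ℕ.≤ N × N ℕ.< suc τ ℕ.^ d → ∃ λ (S : Scaled N) → T ℕ.≤ Scaled.τ S
  go τ (lo , hi) = record { τ = τ ; w = w⁴ τ ; w≡ = refl ; 200≤w = 200≤ ; N≥ = ℕ≡≤ (w^ τ) lo ; N≤ = ℕ.≤-trans (ℕ.<⇒≤ hi) (ℕ≤≡ (double τ d (ℕ.≤-trans d+d≤ (ℕ.s≤s 63≤τ))) (cong (2 ℕ.*_) (sym (w^ τ)))) } , T≤τ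
   where
   T≤τ : T ℕ.≤ τ
   T≤τ = ℕ.≮⇒≥ λ lt → ℕ.<-irrefl refl (ℕ.<-≤-trans hi (ℕ.≤-trans (ℕ.^-monoˡ-≤ d lt) h))
   63≤τ : 63 ℕ.≤ τ
   63≤τ = ℕ.≤-trans 63≤T T≤τ
   200≤ : 200 ℕ.≤ w⁴ τ
   200≤ = ℕ.≤-trans (ℕ.≤ᵇ⇒≤ 200 (63 ℕ.* 63 ℕ.* (63 ℕ.* 63)) tt) (ℕ.*-mono-≤ (ℕ.*-mono-≤ 63≤τ 63≤τ) (ℕ.*-mono-≤ 63≤τ 63≤τ))

 scaled : ∀ N T → 63 ℕ.≤ T → T ℕ.^ (4 ℕ.* 4 ℕ.* 2) ℕ.≤ N → ∃ λ (S : Scaled N) → T ℕ.≤ Scaled.τ S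
 scaled = scaled-at (4 ℕ.* 4 ℕ.* 2) (λ x → trans (w³² x) (trans (cong (ℕ._^ 2) (ℕ.^-*-assoc x 4 4)) (ℕ.^-*-assoc x (4 ℕ.* 4) 2))) ℕ.≤-refl

 module _ (N : ℕ) .{{N≢0 : ℕ.NonZero N}} (S : Scaled N) where
  open Scaled S
  open ≤-Reasoning

  private
   ν i : ℚ
   ν = inv (ℕ.pred N)
   i = inv (ℕ.pred w) * inv (ℕ.pred w)

   2ν≤i : ν + ν ≤ i
   2ν≤i = begin
    ν + ν ≡⟨ r₀ ν ⟩
    1ℚ * 1ℚ * (2ℚ * ν) ≡⟨ cong (λ x → x * x * (2ℚ * ν)) (sym (inv≡ w 200≤w)) ⟩
    ⌜ w ⌝ * ι * (⌜ w ⌝ * ι) * (2ℚ * ν) ≡⟨ r₁ ⌜ w ⌝ ι ν ⟩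
    i * (2ℚ * (⌜ w ⌝ * ⌜ w ⌝) * ν) ≤⟨ *-monoˡ (0≤* (0≤inv (ℕ.pred w)) (0≤inv (ℕ.pred w))) (*-monoʳ (0≤inv (ℕ.pred N)) (≡≤ (trans (cong (2ℚ *_) (sym (⌜*⌝ w w))) (sym (⌜*⌝ 2 (w² w)))) (⌜⌝-mono 2w²≤N))) ⟩
    i * (⌜ N ⌝ * ν) ≡⟨ trans (cong (i *_) (trans (cong (λ n → ⌜ n ⌝ * ν) (sym (ℕ.suc-pred N))) (⌜*⌝-inv (ℕ.pred N)))) (*-identityʳ i) ⟩
    i ∎
    where
    ι = inv (ℕ.pred w)
    r₀ = solve 1 (λ v → v :+ v := :1 :* :1 :* (# 2 :* v)) refl
    r₁ = solve 3 (λ w i v → w :* i :* (w :* i) :* (# 2 :* v) := i :* i :* (# 2 :* (w :* w) :* v)) refl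
    inv≡ : ∀ w → 200 ℕ.≤ w → ⌜ w ⌝ * inv (ℕ.pred w) ≡ 1ℚ
    inv≡ (suc w) _ = ⌜*⌝-inv w
    1≤w : 1 ℕ.≤ w
    1≤w = ℕ.≤-trans (ℕ.≤ᵇ⇒≤ 1 200 tt) 200≤w
    1≤w² : 1 ℕ.≤ w² w
    1≤w² = ℕ.*-mono-≤ 1≤w 1≤w
    2≤w² : 2 ℕ.≤ w² w
    2≤w² = ℕ.≤-trans (ℕ.≤ᵇ⇒≤ 2 (200 ℕ.* 1) tt) (ℕ.*-mono-≤ 200≤w 1≤w)
    2w²≤N : 2 ℕ.* w² w ℕ.≤ N
    2w²≤N = ℕ.≤-trans (ℕ.*-monoˡ-≤ (w² w) 2≤w²) (ℕ.≤-trans (ℕ≡≤ (sym (ℕ.*-identityʳ (w⁴ w))) (ℕ.*-monoʳ-≤ (w⁴ w) (ℕ.*-mono-≤ 1≤w² 1≤w²))) N≥)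

  -- `Θ-near` is used with ε = 1/N, and 2/N is below w^(-2).
  scale-onset : ∃ λ K → ∀ k → K ℕ.≤ k → ∣ ⌜ N ⌝ * (Θ (6 ℕ.* N) k * Θ (6 ℕ.* N) k) - ζ N ∣ ≤ i
  scale-onset = proj₁ A , λ k h → ≤-trans (proj₂ A k h) 2ν≤i
   where A = Θ-near N ν (0<inv (ℕ.pred N))

-- The rank estimate with the exponential in place of the power

module RankEstimate where
 open QSeries using (t; module Compositions)
 open Rationals
 open LocalGrowth using (p̂; 0≤p̂)
 open ZetaSums using (inv; inv≤1; ζ)
 open Scales using (w⁶; Setting; module Setting)
 open UniformRank
 open ExpBounds using (exp-bounds)
 open RootBounds
 open ScaleChoice
 open import Data.Rational.Properties
 open ≤-Reasoning

 bernoulli : ∀ {u} → 0ℚ ≤ u → u ≤ 1ℚ → ∀ n → 1ℚ - ⌜ n ⌝ * u ≤ pow (1ℚ - u) n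
 bernoulli {u} 0≤u u≤1 zero = ≤-reflexive (r u)
  where
  r = solve 1 (λ u → :1 :- :0 :* u := :1) refl
 bernoulli {u} 0≤u u≤1 (suc n) = begin
  1ℚ - ⌜ suc n ⌝ * u ≡⟨ cong (λ x → 1ℚ - x * u) (⌜suc⌝ n) ⟩
  1ℚ - (1ℚ + ⌜ n ⌝) * u ≤⟨ by (⌜ n ⌝ * (u * u)) (0≤* (0≤⌜⌝ n) (0≤* 0≤u 0≤u)) (r ⌜ n ⌝ u) ⟩
  (1ℚ - u) * (1ℚ - ⌜ n ⌝ * u) ≤⟨ *-monoˡ (sub≥0 u≤1) (bernoulli 0≤u u≤1 n) ⟩
  (1ℚ - u) * pow (1ℚ - u) n ∎
  where
  r = solve 2 (λ n u → :1 :- (:1 :+ n) :* u :+ n :* (u :* u) := (:1 :- u) :* (:1 :- n :* u)) refl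

 -- y^ℓ - (1-θ)^ℓ = y^ℓ (1 - (1-θ²)^ℓ) ≤ θ · ℓθ y^ℓ
 geometric-gap : ∀ {θ y} → 0ℚ ≤ θ → θ ≤ 1ℚ → y * (1ℚ + θ) ≡ 1ℚ → 0ℚ ≤ y → ∀ ℓ → pow y ℓ ≤ pow (1ℚ - θ) ℓ + θ
 geometric-gap {θ} {y} 0≤θ θ≤1 yθ 0≤y ℓ = begin
  z ≤⟨ by (z * (u - (1ℚ - ⌜ ℓ ⌝ * (θ * θ))) + θ * (1ℚ - z * (1ℚ + ⌜ ℓ ⌝ * θ)) + θ * z)
                            (0≤+ (0≤+ (0≤* 0≤z (sub≥0 (bernoulli (0≤* 0≤θ 0≤θ) θθ≤1 ℓ))) (0≤* 0≤θ (sub≥0 (pow-upper 0≤θ yθ 0≤y ℓ)))) (0≤* 0≤θ 0≤z)) (r z u θ ⌜ ℓ ⌝) ⟩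
  z * u + θ ≡⟨ cong (_+ θ) (trans (sym (pow-*-distrib y (1ℚ - θ * θ) ℓ)) (cong (λ x → pow x ℓ) (trans (r₂ y θ) (trans (cong (_* (1ℚ - θ)) yθ) (*-identityˡ (1ℚ - θ)))))) ⟩
  pow (1ℚ - θ) ℓ + θ ∎
  where
  z = pow y ℓ
  u = pow (1ℚ - θ * θ) ℓ
  0≤z : 0ℚ ≤ z
  0≤z = 0≤pow 0≤y ℓ
  θθ≤1 : θ * θ ≤ 1ℚ
  θθ≤1 = ≤≡ (*-mono 0≤1 0≤θ θ≤1 θ≤1) (*-identityˡ 1ℚ)
  r = solve 4 (λ z u θ l → z :+ (z :* (u :- (:1 :- l :* (θ :* θ))) :+ θ :* (:1 :- z :* (:1 :+ l :* θ)) :+ θ :* z) := z :* u :+ θ) refl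
  r₂ = solve 2 (λ y θ → y :* (:1 :- θ :* θ) := y :* (:1 :+ θ) :* (:1 :- θ)) refl

 -- The difference of the two expressions factors as (x - z)((1 + x + z) V - p). Its constant is 27
 -- = 3 (4 · 2 + 1).
 transfer : ∀ x z V p ι e → ∣ x - z ∣ ≤ 3ℚ * ι → 0ℚ ≤ ι → 0ℚ ≤ z → z ≤ 1ℚ → - ½ ≤ x → x ≤ 2ℚ → 0ℚ ≤ V → V ≤ 2ℚ * p → 0ℚ ≤ p →
  ∣ (1ℚ + z + z * z) * V - (1ℚ + z) * p ∣ ≤ e → ∣ (1ℚ + x + x * x) * V - (1ℚ + x) * p ∣ ≤ e + ⌜ 27 ⌝ * ι * p
 transfer x z V p ι e h 0≤ι 0≤z z≤1 -½≤x x≤2 0≤V V≤ 0≤p h′ = begin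
  ∣ (1ℚ + x + x * x) * V - (1ℚ + x) * p ∣ ≡⟨ cong ∣_∣ (r₁ x z V p) ⟩
  ∣ ((1ℚ + z + z * z) * V - (1ℚ + z) * p) + (x - z) * ((1ℚ + x + z) * V - p) ∣ ≤⟨ ∣+∣ {(1ℚ + z + z * z) * V - (1ℚ + z) * p} h′ second ⟩
  e + ⌜ 27 ⌝ * ι * p ∎
  where
  r₁ = solve 4 (λ x z V p → (:1 :+ x :+ x :* x) :* V :- (:1 :+ x) :* p := ((:1 :+ z :+ z :* z) :* V :- (:1 :+ z) :* p) :+ (x :- z) :* ((:1 :+ x :+ z) :* V :- p)) refl
  r₂ = solve 2 (λ x z → :0 :+ ((x :- :- :½) :+ z :+ :½) := :1 :+ x :+ z) refl
  r₃ = solve 2 (λ i p → # 3 :* i :* (# 4 :* (# 2 :* p) :+ p) := # 27 :* i :* p) refl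
  0≤s : 0ℚ ≤ 1ℚ + x + z
  0≤s = by ((x - - ½) + z + ½) (0≤+ (0≤+ (sub≥0 -½≤x) 0≤z) 0≤½) (r₂ x z)
  s≤4 : 1ℚ + x + z ≤ 4ℚ
  s≤4 = +-mono-≤ (+-monoʳ-≤ 1ℚ x≤2) z≤1
  inner : ∣ (1ℚ + x + z) * V - p ∣ ≤ 4ℚ * (2ℚ * p) + p
  inner = ∣-∣ {(1ℚ + x + z) * V} (∣≥0∣ (0≤* 0≤s 0≤V) (*-mono 0≤4 0≤V s≤4 V≤)) (∣≥0∣ 0≤p ≤-refl)
  second : ∣ (x - z) * ((1ℚ + x + z) * V - p) ∣ ≤ ⌜ 27 ⌝ * ι * p
  second = ≡≤ (∣p*q∣≡∣p∣*∣q∣ (x - z) ((1ℚ + x + z) * V - p)) (≤≡ (*-mono (0≤* 0≤3 0≤ι) (0≤∣p∣ ((1ℚ + x + z) * V - p)) h inner) (r₃ ι p))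

 module Bound (set : Setting) (ℓ : ℕ) where
  open Setting set
  module Co = Core set
  open Co using (ω; ι; 0≤ι; ωι; θ≤1; θ≤2Y; Y≤i) public

  Vℓ z : ℚ
  Vℓ = ⌜ Compositions.a (t (suc ℓ) ℕ.+ N) ℓ ⌝
  z = pow y ℓ

  0≤z : 0ℚ ≤ z
  0≤z = 0≤pow 0≤y ℓ

  z≤1 : z ≤ 1ℚ
  z≤1 = pow≤1 0≤y (y≤1 0≤θ yθ 0≤y) ℓ

  θ≤2ι : θ ≤ 2ℚ * ι
  θ≤2ι = ≤-trans θ≤2Y (*-monoˡ 0≤2 (≤-trans Y≤i (≤≡ (*-monoˡ 0≤ι (inv≤1 (ℕ.pred w))) (*-identityʳ ι))))

  module _ {x : ℚ} (x-below : x ≤ z + ι) (x-above : pow (1ℚ - θ) ℓ ≤ x + ι) where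
   x-z : ∣ x - z ∣ ≤ 3ℚ * ι
   x-z = close {x} {z} (≤-trans x-below (by (2ℚ * ι) (0≤* 0≤2 0≤ι) (r₁ z ι)))
     (by ((p′ + θ - z) + (x + ι - p′) + (2ℚ * ι - θ)) (0≤+ (0≤+ (sub≥0 (geometric-gap 0≤θ θ≤1 yθ 0≤y ℓ)) (sub≥0 x-above)) (sub≥0 θ≤2ι)) (r₂ z p′ θ x ι))
    where
    p′ = pow (1ℚ - θ) ℓ
    r₁ = solve 2 (λ z i → z :+ i :+ # 2 :* i := z :+ # 3 :* i) refl
    r₂ = solve 5 (λ z p θ x i → z :+ ((p :+ θ :- z) :+ (x :+ i :- p) :+ (# 2 :* i :- θ)) := x :+ # 3 :* i) refl
   ι≤½ : ι ≤ ½
   ι≤½ = inv-antitone {1} {ℕ.pred w} (ℕ.pred-mono-≤ {2} (ℕ.≤-trans (ℕ.m≤m+n 2 198) 200≤w))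
   x≥ : - ½ ≤ x
   x≥ = by ((x + ι - p′) + p′ + (½ - ι)) (0≤+ (0≤+ (sub≥0 x-above) (0≤pow (sub≥0 θ≤1) ℓ)) (sub≥0 ι≤½)) (r x ι p′)
    where
    p′ = pow (1ℚ - θ) ℓ
    r = solve 3 (λ x i p → :- :½ :+ ((x :+ i :- p) :+ p :+ (:½ :- i)) := x) refl
   x≤ : x ≤ 2ℚ
   x≤ = ≤-trans x-below (+-mono-≤ z≤1 (inv≤1 (ℕ.pred w)))
   uniform′ : ∣ (1ℚ + z + z * z) * Vℓ - (1ℚ + z) * p̂ N ∣ ≤ ι * (⌜ 305812 ⌝ * p̂ N)
   uniform′ = ≡≤ (trans (sym (*-identityˡ D)) (trans (cong (_* D) (sym (trans (*-comm ι ω) ωι))) (*-assoc ι ω D))) (*-monoˡ 0≤ι (Co.Main.uniform ℓ))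
    where D = ∣ (1ℚ + z + z * z) * Vℓ - (1ℚ + z) * p̂ N ∣
   total : ∣ (1ℚ + x + x * x) * Vℓ - (1ℚ + x) * p̂ N ∣ ≤ ⌜ 305839 ⌝ * ι * p̂ N
   total = ≤≡ (transfer x z Vℓ (p̂ N) ι (ι * (⌜ 305812 ⌝ * p̂ N)) x-z 0≤ι 0≤z z≤1 x≥ x≤ (0≤⌜⌝ (Compositions.a (t (suc ℓ) ℕ.+ N) ℓ)) V≤ (0≤p̂ N) uniform′) (r ι (p̂ N))
    where
    V≤ : Vℓ ≤ 2ℚ * p̂ N
    V≤ = Co.Centre.Rank.V̂≤ N (ℕ.m≤n+m N (w⁶ w)) ℕ.≤-refl ℓ
    r = solve 2 (λ i p → i :* (# 305812 :* p) :+ # 27 :* i :* p := # 305839 :* i :* p) refl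

 module _ (N : ℕ) .{{_ : ℕ.NonZero N}} (S : Scaled N) (ℓ : ℕ) where
  open Scaled S

  private
   ι : ℚ
   ι = inv (ℕ.pred w)

   A = exp-bounds ℓ ℓ ι (0<inv (ℕ.pred w))
   B = scale-onset N S

  -- Approximants of e^(-α) may leave [0,1]; the lower bound -1/2 keeps 1 + x away from 0 so that it
  -- can be inverted.
  Estimate : ℚ → Set
  Estimate x = - ½ ≤ x × x ≤ 2ℚ × ∣ (1ℚ + x + x * x) * ⌜ Compositions.a (t (suc ℓ) ℕ.+ N) ℓ ⌝ - (1ℚ + x) * p̂ N ∣ ≤ ⌜ 305839 ⌝ * ι * p̂ N

  estimate : ∃ λ K → ∀ k → K ℕ.≤ k → Estimate (expSum (- (⌜ ℓ ⌝ * Θ (6 ℕ.* N) k)) k)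
  estimate = suc (proj₁ A ℕ.+ proj₁ B) , main
   where
   go : ∀ k → proj₁ A ℕ.≤ k → ∀ θ → 0ℚ ≤ θ → ∣ ⌜ N ⌝ * (θ * θ) - ζ N ∣ ≤ ι * ι → (∃ λ y → 0ℚ < y × (1ℚ + θ) * y ≡ 1ℚ) → Estimate (expSum (- (⌜ ℓ ⌝ * θ)) k)
   go k A≤k θ 0≤θ near (y , 0<y , yθ) = x≥ below above , x≤ below above , total below above
    where
    yθ′ : y * (1ℚ + θ) ≡ 1ℚ
    yθ′ = trans (*-comm y (1ℚ + θ)) yθ
    set : Setting
    set = record { w = w ; N = N ; 200≤w = 200≤w ; N≥ = N≥ ; N≤ = N≤ ; θ = θ ; y = y ; 0≤θ = 0≤θ ; yθ = yθ′ ; 0≤y = <⇒≤ 0<y ; θ-near = near }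
    open Bound set ℓ using (θ≤1; x≥; x≤; total)
    bounds = proj₂ A k A≤k θ y 0≤θ θ≤1 (≤≡ (*-monoˡ (0≤⌜⌝ ℓ) θ≤1) (*-identityʳ ⌜ ℓ ⌝)) yθ′ (<⇒≤ 0<y)
    below = proj₁ bounds
    above = proj₂ bounds
   main : ∀ k → suc (proj₁ A ℕ.+ proj₁ B) ℕ.≤ k → Estimate (expSum (- (⌜ ℓ ⌝ * Θ (6 ℕ.* N) k)) k)
   main (suc k) (ℕ.s≤s K≤k) = go (suc k) (ℕ.≤-trans (ℕ.m≤m+n (proj₁ A) (proj₁ B)) (ℕ.m≤n⇒m≤1+n K≤k)) (Θ (6 ℕ.* N) (suc k)) 0≤θ
     (proj₂ B (suc k) (ℕ.≤-trans (ℕ.m≤n+m (proj₁ B) (proj₁ A)) (ℕ.m≤n⇒m≤1+n K≤k))) (reciprocal (1ℚ + Θ (6 ℕ.* N) (suc k)) (<-≤-trans 0<1 (p≤p+q 1ℚ 0≤θ)))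
    where
    0≤θ : 0ℚ ≤ Θ (6 ℕ.* N) (suc k)
    0≤θ = 0≤Θ (6 ℕ.* N) k {{6N≢0 N}}

-- The uniform asymptotic formula

module UniformTheorem where
 open QSeries using (t; P; P-increasing; module Compositions)
 open Counting using (p≡P; V≡a)
 open Rationals
 open LocalGrowth using (p̂)
 open ZetaSums using (inv; 0≤inv)
 open Scales using (w²; w⁸; 2t+r)
 open RootBounds
 open ScaleChoice
 open RankEstimate
 open import Data.Integer.Base as ℤ using (ℤ)
 open import Data.Rational.Properties
 open ≤-Reasoning

 pow-strict : ∀ {a b} → 0ℚ ≤ b → b < a → ∀ n → pow b (suc n) < pow a (suc n)
 pow-strict {a} {b} 0≤b b<a n = ≤-<-trans (*-monoˡ 0≤b (pow-mono 0≤b (<⇒≤ b<a) n)) (*-monoˡ-<-pos (pow a n) {{positive (0<pow (≤-<-trans 0≤b b<a) n)}} b<a)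

 root≤ : ∀ d .{{_ : ℕ.NonZero d}} n k w → n ℕ.≤ w ℕ.^ d → rootSeq d n k ≤ ⌜ w ⌝
 root≤ (suc d) n k w h = ≮⇒≥ λ lt → <-irrefl refl (<-≤-trans (pow-strict (0≤⌜⌝ w) lt d) (≤-trans (rootSeq-≤ (suc d) n k) (≤≡ (⌜⌝-mono h) (⌜⌝-pow w (suc d)))))

 triangular : ∀ ℓ N → t (suc ℓ) ℕ.+ N ≡ N ℕ.+ (ℓ ℕ.* (ℓ ℕ.+ 1)) ℕ./ 2
 triangular ℓ N = trans (ℕ.+-comm (t (suc ℓ)) N) (cong (N ℕ.+_) (trans (sym (ℕ.m*n/n≡m (t (suc ℓ)) 2)) (cong (ℕ._/ 2) (ℕ.+-cancelʳ-≡ (suc ℓ) (t (suc ℓ) ℕ.* 2) (ℓ ℕ.* (ℓ ℕ.+ 1)) (trans (cong (ℕ._+ suc ℓ) (ℕ.*-comm (t (suc ℓ)) 2)) (trans (2t+r (suc ℓ)) (e ℓ)))))))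
  where
  e : ∀ l → suc l ℕ.* suc l ≡ l ℕ.* (l ℕ.+ 1) ℕ.+ suc l
  e = ℕ-Ring.solve-∀

 relative-error : ∀ u D V p i r e → ½ ≤ u → u * r ≡ 1ℚ → 0ℚ ≤ r → p * i ≡ 1ℚ → 0ℚ ≤ i → 0ℚ ≤ e → ∣ D * V - u * p ∣ ≤ e * p → ∣ V * i * (D * r) - 1ℚ ∣ ≤ 2ℚ * e
 relative-error u D V p i r e ½≤u ur 0≤r pi 0≤i 0≤e h = begin
  ∣ V * i * (D * r) - 1ℚ ∣ ≡⟨ cong ∣_∣ (trans (cong (λ x → V * i * (D * r) - x) (sym (trans (cong₂ _*_ pi ur) (*-identityˡ 1ℚ)))) (r₁ V i D r p u)) ⟩
  ∣ i * r * (D * V - u * p) ∣ ≤⟨ ∣*∣ (0≤* 0≤i 0≤r) h ⟩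
  i * r * (e * p) ≡⟨ trans (r₂ i r e p) (trans (cong (_* (r * e)) pi) (*-identityˡ (r * e))) ⟩
  r * e ≤⟨ *-monoʳ {e} {r} {2ℚ * 1ℚ} 0≤e (by (2ℚ * ((u - ½) * r)) (0≤* 0≤2 (0≤* (sub≥0 ½≤u) 0≤r)) (trans (r₃ r u) (cong (2ℚ *_) ur))) ⟩
  2ℚ * 1ℚ * e ≡⟨ cong (_* e) (*-identityʳ 2ℚ) ⟩
  2ℚ * e ∎
  where
  r₁ = solve 6 (λ V i D r p u → V :* i :* (D :* r) :- p :* i :* (u :* r) := i :* r :* (D :* V :- u :* p)) refl
  r₂ = solve 4 (λ i r e p → i :* r :* (e :* p) := p :* i :* (r :* e)) refl
  r₃ = solve 2 (λ r u → r :+ # 2 :* ((u :- :½) :* r) := # 2 :* (u :* r)) refl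

 exact : ∀ u D V p i r s → u * r ≡ 1ℚ → D * s ≡ 1ℚ → p * i ≡ 1ℚ → p * (u * s) * (1ℚ + (V * i * (D * r) + - 1ℚ)) ≡ V
 exact u D V p i r s ur Ds pi = trans (r₁ u D V p i r s) (trans (cong₂ (λ a b → a * b * (p * i) * V) ur Ds) (trans (cong (λ a → 1ℚ * 1ℚ * a * V) pi) (r₂ V)))
  where
  r₁ = solve 7 (λ u D V p i r s → p :* (u :* s) :* (:1 :+ (V :* i :* (D :* r) :+ :- :1)) := u :* r :* (D :* s) :* (p :* i) :* V) refl
  r₂ = solve 1 (λ V → :1 :* :1 :* :1 :* V := V) refl

 module UniformBound (N : ℕ) .{{_ : ℕ.NonZero N}} (S : Scaled N) (ℓ : ℤ) where
  open Scaled S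

  λ′ : ℕ
  λ′ = ℤ.∣ ℓ ∣

  α e^ u : ℝ
  α = scaledRank ℓ N
  e^ = exp (-ᴿ α)
  u = fromℕ 1 +ᴿ e^

  M : ℕ
  M = N ℕ.+ (λ′ ℕ.* (λ′ ℕ.+ 1)) ℕ./ 2

  private
   A = estimate N S λ′
   K = proj₁ A

  x : ℕ → ℚ
  x k = seq e^ k

  x≡ : ∀ k → expSum (- (⌜ λ′ ⌝ * Θ (6 ℕ.* N) k)) k ≡ x k
  x≡ k = cong (λ a → expSum (- a) k) (r ⌜ λ′ ⌝ (seq π k) (recip 1ℚ 0<1 (rootSeq 2 (6 ℕ.* N) k)))
   where
   r = solve 3 (λ l p q → l :* (p :* q) := p :* l :* q) refl

  V̂ ι : ℚ
  V̂ = ⌜ V ℓ M ⌝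
  ι = inv (ℕ.pred w)

  V̂≡ : ⌜ Compositions.a (t (suc λ′) ℕ.+ N) λ′ ⌝ ≡ V̂
  V̂≡ = cong ⌜_⌝ (trans (cong (λ m → Compositions.a m λ′) (triangular λ′ N)) (sym (V≡a ℓ M)))

  p̂≡ : p̂ N ≡ ⌜ p N ⌝
  p̂≡ = cong ⌜_⌝ (sym (p≡P N))

  bounds : ∀ k → K ℕ.≤ k → - ½ ≤ x k × x k ≤ 2ℚ × ∣ (1ℚ + x k + x k * x k) * V̂ - (1ℚ + x k) * ⌜ p N ⌝ ∣ ≤ ⌜ 305839 ⌝ * ι * ⌜ p N ⌝
  bounds k h = go (x≡ k) V̂≡ p̂≡ (proj₂ A k h)
   where
   go : ∀ {x x′ v v′ p p′} → x ≡ x′ → v ≡ v′ → p ≡ p′ →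
    - ½ ≤ x × x ≤ 2ℚ × ∣ (1ℚ + x + x * x) * v - (1ℚ + x) * p ∣ ≤ ⌜ 305839 ⌝ * ι * p →
    - ½ ≤ x′ × x′ ≤ 2ℚ × ∣ (1ℚ + x′ + x′ * x′) * v′ - (1ℚ + x′) * p′ ∣ ≤ ⌜ 305839 ⌝ * ι * p′
   go refl refl refl b = b

  0<½ : 0ℚ < ½
  0<½ = positive⁻¹ ½

  ½≤u : ∀ k → K ℕ.≤ k → ½ ≤ 1ℚ + x k
  ½≤u k h = +-monoʳ-≤ 1ℚ (proj₁ (bounds k h))

  u⁺ : Positiveᴿ u
  u⁺ = mkPositiveᴿ ½ 0<½ K ½≤u

  ip : ℚ
  ip = inv (ℕ.pred (p N))

  pip : ⌜ p N ⌝ * ip ≡ 1ℚ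
  pip = go (p N) (subst (1 ℕ.≤_) (sym (p≡P N)) (P≥1 N))
   where
   go : ∀ n → 1 ℕ.≤ n → ⌜ n ⌝ * inv (ℕ.pred n) ≡ 1ℚ
   go (suc n) _ = ⌜*⌝-inv n
   P≥1 : ∀ n → 1 ℕ.≤ P n
   P≥1 zero = ℕ.≤-refl
   P≥1 (suc n) = ℕ.≤-trans (P≥1 n) (P-increasing n)

  -- The relative error is defined as the quotient of the two sides minus 1. Then `identity` holds
  -- exactly once the reciprocals are genuine, and the estimates serve only to bound E.
  E : ℝ
  E = fromℚ (V̂ * ip) *ᴿ (F-denominator α ÷ᴿ u ⟨ u⁺ ⟩) -ᴿ fromℕ 1

  E-bound : ∀ k → K ℕ.≤ k → ∣ seq E k ∣ ≤ 2ℚ * (⌜ 305839 ⌝ * ι)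
  E-bound k h = relative-error (1ℚ + x k) (1ℚ + x k + x k * x k) V̂ ⌜ p N ⌝ ip (recip ½ 0<½ (1ℚ + x k)) (⌜ 305839 ⌝ * ι) (½≤u k h) (recip-inverse 0<½ (½≤u k h)) (0≤recip 0<½ (½≤u k h)) pip (0≤inv (ℕ.pred (p N)))
   (0≤* (0≤⌜⌝ 305839) (0≤inv (ℕ.pred w))) (proj₂ (proj₂ (bounds k h)))

  -- N ≤ 2w⁸ ≤ w¹⁰; the exponent 1/10 absorbs the factor 2.
  ι≤tenth : ∀ k → ι ≤ recip 1ℚ 0<1 (rootSeq 10 N k)
  ι≤tenth k = go (rootSeq 10 N k) (1≤rootSeq 10 N k) (root≤ 10 N k w (ℕ.≤-trans N≤ (ℕ≤≡ (ℕ.*-monoˡ-≤ (w⁸ w) 2≤w²) (e w))))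
   where
   e : ∀ w → w ℕ.* w ℕ.* (w ℕ.* w ℕ.* (w ℕ.* w) ℕ.* (w ℕ.* w ℕ.* (w ℕ.* w))) ≡ w ℕ.* (w ℕ.* (w ℕ.* (w ℕ.* (w ℕ.* (w ℕ.* (w ℕ.* (w ℕ.* (w ℕ.* (w ℕ.* 1)))))))))
   e = ℕ-Ring.solve-∀
   2≤w² : 2 ℕ.≤ w² w
   2≤w² = ℕ.≤-trans (ℕ.m≤m+n 2 198) (ℕ.≤-trans 200≤w (ℕ.m≤m*n w w {{ℕ.>-nonZero (ℕ.≤-trans (ℕ.m≤m+n 1 199) 200≤w)}}))
   wι : ∀ w → 200 ℕ.≤ w → ⌜ w ⌝ * inv (ℕ.pred w) ≡ 1ℚ
   wι (suc w) _ = ⌜*⌝-inv w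
   go : ∀ r → 1ℚ ≤ r → r ≤ ⌜ w ⌝ → ι ≤ recip 1ℚ 0<1 r
   go r 1≤r r≤w = begin
    ι ≡⟨ trans (sym (*-identityˡ ι)) (cong (_* ι) (sym (recip-inverse 0<1 1≤r))) ⟩
    r * R * ι ≤⟨ *-monoʳ (0≤inv (ℕ.pred w)) (*-monoʳ (0≤recip 0<1 1≤r) r≤w) ⟩
    ⌜ w ⌝ * R * ι ≡⟨ trans (r₁ ⌜ w ⌝ R ι) (trans (cong (_* R) (wι w 200≤w)) (*-identityˡ R)) ⟩
    R ∎
    where
    R = recip 1ℚ 0<1 r
    r₁ = solve 3 (λ a b c → a :* b :* c := a :* c :* b) refl

  E-small : ∣ E ∣ᴿ ≤ᴿ fromℕ 611678 *ᴿ tenthRoot⁻¹ N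
  E-small ε 0<ε = K , λ k h → begin
   ∣ seq E k ∣ ≤⟨ E-bound k h ⟩
   2ℚ * (⌜ 305839 ⌝ * ι) ≡⟨ r₁ ι ⟩
   ⌜ 611678 ⌝ * (1ℚ * ι) ≤⟨ *-monoˡ (0≤⌜⌝ 611678) (*-monoˡ 0≤1 (ι≤tenth k)) ⟩
   ⌜ 611678 ⌝ * (1ℚ * recip 1ℚ 0<1 (rootSeq 10 N k)) ≤⟨ p≤p+q _ (<⇒≤ 0<ε) ⟩
   ⌜ 611678 ⌝ * (1ℚ * recip 1ℚ 0<1 (rootSeq 10 N k)) + ε ∎
   where
   r₁ = solve 1 (λ i → # 2 :* (# 305839 :* i) := # 611678 :* (:1 :* i)) refl

  identity : fromℕ (V ℓ M) ≈ᴿ fromℕ (p N) *ᴿ F α *ᴿ (fromℕ 1 +ᴿ E)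
  identity ε 0<ε = K , λ k h → ≤-trans (≤-reflexive (trans (cong (λ q → ∣ V̂ - q ∣)
    (exact (1ℚ + x k) (D k) V̂ ⌜ p N ⌝ ip (recip ½ 0<½ (1ℚ + x k)) _ (recip-inverse 0<½ (½≤u k h)) (recip-inverse (positive⁻¹ _) (Positiveᴿ.bound≤ (F-denominator-positive α) k ℕ.z≤n)) pip))
    (cong ∣_∣ (+-inverseʳ V̂)))) (<⇒≤ 0<ε)
   where
   D : ℕ → ℚ
   D k = 1ℚ + x k + x k * x k

-- From powers of 1/(1+θ) to a Gaussian factor

module SquareRoots where
 open Rationals
 open LocalGrowth using (Near; _&_; trans-≤; near-abs; near-√; near-trans; near-sym; near-refl; near-scale; near-*)
 open import Data.Rational.Properties

 near-pow : ∀ {κ x z} → 0ℚ ≤ κ → 0ℚ ≤ x → 0ℚ ≤ z → Near κ x z → ∀ n → Near (⌜ n ⌝ * κ) (pow x n) (pow z n)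
 near-pow {κ} 0≤κ 0≤x 0≤z h zero = near-refl (≤-reflexive (sym (*-zeroˡ κ))) 0≤1
 near-pow {κ} {x} {z} 0≤κ 0≤x 0≤z h (suc n) = subst (λ k → Near k (x * pow x n) (z * pow z n)) (trans (r ⌜ n ⌝ κ) (cong (_* κ) (sym (⌜suc⌝ n))))
   (near-* 0≤κ (0≤* (0≤⌜⌝ n) 0≤κ) 0≤x 0≤z (0≤pow 0≤x n) (0≤pow 0≤z n) h (near-pow 0≤κ 0≤x 0≤z h n))
  where
  r = solve 2 (λ n k → k :+ n :* k := (:1 :+ n) :* k) refl

 -- 1 - φ and 1/(1 + φ) are both square roots of y = 1/(1 + θ) up to second order when 2φ ≈ θ.
 module Halving (θ φ y v κ : ℚ) (0≤θ : 0ℚ ≤ θ) (θ≤½ : θ ≤ ½) (0≤φ : 0ℚ ≤ φ) (yθ : y * (1ℚ + θ) ≡ 1ℚ) (0≤y : 0ℚ ≤ y) (vφ : v * (1ℚ + φ) ≡ 1ℚ) (0≤v : 0ℚ ≤ v)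
  (0≤κ : 0ℚ ≤ κ) (κ≤½ : κ ≤ ½) (φ-near : Near κ (2ℚ * φ) θ) where

  open Near φ-near

  μ : ℚ
  μ = 2ℚ * κ + 4ℚ * (θ * θ)

  0≤μ : 0ℚ ≤ μ
  0≤μ = 0≤+ (0≤* 0≤2 0≤κ) (0≤* 0≤4 (0≤* 0≤θ 0≤θ))

  φ≤θ : φ ≤ θ
  φ≤θ = by ((θ - (1ℚ - κ) * (2ℚ * φ)) + (½ - κ) * (2ℚ * φ)) (0≤+ (sub≥0 near-≤) (0≤* (sub≥0 κ≤½) (0≤* 0≤2 0≤φ))) (r θ φ κ)
   where
   r = solve 3 (λ θ φ κ → φ :+ ((θ :- (:1 :- κ) :* (# 2 :* φ)) :+ (:½ :- κ) :* (# 2 :* φ)) := θ) refl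

  φ≤½ : φ ≤ ½
  φ≤½ = ≤-trans φ≤θ θ≤½

  θ≤1 : θ ≤ 1ℚ
  θ≤1 = ≤-trans θ≤½ (p≤p+q ½ 0≤½)

  0≤1-φ : 0ℚ ≤ 1ℚ - φ
  0≤1-φ = sub≥0 (≤-trans φ≤θ θ≤1)

  above : θ - 2ℚ * φ ≤ 2ℚ * κ
  above = by ((2ℚ * φ - (1ℚ - κ) * θ) + κ * (1ℚ - θ) + κ) (0≤+ (0≤+ (sub≥0 near-≥) (0≤* 0≤κ (sub≥0 θ≤1))) 0≤κ) (r θ φ κ)
   where
   r = solve 3 (λ θ φ κ → θ :- # 2 :* φ :+ ((# 2 :* φ :- (:1 :- κ) :* θ) :+ κ :* (:1 :- θ) :+ κ) := # 2 :* κ) refl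

  below : 2ℚ * φ - θ ≤ 2ℚ * κ
  below = by ((θ - (1ℚ - κ) * (2ℚ * φ)) + 2ℚ * (κ * (θ - φ)) + 2ℚ * (κ * (1ℚ - θ))) (0≤+ (0≤+ (sub≥0 near-≤) (0≤* 0≤2 (0≤* 0≤κ (sub≥0 φ≤θ)))) (0≤* 0≤2 (0≤* 0≤κ (sub≥0 θ≤1)))) (r θ φ κ)
   where
   r = solve 3 (λ θ φ κ → # 2 :* φ :- θ :+ ((θ :- (:1 :- κ) :* (# 2 :* φ)) :+ # 2 :* (κ :* (θ :- φ)) :+ # 2 :* (κ :* (:1 :- θ))) := # 2 :* κ) refl

  0≤θθ-φφ : 0ℚ ≤ θ * θ - φ * φ
  0≤θθ-φφ = sub≥0 (*-mono 0≤θ 0≤φ φ≤θ φ≤θ)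

  y≤1′ : y ≤ 1ℚ
  y≤1′ = y≤1 0≤θ yθ 0≤y

  lower-root : Near μ ((1ℚ - φ) * (1ℚ - φ)) y
  lower-root = near-sym (near-abs 0≤μ 0≤y (0≤* 0≤1-φ 0≤1-φ) (≡≤ (trans (cong ∣_∣ eq) (trans (∣p*q∣≡∣p∣*∣q∣ y (1ℚ - c)) (cong (_* ∣ 1ℚ - c ∣) (0≤p⇒∣p∣≡p 0≤y))))
    (≤-trans (*-monoˡ 0≤y (close {1ℚ} {c}
     (by ((2ℚ * κ - (2ℚ * φ - θ)) + (φ * φ + φ * φ * θ) + 2ℚ * (θ * (θ - φ)) + 2ℚ * (θ * θ)) (0≤+ (0≤+ (0≤+ (sub≥0 below) (0≤+ (0≤* 0≤φ 0≤φ) (0≤* (0≤* 0≤φ 0≤φ) 0≤θ))) (0≤* 0≤2 (0≤* 0≤θ (sub≥0 φ≤θ)))) (0≤* 0≤2 (0≤* 0≤θ 0≤θ))) (r₁ θ φ κ))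
     (by ((2ℚ * κ - (θ - 2ℚ * φ)) + (θ * θ - φ * φ) + ((θ * θ - φ * φ) * θ + θ * θ * (1ℚ - θ)) + 2ℚ * (φ * θ) + 2ℚ * (θ * θ)) (0≤+ (0≤+ (0≤+ (0≤+ (sub≥0 above) 0≤θθ-φφ) (0≤+ (0≤* 0≤θθ-φφ 0≤θ) (0≤* (0≤* 0≤θ 0≤θ) (sub≥0 θ≤1)))) (0≤* 0≤2 (0≤* 0≤φ 0≤θ))) (0≤* 0≤2 (0≤* 0≤θ 0≤θ))) (r₂ θ φ κ))))
     (≤-reflexive (*-comm y μ)))))
   where
   c : ℚ
   c = (1ℚ + θ) * ((1ℚ - φ) * (1ℚ - φ))
   eq : y - (1ℚ - φ) * (1ℚ - φ) ≡ y * (1ℚ - c)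
   eq = trans (cong (λ x → y - x) (trans (sym (*-identityˡ ((1ℚ - φ) * (1ℚ - φ)))) (cong (_* ((1ℚ - φ) * (1ℚ - φ))) (sym yθ)))) (r y θ φ)
    where
    r = solve 3 (λ y θ φ → y :- y :* (:1 :+ θ) :* ((:1 :- φ) :* (:1 :- φ)) := y :* (:1 :- (:1 :+ θ) :* ((:1 :- φ) :* (:1 :- φ)))) refl
   r₁ = solve 3 (λ θ φ κ → :1 :+ ((# 2 :* κ :- (# 2 :* φ :- θ)) :+ (φ :* φ :+ φ :* φ :* θ) :+ # 2 :* (θ :* (θ :- φ)) :+ # 2 :* (θ :* θ)) := (:1 :+ θ) :* ((:1 :- φ) :* (:1 :- φ)) :+ (# 2 :* κ :+ # 4 :* (θ :* θ))) refl
   r₂ = solve 3 (λ θ φ κ → (:1 :+ θ) :* ((:1 :- φ) :* (:1 :- φ)) :+ ((# 2 :* κ :- (θ :- # 2 :* φ)) :+ (θ :* θ :- φ :* φ) :+ ((θ :* θ :- φ :* φ) :* θ :+ θ :* θ :* (:1 :- θ)) :+ # 2 :* (φ :* θ) :+ # 2 :* (θ :* θ)) := :1 :+ (# 2 :* κ :+ # 4 :* (θ :* θ))) refl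

  upper-root : Near μ (v * v) y
  upper-root = near-abs 0≤μ 0≤vv 0≤y (≡≤ (trans (cong ∣_∣ eq) (trans (∣p*q∣≡∣p∣*∣q∣ (v * v * y) e) (cong (_* ∣ e ∣) (0≤p⇒∣p∣≡p (0≤* 0≤vv 0≤y)))))
    (≤-trans (*-mono (≤≡ 0≤vv (sym (*-identityʳ (v * v)))) (0≤∣p∣ e) (*-monoˡ 0≤vv y≤1′) (close {1ℚ + θ} {(1ℚ + φ) * (1ℚ + φ)}
     (by ((2ℚ * κ - (θ - 2ℚ * φ)) + φ * φ + 4ℚ * (θ * θ)) (0≤+ (0≤+ (sub≥0 above) (0≤* 0≤φ 0≤φ)) (0≤* 0≤4 (0≤* 0≤θ 0≤θ))) (r₁ θ φ κ))
     (by ((2ℚ * κ - (2ℚ * φ - θ)) + (θ * θ - φ * φ) + 3ℚ * (θ * θ)) (0≤+ (0≤+ (sub≥0 below) 0≤θθ-φφ) (0≤* 0≤3 (0≤* 0≤θ 0≤θ))) (r₂ θ φ κ))))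
     (≤-reflexive (r₃ (v * v) μ))))
   where
   0≤vv : 0ℚ ≤ v * v
   0≤vv = 0≤* 0≤v 0≤v
   e : ℚ
   e = 1ℚ + θ - (1ℚ + φ) * (1ℚ + φ)
   eq : v * v - y ≡ v * v * y * e
   eq = trans (r₀ v y) (trans (cong₂ (λ a b → v * v * a - b * b * y) (sym yθ) (sym vφ)) (r v y θ φ))
    where
    r₀ = solve 2 (λ v y → v :* v :- y := v :* v :* :1 :- :1 :* :1 :* y) refl
    r = solve 4 (λ v y θ φ → v :* v :* (y :* (:1 :+ θ)) :- v :* (:1 :+ φ) :* (v :* (:1 :+ φ)) :* y := v :* v :* y :* (:1 :+ θ :- (:1 :+ φ) :* (:1 :+ φ))) refl
   r₁ = solve 3 (λ θ φ κ → :1 :+ θ :+ ((# 2 :* κ :- (θ :- # 2 :* φ)) :+ φ :* φ :+ # 4 :* (θ :* θ)) := (:1 :+ φ) :* (:1 :+ φ) :+ (# 2 :* κ :+ # 4 :* (θ :* θ))) refl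
   r₂ = solve 3 (λ θ φ κ → (:1 :+ φ) :* (:1 :+ φ) :+ ((# 2 :* κ :- (# 2 :* φ :- θ)) :+ (θ :* θ :- φ :* φ) :+ # 3 :* (θ :* θ)) := :1 :+ θ :+ (# 2 :* κ :+ # 4 :* (θ :* θ))) refl
   r₃ = solve 2 (λ a m → a :* :1 :* m := m :* a) refl

  near-1 : ∀ ℓ → Near (⌜ ℓ ⌝ * θ) 1ℚ (pow y ℓ)
  near-1 ℓ = by (⌜ ℓ ⌝ * θ * z + ⌜ ℓ ⌝ * θ * z + (1ℚ - z * (1ℚ + ⌜ ℓ ⌝ * θ))) (0≤+ (0≤+ (0≤* 0≤ℓθ 0≤z) (0≤* 0≤ℓθ 0≤z)) (sub≥0 (pow-upper 0≤θ yθ 0≤y ℓ))) (r (⌜ ℓ ⌝ * θ) z)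
    & ≡≤ (*-identityʳ _) (pow-lower 0≤θ yθ 0≤y ℓ)
   where
   z = pow y ℓ
   0≤z : 0ℚ ≤ z
   0≤z = 0≤pow 0≤y ℓ
   0≤ℓθ : 0ℚ ≤ ⌜ ℓ ⌝ * θ
   0≤ℓθ = 0≤* (0≤⌜⌝ ℓ) 0≤θ
   r = solve 2 (λ a z → (:1 :- a) :* z :+ (a :* z :+ a :* z :+ (:1 :- z :* (:1 :+ a))) := :1) refl

  -- Compare squares: (s^M)² is close to y^M, and y^(2d) has only the further factor y^ℓ, which is
  -- close to 1. In the application M = ℓ².
  root-pow : ∀ {s} → 0ℚ ≤ s → Near μ (s * s) y → ∀ M ℓ d → d ℕ.+ d ≡ M ℕ.+ ℓ → Near (⌜ M ⌝ * μ + ⌜ ℓ ⌝ * θ) (pow s M) (pow y d)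
  root-pow {s} 0≤s h M ℓ d e = near-√ (0≤+ 0≤Mμ 0≤ℓθ) (0≤pow 0≤s M) (0≤pow 0≤y d)
    (near-trans 0≤Mμ 0≤ℓθ (0≤* (0≤pow 0≤s M) (0≤pow 0≤s M)) (0≤* (0≤pow 0≤y d) (0≤pow 0≤y d))
     (subst (λ x → Near (⌜ M ⌝ * μ) x (pow y M)) (pow-*-distrib s s M) (near-pow 0≤μ (0≤* 0≤s 0≤s) 0≤y h M))
     (subst₂ (Near (⌜ ℓ ⌝ * θ)) (*-identityʳ (pow y M)) (trans (sym (pow-+ y M ℓ)) (trans (cong (pow y) (sym e)) (pow-+ y d d)))
      (near-scale (0≤pow 0≤y M) 0≤ℓθ 0≤1 (0≤pow 0≤y ℓ) (near-1 ℓ))))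
   where
   0≤Mμ : 0ℚ ≤ ⌜ M ⌝ * μ
   0≤Mμ = 0≤* (0≤⌜⌝ M) 0≤μ
   0≤ℓθ : 0ℚ ≤ ⌜ ℓ ⌝ * θ
   0≤ℓθ = 0≤* (0≤⌜⌝ ℓ) 0≤θ

 -- A is enclosed up to an absolute error ε, and a, b may be tiny, so ε must be small relative to
 -- them as well.
 sandwich : ∀ {κ δ ε a b A z} → 0ℚ ≤ κ → 0ℚ ≤ δ → δ ≤ 1ℚ → 0ℚ ≤ a → 0ℚ ≤ b → 0ℚ ≤ z → Near κ a z → Near κ b z → ε ≤ δ * a → ε ≤ δ * b → a ≤ A + ε → A ≤ b + ε → Near (κ + δ) A z
 sandwich {κ} {δ} {ε} {a} {b} {A} {z} 0≤κ 0≤δ δ≤1 0≤a 0≤b 0≤z na nb εa εb a≤ ≤b =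
   ≡≤ (cong (λ t → (1ℚ - t) * z) (+-comm κ δ)) (trans-≤ 0≤δ 0≤κ 0≤z 0≤A low (Near.near-≥ na)) & trans-≤ 0≤κ 0≤δ 0≤A 0≤z (Near.near-≤ nb) high
  where
  low : (1ℚ - δ) * a ≤ A
  low = by ((A + ε - a) + (δ * a - ε)) (0≤+ (sub≥0 a≤) (sub≥0 εa)) (r δ a A ε)
   where
   r = solve 4 (λ δ a A ε → (:1 :- δ) :* a :+ ((A :+ ε :- a) :+ (δ :* a :- ε)) := A) refl
  0≤A : 0ℚ ≤ A
  0≤A = ≤-trans (0≤* (sub≥0 δ≤1) 0≤a) low
  high : (1ℚ - δ) * A ≤ b
  high = by ((1ℚ - δ) * (b + ε - A) + (1ℚ - δ) * (δ * b - ε) + δ * δ * b) (0≤+ (0≤+ (0≤* (sub≥0 δ≤1) (sub≥0 ≤b)) (0≤* (sub≥0 δ≤1) (sub≥0 εb))) (0≤* (0≤* 0≤δ 0≤δ) 0≤b)) (r δ b A ε)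
   where
   r = solve 4 (λ δ b A ε → (:1 :- δ) :* A :+ ((:1 :- δ) :* (b :+ ε :- A) :+ (:1 :- δ) :* (δ :* b :- ε) :+ δ :* δ :* b) := b) refl

 near-quotient : ∀ {κ u A r} → 0ℚ ≤ κ → κ ≤ ½ → 0ℚ ≤ r → A * r ≡ 1ℚ → Near κ u A → ∣ u * r - 1ℚ ∣ ≤ 2ℚ * κ
 near-quotient {κ} {u} {A} {r} 0≤κ κ≤½ 0≤r Ar (a & b) = close {u * r} {1ℚ}
   (*-cancel-≤ {1ℚ - κ} (<-≤-trans (positive⁻¹ ½) (by (½ - κ) (sub≥0 κ≤½) (r₀ κ))) (≡≤ (sym (*-assoc (1ℚ - κ) u r)) (≤-trans (*-monoʳ 0≤r b) (≡≤ Ar (by (2ℚ * (κ * (½ - κ))) (0≤* 0≤2 (0≤* 0≤κ (sub≥0 κ≤½))) (r₁ κ))))))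
   (by ((u * r - (1ℚ - κ) * 1ℚ) + κ) (0≤+ (sub≥0 (≡≤ (trans (cong ((1ℚ - κ) *_) (sym Ar)) (sym (*-assoc (1ℚ - κ) A r))) (*-monoʳ 0≤r a))) 0≤κ) (r₂ (u * r) κ))
  where
  r₀ = solve 1 (λ κ → :½ :+ (:½ :- κ) := :1 :- κ) refl
  r₁ = solve 1 (λ κ → :1 :+ # 2 :* (κ :* (:½ :- κ)) := (:1 :- κ) :* (:1 :+ # 2 :* κ)) refl
  r₂ = solve 2 (λ u κ → :1 :+ ((u :- (:1 :- κ) :* :1) :+ κ) := u :+ # 2 :* κ) refl

-- The Gaussian law at a fixed approximation index

module GaussianEstimate where
 open QSeries using (t)
 open Rationals
 open LocalGrowth
 open Scales using (w²; w⁴; 2t+r; Setting; module Setting)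
 open RankDistribution
 open SquareRoots
 open import Data.Rational.Properties
 open ≤-Reasoning

 -- In the application l stands for π/4, θ and φ for π/√(6N) and π/√(24N), the r's for √(6N), √(24N)
 -- and the fourth root of 24N, the R's for reciprocals, and η for the accuracy.
 record Approximants (l θ φ r₄ η : ℚ) : Set where
  field
   r₆ R₆ r₂₄ R₂₄ : ℚ
   0<l : 0ℚ < l
   0≤r₆ : 0ℚ ≤ r₆
   0≤R₆ : 0ℚ ≤ R₆
   0≤r₂₄ : 0ℚ ≤ r₂₄
   0≤R₂₄ : 0ℚ ≤ R₂₄
   0≤r₄ : 0ℚ ≤ r₄
   rR₆ : r₆ * R₆ ≡ 1ℚ
   rR₂₄ : r₂₄ * R₂₄ ≡ 1ℚ
   θ≡ : θ ≡ 4ℚ * l * R₆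
   φ≡ : φ ≡ 4ℚ * l * R₂₄
   0≤η : 0ℚ ≤ η
   near₂₄ : Near η (2ℚ * r₆) r₂₄
   near₄ : Near η (2ℚ * r₆) (r₄ * r₄)

  φ-near : Near η (2ℚ * φ) θ
  φ-near = subst₂ (Near η) (trans (e₁ l R₆ R₂₄ r₆) (trans (cong (λ x → 2ℚ * (4ℚ * l * R₂₄) * x) rR₆) (trans (*-identityʳ _) (cong (2ℚ *_) (sym φ≡)))))
    (trans (e₂ l R₆ R₂₄ r₂₄) (trans (cong (λ x → 4ℚ * l * R₆ * x) rR₂₄) (trans (*-identityʳ _) (sym θ≡))))
    (near-scale 0≤c 0≤η (0≤* 0≤2 0≤r₆) 0≤r₂₄ near₂₄)
   where
   0≤c : 0ℚ ≤ 4ℚ * l * R₆ * R₂₄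
   0≤c = 0≤* (0≤* (0≤* 0≤4 (<⇒≤ 0<l)) 0≤R₆) 0≤R₂₄
   e₁ = solve 4 (λ l R S r → # 4 :* l :* R :* S :* (# 2 :* r) := # 2 :* (# 4 :* l :* S) :* (r :* R)) refl
   e₂ = solve 4 (λ l R S r → # 4 :* l :* R :* S :* r := # 4 :* l :* R :* (r :* S)) refl

  -- W²θ ≈ 2l says 4W² ≈ 2r₆ ≈ r₄².
  root-near : ∀ {κ W} → 0ℚ ≤ κ → 0ℚ ≤ W → Near κ (W * W * θ) (2ℚ * l) → Near (κ + η) (2ℚ * W) r₄
  root-near {κ} {W} 0≤κ 0≤W h = near-√ (0≤+ 0≤κ 0≤η) 0≤2W 0≤r₄ (near-trans 0≤κ 0≤η (0≤* 0≤2W 0≤2W) (0≤* 0≤r₄ 0≤r₄)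
    (near-cancel 0<l (subst₂ (Near κ) (trans (cong (λ x → r₆ * (W * W * x)) θ≡) (trans (e₁ W l R₆ r₆) (trans (cong (λ x → l * (2ℚ * W * (2ℚ * W)) * x) rR₆) (*-identityʳ _)))) (e₂ r₆ l)
     (near-scale 0≤r₆ 0≤κ (0≤* (0≤* 0≤W 0≤W) 0≤θ) (0≤* 0≤2 (<⇒≤ 0<l)) h))) near₄)
   where
   0≤2W : 0ℚ ≤ 2ℚ * W
   0≤2W = 0≤* 0≤2 0≤W
   0≤θ : 0ℚ ≤ θ
   0≤θ = ≤≡ (0≤* (0≤* 0≤4 (<⇒≤ 0<l)) 0≤R₆) (sym θ≡)
   e₁ = solve 4 (λ W l R r → r :* (W :* W :* (# 4 :* l :* R)) := l :* (# 2 :* W :* (# 2 :* W)) :* (r :* R)) refl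
   e₂ = solve 2 (λ r l → r :* (# 2 :* l) := l :* (# 2 :* r)) refl

 module Gaussian (set : Setting) (τ : ℕ) (w≡ : Setting.w set ≡ w⁴ τ)
  (n : ℕ) (nθ≤ : (1ℚ + ⌜ n ⌝) * Setting.θ set ≤ 2ℚ) (nθ≥ : 2ℚ ≤ (2ℚ + ⌜ n ⌝) * Setting.θ set)
  (s ℓ : ℕ) (sℓ≤h : suc s ℕ.* ℓ ℕ.≤ Setting.w set ℕ.* w² (Setting.w set)) where
  open Setting set
  open Core₃ set τ w≡ n nθ≤ nθ≥ using (ω; ι; o; i; T; b; W; Vtot; 0≤W; 0≤b; b≤1; ι≤b; i≤ι; 0≤ι; ι200; θ≤2Y; Y≤i; T≤2; ωoθ; cast-h; W²θ-near; module Small) public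
  open Small s ℓ sℓ≤h using (Vℓ; σ′; 0≤σ′; proportion; d; ℓ≤h; yd; 0≤yd) public

  M : ℕ
  M = ℓ ℕ.* ℓ

  d+d : d ℕ.+ d ≡ M ℕ.+ ℓ
  d+d = ℕ.+-cancelʳ-≡ (suc ℓ) (d ℕ.+ d) (M ℕ.+ ℓ) (trans (cong (λ x → d ℕ.+ x ℕ.+ suc ℓ) (sym (ℕ.+-identityʳ d))) (trans (2t+r (suc ℓ)) (e ℓ)))
   where
   e : ∀ l → suc l ℕ.* suc l ≡ l ℕ.* l ℕ.+ l ℕ.+ suc l
   e = ℕ-Ring.solve-∀

  ℓθ≤ : ⌜ ℓ ⌝ * θ ≤ 2ℚ * ι
  ℓθ≤ = begin
   ⌜ ℓ ⌝ * θ ≤⟨ *-monoʳ 0≤θ (≤≡ (⌜⌝-mono ℓ≤h) cast-h) ⟩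
   ω * o * θ ≡⟨ ωoθ ⟩
   ι * T ≤⟨ *-monoˡ 0≤ι T≤2 ⟩
   ι * 2ℚ ≡⟨ *-comm ι 2ℚ ⟩
   2ℚ * ι ∎

  Mθθ≤ : ⌜ M ⌝ * (θ * θ) ≤ 4ℚ * b
  Mθθ≤ = begin
   ⌜ M ⌝ * (θ * θ) ≡⟨ trans (cong (_* (θ * θ)) (⌜*⌝ ℓ ℓ)) (r₁ ⌜ ℓ ⌝ θ) ⟩
   ⌜ ℓ ⌝ * θ * (⌜ ℓ ⌝ * θ) ≤⟨ *-mono (0≤* 0≤2 0≤ι) (0≤* (0≤⌜⌝ ℓ) 0≤θ) ℓθ≤ ℓθ≤ ⟩
   2ℚ * ι * (2ℚ * ι) ≡⟨ r₂ ι ⟩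
   4ℚ * i ≤⟨ *-monoˡ 0≤4 (≤-trans i≤ι ι≤b) ⟩
   4ℚ * b ∎
   where
   r₁ = solve 2 (λ l θ → l :* l :* (θ :* θ) := l :* θ :* (l :* θ)) refl
   r₂ = solve 1 (λ i → # 2 :* i :* (# 2 :* i) := # 4 :* (i :* i)) refl

  θ≤½ : θ ≤ ½
  θ≤½ = ≤-trans (≤-trans θ≤2Y (*-monoˡ 0≤2 (≤-trans Y≤i i≤ι))) (by (½ * (1ℚ - ι * ⌜ 200 ⌝) + ⌜ 98 ⌝ * ι) (0≤+ (0≤* 0≤½ (sub≥0 ι200)) (0≤* (0≤⌜⌝ 98) 0≤ι)) (r ι))
   where
   r = solve 1 (λ i → # 2 :* i :+ (:½ :* (:1 :- i :* # 200) :+ # 98 :* i) := :½) refl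

  module _ {l φ v r₄ η ε A : ℚ} (0≤φ : 0ℚ ≤ φ) (vφ : v * (1ℚ + φ) ≡ 1ℚ) (0≤v : 0ℚ ≤ v) (ap : Approximants l θ φ r₄ η)
   -- The accuracy of the exponential is tied to 2^(-M), a lower bound for both comparison powers
   -- (1-φ)^M and v^M.
   (η≤½ : η ≤ ½) (η≤b : η ≤ b) (Mη≤b : ⌜ M ⌝ * η ≤ b) (ε≤ : ε ≤ b * pow ½ M) (A≥ : pow (1ℚ - φ) M ≤ A + ε) (A≤ : A ≤ pow v M + ε) where
   open Approximants ap
   open Halving θ φ y v η 0≤θ θ≤½ 0≤φ yθ 0≤y vφ 0≤v 0≤η η≤½ φ-near hiding (θ≤1)

   κ′ : ⌜ M ⌝ * μ + ⌜ ℓ ⌝ * θ ≤ ⌜ 20 ⌝ * b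
   κ′ = by (2ℚ * (b - ⌜ M ⌝ * η) + 4ℚ * (4ℚ * b - ⌜ M ⌝ * (θ * θ)) + (2ℚ * ι - ⌜ ℓ ⌝ * θ) + 2ℚ * (b - ι))
     (0≤+ (0≤+ (0≤+ (0≤* 0≤2 (sub≥0 Mη≤b)) (0≤* 0≤4 (sub≥0 Mθθ≤))) (sub≥0 ℓθ≤)) (0≤* 0≤2 (sub≥0 ι≤b))) (r ⌜ M ⌝ η (θ * θ) (⌜ ℓ ⌝ * θ) ι b)
    where
    r = solve 6 (λ M η t lt i b → M :* (# 2 :* η :+ # 4 :* t) :+ lt :+ (# 2 :* (b :- M :* η) :+ # 4 :* (# 4 :* b :- M :* t) :+ (# 2 :* i :- lt) :+ # 2 :* (b :- i)) := # 20 :* b) refl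

   root-yd : ∀ {u} → 0ℚ ≤ u → Near μ (u * u) y → Near (⌜ 20 ⌝ * b) (pow u M) yd
   root-yd 0≤u h = near-weaken κ′ (0≤pow 0≤u M) 0≤yd (root-pow 0≤u h M ℓ d d+d)

   pow-½ : ∀ {u} → ½ ≤ u → b * pow ½ M ≤ b * pow u M
   pow-½ h = *-monoˡ 0≤b (pow-mono 0≤½ h M)

   ½≤v : ½ ≤ v
   ½≤v = *-cancel-≤ {2ℚ} (0<⌜suc⌝ 1) (by (v * (½ - φ) + v * ½) (0≤+ (0≤* 0≤v (sub≥0 φ≤½)) (0≤* 0≤v 0≤½)) (trans (cong (_+ (v * (½ - φ) + v * ½)) (sym vφ)) (r v φ)))
    where
    r = solve 2 (λ v φ → v :* (:1 :+ φ) :+ (v :* (:½ :- φ) :+ v :* :½) := # 2 :* v) refl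

   ½≤1-φ : ½ ≤ 1ℚ - φ
   ½≤1-φ = by (½ - φ) (sub≥0 φ≤½) (r φ)
    where
    r = solve 1 (λ φ → :½ :+ (:½ :- φ) := :1 :- φ) refl

   A-near : Near (⌜ 20 ⌝ * b + b) A yd
   A-near = sandwich (0≤* (0≤⌜⌝ 20) 0≤b) 0≤b b≤1 (0≤pow 0≤1-φ M) (0≤pow 0≤v M) 0≤yd (root-yd 0≤1-φ lower-root) (root-yd 0≤v upper-root)
    (≤-trans ε≤ (pow-½ ½≤1-φ)) (≤-trans ε≤ (pow-½ ½≤v)) A≥ A≤

   module _ (l-near : Near (⌜ 10 ⌝ * b) (W * W * θ) (2ℚ * l)) (0≤A : 0ℚ ≤ A) {q : ℚ} (0≤q : 0ℚ ≤ q) (qV : q * Vtot ≡ Vℓ) (0<Vtot : 0ℚ < Vtot) where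
    κ₁ : ℚ
    κ₁ = ⌜ 153306 ⌝ * b + ⌜ 3504 ⌝ * σ′

    0≤κ₁ : 0ℚ ≤ κ₁
    0≤κ₁ = 0≤+ (0≤* (0≤⌜⌝ 153306) 0≤b) (0≤* (0≤⌜⌝ 3504) 0≤σ′)

    q-near : Near κ₁ (q * (2ℚ * W)) yd
    q-near = near-cancel 0<Vtot (subst₂ (Near κ₁) (trans (cong (_* (2ℚ * W)) (sym qV)) (r q Vtot (2ℚ * W))) (*-comm yd Vtot) proportion)
     where
     r = solve 3 (λ q V w → q :* V :* w := V :* (q :* w)) refl

    -- The chain is q r₄ ≈ q · 2W ≈ y^d ≈ A, by `root-near`, `q-near` and `A-near`.
    gaussian-near : Near (⌜ 153338 ⌝ * b + ⌜ 3504 ⌝ * σ′) (q * r₄) A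
    gaussian-near = near-weaken κ≤ (0≤* 0≤q 0≤r₄) 0≤A (near-trans (0≤+ 0≤10b+η 0≤κ₁) 0≤21b (0≤* 0≤q 0≤r₄) 0≤A
      (near-trans 0≤10b+η 0≤κ₁ (0≤* 0≤q 0≤r₄) 0≤yd
       (near-scale 0≤q 0≤10b+η 0≤r₄ (0≤* 0≤2 0≤W) (near-sym (root-near (0≤* (0≤⌜⌝ 10) 0≤b) 0≤W l-near)))
       q-near)
      (near-sym A-near))
     where
     0≤10b+η : 0ℚ ≤ ⌜ 10 ⌝ * b + η
     0≤10b+η = 0≤+ (0≤* (0≤⌜⌝ 10) 0≤b) 0≤η
     0≤21b : 0ℚ ≤ ⌜ 20 ⌝ * b + b
     0≤21b = 0≤+ (0≤* (0≤⌜⌝ 20) 0≤b) 0≤b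
     κ≤ : ⌜ 10 ⌝ * b + η + κ₁ + (⌜ 20 ⌝ * b + b) ≤ ⌜ 153338 ⌝ * b + ⌜ 3504 ⌝ * σ′
     κ≤ = by (b - η) (sub≥0 η≤b) (r b η σ′)
      where
      r = solve 3 (λ b e s → # 10 :* b :+ e :+ (# 153306 :* b :+ # 3504 :* s) :+ (# 20 :* b :+ b) :+ (b :- e) := # 153338 :* b :+ # 3504 :* s) refl

-- The Gaussian law in the limit

module GaussianTheorem where
 open QSeries using (module Compositions)
 open Counting using (V≡a; V-total≡)
 open Rationals
 open LocalGrowth
 open ZetaSums using (inv; 0≤inv; ζ; ⌜Σ⌝)
 open Scales using (w²; w⁸; Setting; module Scale)
 open Basel using (L)
 open TotalCount using (floor₂)
 open ExpBounds using (exp-bounds)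
 open RootBounds
 open ScaleChoice
 open SquareRoots
 open GaussianEstimate
 open UniformTheorem using (root≤)
 open import Data.Integer.Base as ℤ using (ℤ; +_)
 import Data.Integer.Properties as ℤ
 open import Data.Rational.Properties
 import Data.Rational.Unnormalised.Base as ℚᵘ
 import Data.Rational.Unnormalised.Properties as ℚᵘ
 open ≤-Reasoning

 /-* : ∀ a n .{{_ : ℕ.NonZero n}} → (+ a / n) * ⌜ n ⌝ ≡ ⌜ a ⌝
 /-* a (suc n) = toℚᵘ-injective (ℚᵘ.≃-trans (toℚᵘ-homo-* (+ a / suc n) ⌜ suc n ⌝)
  (ℚᵘ.≃-trans (ℚᵘ.*-cong (toℚᵘ-fromℚᵘ (ℚᵘ.mkℚᵘ (+ a) n)) (toℚᵘ-fromℚᵘ (ℚᵘ.mkℚᵘ (+ suc n) 0)))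
  (ℚᵘ.≃-trans (ℚᵘ.*≡* (ℤ.*-assoc (+ a) (+ suc n) (+ 1))) (ℚᵘ.≃-sym (toℚᵘ-fromℚᵘ (ℚᵘ.mkℚᵘ (+ a) 0))))))

 total-cast : ∀ N → ⌜ Compositions.a N 0 ⌝ + 2ℚ * ∑< (suc N) (λ i → ⌜ Compositions.a N (suc i ℕ.+ 0) ⌝) ≡ ⌜ V-total N ⌝
 total-cast N = sym (trans (cong ⌜_⌝ (V-total≡ N)) (trans (⌜+⌝ (a 0) _) (cong (λ x → ⌜ a 0 ⌝ + x) (trans (⌜Σ⌝ (suc N) (λ i → a (suc i) ℕ.+ a (suc i))) (trans (∑-cong (suc N) double′) (∑-* (suc N) 2ℚ (λ i → ⌜ a (suc i ℕ.+ 0) ⌝)))))))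
  where
  a = Compositions.a N
  r = solve 1 (λ x → x :+ x := # 2 :* x) refl
  double′ : ∀ i → ⌜ a (suc i) ℕ.+ a (suc i) ⌝ ≡ 2ℚ * ⌜ a (suc i ℕ.+ 0) ⌝
  double′ i = trans (⌜+⌝ (a (suc i)) (a (suc i))) (trans (r ⌜ a (suc i) ⌝) (cong (λ j → 2ℚ * ⌜ a j ⌝) (sym (ℕ.+-identityʳ (suc i)))))

 module Approximation (N : ℕ) .{{N≢0 : ℕ.NonZero N}} (S : Scaled N) (63≤τ : 63 ℕ.≤ Scaled.τ S) (s ℓ : ℕ) (sℓ≤h : suc s ℕ.* ℓ ℕ.≤ Scaled.w S ℕ.* w² (Scaled.w S)) where
  open Scaled S

  M : ℕ
  M = ℓ ℕ.* ℓ

  -- c is a positive lower bound for the approximants of the Gaussian exponential, depending on ℓ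
  -- only; it makes that real number invertible.
  b c : ℚ
  b = inv (ℕ.pred τ)
  c = ½ * pow ½ M

  0<½ : 0ℚ < ½
  0<½ = positive⁻¹ ½

  0<c : 0ℚ < c
  0<c = 0<* 0<½ (0<pow 0<½ M)

  0<b : 0ℚ < b
  0<b = 0<inv (ℕ.pred τ)

  b≤½ : b ≤ ½
  b≤½ = inv-antitone {1} {ℕ.pred τ} (ℕ.pred-mono-≤ {2} (ℕ.≤-trans (ℕ.≤ᵇ⇒≤ 2 63 tt) 63≤τ))

  Close : ℚ → ℚ → Set
  Close r₄ A = c ≤ A × (∀ q → 0ℚ ≤ q → q * ⌜ V-total N ⌝ ≡ ⌜ Compositions.a N ℓ ⌝ → Near (⌜ 153338 ⌝ * b + ⌜ 3504 ⌝ * inv s) (q * r₄) A)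

  ε : ℚ
  ε = b * pow ½ M

  private
   A₁ = exp-bounds M M ε (0<* 0<b (0<pow 0<½ M))
   A₂ = scale-onset N S
   -- The accuracy of the roots is 18/(k+1); the factor M + 1 makes both it and its M-fold at most
   -- b.
   A₃ = small (⌜ 18 ⌝ * ⌜ suc M ⌝) 0<b

   Exp-bounds : (k : ℕ) → Set
   Exp-bounds k = ∀ x y → 0ℚ ≤ x → x ≤ 1ℚ → ⌜ M ⌝ * x ≤ ⌜ M ⌝ → y * (1ℚ + x) ≡ 1ℚ → 0ℚ ≤ y → expSum (- (⌜ M ⌝ * x)) k ≤ pow y M + ε × pow (1ℚ - x) M ≤ expSum (- (⌜ M ⌝ * x)) k + ε

   positive-total : 0ℚ < ⌜ V-total N ⌝
   positive-total = go (V-total N) {{V-total-nonZero N}}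
    where
    go : ∀ n .{{_ : ℕ.NonZero n}} → 0ℚ < ⌜ n ⌝
    go (suc n) = 0<⌜suc⌝ n

   setting : ∀ θ y → 0ℚ ≤ θ → ∣ ⌜ N ⌝ * (θ * θ) - ζ N ∣ ≤ inv (ℕ.pred w) * inv (ℕ.pred w) → y * (1ℚ + θ) ≡ 1ℚ → 0ℚ ≤ y → Setting
   setting θ y 0≤θ θ-near yθ 0≤y = record { w = w ; N = N ; 200≤w = 200≤w ; N≥ = N≥ ; N≤ = N≤ ; θ = θ ; y = y ; 0≤θ = 0≤θ ; yθ = yθ ; 0≤y = 0≤y ; θ-near = θ-near }

   conclude : ∀ k → τ ℕ.≤ k → ∀ θ φ y v n r₄ η → 0ℚ ≤ θ → 0ℚ ≤ φ → ∣ ⌜ N ⌝ * (θ * θ) - ζ N ∣ ≤ inv (ℕ.pred w) * inv (ℕ.pred w) →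
    y * (1ℚ + θ) ≡ 1ℚ → 0ℚ ≤ y → v * (1ℚ + φ) ≡ 1ℚ → 0ℚ ≤ v → (1ℚ + ⌜ n ⌝) * θ ≤ 2ℚ → 2ℚ ≤ (2ℚ + ⌜ n ⌝) * θ →
    Approximants (L k) θ φ r₄ η → η ≤ b → ⌜ M ⌝ * η ≤ b → Exp-bounds k → Close r₄ (expSum (- (⌜ M ⌝ * φ)) k)
   conclude k τ≤k θ φ y v n r₄ η 0≤θ 0≤φ θ-near yθ 0≤y vφ 0≤v nθ≤ nθ≥ ap η≤b Mη≤b eb = c≤A ,
     λ q 0≤q qV → G.gaussian-near 0≤φ vφ 0≤v ap η≤½ η≤b Mη≤b ≤-refl (proj₂ bounds) (proj₁ bounds) (G.W²θ-near k τ≤k) (≤-trans (<⇒≤ 0<c) c≤A) 0≤q (trans (cong (q *_) (total-cast N)) qV) (subst (0ℚ <_) (sym (total-cast N)) positive-total)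
    where
    module G = Gaussian (setting θ y 0≤θ θ-near yθ 0≤y) τ w≡ n nθ≤ nθ≥ s ℓ sℓ≤h
    open Approximants ap using (0≤η; φ-near)
    η≤½ : η ≤ ½
    η≤½ = ≤-trans η≤b b≤½
    φ≤½ : φ ≤ ½
    φ≤½ = Halving.φ≤½ θ φ y v η 0≤θ G.θ≤½ 0≤φ yθ 0≤y vφ 0≤v 0≤η η≤½ φ-near
    φ≤1 : φ ≤ 1ℚ
    φ≤1 = ≤-trans φ≤½ (p≤p+q ½ (<⇒≤ 0<½))
    A : ℚ
    A = expSum (- (⌜ M ⌝ * φ)) k
    bounds : A ≤ pow v M + ε × pow (1ℚ - φ) M ≤ A + ε
    bounds = eb φ v 0≤φ φ≤1 (≤≡ (*-monoˡ (0≤⌜⌝ M) φ≤1) (*-identityʳ ⌜ M ⌝)) vφ 0≤v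
    c≤A : c ≤ A
    c≤A = by ((½ - b) * pow ½ M + (pow (1ℚ - φ) M - pow ½ M) + (A + ε - pow (1ℚ - φ) M)) (0≤+ (0≤+ (0≤* (sub≥0 b≤½) (<⇒≤ (0<pow 0<½ M))) (sub≥0 (pow-mono (<⇒≤ 0<½) (by (½ - φ) (sub≥0 φ≤½) (r₁ φ)) M))) (sub≥0 (proj₂ bounds))) (r₂ b (pow ½ M) (pow (1ℚ - φ) M) A)
     where
     r₁ = solve 1 (λ φ → :½ :+ (:½ :- φ) := :1 :- φ) refl
     r₂ = solve 4 (λ b h p A → :½ :* h :+ ((:½ :- b) :* h :+ (p :- h) :+ (A :+ b :* h :- p)) := A) refl

   find-n : ∀ θ → 0ℚ < θ → θ ≤ 1ℚ → ∃ λ n → (1ℚ + ⌜ n ⌝) * θ ≤ 2ℚ × 2ℚ ≤ (2ℚ + ⌜ n ⌝) * θ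
   find-n θ 0<θ θ≤1 = go (floor₂ θ 0<θ)
    where
    go : (∃ λ n → ⌜ n ⌝ * θ ≤ 2ℚ × 2ℚ < ⌜ suc n ⌝ * θ) → ∃ λ n → (1ℚ + ⌜ n ⌝) * θ ≤ 2ℚ × 2ℚ ≤ (2ℚ + ⌜ n ⌝) * θ
    go (zero , _ , h) with () ← <-irrefl refl (<-≤-trans h (≡≤ (*-identityˡ θ) (≤-trans θ≤1 (⌜⌝-mono {1} {2} (ℕ.n≤1+n 1)))))
    go (suc n , h , h′) = n , subst (λ x → x * θ ≤ 2ℚ) (⌜suc⌝ n) h , <⇒≤ (subst (λ x → 2ℚ < x * θ) (⌜+⌝ 2 n) h′)

   step : ∀ k → τ ℕ.≤ k → ∀ θ φ r₄ η → 0ℚ < θ → 0ℚ ≤ φ → ∣ ⌜ N ⌝ * (θ * θ) - ζ N ∣ ≤ inv (ℕ.pred w) * inv (ℕ.pred w) →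
    Approximants (L k) θ φ r₄ η → η ≤ b → ⌜ M ⌝ * η ≤ b → Exp-bounds k → Close r₄ (expSum (- (⌜ M ⌝ * φ)) k)
   step k τ≤k θ φ r₄ η 0<θ 0≤φ θ-near ap η≤b Mη≤b eb = go (reciprocal (1ℚ + θ) (1+ (<⇒≤ 0<θ))) (reciprocal (1ℚ + φ) (1+ 0≤φ))
    where
    1+ : ∀ {x} → 0ℚ ≤ x → 0ℚ < 1ℚ + x
    1+ h = <-≤-trans 0<1 (p≤p+q 1ℚ h)
    go : (∃ λ y → 0ℚ < y × (1ℚ + θ) * y ≡ 1ℚ) → (∃ λ v → 0ℚ < v × (1ℚ + φ) * v ≡ 1ℚ) → Close r₄ (expSum (- (⌜ M ⌝ * φ)) k)
    go (y , 0<y , yθ) (v , 0<v , vφ) = go′ (find-n θ 0<θ (Scale.θ≤1 (setting θ y (<⇒≤ 0<θ) θ-near yθ′ (<⇒≤ 0<y))))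
     where
     yθ′ : y * (1ℚ + θ) ≡ 1ℚ
     yθ′ = trans (*-comm y (1ℚ + θ)) yθ
     go′ : (∃ λ n → (1ℚ + ⌜ n ⌝) * θ ≤ 2ℚ × 2ℚ ≤ (2ℚ + ⌜ n ⌝) * θ) → Close r₄ (expSum (- (⌜ M ⌝ * φ)) k)
     go′ (n , n≤ , n≥) = conclude k τ≤k θ φ y v n r₄ η (<⇒≤ 0<θ) 0≤φ θ-near yθ′ (<⇒≤ 0<y) (trans (*-comm v (1ℚ + φ)) vφ) (<⇒≤ 0<v) n≤ n≥ ap η≤b Mη≤b eb

   approximants : ∀ k → Approximants (L (suc k)) (Θ (6 ℕ.* N) (suc k)) (Θ (24 ℕ.* N) (suc k)) (rootSeq 4 (24 ℕ.* N) (suc k)) (⌜ 18 ⌝ * inv (suc k))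
   approximants k = record
    { r₆ = rootSeq 2 (6 ℕ.* N) (suc k) ; R₆ = recip 1ℚ 0<1 (rootSeq 2 (6 ℕ.* N) (suc k))
    ; r₂₄ = rootSeq 2 (24 ℕ.* N) (suc k) ; R₂₄ = recip 1ℚ 0<1 (rootSeq 2 (24 ℕ.* N) (suc k))
    ; 0<l = <-≤-trans 0<½ (proj₂ (proj₂ (L-range k)))
    ; 0≤r₆ = 0≤rootSeq 2 (6 ℕ.* N) (suc k) ; 0≤R₆ = Root.0≤R (6 ℕ.* N) (suc k) {{6N≢0 N}}
    ; 0≤r₂₄ = 0≤rootSeq 2 (24 ℕ.* N) (suc k) ; 0≤R₂₄ = Root.0≤R (24 ℕ.* N) (suc k) {{24N≢0 N}}
    ; 0≤r₄ = 0≤rootSeq 4 (24 ℕ.* N) (suc k)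
    ; rR₆ = Root.rR (6 ℕ.* N) (suc k) {{6N≢0 N}} ; rR₂₄ = Root.rR (24 ℕ.* N) (suc k) {{24N≢0 N}}
    ; θ≡ = refl ; φ≡ = refl
    ; 0≤η = 0≤* (0≤⌜⌝ 18) (0≤inv (suc k))
    ; near₂₄ = root₂₄-near N (suc k) ; near₄ = root₄-near N (suc k) }

  approximation : ∃ λ K → ∀ k → K ℕ.≤ k → Close (rootSeq 4 (24 ℕ.* N) k) (expSum (- (⌜ M ⌝ * Θ (24 ℕ.* N) k)) k)
  approximation = suc (τ ℕ.+ (proj₁ A₁ ℕ.+ (proj₁ A₂ ℕ.+ proj₁ A₃))) , main
   where
   main : ∀ k → suc (τ ℕ.+ (proj₁ A₁ ℕ.+ (proj₁ A₂ ℕ.+ proj₁ A₃))) ℕ.≤ k → Close (rootSeq 4 (24 ℕ.* N) k) (expSum (- (⌜ M ⌝ * Θ (24 ℕ.* N) k)) k)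
   main (suc k) (ℕ.s≤s h) = step (suc k) (up (ℕ.m+n≤o⇒m≤o τ h)) (Θ (6 ℕ.* N) (suc k)) (Θ (24 ℕ.* N) (suc k)) (rootSeq 4 (24 ℕ.* N) (suc k)) (⌜ 18 ⌝ * inv (suc k))
     0<Θ (0≤Θ (24 ℕ.* N) k {{24N≢0 N}}) near (approximants k) η≤b Mη≤b (proj₂ A₁ (suc k) (up (ℕ.m+n≤o⇒m≤o (proj₁ A₁) h₁)))
    where
    up : ∀ {n} → n ℕ.≤ k → n ℕ.≤ suc k
    up = ℕ.m≤n⇒m≤1+n
    h₁ = ℕ.m+n≤o⇒n≤o τ h
    h₂ = ℕ.m+n≤o⇒n≤o (proj₁ A₁) h₁
    near : ∣ ⌜ N ⌝ * (Θ (6 ℕ.* N) (suc k) * Θ (6 ℕ.* N) (suc k)) - ζ N ∣ ≤ inv (ℕ.pred w) * inv (ℕ.pred w)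
    near = proj₂ A₂ (suc k) (up (ℕ.m+n≤o⇒m≤o (proj₁ A₂) h₂))
    0<Θ : 0ℚ < Θ (6 ℕ.* N) (suc k)
    0<Θ = 0<* (0<* (0<⌜suc⌝ 3) (<-≤-trans 0<½ (proj₂ (proj₂ (L-range k))))) (0<recip 0<1 (1≤rootSeq 2 (6 ℕ.* N) (suc k) {{6N≢0 N}}))
    total : ⌜ 18 ⌝ * ⌜ suc M ⌝ * inv (suc k) ≤ b
    total = proj₂ A₃ (suc k) (up (ℕ.m+n≤o⇒n≤o (proj₁ A₂) h₂))
    η≤b : ⌜ 18 ⌝ * inv (suc k) ≤ b
    η≤b = ≤-trans (by (⌜ M ⌝ * (⌜ 18 ⌝ * inv (suc k))) (0≤* (0≤⌜⌝ M) (0≤* (0≤⌜⌝ 18) (0≤inv (suc k)))) (trans (r (inv (suc k)) ⌜ M ⌝) (cong (λ x → ⌜ 18 ⌝ * x * inv (suc k)) (sym (⌜suc⌝ M))))) total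
     where
     r = solve 2 (λ i m → # 18 :* i :+ m :* (# 18 :* i) := # 18 :* (:1 :+ m) :* i) refl
    Mη≤b : ⌜ M ⌝ * (⌜ 18 ⌝ * inv (suc k)) ≤ b
    Mη≤b = ≤-trans (by (⌜ 18 ⌝ * inv (suc k)) (0≤* (0≤⌜⌝ 18) (0≤inv (suc k))) (trans (r (inv (suc k)) ⌜ M ⌝) (cong (λ x → ⌜ 18 ⌝ * x * inv (suc k)) (sym (⌜suc⌝ M))))) total
     where
     r = solve 2 (λ i m → m :* (# 18 :* i) :+ # 18 :* i := # 18 :* (:1 :+ m) :* i) refl

 -- N³ ≤ 8w²⁴ ≤ (2w³)⁸, so N^(3/8) ≤ 2w³ and (s+1)ε ≤ 1/4 leaves w³/2. The slack of the real
 -- inequality is set to 1/(2(s+1)), which contributes 1/2 ≤ w³/2.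
 small-rank : ∀ N (S : Scaled N) s ℓ ε → ⌜ suc s ⌝ * ε ≤ ½ * ½ → fromℕ ℓ ≤ᴿ fromℚ ε *ᴿ root 8 (N ℕ.^ 3) → 0ℚ ≤ ε → suc s ℕ.* ℓ ℕ.≤ Scaled.w S ℕ.* w² (Scaled.w S)
 small-rank N S s ℓ ε sε≤ h 0≤ε = ⌜⌝-reflect (begin
   ⌜ suc s ℕ.* ℓ ⌝ ≡⟨ ⌜*⌝ (suc s) ℓ ⟩
   ⌜ suc s ⌝ * ⌜ ℓ ⌝ ≤⟨ *-monoˡ (0≤⌜⌝ (suc s)) (proj₂ H (proj₁ H) ℕ.≤-refl) ⟩
   ⌜ suc s ⌝ * (ε * rootSeq 8 (N ℕ.^ 3) (proj₁ H) + ½ * inv s) ≡⟨ trans (r₁ ⌜ suc s ⌝ ε (rootSeq 8 (N ℕ.^ 3) (proj₁ H)) (inv s)) (cong (λ x → ⌜ suc s ⌝ * ε * rootSeq 8 (N ℕ.^ 3) (proj₁ H) + ½ * x) (⌜*⌝-inv s)) ⟩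
   ⌜ suc s ⌝ * ε * rootSeq 8 (N ℕ.^ 3) (proj₁ H) + ½ * 1ℚ ≤⟨ +-monoˡ-≤ (½ * 1ℚ) (*-mono (<⇒≤ (positive⁻¹ (½ * ½))) (0≤rootSeq 8 (N ℕ.^ 3) (proj₁ H)) sε≤ (root≤ 8 (N ℕ.^ 3) (proj₁ H) (2 ℕ.* h′) N³≤)) ⟩
   ½ * ½ * ⌜ 2 ℕ.* h′ ⌝ + ½ * 1ℚ ≤⟨ +-mono-≤ (≤-reflexive (trans (cong (½ * ½ *_) (⌜*⌝ 2 h′)) (r₂ ⌜ h′ ⌝))) (*-monoˡ 0≤½ (⌜⌝-mono 1≤h)) ⟩
   ½ * ⌜ h′ ⌝ + ½ * ⌜ h′ ⌝ ≡⟨ r₃ ⌜ h′ ⌝ ⟩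
   ⌜ h′ ⌝ ∎)
  where
  open Scaled S
  h′ : ℕ
  h′ = w ℕ.* w² w
  H = h (½ * inv s) (0<* (positive⁻¹ ½) (0<inv s))
  r₁ = solve 4 (λ s e r i → s :* (e :* r :+ :½ :* i) := s :* e :* r :+ :½ :* (s :* i)) refl
  r₂ = solve 1 (λ h → :½ :* :½ :* (# 2 :* h) := :½ :* h) refl
  r₃ = solve 1 (λ h → :½ :* h :+ :½ :* h := h) refl
  1≤w : 1 ℕ.≤ w
  1≤w = ℕ.≤-trans (ℕ.≤ᵇ⇒≤ 1 200 tt) 200≤w
  1≤h : 1 ℕ.≤ h′
  1≤h = ℕ.*-mono-≤ 1≤w (ℕ.*-mono-≤ 1≤w 1≤w)
  N³≤ : N ℕ.^ 3 ℕ.≤ (2 ℕ.* h′) ℕ.^ 8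
  N³≤ = ℕ.≤-trans (ℕ.^-monoˡ-≤ 3 N≤) (ℕ≤≡ (ℕ.m≤m*n ((2 ℕ.* w⁸ w) ℕ.^ 3) 32) (e w))
   where
   e : ∀ w → (2 ℕ.* (w ℕ.* w ℕ.* (w ℕ.* w) ℕ.* (w ℕ.* w ℕ.* (w ℕ.* w)))) ℕ.^ 3 ℕ.* 32 ≡ (2 ℕ.* (w ℕ.* (w ℕ.* w))) ℕ.^ 8
   e w = trans (e₃ w) (sym (trans (^-distribʳ-* 8 2 (w ℕ.* (w ℕ.* w))) (cong (256 ℕ.*_) (e₈ (w ℕ.* (w ℕ.* w))))))
    where
    e₈ : ∀ x → x ℕ.^ 8 ≡ (x ℕ.* x ℕ.* (x ℕ.* x)) ℕ.* (x ℕ.* x ℕ.* (x ℕ.* x))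
    e₈ = f
     where
     f : ∀ x → x ℕ.* (x ℕ.* (x ℕ.* (x ℕ.* (x ℕ.* (x ℕ.* (x ℕ.* (x ℕ.* 1))))))) ≡ (x ℕ.* x ℕ.* (x ℕ.* x)) ℕ.* (x ℕ.* x ℕ.* (x ℕ.* x))
     f = ℕ-Ring.solve-∀
    e₃ : ∀ w → (2 ℕ.* (w ℕ.* w ℕ.* (w ℕ.* w) ℕ.* (w ℕ.* w ℕ.* (w ℕ.* w)))) ℕ.^ 3 ℕ.* 32 ≡ 256 ℕ.* ((w ℕ.* (w ℕ.* w) ℕ.* (w ℕ.* (w ℕ.* w)) ℕ.* (w ℕ.* (w ℕ.* w) ℕ.* (w ℕ.* (w ℕ.* w)))) ℕ.* (w ℕ.* (w ℕ.* w) ℕ.* (w ℕ.* (w ℕ.* w)) ℕ.* (w ℕ.* (w ℕ.* w) ℕ.* (w ℕ.* (w ℕ.* w)))))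
    e₃ = f
     where
     f : ∀ w → (2 ℕ.* (w ℕ.* w ℕ.* (w ℕ.* w) ℕ.* (w ℕ.* w ℕ.* (w ℕ.* w)))) ℕ.* ((2 ℕ.* (w ℕ.* w ℕ.* (w ℕ.* w) ℕ.* (w ℕ.* w ℕ.* (w ℕ.* w)))) ℕ.* ((2 ℕ.* (w ℕ.* w ℕ.* (w ℕ.* w) ℕ.* (w ℕ.* w ℕ.* (w ℕ.* w)))) ℕ.* 1)) ℕ.* 32 ≡ 256 ℕ.* ((w ℕ.* (w ℕ.* w) ℕ.* (w ℕ.* (w ℕ.* w)) ℕ.* (w ℕ.* (w ℕ.* w) ℕ.* (w ℕ.* (w ℕ.* w)))) ℕ.* (w ℕ.* (w ℕ.* w) ℕ.* (w ℕ.* (w ℕ.* w)) ℕ.* (w ℕ.* (w ℕ.* w) ℕ.* (w ℕ.* (w ℕ.* w)))))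
     f = ℕ-Ring.solve-∀

 module Limit (m : ℤ) (N : ℕ) .{{N≢0 : ℕ.NonZero N}} (S : Scaled N) (63≤τ : 63 ℕ.≤ Scaled.τ S) (s : ℕ) (sℓ≤h : suc s ℕ.* ℤ.∣ m ∣ ℕ.≤ Scaled.w S ℕ.* w² (Scaled.w S)) where
  private
   ℓ : ℕ
   ℓ = ℤ.∣ m ∣

  open Approximation N S 63≤τ s ℓ sℓ≤h

  private
   K = proj₁ approximation
   q κ : ℚ
   q = rankProportion m N
   κ = ⌜ 153338 ⌝ * b + ⌜ 3504 ⌝ * inv s
   r₄ : ℕ → ℚ
   r₄ = rootSeq 4 (24 ℕ.* N)

  e^ : ℝ
  e^ = exp (-ᴿ ((π *ᴿ fromℕ (ℓ ℕ.* ℓ)) ÷ᴿ root 2 (24 ℕ.* N) ⟨ root-positive 2 (24 ℕ.* N) {{24N≢0 N}} ⟩))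

  close-at : ∀ k → K ℕ.≤ k → Close (r₄ k) (seq e^ k)
  close-at k h = subst (λ a → Close (r₄ k) (expSum (- a) k)) (r ⌜ M ⌝ (seq π k) (recip 1ℚ 0<1 (rootSeq 2 (24 ℕ.* N) k))) (proj₂ approximation k h)
   where
   r = solve 3 (λ l p q → l :* (p :* q) := p :* l :* q) refl

  e^⁺ : Positiveᴿ e^
  e^⁺ = mkPositiveᴿ c 0<c K λ k h → proj₁ (close-at k h)

  E : ℝ
  E = fromℚ q *ᴿ (root 4 (24 ℕ.* N) ÷ᴿ e^ ⟨ e^⁺ ⟩) -ᴿ fromℕ 1

  E-bound : κ ≤ ½ → ∀ k → K ℕ.≤ k → ∣ seq E k ∣ ≤ 2ℚ * κ
  E-bound κ≤½ k h = subst (λ x → ∣ x - 1ℚ ∣ ≤ 2ℚ * κ) (*-assoc q (r₄ k) R) (near-quotient {κ} {q * r₄ k} {seq e^ k} {R} 0≤κ κ≤½ (0≤recip 0<c c≤) (recip-inverse 0<c c≤) (proj₂ (close-at k h) q 0≤q qV))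
   where
   c≤ = proj₁ (close-at k h)
   R = recip c 0<c (seq e^ k)
   0≤κ : 0ℚ ≤ κ
   0≤κ = 0≤+ (0≤* (0≤⌜⌝ 153338) (<⇒≤ 0<b)) (0≤* (0≤⌜⌝ 3504) (0≤inv s))
   0≤q : 0ℚ ≤ q
   0≤q = nonNegative⁻¹ q {{normalize-nonNeg (V m N) (V-total N) {{V-total-nonZero N}}}}
   qV : q * ⌜ V-total N ⌝ ≡ ⌜ Compositions.a N ℓ ⌝
   qV = trans (/-* (V m N) (V-total N) {{V-total-nonZero N}}) (cong ⌜_⌝ (V≡a m N))

  identity : fromℚ (rankProportion m N) ≈ᴿ gaussian m N *ᴿ (fromℕ 1 +ᴿ E)
  identity ε 0<ε = K , λ k h → ≡≤ (trans (cong (λ x → ∣ q - x ∣) (exact′ q (r₄ k) (recip 1ℚ 0<1 (r₄ k)) (seq e^ k) (recip c 0<c (seq e^ k)) (recip-inverse 0<1 (1≤rootSeq 4 (24 ℕ.* N) k {{24N≢0 N}})) (recip-inverse 0<c (proj₁ (close-at k h))))) (cong ∣_∣ (+-inverseʳ q))) (<⇒≤ 0<ε)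
   where
   exact′ : ∀ q r R e i → r * R ≡ 1ℚ → e * i ≡ 1ℚ → 1ℚ * R * e * (1ℚ + (q * (r * i) + - 1ℚ)) ≡ q
   exact′ q r R e i rR ei = trans (r₁ q r R e i) (trans (cong₂ (λ a b → q * (a * b)) rR ei) (*-identityʳ q))
    where
    r₁ = solve 5 (λ q r R e i → :1 :* R :* e :* (:1 :+ (q :* (r :* i) :+ :- :1)) := q :* (r :* R :* (e :* i))) refl

 asymptotic : ∀ (m : ℕ → ℤ) → (∀ ε → 0ℚ < ε → ∃ λ N₀ → ∀ N → N₀ ℕ.≤ N → fromℕ ℤ.∣ m N ∣ ≤ᴿ fromℚ ε *ᴿ root 8 (N ℕ.^ 3)) →
  (λ N → fromℚ (rankProportion (m N) N)) ∼ (λ N → gaussian (m N) N)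
 asymptotic m hyp ε 0<ε = T ℕ.^ (4 ℕ.* 4 ℕ.* 2) ℕ.+ proj₁ H , main
  where
  ε₁ : ℚ
  -- A quarter for each of the two errors, since `near-quotient` doubles their sum; the minimum with
  -- 1 secures its hypothesis κ ≤ 1/2.
  ε₁ = ½ * ½ * (ε ⊓ 1ℚ)
  0<ε⊓1 : 0ℚ < ε ⊓ 1ℚ
  0<ε⊓1 = go (⊓-sel ε 1ℚ)
   where
   go : ε ⊓ 1ℚ ≡ ε ⊎ ε ⊓ 1ℚ ≡ 1ℚ → 0ℚ < ε ⊓ 1ℚ
   go (inj₁ e) = subst (0ℚ <_) (sym e) 0<ε
   go (inj₂ e) = subst (0ℚ <_) (sym e) 0<1
  0<ε₁ : 0ℚ < ε₁
  0<ε₁ = 0<* (positive⁻¹ (½ * ½)) 0<ε⊓1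
  A = small ⌜ 3504 ⌝ 0<ε₁
  B = small ⌜ 153338 ⌝ 0<ε₁
  s T : ℕ
  s = proj₁ A
  T = 63 ℕ.+ proj₁ B
  ε₂ : ℚ
  ε₂ = ½ * ½ * inv s
  0<ε₂ : 0ℚ < ε₂
  0<ε₂ = 0<* (positive⁻¹ (½ * ½)) (0<inv s)
  sε₂ : ⌜ suc s ⌝ * ε₂ ≤ ½ * ½
  sε₂ = ≤-reflexive (trans (r ⌜ suc s ⌝ (inv s)) (trans (cong (½ * ½ *_) (⌜*⌝-inv s)) (*-identityʳ (½ * ½))))
   where
   r = solve 2 (λ s i → s :* (:½ :* :½ :* i) := :½ :* :½ :* (s :* i)) refl
  H = hyp ε₂ 0<ε₂
  main : ∀ N → .{{_ : ℕ.NonZero N}} → T ℕ.^ (4 ℕ.* 4 ℕ.* 2) ℕ.+ proj₁ H ℕ.≤ N → ∃ λ E → ∣ E ∣ᴿ ≤ᴿ fromℚ ε × fromℚ (rankProportion (m N) N) ≈ᴿ gaussian (m N) N *ᴿ (fromℕ 1 +ᴿ E)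
  main N N₀≤N = go (scaled N T (ℕ.m≤m+n 63 (proj₁ B)) (ℕ.≤-trans (ℕ.m≤m+n (T ℕ.^ (4 ℕ.* 4 ℕ.* 2)) (proj₁ H)) N₀≤N))
   where
   go : (∃ λ (S : Scaled N) → T ℕ.≤ Scaled.τ S) → ∃ λ E → ∣ E ∣ᴿ ≤ᴿ fromℚ ε × fromℚ (rankProportion (m N) N) ≈ᴿ gaussian (m N) N *ᴿ (fromℕ 1 +ᴿ E)
   go (S , T≤τ) = E , (λ ε′ 0<ε′ → _ , λ k h → ≤-trans (E-bound κ≤½ k h) (≤-trans 2κ≤ε (p≤p+q ε (<⇒≤ 0<ε′)))) , identity
    where
    open Limit (m N) N S (ℕ.≤-trans (ℕ.m≤m+n 63 (proj₁ B)) T≤τ) s (small-rank N S s ℤ.∣ m N ∣ ε₂ sε₂ (proj₂ H N (ℕ.≤-trans (ℕ.m≤n+m (proj₁ H) (T ℕ.^ (4 ℕ.* 4 ℕ.* 2))) N₀≤N)) (<⇒≤ 0<ε₂))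
    κ : ℚ
    κ = ⌜ 153338 ⌝ * inv (ℕ.pred (Scaled.τ S)) + ⌜ 3504 ⌝ * inv s
    κ≤ : κ ≤ ε₁ + ε₁
    κ≤ = +-mono-≤ (proj₂ B (ℕ.pred (Scaled.τ S)) (ℕ.pred-mono-≤ {suc (proj₁ B)} (ℕ.≤-trans (ℕ.m≤n+m (suc (proj₁ B)) 62) (ℕ≡≤ (ℕ.+-suc 62 (proj₁ B)) T≤τ)))) (proj₂ A s ℕ.≤-refl)
    2κ≤ : 2ℚ * κ ≤ ε ⊓ 1ℚ
    2κ≤ = ≤≡ (*-monoˡ 0≤2 κ≤) (r (ε ⊓ 1ℚ))
     where
     r = solve 1 (λ e → # 2 :* (:½ :* :½ :* e :+ :½ :* :½ :* e) := e) refl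
    2κ≤ε : 2ℚ * κ ≤ ε
    2κ≤ε = ≤-trans 2κ≤ (p⊓q≤p ε 1ℚ)
    κ≤½ : κ ≤ ½
    κ≤½ = *-cancel-≤ {2ℚ} (0<⌜suc⌝ 1) (≤-trans 2κ≤ (p⊓q≤q ε 1ℚ))

open import Defs
open import Data.Nat using (ℕ; NonZero; _+_; _*_; _/_; _^_; _≤_)
open import Data.Integer using (ℤ; ∣_∣)
open import Data.Rational using (ℚ; 0ℚ; _<_)
open import Data.Product using (∃; _×_)
open ScaleChoice using (scaled)
open UniformTheorem using (module UniformBound)
open GaussianTheorem using (asymptotic)

theorem1 : (∃ λ (C : ℝ) → ∃ λ (N₀ : ℕ) →
    ∀ (N : ℕ) → .{{_ : NonZero N}} → N₀ ≤ N → ∀ (ℓ : ℤ) →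
    ∃ λ (E : ℝ) →
    ∣ E ∣ᴿ ≤ᴿ C *ᴿ tenthRoot⁻¹ N ×
    fromℕ (V ℓ (N + (∣ ℓ ∣ * (∣ ℓ ∣ + 1)) / 2))
    ≈ᴿ fromℕ (p N) *ᴿ F (scaledRank ℓ N) *ᴿ (fromℕ 1 +ᴿ E))
    ×
    (∀ (m : ℕ → ℤ) →
    (∀ (ε : ℚ) → 0ℚ < ε → ∃ λ (N₀ : ℕ) → ∀ (N : ℕ) → N₀ ≤ N →
    fromℕ ∣ m N ∣ ≤ᴿ fromℚ ε *ᴿ root 8 (N ^ 3)) →
    (λ N → fromℚ (rankProportion (m N) N)) ∼ (λ N → gaussian (m N) N))
-- 611678 = 2 (305812 + 27): the error of the rank estimate, the passage from the power to the
-- exponential, and division by 1 + e^(-α), bounded below by 1/2. From N ≥ 63^32 one gets τ ≥ 63.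
theorem1 = (fromℕ 611678 , 63 ^ (4 * 4 * 2) , uniform) , asymptotic
  where
  uniform : ∀ (N : ℕ) → .{{_ : NonZero N}} → 63 ^ (4 * 4 * 2) ≤ N → ∀ (ℓ : ℤ) →
    ∃ λ (E : ℝ) →
    ∣ E ∣ᴿ ≤ᴿ fromℕ 611678 *ᴿ tenthRoot⁻¹ N ×
    fromℕ (V ℓ (N + (∣ ℓ ∣ * (∣ ℓ ∣ + 1)) / 2))
    ≈ᴿ fromℕ (p N) *ᴿ F (scaledRank ℓ N) *ᴿ (fromℕ 1 +ᴿ E)
  uniform N N₀≤N ℓ = E , E-small , identity
    where
    open UniformBound N (proj₁ (scaled N 63 ℕ.≤-refl N₀≤N)) ℓ
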